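{- Let $\ell\ge 1$ and let $(\Psi,\gamma,w)$ be a tame labeled root ideal of length $\ell$ with $\gamma\in\mathbb{Z}_{\ge0}^\ell$. Write $(n_1,\dots,n_{\ell-1})=\mathrm{nr}(\Psi)$. Then \[ H(\Psi;\gamma;w)=\pi_w\, x_1^{\gamma_1}\,\Phi\,\pi_{\mathsf c(n_1)}\,x_1^{\gamma_2}\,\Phi\,\pi_{\mathsf c(n_2)}\,x_1^{\gamma_3}\cdots\Phi\,\pi_{\mathsf c(n_{\ell-1})}\,x_1^{\gamma_\ell}, \] where the right side is the composite of the indicated operators (multiplication by powers of $x_1$, $\Phi$, and Demazure operators) applied to the polynomial $x_1^{\gamma_\ell}$.
   Context: Polynomials are in $\mathbb{Z}[q][x_1^{\pm1},\dots,x_\ell^{\pm1}]$ (and power series in $q$ with such coefficients). $\mathfrak S_\ell$ acts by permuting variables; $s_i$ swaps $x_i,x_{i+1}$. The Demazure operator is $\pi_i(f)=\frac{x_if-x_{i+1}s_i(f)}{x_i-x_{i+1}}$ for $i\in[\ell-1]$. The 0-Hecke monoid $H_\ell$ is generated by $\bar s_1,\dots,\bar s_{\ell-1}$ with relations $\bar s_i^2=\bar s_i$, $\bar s_i\bar s_j=\bar s_j\bar s_i$ for $|i-j|>1$, $\bar s_i\bar s_{i+1}\bar s_i=\bar s_{i+1}\bar s_i\bar s_{i+1}$; for $w=\bar s_{i_1}\cdots\bar s_{i_m}$ put $\pi_w=\pi_{i_1}\cdots\pi_{i_m}$ (well defined). $H_\ell$ acts on $\mathbb{Z}^\ell$ by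 $\bar s_i\alpha=s_i\alpha$ if $\alpha_i\ge\alpha_{i+1}$ and $\bar s_i\alpha=\alpha$ otherwise. For $\alpha\in\mathbb{Z}^\ell$ let $\alpha^+$ be its weakly decreasing rearrangement, $\mathsf p(\alpha)\in H_\ell$ the shortest element with $\mathsf p(\alpha)\alpha^+=\alpha$, and $\kappa_\alpha=\pi_{\mathsf p(\alpha)}\mathbf x^{\alpha^+}$ (key polynomial); $\{\kappa_\alpha:\alpha\in\mathbb{Z}^\ell\}$ is a $\mathbb{Z}$-basis of $\mathbb{Z}[x_1^{\pm1},\dots,x_\ell^{\pm1}]$. Polynomial truncation $\mathrm{poly}$ is the linear operator with $\mathrm{poly}(\kappa_\alpha)=\kappa_\alpha$ if $\alpha\in\mathbb{Z}_{\ge0}^\ell$ and $0$ otherwise, extended coefficientwise to power series in $q$. $\Delta^+_\ell=\{(i,j):1\le i<j\le\ell\}$ is ordered by $(a,b)\le(c,d)$ iff $a\ge c$ and $b\le d$; a root ideal is an upper order ideal $\Psi\subset\Delta^+_\ell$. For a root ideal $\Psi$, $\gamma\in\mathbb{Z}^\ell$, $w\in H_\ell$ (a labeled root ideal), the nonsymmetric Catalan function is $H(\Psi;\gamma;w)=\pi_w\big(\mathrm{poly}\big(\prod_{(i,j)\in\Psi}(1-qx_i/x_j)^{ -1}\mathbf x^\gamma\big)\big)$, the product expanded as a power series in $q$. Set $\mathrm{nr}(\Psi)_i=|\{j\in\{i,\dots,\ell\}:(i,j)\notin\Psi\}|$ for $i\in[\ell-1]$. $(\Psi,\gamma,w)$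 is tame if the right descent set $\{i: w\bar s_i=w\}$ contains $\mathrm{nr}(\Psi)_1+1,\dots,\ell-1$. For $d\in[\ell]$, $\mathsf c(d)=\bar s_{\ell-1}\bar s_{\ell-2}\cdots\bar s_d$ (the identity when $d=\ell$). $\Phi$ is the $\mathbb{Z}[q]$-algebra homomorphism with $\Phi(x_i)=x_{i+1}$ for $i\in[\ell-1]$ and $\Phi(x_\ell)=qx_1$. -}

module Defs where

open import Data.Bool using (Bool; true; false; if_then_else_; _∧_; not)
open import Data.Nat as ℕ using (ℕ; zero; suc)
open import Data.Integer as ℤ using (ℤ; +_; -[1+_]; ∣_∣)
open import Data.Fin as F using (Fin; zero; suc; toℕ; inject₁)
open import Data.Vec as V using (Vec; []; _∷_; lookup; tabulate; _[_]≔_; _[_]%=_; zipWith)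
open import Data.Vec.Properties using (≡-dec)
open import Data.Vec.Relation.Unary.All using (All)
open import Data.Vec.Relation.Unary.All as VAll using (all?)
open import Data.List as L using (List; []; _∷_; _++_; length; upTo; allFin; filter; concatMap; map; foldr)
open import Relation.Nullary using (does)
open import Data.Product using (_×_; _,_)
open import Data.Unit using (⊤)
import Data.Bool
open import Relation.Binary.PropositionalEquality using (_≡_)

-- Conventions.  ℓ = suc n variables x_1..x_ℓ, indexed by Fin (suc n)
-- (x_1 ↔ zero).  Generators s̄_1..s̄_{ℓ-1} of H_ℓ are indexed by Fin n:
-- generator i : Fin n is s̄_{toℕ i + 1}, swapping positions inject₁ i
-- and suc i.

Exp : ℕ → Set
Exp ℓ = Vec ℤ ℓ

-- A term  c · q^d · x^α  of Z[q][x^{±1}]  (q-degree kept in ℤ so that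
-- Φ is total on Laurent monomials; all objects below have d ≥ 0).
record Term (ℓ : ℕ) : Set where
  constructor term
  field
    coef : ℤ
    qdeg : ℤ
    exp  : Exp ℓ

-- Polynomials as finite formal sums of terms (equality = equal coefficients).
Poly : ℕ → Set
Poly ℓ = List (Term ℓ)

coeffAt : ∀ {ℓ} → Poly ℓ → ℤ → Exp ℓ → ℤ
coeffAt [] k α = + 0
coeffAt (term c d β ∷ p) k α =
  (if does (d ℤ.≟ k) ∧ does (≡-dec ℤ._≟_ β α) then c else + 0) ℤ.+ coeffAt p k α

_≈P_ : ∀ {ℓ} → Poly ℓ → Poly ℓ → Set
p ≈P p' = ∀ k α → coeffAt p k α ≡ coeffAt p' k α

monomial : ∀ {ℓ} → Exp ℓ → Poly ℓ
monomial α = term (+ 1) (+ 0) α ∷ []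

one : ∀ {ℓ} → Poly ℓ
one = monomial (tabulate (λ _ → + 0))

scale : ∀ {ℓ} → ℤ → Poly ℓ → Poly ℓ
scale c = map (λ { (term a d β) → term (c ℤ.* a) d β })

mulP : ∀ {ℓ} → Poly ℓ → Poly ℓ → Poly ℓ
mulP p p' = concatMap (λ { (term a d β) →
              map (λ { (term b e δ) → term (a ℤ.* b) (d ℤ.+ e) (zipWith ℤ._+_ β δ) }) p' }) p

mulX1 : ∀ {n} → ℤ → Poly (suc n) → Poly (suc n)
mulX1 a = map (λ { (term c d β) → term c d (β [ zero ]%= (λ z → a ℤ.+ z)) })

-- Φ : x_i ↦ x_{i+1} (i < ℓ), x_ℓ ↦ q x_1 ;  q^d x^α ↦ q^{d+α_ℓ} x^{(α_ℓ,α_1,…,α_{ℓ-1})}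
Φ : ∀ {n} → Poly (suc n) → Poly (suc n)
Φ = map (λ { (term c d β) → term c (d ℤ.+ V.last β) (V.last β ∷ V.init β) })

-- Demazure operators  π_i f = (x_i f − x_{i+1} s_i f)/(x_i − x_{i+1}).
-- The division is exact; on a monomial, with β = α + e_i, p = β_i,
-- r = β_{i+1}, the quotient (x^β − x^{s_i β})/(x_i − x_{i+1}) is
--   p > r :   Σ_{t=0}^{p-r-1} x^β with (β_i,β_{i+1}) := (r+t, p-1-t)
--   p ≤ r : − Σ_{t=0}^{r-p-1} x^β with (β_i,β_{i+1}) := (p+t, r-1-t)
-- (this is the literal result of carrying out the division).

set2 : ∀ {n} → Fin n → ℤ → ℤ → Exp (suc n) → Exp (suc n)
set2 i a b β = (β [ inject₁ i ]≔ a) [ suc i ]≔ b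

demTerm : ∀ {n} → Fin n → Term (suc n) → Poly (suc n)
demTerm i (term c d α) =
  let β = α [ inject₁ i ]%= (λ z → z ℤ.+ + 1)
      p = lookup β (inject₁ i)
      r = lookup β (suc i)
  in if does (r ℤ.<? p)
     then map (λ t → term c d (set2 i (r ℤ.+ + t) ((p ℤ.- + 1) ℤ.- + t) β)) (upTo ∣ p ℤ.- r ∣)
     else map (λ t → term (ℤ.- c) d (set2 i (p ℤ.+ + t) ((r ℤ.- + 1) ℤ.- + t) β)) (upTo ∣ r ℤ.- p ∣)

dem : ∀ {n} → Fin n → Poly (suc n) → Poly (suc n)
dem i = concatMap (demTerm i)

Word : ℕ → Set
Word n = List (Fin n)

demWord : ∀ {n} → Word n → Poly (suc n) → Poly (suc n)
demWord [] f = f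
demWord (i ∷ u) f = dem i (demWord u f)

data _≈H_ {n : ℕ} : Word n → Word n → Set where
  H-refl  : ∀ {u} → u ≈H u
  H-sym   : ∀ {u v} → u ≈H v → v ≈H u
  H-trans : ∀ {u v w} → u ≈H v → v ≈H w → u ≈H w
  H-cong  : ∀ {u u' v v'} → u ≈H u' → v ≈H v' → (u ++ v) ≈H (u' ++ v')
  H-idem  : ∀ i → (i ∷ i ∷ []) ≈H (i ∷ [])
  H-comm  : ∀ i j → suc (toℕ i) ℕ.< toℕ j → (i ∷ j ∷ []) ≈H (j ∷ i ∷ [])
  H-braid : ∀ i j → toℕ j ≡ suc (toℕ i) → (i ∷ j ∷ i ∷ []) ≈H (j ∷ i ∷ j ∷ [])

swapAt : ∀ {n} → Fin n → Exp (suc n) → Exp (suc n)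
swapAt i α = set2 i (lookup α (suc i)) (lookup α (inject₁ i)) α

hAct : ∀ {n} → Fin n → Exp (suc n) → Exp (suc n)
hAct i α = if does (lookup α (suc i) ℤ.≤? lookup α (inject₁ i)) then swapAt i α else α

act : ∀ {n} → Word n → Exp (suc n) → Exp (suc n)
act [] α = α
act (i ∷ u) α = hAct i (act u α)

WeaklyDecreasing : ∀ {ℓ} → Exp ℓ → Set
WeaklyDecreasing [] = ⊤
WeaklyDecreasing (a ∷ []) = ⊤
WeaklyDecreasing (a ∷ b ∷ β) = (b ℤ.≤ a) × WeaklyDecreasing (b ∷ β)

-- Key polynomials and polynomial truncation.
-- A key term c·κ_α records α, its decreasing rearrangement β = α⁺, and a
-- word u for 𝗉(α): u β = α and u has minimal length among all such words
-- (so u is a reduced word of the shortest element 𝗉(α)).  κ_α = π_u x^β.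

record KeyTerm (n : ℕ) : Set where
  field
    kcoef : ℤ
    α     : Exp (suc n)
    β     : Exp (suc n)
    u     : Word n
    β-dec : WeaklyDecreasing β
    u-act : act u β ≡ α
    u-min : ∀ (v : Word n) → act v β ≡ α → length u ℕ.≤ length v

KeyExpansion : ℕ → Set
KeyExpansion n = List (KeyTerm n)

⟦_⟧K : ∀ {n} → KeyExpansion n → Poly (suc n)
⟦ E ⟧K = concatMap (λ t → scale (KeyTerm.kcoef t) (demWord (KeyTerm.u t) (monomial (KeyTerm.β t)))) E

nonneg? : ∀ {ℓ} → Exp ℓ → Bool
nonneg? α = does (all? (λ z → + 0 ℤ.≤? z) α)

polyPart : ∀ {n} → KeyExpansion n → Poly (suc n)
polyPart E = ⟦ filter (λ t → Data.Bool._≟_ (nonneg? (KeyTerm.α t)) true) E ⟧K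

IsRootIdeal : ∀ {ℓ} → (Fin ℓ → Fin ℓ → Bool) → Set
IsRootIdeal {ℓ} Ψ =
  (∀ i j → Ψ i j ≡ true → i F.< j) ×
  (∀ a b c d → Ψ a b ≡ true → c F.≤ a → b F.≤ d → Ψ c d ≡ true)

-- nr(Ψ)_i for i ∈ [ℓ-1]  (row i : Fin n is row toℕ i + 1)
nr : ∀ {n} → (Fin (suc n) → Fin (suc n) → Bool) → Fin n → ℕ
nr {n} Ψ i = length (filter (λ j → Data.Bool._≟_
               (does (toℕ i ℕ.≤? toℕ j) ∧ not (Ψ (inject₁ i) j)) true) (allFin (suc n)))

firstFin : ∀ {n} → Fin n → Fin n
firstFin zero = zero
firstFin (suc _) = zero

-- tame: w s̄_i = w for i = nr(Ψ)_1 + 1, …, ℓ-1  (generator j ↔ s̄_{toℕ j + 1})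
Tame : ∀ {n} → (Fin (suc n) → Fin (suc n) → Bool) → Word n → Set
Tame {n} Ψ w = ∀ (j : Fin n) → nr Ψ (firstFin j) ℕ.≤ toℕ j → (w ++ (j ∷ [])) ≈H w

-- 𝖼(d) = s̄_{ℓ-1} s̄_{ℓ-2} ⋯ s̄_d  (identity when d = ℓ)
cWord : ∀ {n} → ℕ → Word n
cWord {n} d = L.reverse (filter (λ j → d ℕ.≤? suc (toℕ j)) (allFin n))

-- Power series in q with Laurent-polynomial coefficients: m ↦ coefficient
-- of q^m (a polynomial whose terms have q-degree 0).

Series : ℕ → Set
Series ℓ = ℕ → Poly ℓ

_*S_ : ∀ {ℓ} → Series ℓ → Series ℓ → Series ℓ
(f *S g) m = concatMap (λ a → mulP (f a) (g (m ℕ.∸ a))) (upTo (suc m))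

-- (1 - q x_i/x_j)^{-1} = Σ_m q^m x^{m(e_i - e_j)}
geom : ∀ {ℓ} → Fin ℓ → Fin ℓ → Series ℓ
geom i j m = monomial (tabulate (λ k →
  if does (k F.≟ i) then + m else if does (k F.≟ j) then ℤ.- (+ m) else + 0))

constS : ∀ {ℓ} → Poly ℓ → Series ℓ
constS p zero = p
constS p (suc m) = []

roots : ∀ {ℓ} → (Fin ℓ → Fin ℓ → Bool) → List (Fin ℓ × Fin ℓ)
roots {ℓ} Ψ = filter (λ { (i , j) → Data.Bool._≟_ (Ψ i j) true })
                (concatMap (λ i → map (i ,_) (allFin ℓ)) (allFin ℓ))

catalanSeries : ∀ {ℓ} → (Fin ℓ → Fin ℓ → Bool) → Exp ℓ → Series ℓ
catalanSeries Ψ γ = foldr (λ { (i , j) s → geom i j *S s }) (constS (monomial γ)) (roots Ψ)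

-- H(Ψ;γ;w) = P  : for every key expansion of each q-coefficient of the
-- series, π_w(poly(·)) has the same q^m-coefficients as P (and P has no
-- negative q-powers).
HEquals : ∀ {n} → (Fin (suc n) → Fin (suc n) → Bool) → Exp (suc n) → Word n → Poly (suc n) → Set
HEquals {n} Ψ γ w P =
  ∀ (E : ℕ → KeyExpansion n) →
  (∀ m → ⟦ E m ⟧K ≈P catalanSeries Ψ γ m) →
  (∀ (m : ℕ) α → coeffAt (demWord w (polyPart (E m))) (+ 0) α ≡ coeffAt P (+ m) α)
  × (∀ (m : ℕ) α → coeffAt P -[1+ m ] α ≡ + 0)

chain : ∀ {n k} → Vec ℤ (suc k) → Vec ℕ k → Poly (suc n)
chain (g ∷ []) [] = mulX1 g one
chain (g ∷ g' ∷ gs) (m ∷ ms) = mulX1 g (Φ (demWord (cWord m) (chain (g' ∷ gs) ms)))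

rhs : ∀ {n} → (Fin (suc n) → Fin (suc n) → Bool) → Exp (suc n) → Word n → Poly (suc n)
rhs Ψ γ w = demWord w (chain γ (tabulate (nr Ψ)))

{-# OPTIONS --safe #-}
module Submission where

-- Polynomial truncation is realised by an explicit operator T. It commutes with the Demazure operators, fixes x^β
-- when β ≥ 0 and kills x^β when the last exponent is negative; as κ_α = π_u x^{α⁺}, it maps every key polynomial
-- to itself or to 0, so truncations can be computed from any key expansion without knowing that the key
-- polynomials form a basis. T is built one variable at a time, T_N = J_N T_{N-1} Π_{i<N} (1 - x_i/x_N), where J_N
-- replaces x_N^a by h_a(x_1, …, x_N). It satisfies T(x_1^a g) = x_1^a T(g) for a ≥ 0 and g free of x_1, and
-- T(x_N^{-a} f) is the part of x_N^{-a} T(f) with nonnegative exponent of x_N.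
--
-- The theorem follows by induction on the rows. The first row contributes Σ_a q^a x_1^a h_a(1/x_{n_1+1}, …,
-- 1/x_ℓ). After the symmetrisation that tameness permits, h_a(1/x_d, …, 1/x_{ℓ-1}) acts as x_{ℓ-1}^{-a}, and for f
-- free of x_ℓ the part of x_{ℓ-1}^{-a} f with nonnegative exponent of x_{ℓ-1} is the coefficient of x_ℓ^a in
-- π_{ℓ-1} f, which Φ multiplies by q^a x_1^a.

open import Defs
open import Algebra.Bundles using (CommutativeRing)
import Algebra.Solver.Ring
import Algebra.Solver.Ring.AlmostCommutativeRing as ACR
open import Data.Bool using (Bool; true; false; if_then_else_; _∧_; not)
import Data.Bool
open import Data.Empty using (⊥-elim)
open import Data.Fin as F using (Fin; zero; suc; toℕ; inject₁; fromℕ<)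
import Data.Fin.Properties as Finₚ
open import Data.Integer as ℤ using (ℤ; +_; -[1+_]; ∣_∣; _≤_)
import Data.Integer.Properties as ℤₚ
open import Data.Integer.Tactic.RingSolver using (solve-∀)
open import Data.List using (List; []; _∷_; _++_; length; map; concatMap; filter; upTo; applyUpTo; downFrom;
  tabulate; allFin; reverse; foldr)
import Data.List.Properties as Listₚ
open import Data.List.Relation.Unary.All as Allˡ using ([]; _∷_) renaming (All to Allˡ)
import Data.List.Relation.Unary.All.Properties as Allₚ
open import Data.List.Relation.Unary.AllPairs using (AllPairs; []; _∷_)
open import Data.Maybe using (Maybe; just; nothing)
open import Data.Nat as ℕ using (ℕ; zero; suc)
import Data.Nat.Properties as ℕₚ
open import Data.Product using (_×_; _,_; proj₁; proj₂; Σ; Σ-syntax)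
open import Data.Unit using (⊤; tt)
open import Data.Vec as V using (Vec; []; _∷_; lookup; zipWith)
open import Data.Vec.Properties using (≡-dec)
open import Data.Vec.Relation.Unary.All as VAll using (All)
open import Function using (_∘_; id)
open import Level using (0ℓ)
open import Relation.Binary.Bundles using (Setoid)
open import Relation.Binary.PropositionalEquality
  using (_≡_; _≢_; refl; sym; trans; cong; cong₂; subst; module ≡-Reasoning)
import Relation.Binary.Reasoning.Setoid as SetoidReasoning
open import Relation.Nullary using (Dec; yes; no; does; ¬_)
open import Relation.Nullary.Decidable using (dec-true; dec-false)
open import Relation.Unary using (Decidable)

-- Truncation does not commute with division by a variable, so the inverse variables of a row cannot
-- simply be pulled through `T`. What can be controlled is division by the largest variable of `T`.
-- Hence h_a of several inverse variables has to come from a power of a single one by symmetrising.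
-- The induction hypothesis must therefore hold under more operators than π_w: it is stated for
-- every operator W with W π_j = W at the j demanded by tameness, because the step applies it to W
-- composed with powers of x_1, Φ, coefficient extraction and a symmetriser.
--
-- On a monomial, T(x^α) is the flagged Jacobi-Trudi determinant det(h_{α_i-i+j}(x_1,...,x_i)), with
-- h_a = 0 for a < 0; the factors 1 - x_i/x_j act as raising operators. Its commutation with π_i
-- comes down to a 2×2 determinant in the entries i and i+1.
--
-- Each linear operator carries its transpose on functionals, so identities are checked on
-- monomials, where π_i is a difference of two values of a discrete primitive.

private variable
  ℓ ℓ′ n : ℕ

-- Laurent polynomials as formal sums tested by functionals.

module Evaluation where
  Fun : ℕ → Set
  Fun ℓ = ℤ → Exp ℓ → ℤ

  ev : Fun ℓ → Poly ℓ → ℤ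
  ev F [] = + 0
  ev F (term c d α ∷ p) = c ℤ.* F d α ℤ.+ ev F p

  infix 4 _≈_
  -- Testing against all functionals, rather than against coefficients, makes equality stable under
  -- linear maps: the map is moved onto the functional, and no normal form of a formal sum is ever
  -- needed.
  record _≈_ {ℓ} (p q : Poly ℓ) : Set where
    constructor mk≈
    field at : ∀ F → ev F p ≡ ev F q
  open _≈_

  ≈-setoid : ℕ → Setoid 0ℓ 0ℓ
  ≈-setoid ℓ = record
    { Carrier = Poly ℓ ; _≈_ = _≈_
    ; isEquivalence = record
      { refl = mk≈ λ _ → refl
      ; sym = λ e → mk≈ λ F → sym (at e F)
      ; trans = λ e f → mk≈ λ F → trans (at e F) (at f F) } }

  infixl 6 _⊞_
  _⊞_ : Exp ℓ → Exp ℓ → Exp ℓ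
  _⊞_ = zipWith ℤ._+_

  mono : ℤ → Exp ℓ → Poly ℓ
  mono d α = term (+ 1) d α ∷ []

  ev-cong : {F G : Fun ℓ} → (∀ d α → F d α ≡ G d α) → ∀ p → ev F p ≡ ev G p
  ev-cong e [] = refl
  ev-cong e (term c d α ∷ p) = cong₂ ℤ._+_ (cong (c ℤ.*_) (e d α)) (ev-cong e p)

  ev-++ : (F : Fun ℓ) (p q : Poly ℓ) → ev F (p ++ q) ≡ ev F p ℤ.+ ev F q
  ev-++ F [] q = sym (ℤₚ.+-identityˡ _)
  ev-++ F (term c d α ∷ p) q =
    trans (cong (λ z → c ℤ.* F d α ℤ.+ z) (ev-++ F p q)) (sym (ℤₚ.+-assoc (c ℤ.* F d α) (ev F p) (ev F q)))

  ev-map : (f : Term ℓ → Term ℓ′) (F : Fun ℓ′) (G : Fun ℓ) (a : ℤ) →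
    (∀ t → Term.coef (f t) ℤ.* F (Term.qdeg (f t)) (Term.exp (f t))
             ≡ a ℤ.* (Term.coef t ℤ.* G (Term.qdeg t) (Term.exp t))) →
    ∀ p → ev F (map f p) ≡ a ℤ.* ev G p
  ev-map f F G a h [] = sym (ℤₚ.*-zeroʳ a)
  ev-map f F G a h (t@(term c d α) ∷ p) =
    trans (cong₂ ℤ._+_ (h t) (ev-map f F G a h p)) (sym (ℤₚ.*-distribˡ-+ a (c ℤ.* G d α) (ev G p)))

  ev-concatMap : (f : Term ℓ → Poly ℓ′) (F : Fun ℓ′) (G : Fun ℓ) →
    (∀ c d α → ev F (f (term c d α)) ≡ c ℤ.* G d α) →
    ∀ p → ev F (concatMap f p) ≡ ev G p
  ev-concatMap f F G h [] = refl
  ev-concatMap f F G h (t@(term c d α) ∷ p) =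
    trans (ev-++ F (f t) (concatMap f p)) (cong₂ ℤ._+_ (h c d α) (ev-concatMap f F G h p))

  ev-scale : (F : Fun ℓ) (a : ℤ) (p : Poly ℓ) → ev F (scale a p) ≡ a ℤ.* ev F p
  ev-scale F a = ev-map _ F F a λ t → ℤₚ.*-assoc a (Term.coef t) (F (Term.qdeg t) (Term.exp t))

  ev-mono : (F : Fun ℓ) (d : ℤ) (α : Exp ℓ) → ev F (mono d α) ≡ F d α
  ev-mono F d α = trans (ℤₚ.+-identityʳ _) (ℤₚ.*-identityˡ _)

  ev-+ : (F G : Fun ℓ) (p : Poly ℓ) → ev (λ d α → F d α ℤ.+ G d α) p ≡ ev F p ℤ.+ ev G p
  ev-+ F G [] = refl
  ev-+ F G (term c d α ∷ p) = trans (cong (λ z → c ℤ.* (F d α ℤ.+ G d α) ℤ.+ z) (ev-+ F G p))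
    (lem c (F d α) (G d α) (ev F p) (ev G p))
    where lem : ∀ c x y u v → c ℤ.* (x ℤ.+ y) ℤ.+ (u ℤ.+ v) ≡ c ℤ.* x ℤ.+ u ℤ.+ (c ℤ.* y ℤ.+ v)
          lem = solve-∀

  ev-* : (a : ℤ) (F : Fun ℓ) (p : Poly ℓ) → ev (λ d α → a ℤ.* F d α) p ≡ a ℤ.* ev F p
  ev-* a F [] = sym (ℤₚ.*-zeroʳ a)
  ev-* a F (term c d α ∷ p) = trans (cong (λ z → c ℤ.* (a ℤ.* F d α) ℤ.+ z) (ev-* a F p)) (lem c a (F d α) (ev F p))
    where lem : ∀ c a x u → c ℤ.* (a ℤ.* x) ℤ.+ a ℤ.* u ≡ a ℤ.* (c ℤ.* x ℤ.+ u)
          lem = solve-∀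

  ev-0 : (p : Poly ℓ) → ev (λ _ _ → + 0) p ≡ + 0
  ev-0 [] = refl
  ev-0 (term c d α ∷ p) = cong₂ ℤ._+_ (ℤₚ.*-zeroʳ c) (ev-0 p)

  -- Exchange of two finite sums; commutativity of the product rests on it.
  ev-swap : (F : ℤ → Exp ℓ → ℤ → Exp ℓ′ → ℤ) (p : Poly ℓ) (q : Poly ℓ′) →
    ev (λ d α → ev (F d α) q) p ≡ ev (λ e β → ev (λ d α → F d α e β) p) q
  ev-swap F [] q = sym (ev-0 q)
  ev-swap F (term c d α ∷ p) q = trans (cong₂ ℤ._+_ (sym (ev-* c (F d α) q)) (ev-swap F p q))
    (sym (ev-+ (λ e β → c ℤ.* F d α e β) (λ e β → ev (λ d α → F d α e β) p) q))

  ev-mulP : (F : Fun ℓ) (p q : Poly ℓ) →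
    ev F (mulP p q) ≡ ev (λ d α → ev (λ e β → F (d ℤ.+ e) (α ⊞ β)) q) p
  ev-mulP F p q = ev-concatMap _ F _
    (λ c d α → ev-map _ F (λ e β → F (d ℤ.+ e) (α ⊞ β)) c
      (λ t → ℤₚ.*-assoc c (Term.coef t) _) q) p

  -- Coefficientwise equality

  dec-refl : ∀ {a} {A : Set a} (d : (x y : A) → Dec (x ≡ y)) (x : A) → does (d x x) ≡ true
  dec-refl d x = dec-true (d x x) refl

  sameKey : ℤ → Exp ℓ → ℤ → Exp ℓ → Bool
  sameKey d β k α = does (d ℤ.≟ k) ∧ does (≡-dec ℤ._≟_ β α)

  sameKey-sound : (d : ℤ) (β : Exp ℓ) (k : ℤ) (α : Exp ℓ) → sameKey d β k α ≡ true → (d ≡ k) × (β ≡ α)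
  sameKey-sound d β k α e with d ℤ.≟ k | ≡-dec ℤ._≟_ β α
  ... | yes p | yes q = p , q
  ... | yes p | no q with () ← e
  ... | no p | _ with () ← e

  sameKey-refl : (d : ℤ) (β : Exp ℓ) → sameKey d β d β ≡ true
  sameKey-refl d β = cong₂ _∧_ (dec-refl ℤ._≟_ d) (dec-refl (≡-dec ℤ._≟_) β)

  δ : ℤ → Exp ℓ → Fun ℓ
  δ k α d β = if sameKey d β k α then + 1 else + 0

  coeffAt-ev : (p : Poly ℓ) (k : ℤ) (α : Exp ℓ) → coeffAt p k α ≡ ev (δ k α) p
  coeffAt-ev [] k α = refl
  coeffAt-ev (term c d β ∷ p) k α = cong₂ ℤ._+_ (lem (sameKey d β k α)) (coeffAt-ev p k α)
    where lem : ∀ b → (if b then c else + 0) ≡ c ℤ.* (if b then + 1 else + 0)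
          lem true = sym (ℤₚ.*-identityʳ c)
          lem false = sym (ℤₚ.*-zeroʳ c)

  remove : ℤ → Exp ℓ → Poly ℓ → Poly ℓ
  remove k α [] = []
  remove k α (term c d β ∷ p) = if sameKey d β k α then remove k α p else term c d β ∷ remove k α p

  remove-length : (k : ℤ) (α : Exp ℓ) (p : Poly ℓ) → length (remove k α p) ℕ.≤ length p
  remove-length k α [] = ℕ.z≤n
  remove-length k α (term c d β ∷ p) with sameKey d β k α
  ... | true = ℕₚ.m≤n⇒m≤1+n (remove-length k α p)
  ... | false = ℕ.s≤s (remove-length k α p)

  ev-remove : (F : Fun ℓ) (k : ℤ) (α : Exp ℓ) (p : Poly ℓ) →
    ev F p ≡ coeffAt p k α ℤ.* F k α ℤ.+ ev F (remove k α p)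
  ev-remove F k α [] = sym (ℤₚ.+-identityʳ _)
  ev-remove F k α (term c d β ∷ p) with sameKey d β k α in eq
  ... | true with refl , refl ← sameKey-sound d β k α eq =
    trans (cong (λ z → c ℤ.* F k α ℤ.+ z) (ev-remove F k α p))
          (lem c (F k α) (coeffAt p k α) (ev F (remove k α p)))
    where lem : ∀ c f x y → c ℤ.* f ℤ.+ (x ℤ.* f ℤ.+ y) ≡ (c ℤ.+ x) ℤ.* f ℤ.+ y
          lem = solve-∀
  ... | false = trans (cong (λ z → c ℤ.* F d β ℤ.+ z) (ev-remove F k α p))
          (lem (c ℤ.* F d β) (F k α) (coeffAt p k α) (ev F (remove k α p)))
    where lem : ∀ c f x y → c ℤ.+ (x ℤ.* f ℤ.+ y) ≡ (+ 0 ℤ.+ x) ℤ.* f ℤ.+ (c ℤ.+ y)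
          lem = solve-∀

  coeffAt-remove : (k : ℤ) (α : Exp ℓ) (p : Poly ℓ) (k′ : ℤ) (α′ : Exp ℓ) →
    coeffAt p k′ α′ ≡ + 0 → coeffAt (remove k α p) k′ α′ ≡ + 0
  coeffAt-remove k α p k′ α′ h with sameKey k α k′ α′ in eq
  ... | true with refl , refl ← sameKey-sound k α k′ α′ eq = go p
    where
    go : ∀ p → coeffAt (remove k α p) k α ≡ + 0
    go [] = refl
    go (term c d β ∷ p) with sameKey d β k α in eq′
    ... | true = go p
    ... | false rewrite eq′ = trans (ℤₚ.+-identityˡ _) (go p)
  ... | false = trans (go p) h
    where
    go : ∀ p → coeffAt (remove k α p) k′ α′ ≡ coeffAt p k′ α′
    go [] = refl
    go (term c d β ∷ p) with sameKey d β k α in eq′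
    ... | true with refl , refl ← sameKey-sound d β k α eq′ rewrite eq = trans (go p) (sym (ℤₚ.+-identityˡ _))
    ... | false = cong (λ z → (if sameKey d β k′ α′ then c else + 0) ℤ.+ z) (go p)

  -- All terms sharing the key of the first one are removed together. Their total contribution is
  -- the coefficient at that key times a value of `F`, hence 0, and the list that remains is
  -- strictly shorter. `N` bounds the length for the recursion.
  vanishing : (N : ℕ) (p : Poly ℓ) → length p ℕ.≤ N → (∀ k α → coeffAt p k α ≡ + 0) → ∀ F → ev F p ≡ + 0
  vanishing N [] _ h F = refl
  vanishing (suc N) p@(term c d β ∷ p′) (ℕ.s≤s len) h F =
    trans (ev-remove F d β p) (cong₂ ℤ._+_ (cong (ℤ._* F d β) (h d β))
      (vanishing N (remove d β p) (ℕₚ.≤-trans shorter len) (λ k α → coeffAt-remove d β p k α (h k α)) F))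
    where
    shorter : length (remove d β p) ℕ.≤ length p′
    shorter rewrite sameKey-refl d β = remove-length d β p′

  ≈P⇒≈ : {p q : Poly ℓ} → p ≈P q → p ≈ q
  ≈P⇒≈ {p = p} {q} h = mk≈ λ F →
    ℤₚ.i-j≡0⇒i≡j _ _ (trans (sym (diff F)) (vanishing _ (p ++ scale (ℤ.- + 1) q) ℕₚ.≤-refl vanish F))
    where
    diff : ∀ F → ev F (p ++ scale (ℤ.- + 1) q) ≡ ev F p ℤ.- ev F q
    diff F = trans (ev-++ F p _) (cong (λ z → ev F p ℤ.+ z) (trans (ev-scale F (ℤ.- + 1) q) (ℤₚ.-1*i≡-i (ev F q))))
    vanish : ∀ k α → coeffAt (p ++ scale (ℤ.- + 1) q) k α ≡ + 0
    vanish k α = begin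
      coeffAt (p ++ scale (ℤ.- + 1) q) k α ≡⟨ coeffAt-ev (p ++ scale (ℤ.- + 1) q) k α ⟩
      ev (δ k α) (p ++ scale (ℤ.- + 1) q)  ≡⟨ diff _ ⟩
      ev (δ k α) p ℤ.- ev (δ k α) q        ≡⟨ cong₂ ℤ._-_ (coeffAt-ev p k α) (coeffAt-ev q k α) ⟨
      coeffAt p k α ℤ.- coeffAt q k α      ≡⟨ cong (λ z → z ℤ.- coeffAt q k α) (h k α) ⟩
      coeffAt q k α ℤ.- coeffAt q k α      ≡⟨ ℤₚ.+-inverseʳ (coeffAt q k α) ⟩
      + 0 ∎
      where open ≡-Reasoning

  ≈⇒coeffAt : {p q : Poly ℓ} → p ≈ q → ∀ k α → coeffAt p k α ≡ coeffAt q k α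
  ≈⇒coeffAt {p = p} {q} e k α = trans (coeffAt-ev p k α) (trans (at e _) (sym (coeffAt-ev q k α)))

  -- The ring of Laurent polynomials

  ⊞-comm : (α β : Exp ℓ) → α ⊞ β ≡ β ⊞ α
  ⊞-comm [] [] = refl
  ⊞-comm (a ∷ α) (b ∷ β) = cong₂ _∷_ (ℤₚ.+-comm a b) (⊞-comm α β)

  ⊞-assoc : (α β γ : Exp ℓ) → (α ⊞ β) ⊞ γ ≡ α ⊞ (β ⊞ γ)
  ⊞-assoc [] [] [] = refl
  ⊞-assoc (a ∷ α) (b ∷ β) (c ∷ γ) = cong₂ _∷_ (ℤₚ.+-assoc a b c) (⊞-assoc α β γ)

  𝟎 : Exp ℓ
  𝟎 = V.tabulate λ _ → + 0

  ⊞-identityˡ : (α : Exp ℓ) → 𝟎 ⊞ α ≡ α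
  ⊞-identityˡ [] = refl
  ⊞-identityˡ (a ∷ α) = cong₂ _∷_ (ℤₚ.+-identityˡ a) (⊞-identityˡ α)

  -- Opaque, so that unification never unfolds a sum or product into list operations.
  infixl 6 _+_
  infixl 7 _*_
  infix 8 -_

  opaque
    _+_ _*_ : Poly ℓ → Poly ℓ → Poly ℓ
    _+_ = _++_
    _*_ = mulP

    -_ : Poly ℓ → Poly ℓ
    -_ = scale (ℤ.- + 1)

  opaque
    unfolding _+_

    +-def : (p q : Poly ℓ) → p ++ q ≡ p + q
    +-def p q = refl

    *-def : (p q : Poly ℓ) → mulP p q ≡ p * q
    *-def p q = refl

    ev-sum : (F : Fun ℓ) (p q : Poly ℓ) → ev F (p + q) ≡ ev F p ℤ.+ ev F q
    ev-sum = ev-++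

    ev-neg : (F : Fun ℓ) (p : Poly ℓ) → ev F (- p) ≡ ℤ.- ev F p
    ev-neg F p = trans (ev-scale F (ℤ.- + 1) p) (ℤₚ.-1*i≡-i (ev F p))

    ev-prod : (F : Fun ℓ) (p q : Poly ℓ) →
      ev F (p * q) ≡ ev (λ d α → ev (λ e β → F (d ℤ.+ e) (α ⊞ β)) q) p
    ev-prod = ev-mulP

  ev-prod′ : (F : Fun ℓ) (p q : Poly ℓ) →
    ev F (p * q) ≡ ev (λ e β → ev (λ d α → F (d ℤ.+ e) (α ⊞ β)) p) q
  ev-prod′ F p q = trans (ev-prod F p q) (ev-swap (λ d α e β → F (d ℤ.+ e) (α ⊞ β)) p q)

  polyRing : ℕ → CommutativeRing 0ℓ 0ℓ
  polyRing ℓ = record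
    { Carrier = Poly ℓ ; _≈_ = _≈_ ; _+_ = _+_ ; _*_ = _*_ ; -_ = -_ ; 0# = [] ; 1# = one
    ; isCommutativeRing = record
      { isRing = record
        { +-isAbelianGroup = record
          { isGroup = record
            { isMonoid = record
              { isSemigroup = record
                { isMagma = record
                  { isEquivalence = Setoid.isEquivalence (≈-setoid ℓ)
                  ; ∙-cong = λ {p} {q} {r} {s} e f → mk≈ λ F →
                      trans (ev-sum F p r) (trans (cong₂ ℤ._+_ (at e F) (at f F)) (sym (ev-sum F q s))) }
                ; assoc = λ p q r → mk≈ λ F → trans (ev-sum F (p + q) r) (trans (cong (ℤ._+ ev F r) (ev-sum F p q))
                    (trans (ℤₚ.+-assoc (ev F p) (ev F q) (ev F r))
                      (sym (trans (ev-sum F p (q + r)) (cong (λ z → ev F p ℤ.+ z) (ev-sum F q r)))))) }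
              ; identity = (λ p → mk≈ λ F → trans (ev-sum F [] p) (ℤₚ.+-identityˡ (ev F p)))
                         , (λ p → mk≈ λ F → trans (ev-sum F p []) (ℤₚ.+-identityʳ (ev F p))) }
            ; inverse = (λ p → mk≈ λ F → trans (ev-sum F ((- p)) p)
                          (trans (cong (ℤ._+ ev F p) (ev-neg F p)) (ℤₚ.+-inverseˡ (ev F p))))
                      , (λ p → mk≈ λ F → trans (ev-sum F p ((- p)))
                          (trans (cong (λ z → ev F p ℤ.+ z) (ev-neg F p)) (ℤₚ.+-inverseʳ (ev F p))))
            ; ⁻¹-cong = λ {p} {q} e → mk≈ λ F → trans (ev-neg F p) (trans (cong ℤ.-_ (at e F)) (sym (ev-neg F q))) }
          ; comm = λ p q → mk≈ λ F →
              trans (ev-sum F p q) (trans (ℤₚ.+-comm (ev F p) (ev F q)) (sym (ev-sum F q p))) }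
        ; *-cong = λ {p} {q} {r} {s} e f → mk≈ λ F → begin
            ev F (p * r) ≡⟨ ev-prod F p r ⟩
            _ ≡⟨ at e _ ⟩
            _ ≡⟨ ev-prod F q r ⟨
            ev F (q * r) ≡⟨ ev-prod′ F q r ⟩
            _ ≡⟨ at f _ ⟩
            _ ≡⟨ ev-prod′ F q s ⟨
            ev F (q * s) ∎
        ; *-assoc = λ p q r → mk≈ λ F → begin
            ev F ((p * q) * r) ≡⟨ ev-prod F (p * q) r ⟩
            _ ≡⟨ ev-prod _ p q ⟩
            _ ≡⟨ ev-cong (λ d α → ev-cong (λ e β → ev-cong (λ f γ →
                   cong₂ F (ℤₚ.+-assoc d e f) (⊞-assoc α β γ)) r) q) p ⟩
            _ ≡⟨ ev-cong (λ d α → ev-prod _ q r) p ⟨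
            _ ≡⟨ ev-prod F p (q * r) ⟨
            ev F (p * (q * r)) ∎
        ; *-identity = identityˡ , (λ p → mk≈ λ F → trans (at (*-comm p one) F) (at (identityˡ p) F))
        ; distrib = distribˡ , (λ p q r → mk≈ λ F → trans (at (*-comm (q + r) p) F)
            (trans (at (distribˡ p q r) F) (trans (ev-sum F (p * q) (p * r))
              (trans (cong₂ ℤ._+_ (at (*-comm p q) F) (at (*-comm p r) F))
                (sym (ev-sum F (q * p) (r * p))))))) }
      ; *-comm = *-comm } }
    where
    open ≡-Reasoning
    *-comm : ∀ p q → p * q ≈ q * p
    *-comm p q = mk≈ λ F → trans (ev-prod F p q) (trans
      (ev-cong (λ d α → ev-cong (λ e β → cong₂ F (ℤₚ.+-comm d e) (⊞-comm α β)) q) p)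
      (sym (ev-prod′ F q p)))
    identityˡ : ∀ p → one * p ≈ p
    identityˡ p = mk≈ λ F →
      trans (ev-prod F one p) (trans (ev-mono (λ d α → ev (λ e β → F (d ℤ.+ e) (α ⊞ β)) p) (+ 0) 𝟎)
      (ev-cong (λ e β → cong₂ F (ℤₚ.+-identityˡ e) (⊞-identityˡ β)) p))
    distribˡ : ∀ p q r → p * (q + r) ≈ p * q + p * r
    distribˡ p q r = mk≈ λ F → begin
      ev F (p * (q + r)) ≡⟨ ev-prod′ F p (q + r) ⟩
      _ ≡⟨ ev-sum _ q r ⟩
      _ ≡⟨ cong₂ ℤ._+_ (ev-prod′ F p q) (ev-prod′ F p r) ⟨
      _ ≡⟨ ev-sum F (p * q) (p * r) ⟨
      ev F (p * q + p * r) ∎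

open Evaluation hiding (_+_; _*_; -_)
open _≈_

-- The solver computes with integer coefficients, whose equality is decidable, embedded as constant
-- polynomials.
module PolySolver (ℓ : ℕ) where
  constant : ℤ → Poly ℓ
  constant c = term c (+ 0) 𝟎 ∷ []

  private
    target = ACR.fromCommutativeRing (polyRing ℓ)
    source = CommutativeRing.rawRing ℤₚ.+-*-commutativeRing

    ev-constant : ∀ F c → ev F (constant c) ≡ c ℤ.* F (+ 0) 𝟎
    ev-constant F c = ℤₚ.+-identityʳ _

    morphism : source ACR.-Raw-AlmostCommutative⟶ target
    morphism = record
      { ⟦_⟧ = constant
      ; +-homo = λ a b → mk≈ λ F → trans (ev-constant F (a ℤ.+ b)) (trans (ℤₚ.*-distribʳ-+ (F (+ 0) 𝟎) a b)
          (sym (trans (ev-sum F (constant a) (constant b)) (cong₂ ℤ._+_ (ev-constant F a) (ev-constant F b)))))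
      ; *-homo = λ a b → mk≈ λ F → trans (ev-constant F (a ℤ.* b)) (trans (ℤₚ.*-assoc a b (F (+ 0) 𝟎))
          (sym (trans (ev-prod F (constant a) (constant b))
            (trans (ev-constant (λ d α → ev (λ e β → F (d ℤ.+ e) (α ⊞ β)) (constant b)) a)
              (cong (a ℤ.*_) (trans (ev-constant (λ e β → F (+ 0 ℤ.+ e) (𝟎 ⊞ β)) b)
                (cong (λ β → b ℤ.* F (+ 0) β) (⊞-identityˡ 𝟎))))))))
      ; -‿homo = λ a → mk≈ λ F → trans (ev-constant F (ℤ.- a)) (trans (sym (ℤₚ.neg-distribˡ-* a (F (+ 0) 𝟎)))
          (sym (trans (ev-neg F (constant a)) (cong ℤ.-_ (ev-constant F a)))))
      ; 0-homo = mk≈ λ F → refl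
      ; 1-homo = mk≈ λ F → refl }

    coefficient≟ : ∀ a b → Maybe (constant a ≈ constant b)
    coefficient≟ a b with a ℤ.≟ b
    ... | yes refl = just (mk≈ λ F → refl)
    ... | no _ = nothing

  open Algebra.Solver.Ring source target morphism coefficient≟ public using (solve; _:+_; _:*_; :-_; _:-_; con; _:=_)

-- Linear operators

-- The transpose `dual` is part of the data. From `spec` alone follow additivity, compatibility with
-- `≈`, and the principle that an operator is determined by its values on monomials.
record Op (ℓ : ℕ) : Set where
  constructor mkOp
  infixr 8 _·_
  field
    _·_  : Poly ℓ → Poly ℓ
    dual : Fun ℓ → Fun ℓ
    spec : ∀ F p → ev F (_·_ p) ≡ ev (dual F) p
open Op public

module LaurentRing (ℓ : ℕ) where
  open CommutativeRing (polyRing ℓ) public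
    using (_+_; _*_; -_; _-_; 0#; 1#; +-cong; *-cong; +-assoc; +-comm; *-assoc; *-comm; distribˡ; distribʳ;
      zeroˡ; zeroʳ; *-identityˡ; *-identityʳ; +-congˡ; +-congʳ; *-congˡ; *-congʳ; +-identityˡ; +-identityʳ; -‿cong; -‿inverseʳ; -‿inverseˡ)
    renaming (refl to ≈-refl; sym to ≈-sym; trans to ≈-trans; reflexive to ≈-reflexive)
  open import Algebra.Properties.AbelianGroup (CommutativeRing.+-abelianGroup (polyRing ℓ)) public
    using () renaming (∙-cancelˡ to +-cancelˡ; ε⁻¹≈ε to -0≈0)
  open import Algebra.Properties.Ring (CommutativeRing.ring (polyRing ℓ)) public using (-‿distribˡ-*)
  module ≈-R = SetoidReasoning (≈-setoid ℓ)

module Operators {ℓ : ℕ} where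
  open LaurentRing ℓ

  op-cong : (A : Op ℓ) {p q : Poly ℓ} → p ≈ q → A · p ≈ A · q
  op-cong A {p} {q} e = mk≈ λ F → trans (spec A F p) (trans (at e (dual A F)) (sym (spec A F q)))

  op-+ : (A : Op ℓ) (p q : Poly ℓ) → A · (p + q) ≈ A · p + A · q
  op-+ A p q = mk≈ λ F → trans (spec A F (p + q)) (trans (ev-sum (dual A F) p q)
    (trans (cong₂ ℤ._+_ (sym (spec A F p)) (sym (spec A F q))) (sym (ev-sum F (A · p) (A · q)))))

  op-0 : (A : Op ℓ) → A · 0# ≈ 0#
  op-0 A = mk≈ λ F → spec A F []

  op-scale : (A : Op ℓ) (c : ℤ) (p : Poly ℓ) → A · scale c p ≈ scale c (A · p)
  op-scale A c p = mk≈ λ F → trans (spec A F (scale c p)) (trans (ev-scale (dual A F) c p)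
    (trans (cong (c ℤ.*_) (sym (spec A F p))) (sym (ev-scale F c (A · p)))))

  op-neg : (A : Op ℓ) (p : Poly ℓ) → A · (- p) ≈ - (A · p)
  op-neg A p = mk≈ λ F → trans (spec A F (- p)) (trans (ev-neg (dual A F) p)
    (trans (cong ℤ.-_ (sym (spec A F p))) (sym (ev-neg F (A · p)))))

  dual-mono : (A : Op ℓ) (F : Fun ℓ) (d : ℤ) (α : Exp ℓ) → dual A F d α ≡ ev F (A · mono d α)
  dual-mono A F d α = sym (trans (spec A F (mono d α)) (ev-mono (dual A F) d α))

  op-ext : (A B : Op ℓ) → (∀ d α → A · mono d α ≈ B · mono d α) → ∀ p → A · p ≈ B · p
  op-ext A B h p = mk≈ λ F → trans (spec A F p) (trans
    (ev-cong (λ d α → trans (dual-mono A F d α) (trans (at (h d α) F) (sym (dual-mono B F d α)))) p)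
    (sym (spec B F p)))

  infixr 9 _⊙_
  _⊙_ : Op ℓ → Op ℓ → Op ℓ
  A ⊙ B = mkOp (λ p → A · (B · p)) (λ F → dual B (dual A F))
    (λ F p → trans (spec A F (B · p)) (spec B (dual A F) p))

  infixl 6 _⊕_
  _⊕_ : Op ℓ → Op ℓ → Op ℓ
  A ⊕ B = mkOp (λ p → A · p + B · p) (λ F d α → dual A F d α ℤ.+ dual B F d α)
    (λ F p → trans (ev-sum F (A · p) (B · p))
       (trans (cong₂ ℤ._+_ (spec A F p) (spec B F p)) (sym (ev-+ (dual A F) (dual B F) p))))

  idₒ : Op ℓ
  idₒ = mkOp id id (λ _ _ → refl)

  0ₒ : Op ℓ
  0ₒ = mkOp (λ _ → []) (λ _ _ _ → + 0) (λ F p → sym (ev-0 p))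

  mulBy : Poly ℓ → Op ℓ
  mulBy r = mkOp (r *_) (λ F e β → ev (λ d α → F (d ℤ.+ e) (α ⊞ β)) r) (λ F p → ev-prod′ F r p)

  lin : (ℤ → Exp ℓ → Poly ℓ) → Op ℓ
  lin A = mkOp (concatMap (λ t → scale (Term.coef t) (A (Term.qdeg t) (Term.exp t))))
    (λ F d α → ev F (A d α))
    (λ F p → ev-concatMap _ F _ (λ c d α → ev-scale F c (A d α)) p)

  lin-mono : (A : ℤ → Exp ℓ → Poly ℓ) (d : ℤ) (α : Exp ℓ) → lin A · mono d α ≈ A d α
  lin-mono A d α = mk≈ λ F → trans (spec (lin A) F (mono d α)) (ev-mono (dual (lin A) F) d α)

  mono-* : (d e : ℤ) (α β : Exp ℓ) → mono d α * mono e β ≈ mono (d ℤ.+ e) (α ⊞ β)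
  mono-* d e α β = ≈-reflexive (sym (*-def (mono d α) (mono e β)))

  mono-cong : {d e : ℤ} {α β : Exp ℓ} → d ≡ e → α ≡ β → mono d α ≈ mono e β
  mono-cong refl refl = ≈-refl

-- Exponent vectors are indexed by ℕ, with entry 0 (and no variable) past the end.
coord : Exp ℓ → ℕ → ℤ
coord [] k = + 0
coord (a ∷ α) zero = a
coord (a ∷ α) (suc k) = coord α k

single : ℕ → ℤ → Exp ℓ
single {zero} k z = []
single {suc ℓ} zero z = z ∷ 𝟎
single {suc ℓ} (suc k) z = + 0 ∷ single k z

coord-ext : (α β : Exp ℓ) → (∀ k → coord α k ≡ coord β k) → α ≡ β
coord-ext [] [] h = refl
coord-ext (a ∷ α) (b ∷ β) h = cong₂ _∷_ (h 0) (coord-ext α β (h ∘ suc))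

coord-⊞ : (α β : Exp ℓ) (k : ℕ) → coord (α ⊞ β) k ≡ coord α k ℤ.+ coord β k
coord-⊞ [] [] k = refl
coord-⊞ (a ∷ α) (b ∷ β) zero = refl
coord-⊞ (a ∷ α) (b ∷ β) (suc k) = coord-⊞ α β k

coord-𝟎 : (k : ℕ) → coord (𝟎 {ℓ}) k ≡ + 0
coord-𝟎 {zero} k = refl
coord-𝟎 {suc ℓ} zero = refl
coord-𝟎 {suc ℓ} (suc k) = coord-𝟎 {ℓ} k

coord-single : (k : ℕ) (z : ℤ) → k ℕ.< ℓ → coord (single {ℓ} k z) k ≡ z
coord-single {suc ℓ} zero z _ = refl
coord-single {suc ℓ} (suc k) z (ℕ.s≤s h) = coord-single k z h

coord-single-≢ : (k j : ℕ) (z : ℤ) → j ≢ k → coord (single {ℓ} k z) j ≡ + 0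
coord-single-≢ {zero} k j z _ = refl
coord-single-≢ {suc ℓ} zero zero z ne = ⊥-elim (ne refl)
coord-single-≢ {suc ℓ} zero (suc j) z _ = coord-𝟎 {ℓ} j
coord-single-≢ {suc ℓ} (suc k) zero z _ = refl
coord-single-≢ {suc ℓ} (suc k) (suc j) z ne = coord-single-≢ {ℓ} k j z (ne ∘ cong suc)

single-+ : (k : ℕ) (y z : ℤ) → single {ℓ} k y ⊞ single k z ≡ single k (y ℤ.+ z)
single-+ {zero} k y z = refl
single-+ {suc ℓ} zero y z = cong (_ ∷_) (⊞-identityˡ 𝟎)
single-+ {suc ℓ} (suc k) y z = cong (+ 0 ∷_) (single-+ k y z)

single-0 : (k : ℕ) → single {ℓ} k (+ 0) ≡ 𝟎
single-0 {zero} k = refl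
single-0 {suc ℓ} zero = refl
single-0 {suc ℓ} (suc k) = cong (+ 0 ∷_) (single-0 k)

ℤ-ind : (P : ℤ → Set) → (∀ z → P z → P (+ 1 ℤ.+ z)) → (∀ z → P (+ 1 ℤ.+ z) → P z) → P (+ 0) → ∀ z → P z
ℤ-ind P up down z₀ (+ zero) = z₀
ℤ-ind P up down z₀ (+ suc m) = up (+ m) (ℤ-ind P up down z₀ (+ m))
ℤ-ind P up down z₀ -[1+ zero ] = down -[1+ 0 ] z₀
ℤ-ind P up down z₀ -[1+ suc m ] = down -[1+ suc m ] (ℤ-ind P up down z₀ -[1+ m ])

-- Laurent exponents are reached from `𝟎` by unit steps of both signs, so each step is required in
-- both directions.
Exp-ind : (P : Exp ℓ → Set) → (∀ k α → k ℕ.< ℓ → P α → P (single k (+ 1) ⊞ α)) →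
  (∀ k α → k ℕ.< ℓ → P (single k (+ 1) ⊞ α) → P α) → P 𝟎 → ∀ α → P α
Exp-ind {zero} P up down p₀ [] = p₀
Exp-ind {suc ℓ} P up down p₀ (z ∷ α) = ℤ-ind (λ z → P (z ∷ α))
  (λ z h → subst (λ β → P (_ ∷ β)) (⊞-identityˡ α) (up 0 (z ∷ α) (ℕ.s≤s ℕ.z≤n) h))
  (λ z h → down 0 (z ∷ α) (ℕ.s≤s ℕ.z≤n) (subst (λ β → P (_ ∷ β)) (sym (⊞-identityˡ α)) h))
  (Exp-ind (λ β → P (+ 0 ∷ β)) (λ k β k< → up (suc k) (+ 0 ∷ β) (ℕ.s≤s k<))
     (λ k β k< → down (suc k) (+ 0 ∷ β) (ℕ.s≤s k<)) p₀ α) z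

-- Invertible variables and twisted Leibniz rules.

module Variables {ℓ : ℕ} where
  open LaurentRing ℓ
  open Operators {ℓ}

  X : ℕ → ℤ → Poly ℓ
  X k z = mono (+ 0) (single k z)

  x x⁻ : ℕ → Poly ℓ
  x k = X k (+ 1)
  x⁻ k = X k (ℤ.- + 1)

  X-+ : (k : ℕ) (y z : ℤ) → X k y * X k z ≈ X k (y ℤ.+ z)
  X-+ k y z = ≈-trans (mono-* (+ 0) (+ 0) (single k y) (single k z)) (mono-cong refl (single-+ k y z))

  X-0 : (k : ℕ) → X k (+ 0) ≈ 1#
  X-0 k = mono-cong refl (single-0 k)

  X-cancel : (k : ℕ) (z : ℤ) (f : Poly ℓ) → X k (ℤ.- z) * (X k z * f) ≈ f
  X-cancel k z f = begin
    X k (ℤ.- z) * (X k z * f) ≈⟨ *-assoc (X k (ℤ.- z)) (X k z) f ⟨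
    X k (ℤ.- z) * X k z * f
      ≈⟨ *-congʳ (≈-trans (X-+ k (ℤ.- z) z) (mono-cong refl (cong (single k) (ℤₚ.+-inverseˡ z)))) ⟩
    X k (+ 0) * f ≈⟨ *-congʳ (X-0 k) ⟩
    1# * f ≈⟨ *-identityˡ f ⟩
    f ∎
    where open ≈-R

  X-*-mono : (k : ℕ) (z d : ℤ) (α : Exp ℓ) → X k z * mono d α ≈ mono d (single k z ⊞ α)
  X-*-mono k z d α = ≈-trans (mono-* (+ 0) d (single k z) α) (mono-cong (ℤₚ.+-identityˡ d) refl)

  ev-X : (F : Fun ℓ) (k : ℕ) (z : ℤ) (p : Poly ℓ) → ev F (X k z * p) ≡ ev (λ d α → F d (single k z ⊞ α)) p
  ev-X F k z p = trans (ev-prod F (X k z) p) (trans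
    (ev-mono (λ d α → ev (λ e β → F (d ℤ.+ e) (α ⊞ β)) p) (+ 0) (single k z))
    (ev-cong (λ e β → cong (λ e → F e (single k z ⊞ β)) (ℤₚ.+-identityˡ e)) p))

  x-cancel : (k : ℕ) (f g : Poly ℓ) → x k * f ≈ x k * g → f ≈ g
  x-cancel k f g e = ≈-trans (≈-sym (X-cancel k (+ 1) f)) (≈-trans (*-congˡ e) (X-cancel k (+ 1) g))

  -- Modelled on π_i(x_i f) = x_i f + x_{i+1} π_i f. The variable may change from `k` to `k′`, and
  -- the inhomogeneous part `c` is arbitrary, but both have to be common to the two operators.
  TwistedStep : Op ℓ → Op ℓ → ℕ → Poly ℓ → Set
  TwistedStep A B k f = Σ[ c ∈ Poly ℓ ] Σ[ k′ ∈ ℕ ]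
    (A · (x k * f) ≈ c + x k′ * A · f) × (B · (x k * f) ≈ c + x k′ * B · f)

  -- A twisted step transfers the equality across multiplication by x_k in both directions, x_{k′} being invertible.
  twisted-ext : (A B : Op ℓ) → (∀ d → A · mono d 𝟎 ≈ B · mono d 𝟎) →
    (∀ k f → k ℕ.< ℓ → TwistedStep A B k f) → ∀ f → A · f ≈ B · f
  twisted-ext A B base step = op-ext A B λ d α → Exp-ind (λ α → A · mono d α ≈ B · mono d α)
    (λ k α k< e → let c , k′ , ea , eb = step k (mono d α) k< in begin
       A · mono d (single k (+ 1) ⊞ α) ≈⟨ op-cong A (X-*-mono k (+ 1) d α) ⟨
       A · (x k * mono d α) ≈⟨ ea ⟩
       c + x k′ * A · mono d α ≈⟨ +-congˡ (*-congˡ e) ⟩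
       c + x k′ * B · mono d α ≈⟨ eb ⟨
       B · (x k * mono d α) ≈⟨ op-cong B (X-*-mono k (+ 1) d α) ⟩
       B · mono d (single k (+ 1) ⊞ α) ∎)
    (λ k α k< e → let c , k′ , ea , eb = step k (mono d α) k< in
       x-cancel k′ _ _ (+-cancelˡ c _ _ (begin
         c + x k′ * A · mono d α ≈⟨ ea ⟨
         A · (x k * mono d α) ≈⟨ op-cong A (X-*-mono k (+ 1) d α) ⟩
         A · mono d (single k (+ 1) ⊞ α) ≈⟨ e ⟩
         B · mono d (single k (+ 1) ⊞ α) ≈⟨ op-cong B (X-*-mono k (+ 1) d α) ⟨
         B · (x k * mono d α) ≈⟨ eb ⟩
         c + x k′ * B · mono d α ∎)))
    (base d) α
    where open ≈-R

-- Discrete primitives and Demazure operators on monomials.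

IsPrimitive : (ℤ → ℤ) → (ℤ → ℤ) → Set
IsPrimitive H g = ∀ u → H (+ 1 ℤ.+ u) ≡ H u ℤ.+ g u

-- Signed summation from 0. It lets the two branches of the Demazure quotient, with their opposite
-- signs, be written as one difference of values.
∫ : (ℤ → ℤ) → ℤ → ℤ
∫ g (+ zero) = + 0
∫ g (+ suc m) = ∫ g (+ m) ℤ.+ g (+ m)
∫ g -[1+ zero ] = ℤ.- g -[1+ 0 ]
∫ g -[1+ suc m ] = ∫ g -[1+ m ] ℤ.- g -[1+ suc m ]

∫-primitive : (g : ℤ → ℤ) → IsPrimitive (∫ g) g
∫-primitive g (+ m) = refl
∫-primitive g -[1+ zero ] = sym (ℤₚ.+-inverseˡ (g -[1+ 0 ]))
∫-primitive g -[1+ suc m ] = lem (∫ g -[1+ m ]) (g -[1+ suc m ])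
  where lem : ∀ a b → a ≡ a ℤ.- b ℤ.+ b
        lem = solve-∀

primitive-unique : {H H′ g g′ : ℤ → ℤ} → IsPrimitive H g → IsPrimitive H′ g′ → (∀ u → g u ≡ g′ u) →
  ∀ p r → H p ℤ.- H r ≡ H′ p ℤ.- H′ r
primitive-unique {H} {H′} {g} {g′} h h′ e p r =
  lem (H p) (H′ p) (H r) (H′ r) (trans (constant p) (sym (constant r)))
  where
  step : ∀ z → H (+ 1 ℤ.+ z) ℤ.- H′ (+ 1 ℤ.+ z) ≡ H z ℤ.- H′ z
  step z rewrite h z | h′ z | e z = lem (H z) (H′ z) (g′ z)
    where lem : ∀ a b c → a ℤ.+ c ℤ.- (b ℤ.+ c) ≡ a ℤ.- b
          lem = solve-∀
  constant : ∀ z → H z ℤ.- H′ z ≡ H (+ 0) ℤ.- H′ (+ 0)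
  constant = ℤ-ind (λ z → H z ℤ.- H′ z ≡ H (+ 0) ℤ.- H′ (+ 0))
    (λ z q → trans (step z) q) (λ z q → trans (sym (step z)) q) refl
  lem : ∀ a a′ b b′ → a ℤ.- a′ ≡ b ℤ.- b′ → a ℤ.- b ≡ a′ ℤ.- b′
  lem a a′ b b′ q = trans (l₁ a a′ b) (trans (cong (λ z → z ℤ.+ (a′ ℤ.- b)) q) (l₂ a′ b b′))
    where l₁ : ∀ a a′ b → a ℤ.- b ≡ a ℤ.- a′ ℤ.+ (a′ ℤ.- b)
          l₁ = solve-∀
          l₂ : ∀ a′ b b′ → b ℤ.- b′ ℤ.+ (a′ ℤ.- b) ≡ a′ ℤ.- b′
          l₂ = solve-∀

-- Exponents in adjacent positions

lookup-coord₁ : (i : Fin n) (α : Exp (suc n)) → lookup α (inject₁ i) ≡ coord α (toℕ i)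
lookup-coord₁ zero (a ∷ α) = refl
lookup-coord₁ (suc i) (a ∷ α) = lookup-coord₁ i α

lookup-coord₂ : (i : Fin n) (α : Exp (suc n)) → lookup α (suc i) ≡ coord α (suc (toℕ i))
lookup-coord₂ zero (a ∷ b ∷ α) = refl
lookup-coord₂ (suc i) (a ∷ α) = lookup-coord₂ i α

coord-set2₁ : (i : Fin n) (u v : ℤ) (α : Exp (suc n)) → coord (set2 i u v α) (toℕ i) ≡ u
coord-set2₁ zero u v (a ∷ b ∷ α) = refl
coord-set2₁ (suc i) u v (a ∷ α) = coord-set2₁ i u v α

coord-set2₂ : (i : Fin n) (u v : ℤ) (α : Exp (suc n)) → coord (set2 i u v α) (suc (toℕ i)) ≡ v
coord-set2₂ zero u v (a ∷ b ∷ α) = refl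
coord-set2₂ (suc i) u v (a ∷ α) = coord-set2₂ i u v α

coord-set2-≢ : (i : Fin n) (u v : ℤ) (α : Exp (suc n)) (j : ℕ) → j ≢ toℕ i → j ≢ suc (toℕ i) →
  coord (set2 i u v α) j ≡ coord α j
coord-set2-≢ zero u v (a ∷ b ∷ α) zero h₁ h₂ = ⊥-elim (h₁ refl)
coord-set2-≢ zero u v (a ∷ b ∷ α) (suc zero) h₁ h₂ = ⊥-elim (h₂ refl)
coord-set2-≢ zero u v (a ∷ b ∷ α) (suc (suc j)) h₁ h₂ = refl
coord-set2-≢ (suc i) u v (a ∷ α) zero h₁ h₂ = refl
coord-set2-≢ (suc i) u v (a ∷ α) (suc j) h₁ h₂ = coord-set2-≢ i u v α j (h₁ ∘ cong suc) (h₂ ∘ cong suc)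

coord-raised : (i : Fin n) (α : Exp (suc n)) →
  coord (α V.[ inject₁ i ]%= (λ z → z ℤ.+ + 1)) (toℕ i) ≡ coord α (toℕ i) ℤ.+ + 1
coord-raised zero (a ∷ α) = refl
coord-raised (suc i) (a ∷ α) = coord-raised i α

coord-raised-≢ : (i : Fin n) (α : Exp (suc n)) (j : ℕ) → j ≢ toℕ i →
  coord (α V.[ inject₁ i ]%= (λ z → z ℤ.+ + 1)) j ≡ coord α j
coord-raised-≢ zero (a ∷ α) zero h = ⊥-elim (h refl)
coord-raised-≢ zero (a ∷ α) (suc j) h = refl
coord-raised-≢ (suc i) (a ∷ α) zero h = refl
coord-raised-≢ (suc i) (a ∷ α) (suc j) h = coord-raised-≢ i α j (h ∘ cong suc)

set2-unique : (i : Fin n) (u v : ℤ) (α β : Exp (suc n)) → coord β (toℕ i) ≡ u → coord β (suc (toℕ i)) ≡ v →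
  (∀ j → j ≢ toℕ i → j ≢ suc (toℕ i) → coord β j ≡ coord α j) → set2 i u v α ≡ β
set2-unique i u v α β h₁ h₂ h = coord-ext _ _ λ j → case j (j ℕ.≟ toℕ i) (j ℕ.≟ suc (toℕ i))
  where
  case : ∀ j → Dec (j ≡ toℕ i) → Dec (j ≡ suc (toℕ i)) → coord (set2 i u v α) j ≡ coord β j
  case j (yes refl) _ = trans (coord-set2₁ i u v α) (sym h₁)
  case j (no _) (yes refl) = trans (coord-set2₂ i u v α) (sym h₂)
  case j (no p) (no q) = trans (coord-set2-≢ i u v α j p q) (sym (h j p q))

set2-self : (i : Fin n) (α : Exp (suc n)) → set2 i (coord α (toℕ i)) (coord α (suc (toℕ i))) α ≡ α
set2-self i α = set2-unique i _ _ α α refl refl λ _ _ _ → refl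

toℕ< : (i : Fin n) → toℕ i ℕ.< n
toℕ< zero = ℕ.s≤s ℕ.z≤n
toℕ< (suc i) = ℕ.s≤s (toℕ< i)

single-⊞ : {ℓ : ℕ} (k : ℕ) (z : ℤ) (α : Exp ℓ) → k ℕ.< ℓ → coord (single k z ⊞ α) k ≡ z ℤ.+ coord α k
single-⊞ k z α k< = trans (coord-⊞ (single k z) α k) (cong (ℤ._+ coord α k) (coord-single k z k<))

single-⊞-≢ : {ℓ : ℕ} (k j : ℕ) (z : ℤ) (α : Exp ℓ) → j ≢ k → coord (single k z ⊞ α) j ≡ coord α j
single-⊞-≢ {ℓ} k j z α h = trans (coord-⊞ (single k z) α j)
  (trans (cong (ℤ._+ coord α j) (coord-single-≢ {ℓ} k j z h)) (ℤₚ.+-identityˡ _))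

module _ {n : ℕ} (i : Fin n) where
  private
    k = toℕ i
    k< : k ℕ.< suc n
    k< = ℕₚ.m≤n⇒m≤1+n (toℕ< i)
    sk< : suc k ℕ.< suc n
    sk< = ℕ.s≤s (toℕ< i)

  set2-single₁ : (z u v : ℤ) (α : Exp (suc n)) → set2 i (z ℤ.+ u) v α ≡ single k z ⊞ set2 i u v α
  set2-single₁ z u v α = set2-unique i _ _ α (single k z ⊞ set2 i u v α)
    (trans (single-⊞ k z (set2 i u v α) k<) (cong (λ w → z ℤ.+ w) (coord-set2₁ i u v α)))
    (trans (single-⊞-≢ k (suc k) z (set2 i u v α) ℕₚ.1+n≢n) (coord-set2₂ i u v α))
    (λ j p q → trans (single-⊞-≢ k j z (set2 i u v α) p) (coord-set2-≢ i u v α j p q))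

  set2-single₂ : (z u v : ℤ) (α : Exp (suc n)) → set2 i u (z ℤ.+ v) α ≡ single (suc k) z ⊞ set2 i u v α
  set2-single₂ z u v α = set2-unique i _ _ α (single (suc k) z ⊞ set2 i u v α)
    (trans (single-⊞-≢ (suc k) k z (set2 i u v α) (ℕₚ.1+n≢n ∘ sym)) (coord-set2₁ i u v α))
    (trans (single-⊞ (suc k) z (set2 i u v α) sk<) (cong (λ w → z ℤ.+ w) (coord-set2₂ i u v α)))
    (λ j p q → trans (single-⊞-≢ (suc k) j z (set2 i u v α) q) (coord-set2-≢ i u v α j p q))

  set2-overwrite : (u v : ℤ) (α β : Exp (suc n)) → (∀ j → j ≢ k → j ≢ suc k → coord α j ≡ coord β j) →
    set2 i u v α ≡ set2 i u v β
  set2-overwrite u v α β h = set2-unique i u v α _ (coord-set2₁ i u v β) (coord-set2₂ i u v β)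
    (λ j p q → trans (coord-set2-≢ i u v β j p q) (sym (h j p q)))

  -- Demazure operators

  private
    ev-upTo : (F : Fun (suc n)) (H g : ℤ → ℤ) (c : ℤ) (f : ℕ → Term (suc n)) → IsPrimitive H g →
      ∀ N (h : ℕ → ℕ) s → (∀ t → Term.coef (f (h t)) ≡ c) →
      (∀ t → F (Term.qdeg (f (h t))) (Term.exp (f (h t))) ≡ g (s ℤ.+ + t)) →
      ev F (map f (applyUpTo h N)) ≡ c ℤ.* (H (s ℤ.+ + N) ℤ.- H s)
    ev-upTo F H g c f prim zero h s e₁ e₂ =
      sym (trans (cong (λ z → c ℤ.* (H z ℤ.- H s)) (ℤₚ.+-identityʳ s)) (lem c (H s)))
      where lem : ∀ c a → c ℤ.* (a ℤ.- a) ≡ + 0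
            lem = solve-∀
    ev-upTo F H g c f prim (suc N) h s e₁ e₂ = begin
      Term.coef (f (h 0)) ℤ.* F (Term.qdeg (f (h 0))) (Term.exp (f (h 0))) ℤ.+ ev F (map f (applyUpTo (h ∘ suc) N))
        ≡⟨ cong₂ ℤ._+_ (cong₂ ℤ._*_ (e₁ 0) (trans (e₂ 0) (cong g (ℤₚ.+-identityʳ s))))
             (ev-upTo F H g c f prim N (h ∘ suc) (+ 1 ℤ.+ s) (e₁ ∘ suc)
               (λ t → trans (e₂ (suc t)) (cong g (l₁ s (+ t))))) ⟩
      c ℤ.* g s ℤ.+ c ℤ.* (H (+ 1 ℤ.+ s ℤ.+ + N) ℤ.- H (+ 1 ℤ.+ s))
        ≡⟨ cong₂ (λ u v → c ℤ.* g s ℤ.+ c ℤ.* (H u ℤ.- v)) (sym (l₁ s (+ N))) (prim s) ⟩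
      c ℤ.* g s ℤ.+ c ℤ.* (H (s ℤ.+ + suc N) ℤ.- (H s ℤ.+ g s))
        ≡⟨ l₂ c (g s) (H (s ℤ.+ + suc N)) (H s) ⟩
      c ℤ.* (H (s ℤ.+ + suc N) ℤ.- H s) ∎
      where open ≡-Reasoning
            l₁ : ∀ s t → s ℤ.+ (+ 1 ℤ.+ t) ≡ + 1 ℤ.+ s ℤ.+ t
            l₁ = solve-∀
            l₂ : ∀ c g a b → c ℤ.* g ℤ.+ c ℤ.* (a ℤ.- (b ℤ.+ g)) ≡ c ℤ.* (a ℤ.- b)
            l₂ = solve-∀

  -- Every monomial of π_i x^α agrees with x^α away from the positions i, i+1 and has the same sum
  -- of exponents there; `u` is the exponent of x_i on this string.
  along : Fun (suc n) → ℤ → Exp (suc n) → ℤ → ℤ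
  along F d α u = F d (set2 i u (coord α k ℤ.+ coord α (suc k) ℤ.- u) α)

  private
    a+∣ : (a b : ℤ) → a ℤ.≤ b → a ℤ.+ + ∣ b ℤ.- a ∣ ≡ b
    a+∣ a b h = trans (cong (λ z → a ℤ.+ z) (ℤₚ.0≤i⇒+∣i∣≡i (ℤₚ.i≤j⇒0≤j-i h))) (lem a b)
      where lem : ∀ a b → a ℤ.+ (b ℤ.- a) ≡ b
            lem = solve-∀

  -- With p = 1 + α_i and r = α_{i+1}, the branch r < p sums over r ≤ u < p, and the other one is
  -- minus the sum over p ≤ u < r. Both telescope to H(p) - H(r).
  demTerm-ev : (F : Fun (suc n)) (c d : ℤ) (α : Exp (suc n)) (H : ℤ → ℤ) → IsPrimitive H (along F d α) →
    ev F (demTerm i (term c d α)) ≡ c ℤ.* (H (+ 1 ℤ.+ coord α k) ℤ.- H (coord α (suc k)))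
  demTerm-ev F c d α H prim = main (r ℤ.<? p)
    where
    a b p r : ℤ
    a = coord α k
    b = coord α (suc k)
    β : Exp (suc n)
    β = α V.[ inject₁ i ]%= (λ z → z ℤ.+ + 1)
    p = lookup β (inject₁ i)
    r = lookup β (suc i)
    β₁ : coord β k ≡ coord α k ℤ.+ + 1
    β₁ = coord-raised i α
    β₂ : ∀ j → j ≢ k → coord β j ≡ coord α j
    β₂ = coord-raised-≢ i α
    p≡ : p ≡ + 1 ℤ.+ a
    p≡ = trans (lookup-coord₁ i β) (trans β₁ (ℤₚ.+-comm a (+ 1)))
    r≡ : r ≡ b
    r≡ = trans (lookup-coord₂ i β) (β₂ (suc k) ℕₚ.1+n≢n)
    F-set2 : ∀ u v → v ≡ a ℤ.+ b ℤ.- u → F d (set2 i u v β) ≡ along F d α u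
    F-set2 u v refl = cong (F d) (set2-overwrite u v β α λ j q _ → β₂ j q)
    main : (dec : Dec (r ℤ.< p)) → ev F (if does dec
       then map (λ t → term c d (set2 i (r ℤ.+ + t) ((p ℤ.- + 1) ℤ.- + t) β)) (upTo ∣ p ℤ.- r ∣)
       else map (λ t → term (ℤ.- c) d (set2 i (p ℤ.+ + t) ((r ℤ.- + 1) ℤ.- + t) β)) (upTo ∣ r ℤ.- p ∣))
       ≡ c ℤ.* (H (+ 1 ℤ.+ a) ℤ.- H b)
    main (yes r<p) = trans
      (ev-upTo F H (along F d α) c _ prim ∣ p ℤ.- r ∣ id r (λ _ → refl)
        (λ t → F-set2 (r ℤ.+ + t) _ (trans (cong (λ z → z ℤ.- + 1 ℤ.- + t) p≡)
          (trans (lem a b (+ t)) (cong (λ z → a ℤ.+ b ℤ.- (z ℤ.+ + t)) (sym r≡))))))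
      (cong₂ (λ u v → c ℤ.* (H u ℤ.- H v)) (trans (a+∣ r p (ℤₚ.<⇒≤ r<p)) p≡) r≡)
      where lem : ∀ a b t → + 1 ℤ.+ a ℤ.- + 1 ℤ.- t ≡ a ℤ.+ b ℤ.- (b ℤ.+ t)
            lem = solve-∀
    main (no r≮p) = trans
      (ev-upTo F H (along F d α) (ℤ.- c) _ prim ∣ r ℤ.- p ∣ id p (λ _ → refl)
        (λ t → F-set2 (p ℤ.+ + t) _ (trans (cong (λ z → z ℤ.- + 1 ℤ.- + t) r≡)
          (trans (lem a b (+ t)) (cong (λ z → a ℤ.+ b ℤ.- (z ℤ.+ + t)) (sym p≡))))))
      (trans (cong₂ (λ u v → ℤ.- c ℤ.* (H u ℤ.- H v)) (trans (a+∣ p r (ℤₚ.≮⇒≥ r≮p)) r≡) p≡)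
        (lem₂ c (H b) (H (+ 1 ℤ.+ a))))
      where lem : ∀ a b t → b ℤ.- + 1 ℤ.- t ≡ a ℤ.+ b ℤ.- (+ 1 ℤ.+ a ℤ.+ t)
            lem = solve-∀
            lem₂ : ∀ c x y → ℤ.- c ℤ.* (x ℤ.- y) ≡ c ℤ.* (y ℤ.- x)
            lem₂ = solve-∀

  opaque
    π : Op (suc n)
    π = mkOp (dem i) (λ F d α → ∫ (along F d α) (+ 1 ℤ.+ coord α k) ℤ.- ∫ (along F d α) (coord α (suc k)))
      λ F → ev-concatMap (demTerm i) F _ λ c d α → demTerm-ev F c d α (∫ (along F d α)) (∫-primitive (along F d α))

    π-def : (f : Poly (suc n)) → π · f ≡ dem i f
    π-def f = refl

    π-ev : (F : Fun (suc n)) (d : ℤ) (α : Exp (suc n)) (H : ℤ → ℤ) → IsPrimitive H (along F d α) →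
      ev F (π · mono d α) ≡ H (+ 1 ℤ.+ coord α k) ℤ.- H (coord α (suc k))
    π-ev F d α H prim = trans (ev-++ F (demTerm i (term (+ 1) d α)) []) (trans (ℤₚ.+-identityʳ _)
      (trans (demTerm-ev F (+ 1) d α H prim) (ℤₚ.*-identityˡ _)))

  open LaurentRing (suc n)
  open Operators {suc n}
  open Variables {suc n}

  -- On a monomial, multiplication by x_i moves the upper end of the signed string by one. The
  -- additional endpoint is the summand x_i f; elsewhere the exponent of x_{i+1} has gone up by one.
  π-x₁ : (f : Poly (suc n)) → π · (x k * f) ≈ x k * f + x (suc k) * π · f
  π-x₁ = op-ext (π ⊙ mulBy (x k)) (mulBy (x k) ⊕ mulBy (x (suc k)) ⊙ π) λ d α → mk≈ λ F →
    let a = coord α k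
        b = coord α (suc k)
        α⁺ = single k (+ 1) ⊞ α
        g = along F d α⁺
        a⁺ : coord α⁺ k ≡ + 1 ℤ.+ a
        a⁺ = single-⊞ k (+ 1) α k<
        b⁺ : coord α⁺ (suc k) ≡ b
        b⁺ = single-⊞-≢ k (suc k) (+ 1) α ℕₚ.1+n≢n
        F′ = λ e β → F e (single (suc k) (+ 1) ⊞ β)
        g-set2 : ∀ u → g u ≡ F d (set2 i u (+ 1 ℤ.+ a ℤ.+ b ℤ.- u) α)
        g-set2 u = trans (cong₂ (λ y z → F d (set2 i u (y ℤ.+ z ℤ.- u) α⁺)) a⁺ b⁺)
          (cong (F d) (set2-overwrite u _ α⁺ α λ j p _ → single-⊞-≢ k j (+ 1) α p))
        g≡ : ∀ u → g u ≡ along F′ d α u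
        g≡ u = trans (g-set2 u) (trans (cong (λ z → F d (set2 i u z α)) (lem₁ a b u))
          (cong (F d) (set2-single₂ (+ 1) u (a ℤ.+ b ℤ.- u) α)))
        end : g (+ 1 ℤ.+ a) ≡ F d α⁺
        end = trans (cong₂ (λ y z → F d (set2 i y z α⁺)) (sym a⁺) (trans
                (cong₂ (λ y z → y ℤ.+ z ℤ.- (+ 1 ℤ.+ a)) a⁺ b⁺) (trans (lem₂ (+ 1 ℤ.+ a) b) (sym b⁺))))
              (cong (F d) (set2-self i α⁺))
    in begin
      ev F (π · (x k * mono d α)) ≡⟨ at (op-cong π (X-*-mono k (+ 1) d α)) F ⟩
      ev F (π · mono d α⁺) ≡⟨ π-ev F d α⁺ (∫ g) (∫-primitive g) ⟩
      ∫ g (+ 1 ℤ.+ coord α⁺ k) ℤ.- ∫ g (coord α⁺ (suc k)) ≡⟨ cong₂ (λ u v → ∫ g (+ 1 ℤ.+ u) ℤ.- ∫ g v) a⁺ b⁺ ⟩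
      ∫ g (+ 1 ℤ.+ (+ 1 ℤ.+ a)) ℤ.- ∫ g b ≡⟨ cong (ℤ._- ∫ g b) (∫-primitive g (+ 1 ℤ.+ a)) ⟩
      ∫ g (+ 1 ℤ.+ a) ℤ.+ g (+ 1 ℤ.+ a) ℤ.- ∫ g b ≡⟨ lem₃ (∫ g (+ 1 ℤ.+ a)) (g (+ 1 ℤ.+ a)) (∫ g b) ⟩
      g (+ 1 ℤ.+ a) ℤ.+ (∫ g (+ 1 ℤ.+ a) ℤ.- ∫ g b)
        ≡⟨ cong₂ ℤ._+_ (trans end (trans (sym (ev-mono F d α⁺)) (sym (at (X-*-mono k (+ 1) d α) F))))
             (sym (trans (ev-X F (suc k) (+ 1) (π · mono d α))
               (π-ev F′ d α (∫ g) (λ u → trans (∫-primitive g u) (cong (λ z → ∫ g u ℤ.+ z) (g≡ u)))))) ⟩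
      ev F (x k * mono d α) ℤ.+ ev F (x (suc k) * π · mono d α)
        ≡⟨ ev-sum F (x k * mono d α) (x (suc k) * π · mono d α) ⟨
      ev F (x k * mono d α + x (suc k) * π · mono d α) ∎
    where
    open ≡-Reasoning
    lem₁ : ∀ a b u → + 1 ℤ.+ a ℤ.+ b ℤ.- u ≡ + 1 ℤ.+ (a ℤ.+ b ℤ.- u)
    lem₁ = solve-∀
    lem₂ : ∀ a b → a ℤ.+ b ℤ.- a ≡ b
    lem₂ = solve-∀
    lem₃ : ∀ a b c → a ℤ.+ b ℤ.- c ≡ b ℤ.+ (a ℤ.- c)
    lem₃ = solve-∀

  -- Here the string is reindexed by u ↦ 1 + u, so that one primitive serves both sides; the
  -- endpoint by which they differ is x_i f.
  π-x₂ : (f : Poly (suc n)) → π · (x (suc k) * f) + x k * f ≈ x k * π · f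
  π-x₂ = op-ext (π ⊙ mulBy (x (suc k)) ⊕ mulBy (x k)) (mulBy (x k) ⊙ π) λ d α → mk≈ λ F →
    let a = coord α k
        b = coord α (suc k)
        α⁺ = single (suc k) (+ 1) ⊞ α
        g = along F d α⁺
        a⁺ : coord α⁺ k ≡ a
        a⁺ = single-⊞-≢ (suc k) k (+ 1) α (ℕₚ.1+n≢n ∘ sym)
        b⁺ : coord α⁺ (suc k) ≡ + 1 ℤ.+ b
        b⁺ = single-⊞ (suc k) (+ 1) α sk<
        F′ = λ e β → F e (single k (+ 1) ⊞ β)
        g-set2 : ∀ u → g u ≡ F d (set2 i u (a ℤ.+ (+ 1 ℤ.+ b) ℤ.- u) α)
        g-set2 u = trans (cong₂ (λ y z → F d (set2 i u (y ℤ.+ z ℤ.- u) α⁺)) a⁺ b⁺)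
          (cong (F d) (set2-overwrite u _ α⁺ α λ j _ p → single-⊞-≢ (suc k) j (+ 1) α p))
        g≡ : ∀ u → g (+ 1 ℤ.+ u) ≡ along F′ d α u
        g≡ u = trans (g-set2 (+ 1 ℤ.+ u)) (trans (cong (λ z → F d (set2 i (+ 1 ℤ.+ u) z α)) (lem₁ a b u))
          (cong (F d) (set2-single₁ (+ 1) u (a ℤ.+ b ℤ.- u) α)))
        end : g (+ 1 ℤ.+ a) ≡ ev F (x k * mono d α)
        end = trans (trans (g≡ a) (trans (cong (λ z → F′ d (set2 i a z α)) (lem₂ a b)) (cong (F′ d) (set2-self i α))))
          (trans (sym (ev-mono F d _)) (sym (at (X-*-mono k (+ 1) d α) F)))
        H′ : ℤ → ℤ
        H′ u = ∫ g (+ 1 ℤ.+ u)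
        H′-prim : IsPrimitive H′ (along F′ d α)
        H′-prim u = trans (∫-primitive g (+ 1 ℤ.+ u)) (cong (λ z → H′ u ℤ.+ z) (g≡ u))
    in begin
      ev F (π · (x (suc k) * mono d α) + x k * mono d α) ≡⟨ ev-sum F (π · (x (suc k) * mono d α)) (x k * mono d α) ⟩
      ev F (π · (x (suc k) * mono d α)) ℤ.+ ev F (x k * mono d α)
        ≡⟨ cong₂ ℤ._+_ (trans (at (op-cong π (X-*-mono (suc k) (+ 1) d α)) F)
             (trans (π-ev F d α⁺ (∫ g) (∫-primitive g)) (cong₂ (λ u v → ∫ g (+ 1 ℤ.+ u) ℤ.- ∫ g v) a⁺ b⁺))) (sym end) ⟩
      ∫ g (+ 1 ℤ.+ a) ℤ.- ∫ g (+ 1 ℤ.+ b) ℤ.+ g (+ 1 ℤ.+ a)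
        ≡⟨ lem₃ (∫ g (+ 1 ℤ.+ a)) (∫ g (+ 1 ℤ.+ b)) (g (+ 1 ℤ.+ a)) ⟩
      ∫ g (+ 1 ℤ.+ a) ℤ.+ g (+ 1 ℤ.+ a) ℤ.- ∫ g (+ 1 ℤ.+ b) ≡⟨ cong (ℤ._- H′ b) (∫-primitive g (+ 1 ℤ.+ a)) ⟨
      H′ (+ 1 ℤ.+ a) ℤ.- H′ b ≡⟨ π-ev F′ d α H′ H′-prim ⟨
      ev F′ (π · mono d α) ≡⟨ ev-X F k (+ 1) (π · mono d α) ⟨
      ev F (x k * π · mono d α) ∎
    where
    open ≡-Reasoning
    lem₁ : ∀ a b u → a ℤ.+ (+ 1 ℤ.+ b) ℤ.- (+ 1 ℤ.+ u) ≡ a ℤ.+ b ℤ.- u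
    lem₁ = solve-∀
    lem₂ : ∀ a b → a ℤ.+ b ℤ.- a ≡ b
    lem₂ = solve-∀
    lem₃ : ∀ a b c → a ℤ.- b ℤ.+ c ≡ a ℤ.+ c ℤ.- b
    lem₃ = solve-∀

  π-balanced : (d : ℤ) (α : Exp (suc n)) → coord α k ≡ coord α (suc k) → π · mono d α ≈ mono d α
  π-balanced d α e = mk≈ λ F → begin
    ev F (π · mono d α) ≡⟨ π-ev F d α (∫ (along F d α)) (∫-primitive (along F d α)) ⟩
    ∫ (along F d α) (+ 1 ℤ.+ coord α k) ℤ.- ∫ (along F d α) (coord α (suc k))
      ≡⟨ cong₂ ℤ._-_ (∫-primitive (along F d α) (coord α k)) (cong (∫ (along F d α)) (sym e)) ⟩
    ∫ (along F d α) (coord α k) ℤ.+ along F d α (coord α k) ℤ.- ∫ (along F d α) (coord α k)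
      ≡⟨ lem (∫ (along F d α) (coord α k)) (along F d α (coord α k)) ⟩
    along F d α (coord α k) ≡⟨ cong (λ z → F d (set2 i (coord α k) z α)) (lem (coord α k) (coord α (suc k))) ⟩
    F d (set2 i (coord α k) (coord α (suc k)) α) ≡⟨ cong (F d) (set2-self i α) ⟩
    F d α ≡⟨ ev-mono F d α ⟨
    ev F (mono d α) ∎
    where
    open ≡-Reasoning
    lem : ∀ a b → a ℤ.+ b ℤ.- a ≡ b
    lem = solve-∀

  -- Only the values along the string enter, so functionals may be exchanged if they agree there.
  -- This is how π_i is moved past operators that look at other exponents or at the q-degree.
  π-local : (F F′ : Fun (suc n)) (d d′ : ℤ) (α : Exp (suc n)) →
    (∀ u v → F d (set2 i u v α) ≡ F′ d′ (set2 i u v α)) →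
    ev F (π · mono d α) ≡ ev F′ (π · mono d′ α)
  π-local F F′ d d′ α h = trans (π-ev F d α (∫ (along F d α)) (∫-primitive (along F d α)))
    (trans (primitive-unique {∫ (along F d α)} {∫ (along F′ d′ α)} (∫-primitive (along F d α))
      (∫-primitive (along F′ d′ α)) (λ u → h u (coord α k ℤ.+ coord α (suc k) ℤ.- u)) (+ 1 ℤ.+ coord α k)
      (coord α (suc k)))
      (sym (π-ev F′ d′ α (∫ (along F′ d′ α)) (∫-primitive (along F′ d′ α)))))

  -- The reflection u ↦ α_i + α_{i+1} - u preserves the string and changes the sign of every value.
  -- The sum thus equals its own negative, and an integer with this property is 0.
  π-antisym : (F : Fun (suc n)) (d : ℤ) (α : Exp (suc n)) →
    (∀ u v → F d (set2 i u v α) ≡ ℤ.- F d (set2 i v u α)) → ev F (π · mono d α) ≡ + 0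
  π-antisym F d α h = trans (π-ev F d α H (∫-primitive g)) (i≡-i⇒0 _ (begin
    H (+ 1 ℤ.+ a) ℤ.- H b ≡⟨ primitive-unique {H} {H′} (∫-primitive g) H′-prim (λ _ → refl) (+ 1 ℤ.+ a) b ⟩
    H′ (+ 1 ℤ.+ a) ℤ.- H′ b ≡⟨ cong₂ (λ u v → H u ℤ.- H v) (lem₂ a b) (lem₃ a b) ⟩
    H b ℤ.- H (+ 1 ℤ.+ a) ≡⟨ lem₄ (H b) (H (+ 1 ℤ.+ a)) ⟩
    ℤ.- (H (+ 1 ℤ.+ a) ℤ.- H b) ∎))
    where
    open ≡-Reasoning
    a = coord α k
    b = coord α (suc k)
    g H H′ : ℤ → ℤ
    g = along F d α
    H = ∫ g
    H′ u = H (+ 1 ℤ.+ a ℤ.+ b ℤ.- u)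
    lem₁ : ∀ a b u → + 1 ℤ.+ a ℤ.+ b ℤ.- u ≡ + 1 ℤ.+ (a ℤ.+ b ℤ.- u)
    lem₁ = solve-∀
    lem₁′ : ∀ a b u → + 1 ℤ.+ a ℤ.+ b ℤ.- (+ 1 ℤ.+ u) ≡ a ℤ.+ b ℤ.- u
    lem₁′ = solve-∀
    lem₂ : ∀ a b → + 1 ℤ.+ a ℤ.+ b ℤ.- (+ 1 ℤ.+ a) ≡ b
    lem₂ = solve-∀
    lem₃ : ∀ a b → + 1 ℤ.+ a ℤ.+ b ℤ.- b ≡ + 1 ℤ.+ a
    lem₃ = solve-∀
    lem₄ : ∀ a b → a ℤ.- b ≡ ℤ.- (b ℤ.- a)
    lem₄ = solve-∀
    lem₅ : ∀ x y → x ≡ x ℤ.+ y ℤ.+ ℤ.- y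
    lem₅ = solve-∀
    lem₆ : ∀ a b u → a ℤ.+ b ℤ.- (a ℤ.+ b ℤ.- u) ≡ u
    lem₆ = solve-∀
    H′-prim : IsPrimitive H′ g
    H′-prim u = begin
      H (+ 1 ℤ.+ a ℤ.+ b ℤ.- (+ 1 ℤ.+ u)) ≡⟨ cong H (lem₁′ a b u) ⟩
      H w ≡⟨ lem₅ (H w) (g w) ⟩
      H w ℤ.+ g w ℤ.+ ℤ.- g w ≡⟨ cong₂ ℤ._+_ (sym (trans (cong H (lem₁ a b u)) (∫-primitive g w)))
          (sym (trans (h u w) (cong (λ z → ℤ.- F d (set2 i w z α)) (sym (lem₆ a b u))))) ⟩
      H′ u ℤ.+ g u ∎
      where w = a ℤ.+ b ℤ.- u
    i≡-i⇒0 : ∀ z → z ≡ ℤ.- z → z ≡ + 0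
    i≡-i⇒0 (+ zero) _ = refl
    i≡-i⇒0 (+ suc m) ()
    i≡-i⇒0 -[1+ m ] ()

-- Relations between the Demazure operators.

module _ {n : ℕ} where
  open LaurentRing (suc n)
  open Operators {suc n}
  open Variables {suc n}

  open PolySolver (suc n) using (solve; _:+_; _:*_; :-_; _:-_; con; _:=_)

  q^ : ℤ → Poly (suc n)
  q^ d = mono d 𝟎

  Sym : Fin n → Poly (suc n) → Set
  Sym i f = π i · f ≈ f

  π-q : (i : Fin n) (e : ℤ) (f : Poly (suc n)) → π i · (q^ e * f) ≈ q^ e * π i · f
  π-q i e = op-ext (π i ⊙ mulBy (q^ e)) (mulBy (q^ e) ⊙ π i) λ d α → mk≈ λ F → begin
    ev F (π i · (q^ e * mono d α)) ≡⟨ at (op-cong (π i) (≈-trans (mono-* e d 𝟎 α) (mono-cong refl (⊞-identityˡ α)))) F ⟩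
    ev F (π i · mono (e ℤ.+ d) α) ≡⟨ π-local i F (λ d β → F (e ℤ.+ d) (𝟎 ⊞ β)) (e ℤ.+ d) d α
      (λ u v → cong (F (e ℤ.+ d)) (sym (⊞-identityˡ (set2 i u v α)))) ⟩
    ev (λ d β → F (e ℤ.+ d) (𝟎 ⊞ β)) (π i · mono d α)
      ≡⟨ trans (ev-prod F (q^ e) (π i · mono d α))
        (ev-mono (λ d′ α′ → ev (λ e β → F (d′ ℤ.+ e) (α′ ⊞ β)) (π i · mono d α)) e 𝟎) ⟨
    ev F (q^ e * π i · mono d α) ∎
    where open ≡-Reasoning

  π-x₃ : (i : Fin n) (j : ℕ) (z : ℤ) → j ≢ toℕ i → j ≢ suc (toℕ i) → ∀ f →
    π i · (X j z * f) ≈ X j z * π i · f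
  π-x₃ i j z j≢k j≢sk = op-ext (π i ⊙ mulBy (X j z)) (mulBy (X j z) ⊙ π i) λ d α → mk≈ λ F → begin
    ev F (π i · (X j z * mono d α)) ≡⟨ at (op-cong (π i) (X-*-mono j z d α)) F ⟩
    ev F (π i · mono d (single j z ⊞ α)) ≡⟨ π-ev i F d α⁺ (∫ (along i F d α⁺)) (∫-primitive (along i F d α⁺)) ⟩
    ∫ (along i F d α⁺) (+ 1 ℤ.+ coord α⁺ k) ℤ.- ∫ (along i F d α⁺) (coord α⁺ (suc k))
      ≡⟨ cong₂ (λ u v → ∫ (along i F d α⁺) (+ 1 ℤ.+ u) ℤ.- ∫ (along i F d α⁺) v) c₁ c₂ ⟩
    ∫ (along i F d α⁺) (+ 1 ℤ.+ coord α k) ℤ.- ∫ (along i F d α⁺) (coord α (suc k))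
      ≡⟨ π-ev i (F′ F) d α (∫ (along i F d α⁺)) (λ u → trans (∫-primitive (along i F d α⁺) u)
           (cong (λ z → ∫ (along i F d α⁺) u ℤ.+ z) (g≡ F d u))) ⟨
    ev (F′ F) (π i · mono d α) ≡⟨ ev-X F j z (π i · mono d α) ⟨
    ev F (X j z * π i · mono d α) ∎
    where
    open ≡-Reasoning
    k = toℕ i
    F′ : Fun (suc n) → Fun (suc n)
    F′ F e β = F e (single j z ⊞ β)
    module _ {α : Exp (suc n)} where
      α⁺ : Exp (suc n)
      α⁺ = single j z ⊞ α
      c₁ : coord α⁺ k ≡ coord α k
      c₁ = single-⊞-≢ j k z α (j≢k ∘ sym)
      c₂ : coord α⁺ (suc k) ≡ coord α (suc k)
      c₂ = single-⊞-≢ j (suc k) z α (j≢sk ∘ sym)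
      g≡ : ∀ F d u → along i F d α⁺ u ≡ along i (F′ F) d α u
      g≡ F d u = trans (cong₂ (λ a b → F d (set2 i u (a ℤ.+ b ℤ.- u) α⁺)) c₁ c₂)
        (cong (F d) (set2-unique i u v α⁺ (single j z ⊞ set2 i u v α)
          (trans (single-⊞-≢ j k z (set2 i u v α) (j≢k ∘ sym)) (coord-set2₁ i u v α))
          (trans (single-⊞-≢ j (suc k) z (set2 i u v α) (j≢sk ∘ sym)) (coord-set2₂ i u v α))
          (λ m p q → trans (coord-⊞ (single j z) (set2 i u v α) m)
            (trans (cong (λ w → coord (single {suc n} j z) m ℤ.+ w) (coord-set2-≢ i u v α m p q))
              (sym (coord-⊞ (single j z) α m))))))
        where v = coord α k ℤ.+ coord α (suc k) ℤ.- u

  π-x₂′ : (i : Fin n) (f : Poly (suc n)) →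
    π i · (x (suc (toℕ i)) * f) ≈ - (x (toℕ i) * f) + x (toℕ i) * π i · f
  π-x₂′ i f = ≈-trans (lem (π i · (x (suc (toℕ i)) * f)) (x (toℕ i) * f)) (+-congˡ (π-x₂ i f))
    where lem = solve 2 (λ a b → a := :- b :+ (a :+ b)) ≈-refl

  π-1 : (i : Fin n) (d : ℤ) → Sym i (q^ d)
  π-1 i d = π-balanced i d 𝟎 (trans (coord-𝟎 {suc n} (toℕ i)) (sym (coord-𝟎 {suc n} (suc (toℕ i)))))

  data Position (i : Fin n) (j : ℕ) : Set where
    left  : j ≡ toℕ i → Position i j
    right : j ≡ suc (toℕ i) → Position i j
    away  : j ≢ toℕ i → j ≢ suc (toℕ i) → Position i j

  position : (i : Fin n) (j : ℕ) → Position i j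
  position i j with j ℕ.≟ toℕ i | j ℕ.≟ suc (toℕ i)
  ... | yes p | _ = left p
  ... | no _ | yes p = right p
  ... | no p | no q = away p q

  -- Multiplication by f commutes with the variables, so both operators obey the same twisted rules;
  -- at q^d they agree by the hypothesis on f.
  π-sym : (i : Fin n) {f : Poly (suc n)} → Sym i f → ∀ g → π i · (f * g) ≈ f * π i · g
  π-sym i {f} s = twisted-ext (π i ⊙ mulBy f) (mulBy f ⊙ π i)
    (λ d → begin
      π i · (f * q^ d) ≈⟨ op-cong (π i) (*-comm f (q^ d)) ⟩
      π i · (q^ d * f) ≈⟨ π-q i d f ⟩
      q^ d * π i · f ≈⟨ *-congˡ s ⟩
      q^ d * f ≈⟨ *-comm (q^ d) f ⟩
      f * q^ d ≈⟨ *-congˡ (π-1 i d) ⟨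
      f * π i · q^ d ∎)
    (λ j g _ → step j g (position i j))
    where
    open ≈-R
    k = toℕ i
    swap = solve 3 (λ a b c → a :* (b :* c) := b :* (a :* c)) ≈-refl
    l₁ = solve 5 (λ f x y g p → f :* (x :* g :+ y :* p) := x :* (f :* g) :+ y :* (f :* p)) ≈-refl
    l₂ = solve 4 (λ f x g p → f :* (:- (x :* g) :+ x :* p) := :- (x :* (f :* g)) :+ x :* (f :* p)) ≈-refl
    step : ∀ j g → Position i j → TwistedStep (π i ⊙ mulBy f) (mulBy f ⊙ π i) j g
    step j g (left refl) = x k * (f * g) , suc k ,
      ≈-trans (op-cong (π i) (swap f (x k) g)) (π-x₁ i (f * g)) ,
      ≈-trans (*-congˡ (π-x₁ i g)) (l₁ f (x k) (x (suc k)) g (π i · g))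
    step j g (right refl) = - (x k * (f * g)) , k ,
      ≈-trans (op-cong (π i) (swap f (x (suc k)) g)) (π-x₂′ i (f * g)) ,
      ≈-trans (*-congˡ (π-x₂′ i g)) (l₂ f (x k) g (π i · g))
    step j g (away p q) = 0# , j ,
      ≈-trans (op-cong (π i) (swap f (x j) g)) (≈-trans (π-x₃ i j (+ 1) p q (f * g)) (≈-sym (+-identityˡ _))) ,
      ≈-trans (*-congˡ (π-x₃ i j (+ 1) p q g)) (≈-trans (swap f (x j) (π i · g)) (≈-sym (+-identityˡ _)))

  π-idem : (i : Fin n) (f : Poly (suc n)) → π i · π i · f ≈ π i · f
  π-idem i = twisted-ext (π i ⊙ π i) (π i)
    (λ d → op-cong (π i) (π-1 i d)) (λ j g _ → step j g (position i j))
    where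
    open ≈-R
    k = toℕ i
    a = x k
    b = x (suc k)
    p = π i
    l₁ = solve 5 (λ a b f g h →
      a :* f :+ b :* g :+ (:- (a :* g) :+ a :* h) := a :* f :+ b :* g :- a :* g :+ a :* h) ≈-refl
    l₂ = solve 4 (λ a b f g → a :* f :+ b :* g := a :* f :+ b :* g :- a :* g :+ a :* g) ≈-refl
    l₃ = solve 5 (λ a b f g h →
      :- (a :* f :+ b :* g) :+ (a :* g :+ b :* h) := :- (a :* f :+ b :* g) :+ a :* g :+ b :* h) ≈-refl
    l₄ = solve 4 (λ a b f g → :- (a :* f) :+ a :* g := :- (a :* f :+ b :* g) :+ a :* g :+ b :* g) ≈-refl
    step : ∀ j f → Position i j → TwistedStep (π i ⊙ π i) (π i) j f
    -- The variable stays x_i here, since applying π_i twice carries x_i to x_{i+1} and back. The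
    -- term `- a * p · f` in the common part makes the single π_i fit the same pattern.
    step j f (left refl) = a * f + b * p · f - a * p · f , k ,
      (begin
        p · p · (a * f) ≈⟨ op-cong p (π-x₁ i f) ⟩
        p · (a * f + b * p · f) ≈⟨ op-+ p (a * f) (b * p · f) ⟩
        p · (a * f) + p · (b * p · f) ≈⟨ +-cong (π-x₁ i f) (π-x₂′ i (p · f)) ⟩
        a * f + b * p · f + (- (a * p · f) + a * p · p · f) ≈⟨ l₁ a b f (p · f) (p · p · f) ⟩
        a * f + b * p · f - a * p · f + a * p · p · f ∎) ,
      ≈-trans (π-x₁ i f) (l₂ a b f (p · f))
    step j f (right refl) = - (a * f + b * p · f) + a * p · f , suc k ,
      (begin
        p · p · (b * f) ≈⟨ op-cong p (π-x₂′ i f) ⟩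
        p · (- (a * f) + a * p · f) ≈⟨ op-+ p (- (a * f)) (a * p · f) ⟩
        p · (- (a * f)) + p · (a * p · f) ≈⟨ +-cong (≈-trans (op-neg p (a * f)) (-‿cong (π-x₁ i f))) (π-x₁ i (p · f)) ⟩
        - (a * f + b * p · f) + (a * p · f + b * p · p · f) ≈⟨ l₃ a b f (p · f) (p · p · f) ⟩
        - (a * f + b * p · f) + a * p · f + b * p · p · f ∎) ,
      ≈-trans (π-x₂′ i f) (l₄ a b f (p · f))
    step j f (away u v) = 0# , j ,
      ≈-trans (op-cong p (π-x₃ i j (+ 1) u v f)) (≈-trans (π-x₃ i j (+ 1) u v (p · f)) (≈-sym (+-identityˡ _))) ,
      ≈-trans (π-x₃ i j (+ 1) u v f) (≈-sym (+-identityˡ _))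

  π-comm : (i j : Fin n) → suc (toℕ i) ℕ.< toℕ j → ∀ f → π i · π j · f ≈ π j · π i · f
  π-comm i j far = twisted-ext (π i ⊙ π j) (π j ⊙ π i)
    (λ d → ≈-trans (op-cong (π i) (π-1 j d)) (≈-trans (π-1 i d) (≈-sym (≈-trans (op-cong (π j) (π-1 i d)) (π-1 j d)))))
    (λ m f _ → step m f (position i m) (position j m))
    where
    open ≈-R
    k l : ℕ
    k = toℕ i
    l = toℕ j
    p = π i
    r = π j
    k≢l : k ≢ l
    k≢l = ℕₚ.<⇒≢ (ℕₚ.<-trans (ℕₚ.n<1+n k) far)
    k≢sl : k ≢ suc l
    k≢sl = ℕₚ.<⇒≢ (ℕₚ.<-trans (ℕₚ.n<1+n k) (ℕₚ.<-trans far (ℕₚ.n<1+n l)))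
    sk≢l : suc k ≢ l
    sk≢l = ℕₚ.<⇒≢ far
    sk≢sl : suc k ≢ suc l
    sk≢sl e = k≢l (ℕₚ.suc-injective e)
    step : ∀ m f → Position i m → Position j m → TwistedStep (p ⊙ r) (r ⊙ p) m f
    step m f (left refl) _ = x k * r · f , suc k ,
      ≈-trans (op-cong p (π-x₃ j k (+ 1) k≢l k≢sl f)) (π-x₁ i (r · f)) ,
      (begin
        r · p · (x k * f) ≈⟨ op-cong r (π-x₁ i f) ⟩
        r · (x k * f + x (suc k) * p · f) ≈⟨ op-+ r (x k * f) (x (suc k) * p · f) ⟩
        r · (x k * f) + r · (x (suc k) * p · f)
          ≈⟨ +-cong (π-x₃ j k (+ 1) k≢l k≢sl f) (π-x₃ j (suc k) (+ 1) sk≢l sk≢sl (p · f)) ⟩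
        x k * r · f + x (suc k) * r · p · f ∎)
    step m f (right refl) _ = - (x k * r · f) , k ,
      ≈-trans (op-cong p (π-x₃ j (suc k) (+ 1) sk≢l sk≢sl f)) (π-x₂′ i (r · f)) ,
      (begin
        r · p · (x (suc k) * f) ≈⟨ op-cong r (π-x₂′ i f) ⟩
        r · (- (x k * f) + x k * p · f) ≈⟨ op-+ r (- (x k * f)) (x k * p · f) ⟩
        r · (- (x k * f)) + r · (x k * p · f)
          ≈⟨ +-cong (≈-trans (op-neg r (x k * f)) (-‿cong (π-x₃ j k (+ 1) k≢l k≢sl f)))
          (π-x₃ j k (+ 1) k≢l k≢sl (p · f)) ⟩
        - (x k * r · f) + x k * r · p · f ∎)
    step m f (away u v) (left refl) = x l * p · f , suc l ,
      (begin
        p · r · (x l * f) ≈⟨ op-cong p (π-x₁ j f) ⟩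
        p · (x l * f + x (suc l) * r · f) ≈⟨ op-+ p (x l * f) (x (suc l) * r · f) ⟩
        p · (x l * f) + p · (x (suc l) * r · f)
          ≈⟨ +-cong (π-x₃ i l (+ 1) u v f) (π-x₃ i (suc l) (+ 1) (k≢sl ∘ sym) (sk≢sl ∘ sym) (r · f)) ⟩
        x l * p · f + x (suc l) * p · r · f ∎) ,
      ≈-trans (op-cong r (π-x₃ i l (+ 1) u v f)) (π-x₁ j (p · f))
    step m f (away u v) (right refl) = - (x l * p · f) , l ,
      (begin
        p · r · (x (suc l) * f) ≈⟨ op-cong p (π-x₂′ j f) ⟩
        p · (- (x l * f) + x l * r · f) ≈⟨ op-+ p (- (x l * f)) (x l * r · f) ⟩
        p · (- (x l * f)) + p · (x l * r · f)
          ≈⟨ +-cong (≈-trans (op-neg p (x l * f)) (-‿cong (π-x₃ i l (+ 1) (k≢l ∘ sym) (sk≢l ∘ sym) f)))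
          (π-x₃ i l (+ 1) (k≢l ∘ sym) (sk≢l ∘ sym) (r · f)) ⟩
        - (x l * p · f) + x l * p · r · f ∎) ,
      ≈-trans (op-cong r (π-x₃ i (suc l) (+ 1) u v f)) (π-x₂′ j (p · f))
    step m f (away u v) (away u′ v′) = 0# , m ,
      ≈-trans (op-cong p (π-x₃ j m (+ 1) u′ v′ f)) (≈-trans (π-x₃ i m (+ 1) u v (r · f)) (≈-sym (+-identityˡ _))) ,
      ≈-trans (op-cong r (π-x₃ i m (+ 1) u v f)) (≈-trans (π-x₃ j m (+ 1) u′ v′ (p · f)) (≈-sym (+-identityˡ _)))

  -- Up to common lower terms, both sides carry a factor x_i, x_{i+1}, x_{i+2} to x_{i+2}, x_{i+1},
  -- x_i, the action of the longest element of the symmetric group on three letters. Some of the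
  -- cancellations among the lower terms use idempotence.
  π-braid : (i j : Fin n) → toℕ j ≡ suc (toℕ i) → ∀ f → π i · π j · π i · f ≈ π j · π i · π j · f
  π-braid i j adj = twisted-ext (π i ⊙ π j ⊙ π i) (π j ⊙ π i ⊙ π j)
    (λ d → ≈-trans (op-cong p (≈-trans (op-cong r (π-1 i d)) (π-1 j d))) (≈-trans (π-1 i d)
      (≈-sym (≈-trans (op-cong r (≈-trans (op-cong p (π-1 j d)) (π-1 i d))) (π-1 j d)))))
    (λ m f _ → step m f (position i m) (position j m))
    where
    open ≈-R
    k : ℕ
    k = toℕ i
    a b c : Poly (suc n)
    a = x k
    b = x (suc k)
    c = x (suc (suc k))
    p r : Op (suc n)
    p = π i
    r = π j
    pa : ∀ f → p · (a * f) ≈ a * f + b * p · f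
    pa = π-x₁ i
    pb : ∀ f → p · (b * f) ≈ - (a * f) + a * p · f
    pb = π-x₂′ i
    pc : ∀ f → p · (c * f) ≈ c * p · f
    pc = π-x₃ i (suc (suc k)) (+ 1) (ℕₚ.>⇒≢ (ℕₚ.m≤n⇒m≤1+n (ℕₚ.n<1+n k))) ℕₚ.1+n≢n
    ra : ∀ f → r · (a * f) ≈ a * r · f
    ra = π-x₃ j k (+ 1) (λ e → ℕₚ.1+n≢n (sym (trans e adj)))
      (λ e → ℕₚ.<-irrefl (trans e (cong suc adj)) (ℕₚ.m≤n⇒m≤1+n (ℕₚ.n<1+n k)))
    rb : ∀ f → r · (b * f) ≈ b * f + c * r · f
    rb f = subst (λ l → r · (x l * f) ≈ x l * f + x (suc l) * r · f) adj (π-x₁ j f)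
    rc : ∀ f → r · (c * f) ≈ - (b * f) + b * r · f
    rc f = subst (λ l → r · (x (suc l) * f) ≈ - (x l * f) + x l * r · f) adj (π-x₂′ j f)
    neg : ∀ (o : Op (suc n)) {u v} → o · u ≈ v → o · (- u) ≈ - v
    neg o {u} e = ≈-trans (op-neg o u) (-‿cong e)
    plus : ∀ (o : Op (suc n)) {u v u′ v′} → o · u ≈ u′ → o · v ≈ v′ → o · (u + v) ≈ u′ + v′
    plus o {u} {v} e e′ = ≈-trans (op-+ o u v) (+-cong e e′)
    step : ∀ m f → Position i m → Position j m → TwistedStep (p ⊙ r ⊙ p) (r ⊙ p ⊙ r) m f
    step m f (left refl) _ = a * r · f + b * p · r · f , suc (suc k) ,
      (begin
        p · r · p · (a * f) ≈⟨ op-cong p (op-cong r (pa f)) ⟩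
        p · r · (a * f + b * p · f) ≈⟨ op-cong p (plus r (ra f) (rb (p · f))) ⟩
        p · (a * r · f + (b * p · f + c * r · p · f))
          ≈⟨ plus p (pa (r · f)) (plus p (≈-trans (pb (p · f)) (+-congˡ (*-congˡ (π-idem i f)))) (pc (r · p · f))) ⟩
        a * r · f + b * p · r · f + (- (a * p · f) + a * p · f + c * p · r · p · f)
          ≈⟨ l₁ (a * r · f) (b * p · r · f) (a * p · f) (c * p · r · p · f) ⟩
        a * r · f + b * p · r · f + c * p · r · p · f ∎) ,
      (begin
        r · p · r · (a * f) ≈⟨ op-cong r (op-cong p (ra f)) ⟩
        r · p · (a * r · f) ≈⟨ op-cong r (pa (r · f)) ⟩
        r · (a * r · f + b * p · r · f) ≈⟨ plus r (≈-trans (ra (r · f)) (*-congˡ (π-idem j f))) (rb (p · r · f)) ⟩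
        a * r · f + (b * p · r · f + c * r · p · r · f) ≈⟨ +-assoc _ _ _ ⟨
        a * r · f + b * p · r · f + c * r · p · r · f ∎)
      where l₁ = solve 4 (λ u v w z → u :+ v :+ (:- w :+ w :+ z) := u :+ v :+ z) ≈-refl
    step m f (right refl) _ = - (a * r · f + b * p · r · f) + a * r · p · f , suc k ,
      (begin
        p · r · p · (b * f) ≈⟨ op-cong p (op-cong r (pb f)) ⟩
        p · r · (- (a * f) + a * p · f) ≈⟨ op-cong p (plus r (neg r (ra f)) (ra (p · f))) ⟩
        p · (- (a * r · f) + a * r · p · f) ≈⟨ plus p (neg p (pa (r · f))) (pa (r · p · f)) ⟩
        - (a * r · f + b * p · r · f) + (a * r · p · f + b * p · r · p · f) ≈⟨ +-assoc _ _ _ ⟨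
        - (a * r · f + b * p · r · f) + a * r · p · f + b * p · r · p · f ∎) ,
      (begin
        r · p · r · (b * f) ≈⟨ op-cong r (op-cong p (rb f)) ⟩
        r · p · (b * f + c * r · f) ≈⟨ op-cong r (plus p (pb f) (pc (r · f))) ⟩
        r · (- (a * f) + a * p · f + c * p · r · f)
          ≈⟨ plus r (plus r (neg r (ra f)) (ra (p · f))) (rc (p · r · f)) ⟩
        - (a * r · f) + a * r · p · f + (- (b * p · r · f) + b * r · p · r · f)
          ≈⟨ l₁ (a * r · f) (a * r · p · f) (b * p · r · f) (b * r · p · r · f) ⟩
        - (a * r · f + b * p · r · f) + a * r · p · f + b * r · p · r · f ∎)
      where l₁ = solve 4 (λ u v w z → :- u :+ v :+ (:- w :+ z) := :- (u :+ w) :+ v :+ z) ≈-refl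
    step m f (away u v) (left refl) = ⊥-elim (v adj)
    step m f (away _ _) (right e) with refl ← trans e (cong suc adj) = - (a * r · p · f) , k ,
      (begin
        p · r · p · (c * f) ≈⟨ op-cong p (op-cong r (pc f)) ⟩
        p · r · (c * p · f) ≈⟨ op-cong p (rc (p · f)) ⟩
        p · (- (b * p · f) + b * r · p · f)
          ≈⟨ plus p (neg p (≈-trans (pb (p · f)) (+-congˡ (*-congˡ (π-idem i f))))) (pb (r · p · f)) ⟩
        - (- (a * p · f) + a * p · f) + (- (a * r · p · f) + a * p · r · p · f)
          ≈⟨ l₁ (a * p · f) (a * r · p · f) (a * p · r · p · f) ⟩
        - (a * r · p · f) + a * p · r · p · f ∎) ,
      (begin
        r · p · r · (c * f) ≈⟨ op-cong r (op-cong p (rc f)) ⟩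
        r · p · (- (b * f) + b * r · f) ≈⟨ op-cong r (plus p (neg p (pb f)) (pb (r · f))) ⟩
        r · (- (- (a * f) + a * p · f) + (- (a * r · f) + a * p · r · f))
          ≈⟨ plus r (neg r (plus r (neg r (ra f)) (ra (p · f))))
               (plus r (neg r (≈-trans (ra (r · f)) (*-congˡ (π-idem j f)))) (ra (p · r · f))) ⟩
        - (- (a * r · f) + a * r · p · f) + (- (a * r · f) + a * r · p · r · f)
          ≈⟨ l₂ (a * r · f) (a * r · p · f) (a * r · p · r · f) ⟩
        - (a * r · p · f) + a * r · p · r · f ∎)
      where l₁ = solve 3 (λ u v w → :- (:- u :+ u) :+ (:- v :+ w) := :- v :+ w) ≈-refl
            l₂ = solve 3 (λ u v w → :- (:- u :+ v) :+ (:- u :+ w) := :- v :+ w) ≈-refl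
    step m f (away u v) (away u′ v′) = 0# , m ,
      (begin
        p · r · p · (x m * f) ≈⟨ op-cong p (op-cong r (pm f)) ⟩
        p · r · (x m * p · f) ≈⟨ op-cong p (rm (p · f)) ⟩
        p · (x m * r · p · f) ≈⟨ pm (r · p · f) ⟩
        x m * p · r · p · f ≈⟨ +-identityˡ _ ⟨
        0# + x m * p · r · p · f ∎) ,
      (begin
        r · p · r · (x m * f) ≈⟨ op-cong r (op-cong p (rm f)) ⟩
        r · p · (x m * r · f) ≈⟨ op-cong r (pm (r · f)) ⟩
        r · (x m * p · r · f) ≈⟨ rm (p · r · f) ⟩
        x m * r · p · r · f ≈⟨ +-identityˡ _ ⟨
        0# + x m * r · p · r · f ∎)
      where pm = π-x₃ i m (+ 1) u v
            rm = π-x₃ j m (+ 1) u′ v′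

  demOp : Word n → Op (suc n)
  demOp [] = idₒ
  demOp (i ∷ u) = π i ⊙ demOp u

  demOp-demWord : (u : Word n) (f : Poly (suc n)) → demOp u · f ≡ demWord u f
  demOp-demWord [] f = refl
  demOp-demWord (i ∷ u) f = trans (π-def i (demOp u · f)) (cong (dem i) (demOp-demWord u f))

  demOp-++ : (u v : Word n) (f : Poly (suc n)) → demOp (u ++ v) · f ≡ demOp u · demOp v · f
  demOp-++ [] v f = refl
  demOp-++ (i ∷ u) v f = cong (π i ·_) (demOp-++ u v f)

  -- Well-definedness of π_w on the 0-Hecke monoid; it makes tameness, stated up to `≈H`, available
  -- for operators.
  demOp-≈H : {u v : Word n} → u ≈H v → ∀ f → demOp u · f ≈ demOp v · f
  demOp-≈H H-refl f = ≈-refl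
  demOp-≈H (H-sym e) f = ≈-sym (demOp-≈H e f)
  demOp-≈H (H-trans e e′) f = ≈-trans (demOp-≈H e f) (demOp-≈H e′ f)
  demOp-≈H (H-cong {u} {u′} {v} {v′} e e′) f = begin
    demOp (u ++ v) · f ≡⟨ demOp-++ u v f ⟩
    demOp u · demOp v · f ≈⟨ op-cong (demOp u) (demOp-≈H e′ f) ⟩
    demOp u · demOp v′ · f ≈⟨ demOp-≈H e (demOp v′ · f) ⟩
    demOp u′ · demOp v′ · f ≡⟨ demOp-++ u′ v′ f ⟨
    demOp (u′ ++ v′) · f ∎
    where open ≈-R
  demOp-≈H (H-idem i) f = π-idem i f
  demOp-≈H (H-comm i j far) f = π-comm i j far f
  demOp-≈H (H-braid i j adj) f = π-braid i j adj f

-- Complete homogeneous polynomials and the truncation operator.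

isNonneg isZero : ℤ → Bool
isNonneg (+ _) = true
isNonneg -[1+ _ ] = false
isZero (+ zero) = true
isZero _ = false

Away : ℕ → List ℕ → Set
Away N = Allˡ (_≢ N)

Distinct : List ℕ → Set
Distinct = AllPairs λ N v → v ≢ N

module _ {n : ℕ} where
  open LaurentRing (suc n)
  open Operators {suc n}
  open Variables {suc n}
  open PolySolver (suc n) using (solve; _:+_; _:*_; :-_; _:-_; con; _:=_)

  private
    P : Set
    P = Poly (suc n)

  -- Complete homogeneous symmetric polynomials of a list of ring elements

  hℕ : ℕ → List P → P
  hℕ zero vs = 1#
  hℕ (suc m) [] = 0#
  hℕ (suc m) (v ∷ vs) = v * hℕ m (v ∷ vs) + hℕ (suc m) vs

  h : ℤ → List P → P
  h (+ m) vs = hℕ m vs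
  h -[1+ m ] vs = 0#

  -- Extending h by 0 to negative degrees makes the recursion valid for every integer; at z = -1 it
  -- reads h_0 = 0 + h_0. Exponents can then be inserted as degrees without a case distinction on
  -- their sign.
  h-cons : (z : ℤ) (v : P) (vs : List P) → h (+ 1 ℤ.+ z) (v ∷ vs) ≈ v * h z (v ∷ vs) + h (+ 1 ℤ.+ z) vs
  h-cons (+ m) v vs = ≈-refl
  h-cons -[1+ zero ] v vs = ≈-sym (≈-trans (+-congʳ (zeroʳ v)) (+-identityˡ 1#))
  h-cons -[1+ suc m ] v vs = ≈-sym (≈-trans (+-congʳ (zeroʳ v)) (+-identityˡ 0#))

  hℕ-snoc : (m : ℕ) (vs : List P) (w : P) → hℕ (suc m) (vs ++ w ∷ []) ≈ w * hℕ m (vs ++ w ∷ []) + hℕ (suc m) vs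
  hℕ-snoc m [] w = ≈-refl
  hℕ-snoc zero (v ∷ vs) w = ≈-trans (+-congˡ (hℕ-snoc 0 vs w)) (lem (v * 1#) (w * 1#) (hℕ 1 vs))
    where lem = solve 3 (λ a b c → a :+ (b :+ c) := b :+ (a :+ c)) ≈-refl
  hℕ-snoc (suc m) (v ∷ vs) w = ≈-trans (+-cong (*-congˡ (hℕ-snoc m (v ∷ vs) w)) (hℕ-snoc (suc m) vs w))
    (lem v w (hℕ m (v ∷ vs ++ w ∷ [])) (hℕ (suc m) (v ∷ vs)) (hℕ (suc m) (vs ++ w ∷ [])) (hℕ (suc (suc m)) vs))
    where lem = solve 6 (λ v w a b c d → v :* (w :* a :+ b) :+ (w :* c :+ d) := w :* (v :* a :+ c) :+
            (v :* b :+ d)) ≈-refl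

  h-snoc : (z : ℤ) (vs : List P) (w : P) → h (+ 1 ℤ.+ z) (vs ++ w ∷ []) ≈ w * h z (vs ++ w ∷ []) + h (+ 1 ℤ.+ z) vs
  h-snoc (+ m) vs w = hℕ-snoc m vs w
  h-snoc -[1+ zero ] vs w = ≈-sym (≈-trans (+-congʳ (zeroʳ w)) (+-identityˡ 1#))
  h-snoc -[1+ suc m ] vs w = ≈-sym (≈-trans (+-congʳ (zeroʳ w)) (+-identityˡ 0#))

  hℕ-swap : (m : ℕ) (v w : P) (vs : List P) → hℕ m (v ∷ w ∷ vs) ≈ hℕ m (w ∷ v ∷ vs)
  hℕ-swap zero v w vs = ≈-refl
  hℕ-swap (suc zero) v w vs = lem (v * 1#) (w * 1#) (hℕ 1 vs)
    where lem = solve 3 (λ a b c → a :+ (b :+ c) := b :+ (a :+ c)) ≈-refl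
  hℕ-swap (suc (suc m)) v w vs = begin
    v * H₁ + (w * hw + t) ≈⟨ +-congʳ (*-congˡ (hℕ-swap (suc m) v w vs)) ⟩
    v * (w * H₀′ + hv) + (w * hw + t) ≈⟨ +-congʳ (*-congˡ (+-congʳ (*-congˡ (hℕ-swap m v w vs)))) ⟨
    v * (w * H₀ + hv) + (w * hw + t) ≈⟨ lem v w H₀ hv hw t ⟩
    w * (v * H₀ + hw) + (v * hv + t) ≈⟨ +-congʳ (*-congˡ (hℕ-swap (suc m) v w vs)) ⟩
    w * H₁′ + (v * hv + t) ∎
    where
    open ≈-R
    H₁ = hℕ (suc m) (v ∷ w ∷ vs)
    H₁′ = hℕ (suc m) (w ∷ v ∷ vs)
    H₀ = hℕ m (v ∷ w ∷ vs)
    H₀′ = hℕ m (w ∷ v ∷ vs)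
    hv = hℕ (suc m) (v ∷ vs)
    hw = hℕ (suc m) (w ∷ vs)
    t = hℕ (suc (suc m)) vs
    lem = solve 6 (λ v w a b c t → v :* (w :* a :+ b) :+ (w :* c :+ t) := w :* (v :* a :+ c) :+ (v :* b :+ t)) ≈-refl

  h-closed : (Q : P → Set) → Q 0# → Q 1# → (∀ {a b} → Q a → Q b → Q (a + b)) → (∀ {a b} → Q a → Q b → Q (a * b)) →
    {vs : List P} → Allˡ Q vs → ∀ z → Q (h z vs)
  h-closed Q q₀ q₁ q₊ q* {vs} qs -[1+ m ] = q₀
  h-closed Q q₀ q₁ q₊ q* {vs} qs (+ m) = go m qs
    where
    go : ∀ m {vs} → Allˡ Q vs → Q (hℕ m vs)
    go zero _ = q₁
    go (suc m) [] = q₀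
    go (suc m) (q ∷ qs) = q₊ (q* q (go m (q ∷ qs))) (go (suc m) qs)

  -- Operators acting on each monomial by a factor depending on one exponent

  opaque
    diag : ℕ → (ℤ → P) → Op (suc n)
    diag N φ = lin λ d α → φ (coord α N) * mono d α

    diag-mono : (N : ℕ) (φ : ℤ → P) (d : ℤ) (α : Exp (suc n)) → diag N φ · mono d α ≈ φ (coord α N) * mono d α
    diag-mono N φ = lin-mono λ d α → φ (coord α N) * mono d α

  swap* : ∀ a b c → a * (b * c) ≈ b * (a * c)
  swap* = solve 3 (λ a b c → a :* (b :* c) := b :* (a :* c)) ≈-refl

  diag-X-≢ : (N k : ℕ) (φ : ℤ → P) (z : ℤ) → k ≢ N → ∀ f → diag N φ · (X k z * f) ≈ X k z * diag N φ · f
  diag-X-≢ N k φ z k≢N = op-ext (diag N φ ⊙ mulBy (X k z)) (mulBy (X k z) ⊙ diag N φ) λ d α → begin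
    diag N φ · (X k z * mono d α) ≈⟨ op-cong (diag N φ) (X-*-mono k z d α) ⟩
    diag N φ · mono d (single k z ⊞ α) ≈⟨ diag-mono N φ d (single k z ⊞ α) ⟩
    φ (coord (single k z ⊞ α) N) * mono d (single k z ⊞ α)
      ≈⟨ *-cong (≈-reflexive (cong φ (single-⊞-≢ k N z α (k≢N ∘ sym)))) (≈-sym (X-*-mono k z d α)) ⟩
    φ (coord α N) * (X k z * mono d α) ≈⟨ swap* (φ (coord α N)) (X k z) (mono d α) ⟩
    X k z * (φ (coord α N) * mono d α) ≈⟨ *-congˡ (diag-mono N φ d α) ⟨
    X k z * diag N φ · mono d α ∎
    where open ≈-R

  diag-X-≡ : (N : ℕ) (φ : ℤ → P) (z : ℤ) → N ℕ.≤ n → ∀ f →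
    diag N φ · (X N z * f) ≈ X N z * diag N (λ a → φ (z ℤ.+ a)) · f
  diag-X-≡ N φ z N≤ = op-ext (diag N φ ⊙ mulBy (X N z)) (mulBy (X N z) ⊙ diag N (λ a → φ (z ℤ.+ a))) λ d α → begin
    diag N φ · (X N z * mono d α) ≈⟨ op-cong (diag N φ) (X-*-mono N z d α) ⟩
    diag N φ · mono d (single N z ⊞ α) ≈⟨ diag-mono N φ d (single N z ⊞ α) ⟩
    φ (coord (single N z ⊞ α) N) * mono d (single N z ⊞ α)
      ≈⟨ *-cong (≈-reflexive (cong φ (single-⊞ N z α (ℕ.s≤s N≤)))) (≈-sym (X-*-mono N z d α)) ⟩
    φ (z ℤ.+ coord α N) * (X N z * mono d α) ≈⟨ swap* (φ (z ℤ.+ coord α N)) (X N z) (mono d α) ⟩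
    X N z * (φ (z ℤ.+ coord α N) * mono d α) ≈⟨ *-congˡ (diag-mono N (λ a → φ (z ℤ.+ a)) d α) ⟨
    X N z * diag N (λ a → φ (z ℤ.+ a)) · mono d α ∎
    where open ≈-R

  Intertwines : Op (suc n) → P → P → Set
  Intertwines A r r′ = ∀ f → A · (r * f) ≈ r′ * A · f

  Commutes : Op (suc n) → P → Set
  Commutes A r = Intertwines A r r

  module Intertwining (A : Op (suc n)) where
    open ≈-R
    tw-0 : Intertwines A 0# 0#
    tw-0 f = ≈-trans (op-cong A (zeroˡ f)) (≈-trans (op-0 A) (≈-sym (zeroˡ (A · f))))
    tw-1 : Intertwines A 1# 1#
    tw-1 f = ≈-trans (op-cong A (*-identityˡ f)) (≈-sym (*-identityˡ (A · f)))
    tw-+ : {r r′ s s′ : P} → Intertwines A r r′ → Intertwines A s s′ → Intertwines A (r + s) (r′ + s′)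
    tw-+ {r} {r′} {s} {s′} p q f = begin
      A · ((r + s) * f) ≈⟨ op-cong A (distribʳ f r s) ⟩
      A · (r * f + s * f) ≈⟨ op-+ A (r * f) (s * f) ⟩
      A · (r * f) + A · (s * f) ≈⟨ +-cong (p f) (q f) ⟩
      r′ * A · f + s′ * A · f ≈⟨ distribʳ (A · f) r′ s′ ⟨
      (r′ + s′) * A · f ∎
    tw-* : {r r′ s s′ : P} → Intertwines A r r′ → Intertwines A s s′ → Intertwines A (r * s) (r′ * s′)
    tw-* {r} {r′} {s} {s′} p q f = begin
      A · (r * s * f) ≈⟨ op-cong A (*-assoc r s f) ⟩
      A · (r * (s * f)) ≈⟨ p (s * f) ⟩
      r′ * A · (s * f) ≈⟨ *-congˡ (q f) ⟩
      r′ * (s′ * A · f) ≈⟨ *-assoc r′ s′ (A · f) ⟨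
      r′ * s′ * A · f ∎
    tw-neg : {r r′ : P} → Intertwines A r r′ → Intertwines A (- r) (- r′)
    tw-neg {r} {r′} p f = begin
      A · (- r * f) ≈⟨ op-cong A (-‿distribˡ-* r f) ⟨
      A · (- (r * f)) ≈⟨ op-neg A (r * f) ⟩
      - (A · (r * f)) ≈⟨ -‿cong (p f) ⟩
      - (r′ * A · f) ≈⟨ -‿distribˡ-* r′ (A · f) ⟩
      - r′ * A · f ∎

  diag-comm : (N k : ℕ) (φ ψ : ℤ → P) → (∀ z → Commutes (diag k ψ) (φ z)) → (∀ z → Commutes (diag N φ) (ψ z)) →
    ∀ f → diag N φ · diag k ψ · f ≈ diag k ψ · diag N φ · f
  diag-comm N k φ ψ c c′ = op-ext (diag N φ ⊙ diag k ψ) (diag k ψ ⊙ diag N φ) λ d α → begin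
    diag N φ · diag k ψ · mono d α ≈⟨ op-cong (diag N φ) (diag-mono k ψ d α) ⟩
    diag N φ · (ψ (coord α k) * mono d α) ≈⟨ c′ (coord α k) (mono d α) ⟩
    ψ (coord α k) * diag N φ · mono d α ≈⟨ *-congˡ (diag-mono N φ d α) ⟩
    ψ (coord α k) * (φ (coord α N) * mono d α) ≈⟨ swap* (ψ (coord α k)) (φ (coord α N)) (mono d α) ⟩
    φ (coord α N) * (ψ (coord α k) * mono d α) ≈⟨ *-congˡ (diag-mono k ψ d α) ⟨
    φ (coord α N) * diag k ψ · mono d α ≈⟨ c (coord α N) (mono d α) ⟨
    diag k ψ · (φ (coord α N) * mono d α) ≈⟨ op-cong (diag k ψ) (diag-mono N φ d α) ⟨
    diag k ψ · diag N φ · mono d α ∎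
    where open ≈-R

  indicator : (ℤ → Bool) → ℤ → P
  indicator b z = if b z then 1# else 0#

  indicator-commutes : (A : Op (suc n)) (b : ℤ → Bool) (z : ℤ) → Commutes A (indicator b z)
  indicator-commutes A b z with b z
  ... | true = Intertwining.tw-1 A
  ... | false = Intertwining.tw-0 A

  nonneg const : ℕ → Op (suc n)
  nonneg N = diag N (indicator isNonneg)
  const N = diag N (indicator isZero)

  diag-cong : (N : ℕ) (φ ψ : ℤ → P) → (∀ z → φ z ≈ ψ z) → ∀ f → diag N φ · f ≈ diag N ψ · f
  diag-cong N φ ψ e = op-ext (diag N φ) (diag N ψ) λ d α →
    ≈-trans (diag-mono N φ d α) (≈-trans (*-congʳ (e (coord α N))) (≈-sym (diag-mono N ψ d α)))

  diag-0 : (N : ℕ) (φ : ℤ → P) → (∀ z → φ z ≈ 0#) → ∀ f → diag N φ · f ≈ 0#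
  diag-0 N φ e = op-ext (diag N φ) 0ₒ λ d α →
    ≈-trans (diag-mono N φ d α) (≈-trans (*-congʳ (e (coord α N))) (zeroˡ (mono d α)))

  diag-indicator : (N : ℕ) (φ : ℤ → P) (b : ℤ → Bool) → ∀ f →
    diag N φ · diag N (indicator b) · f ≈ diag N (λ z → indicator b z * φ z) · f
  diag-indicator N φ b = op-ext (diag N φ ⊙ diag N (indicator b)) (diag N (λ z → indicator b z * φ z)) λ d α → begin
    diag N φ · diag N (indicator b) · mono d α ≈⟨ op-cong (diag N φ) (diag-mono N (indicator b) d α) ⟩
    diag N φ · (indicator b (coord α N) * mono d α) ≈⟨ indicator-commutes (diag N φ) b (coord α N) (mono d α) ⟩
    indicator b (coord α N) * diag N φ · mono d α ≈⟨ *-congˡ (diag-mono N φ d α) ⟩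
    indicator b (coord α N) * (φ (coord α N) * mono d α) ≈⟨ *-assoc _ _ _ ⟨
    indicator b (coord α N) * φ (coord α N) * mono d α ≈⟨ diag-mono N (λ z → indicator b z * φ z) d α ⟨
    diag N (λ z → indicator b z * φ z) · mono d α ∎
    where open ≈-R

  nonneg-const : (N : ℕ) (f : P) → nonneg N · const N · f ≈ const N · f
  nonneg-const N f = ≈-trans (diag-indicator N (indicator isNonneg) isZero f) (diag-cong N _ _ lem f)
    where lem : ∀ z → indicator isZero z * indicator isNonneg z ≈ indicator isZero z
          lem (+ zero) = *-identityˡ 1#
          lem (+ suc m) = zeroˡ 1#
          lem -[1+ m ] = zeroˡ 0#

  nonneg-neg-const : (N : ℕ) → N ℕ.≤ n → ∀ f → nonneg N · (x⁻ N * const N · f) ≈ 0#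
  nonneg-neg-const N N≤ f = begin
    nonneg N · (x⁻ N * const N · f) ≈⟨ diag-X-≡ N (indicator isNonneg) (ℤ.- + 1) N≤ (const N · f) ⟩
    x⁻ N * diag N (λ a → indicator isNonneg (ℤ.- + 1 ℤ.+ a)) · const N · f
      ≈⟨ *-congˡ (≈-trans (diag-indicator N _ isZero f) (diag-0 N _ lem f)) ⟩
    x⁻ N * 0# ≈⟨ zeroʳ (x⁻ N) ⟩
    0# ∎
    where open ≈-R
          lem : ∀ z → indicator isZero z * indicator isNonneg (ℤ.- + 1 ℤ.+ z) ≈ 0#
          lem (+ zero) = zeroʳ 1#
          lem (+ suc m) = zeroˡ _
          lem -[1+ m ] = zeroˡ _

  Preserves : ℕ → P → Set
  Preserves N r = ∀ f → nonneg N · f ≈ f → nonneg N · (r * f) ≈ r * f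

  nonneg-idem : (N : ℕ) (f : P) → nonneg N · nonneg N · f ≈ nonneg N · f
  nonneg-idem N f = ≈-trans (diag-indicator N (indicator isNonneg) isNonneg f) (diag-cong N _ _ lem f)
    where lem : ∀ z → indicator isNonneg z * indicator isNonneg z ≈ indicator isNonneg z
          lem (+ m) = *-identityˡ 1#
          lem -[1+ m ] = zeroˡ 0#

  preserves-0 : (N : ℕ) → Preserves N 0#
  preserves-0 N f e = ≈-trans (Intertwining.tw-0 (nonneg N) f) (*-congˡ e)

  preserves-1 : (N : ℕ) → Preserves N 1#
  preserves-1 N f e = ≈-trans (Intertwining.tw-1 (nonneg N) f) (*-congˡ e)

  preserves-+ : (N : ℕ) {r s : P} → Preserves N r → Preserves N s → Preserves N (r + s)
  preserves-+ N {r} {s} p q f e = begin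
    nonneg N · ((r + s) * f) ≈⟨ op-cong (nonneg N) (distribʳ f r s) ⟩
    nonneg N · (r * f + s * f) ≈⟨ op-+ (nonneg N) (r * f) (s * f) ⟩
    nonneg N · (r * f) + nonneg N · (s * f) ≈⟨ +-cong (p f e) (q f e) ⟩
    r * f + s * f ≈⟨ distribʳ f r s ⟨
    (r + s) * f ∎
    where open ≈-R

  preserves-neg : (N : ℕ) {r : P} → Preserves N r → Preserves N (- r)
  preserves-neg N {r} p f e = begin
    nonneg N · (- r * f) ≈⟨ op-cong (nonneg N) (-‿distribˡ-* r f) ⟨
    nonneg N · (- (r * f)) ≈⟨ op-neg (nonneg N) (r * f) ⟩
    - (nonneg N · (r * f)) ≈⟨ -‿cong (p f e) ⟩
    - (r * f) ≈⟨ -‿distribˡ-* r f ⟩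
    - r * f ∎
    where open ≈-R

  preserves-* : (N : ℕ) {r s : P} → Preserves N r → Preserves N s → Preserves N (r * s)
  preserves-* N {r} {s} p q f e = ≈-trans (op-cong (nonneg N) (*-assoc r s f))
    (≈-trans (p (s * f) (q f e)) (≈-sym (*-assoc r s f)))

  preserves-X-≢ : (N k : ℕ) (z : ℤ) → k ≢ N → Preserves N (X k z)
  preserves-X-≢ N k z k≢N f e = ≈-trans (diag-X-≢ N k _ z k≢N f) (*-congˡ e)

  preserves-x : (N k : ℕ) → N ℕ.≤ n → Preserves N (x k)
  preserves-x N k N≤ f e with k ℕ.≟ N
  ... | no k≢N = preserves-X-≢ N k (+ 1) k≢N f e
  ... | yes refl = begin
    nonneg N · (x N * f) ≈⟨ op-cong (nonneg N) (*-congˡ e) ⟨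
    nonneg N · (x N * nonneg N · f) ≈⟨ diag-X-≡ N _ (+ 1) N≤ (nonneg N · f) ⟩
    x N * diag N (λ a → indicator isNonneg (+ 1 ℤ.+ a)) · nonneg N · f
      ≈⟨ *-congˡ (≈-trans (diag-indicator N _ isNonneg f) (diag-cong N _ _ lem f)) ⟩
    x N * nonneg N · f ≈⟨ *-congˡ e ⟩
    x N * f ∎
    where open ≈-R
          lem : ∀ z → indicator isNonneg z * indicator isNonneg (+ 1 ℤ.+ z) ≈ indicator isNonneg z
          lem (+ m) = *-identityˡ 1#
          lem -[1+ m ] = zeroˡ _

  -- Polynomial truncation, one variable at a time

  vars : List ℕ → List P
  vars = map x

  E : ℕ → List ℕ → P
  E N [] = 1#
  E N (v ∷ vs) = (1# - x v * x⁻ N) * E N vs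

  -- x_N^a ↦ h_a(x_N, x_v : v ∈ vs)
  J : ℕ → List ℕ → Op (suc n)
  J N vs = diag N λ z → h z (vars (N ∷ vs)) * X N (ℤ.- z)

  -- Constant term in x against the flagged Cauchy kernel Π_{i<j} (1 - x_i/x_j) / Π_{i≤j} (1 - z_i/x_j), with z renamed
  -- to x; the list of variables is in descending order.
  T : List ℕ → Op (suc n)
  T [] = idₒ
  T (N ∷ vs) = J N vs ⊙ T vs ⊙ mulBy (E N vs)

  module _ (N : ℕ) (vs : List ℕ) (A : Op (suc n)) where
    open Intertwining A
    E-commutes : Allˡ (λ v → Commutes A (x v)) vs → Commutes A (x⁻ N) → Commutes A (E N vs)
    E-commutes cs c = go cs
      where
      go : ∀ {vs} → Allˡ (λ v → Commutes A (x v)) vs → Commutes A (E N vs)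
      go [] = tw-1
      go (c′ ∷ cs) = tw-* (tw-+ tw-1 (tw-neg (tw-* c′ c))) (go cs)

  diag-E : (k N : ℕ) (vs : List ℕ) (φ : ℤ → P) → N ≢ k → Away k vs → Commutes (diag k φ) (E N vs)
  diag-E k N vs φ N≢k aw = E-commutes N vs (diag k φ) (Allˡ.map (λ {v} p → diag-X-≢ k v φ (+ 1) p) aw)
    (diag-X-≢ k N φ (ℤ.- + 1) N≢k)

  diag-h : (k : ℕ) (vs : List ℕ) (φ : ℤ → P) → Away k vs → ∀ z → Commutes (diag k φ) (h z (vars vs))
  diag-h k vs φ aw = h-closed (Commutes (diag k φ)) tw-0 tw-1 tw-+ tw-*
    (Allₚ.map⁺ (Allˡ.map (λ {v} p → diag-X-≢ k v φ (+ 1) p) aw))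
    where open Intertwining (diag k φ)

  T-X : (vs : List ℕ) (k : ℕ) (z : ℤ) → Away k vs → Commutes (T vs) (X k z)
  T-X [] k z [] f = ≈-refl
  T-X (N ∷ vs) k z (N≢k ∷ aw) f = begin
    J N vs · T vs · (E N vs * (X k z * f)) ≈⟨ op-cong (J N vs ⊙ T vs) (swap* (E N vs) (X k z) f) ⟩
    J N vs · T vs · (X k z * (E N vs * f)) ≈⟨ op-cong (J N vs) (T-X vs k z aw (E N vs * f)) ⟩
    J N vs · (X k z * T vs · (E N vs * f)) ≈⟨ diag-X-≢ N k _ z (N≢k ∘ sym) (T vs · (E N vs * f)) ⟩
    X k z * J N vs · T vs · (E N vs * f) ∎
    where open ≈-R

  T-indicator : (vs : List ℕ) (k : ℕ) (b : ℤ → Bool) → Away k vs → ∀ f →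
    T vs · diag k (indicator b) · f ≈ diag k (indicator b) · T vs · f
  T-indicator [] k b [] f = ≈-refl
  T-indicator (N ∷ vs) k b (N≢k ∷ aw) f = begin
    J N vs · T vs · (E N vs * K · f) ≈⟨ op-cong (J N vs ⊙ T vs) (diag-E k N vs (indicator b) N≢k aw f) ⟨
    J N vs · T vs · K · (E N vs * f) ≈⟨ op-cong (J N vs) (T-indicator vs k b aw (E N vs * f)) ⟩
    J N vs · K · T vs · (E N vs * f) ≈⟨ diag-comm N k _ (indicator b)
        (λ z → Intertwining.tw-* K (diag-h k (N ∷ vs) (indicator b) (N≢k ∷ aw) z)
          (diag-X-≢ k N (indicator b) (ℤ.- z) N≢k))
        (indicator-commutes (J N vs) b) (T vs · (E N vs * f)) ⟩
    K · J N vs · T vs · (E N vs * f) ∎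
    where open ≈-R
          K = diag k (indicator b)

  J-nonneg : (N : ℕ) (vs : List ℕ) (f : P) → J N vs · nonneg N · f ≈ J N vs · f
  J-nonneg N vs f = ≈-trans (diag-indicator N _ isNonneg f) (diag-cong N _ _ lem f)
    where lem : ∀ z → indicator isNonneg z * (h z (vars (N ∷ vs)) * X N (ℤ.- z)) ≈ h z (vars (N ∷ vs)) * X N (ℤ.- z)
          lem (+ m) = *-identityˡ _
          lem -[1+ m ] = ≈-trans (zeroˡ _) (≈-sym (zeroˡ _))

  J-const : (N : ℕ) (vs : List ℕ) (f : P) → J N vs · const N · f ≈ const N · f
  J-const N vs f = ≈-trans (diag-indicator N _ isZero f) (diag-cong N _ _ lem f)
    where lem : ∀ z → indicator isZero z * (h z (vars (N ∷ vs)) * X N (ℤ.- z)) ≈ indicator isZero z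
          lem (+ zero) = ≈-trans (*-identityˡ _) (≈-trans (*-identityˡ _) (X-0 N))
          lem (+ suc m) = zeroˡ _
          lem -[1+ m ] = zeroˡ _

  -- Multiplication by r never makes a negative exponent of x_N nonnegative.
  NegClosed : ℕ → P → Set
  NegClosed N r = ∀ f → nonneg N · (r * nonneg N · f) ≈ nonneg N · (r * f)

  negClosed-x⁻ : (N : ℕ) → N ℕ.≤ n → NegClosed N (x⁻ N)
  negClosed-x⁻ N N≤ f = begin
    nonneg N · (x⁻ N * nonneg N · f) ≈⟨ diag-X-≡ N _ (ℤ.- + 1) N≤ (nonneg N · f) ⟩
    x⁻ N * diag N φ · nonneg N · f ≈⟨ *-congˡ (≈-trans (diag-indicator N φ isNonneg f) (diag-cong N _ _ lem f)) ⟩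
    x⁻ N * diag N φ · f ≈⟨ diag-X-≡ N _ (ℤ.- + 1) N≤ f ⟨
    nonneg N · (x⁻ N * f) ∎
    where open ≈-R
          φ : ℤ → P
          φ a = indicator isNonneg (ℤ.- + 1 ℤ.+ a)
          lem : ∀ z → indicator isNonneg z * φ z ≈ φ z
          lem (+ m) = *-identityˡ _
          lem -[1+ m ] = zeroˡ _

  negClosed-commutes : (N : ℕ) {r : P} → Commutes (nonneg N) r → NegClosed N r
  negClosed-commutes N {r} c f = ≈-trans (c (nonneg N · f)) (≈-trans (*-congˡ (nonneg-idem N f)) (≈-sym (c f)))

  negClosed-* : (N : ℕ) {r s : P} → NegClosed N r → NegClosed N s → NegClosed N (r * s)
  negClosed-* N {r} {s} p q f = begin
    nonneg N · (r * s * nonneg N · f) ≈⟨ op-cong (nonneg N) (*-assoc r s (nonneg N · f)) ⟩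
    nonneg N · (r * (s * nonneg N · f)) ≈⟨ p (s * nonneg N · f) ⟨
    nonneg N · (r * nonneg N · (s * nonneg N · f)) ≈⟨ op-cong (nonneg N) (*-congˡ (q f)) ⟩
    nonneg N · (r * nonneg N · (s * f)) ≈⟨ p (s * f) ⟩
    nonneg N · (r * (s * f)) ≈⟨ op-cong (nonneg N) (*-assoc r s f) ⟨
    nonneg N · (r * s * f) ∎
    where open ≈-R

  negClosed-1- : (N : ℕ) {r : P} → NegClosed N r → NegClosed N (1# - r)
  negClosed-1- N {r} p f = begin
    nonneg N · ((1# - r) * nonneg N · f) ≈⟨ expand (nonneg N · f) ⟩
    nonneg N · nonneg N · f - nonneg N · (r * nonneg N · f) ≈⟨ +-cong (nonneg-idem N f) (-‿cong (p f)) ⟩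
    nonneg N · f - nonneg N · (r * f) ≈⟨ expand f ⟨
    nonneg N · ((1# - r) * f) ∎
    where open ≈-R
          lem = solve 2 (λ r f → ((con (+ 1)) :- r) :* f := f :- r :* f) ≈-refl
          expand : ∀ g → nonneg N · ((1# - r) * g) ≈ nonneg N · g - nonneg N · (r * g)
          expand g = ≈-trans (op-cong (nonneg N) (lem r g))
            (≈-trans (op-+ (nonneg N) g (- (r * g))) (+-congˡ (op-neg (nonneg N) (r * g))))

  negClosed-factor : (N v : ℕ) → N ℕ.≤ n → v ≢ N → NegClosed N (1# - x v * x⁻ N)
  negClosed-factor N v N≤ v≢N =
    negClosed-1- N (negClosed-* N (negClosed-commutes N (diag-X-≢ N v _ (+ 1) v≢N)) (negClosed-x⁻ N N≤))

  negClosed-E : (N : ℕ) (vs : List ℕ) → N ℕ.≤ n → Away N vs → NegClosed N (E N vs)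
  negClosed-E N [] N≤ [] = negClosed-commutes N (Intertwining.tw-1 (nonneg N))
  negClosed-E N (v ∷ vs) N≤ (v≢N ∷ aw) = negClosed-* N (negClosed-factor N v N≤ v≢N) (negClosed-E N vs N≤ aw)

  -- Apart from its leading 1, every term of `E N vs` has a negative power of x_N, and no power of
  -- x_N in the other factor can compensate for it.
  nonneg-E-const : (N : ℕ) (vs : List ℕ) → N ℕ.≤ n → Away N vs → ∀ f → nonneg N · (E N vs * const N · f) ≈ const N · f
  nonneg-E-const N [] N≤ [] f = ≈-trans (op-cong (nonneg N) (*-identityˡ _)) (nonneg-const N f)
  nonneg-E-const N (v ∷ vs) N≤ (v≢N ∷ aw) f = begin
    nonneg N · ((1# - x v * x⁻ N) * E N vs * c) ≈⟨ op-cong (nonneg N) (*-assoc _ _ _) ⟩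
    nonneg N · ((1# - x v * x⁻ N) * (E N vs * c)) ≈⟨ negClosed-factor N v N≤ v≢N (E N vs * c) ⟨
    nonneg N · ((1# - x v * x⁻ N) * nonneg N · (E N vs * c))
      ≈⟨ op-cong (nonneg N) (*-congˡ (nonneg-E-const N vs N≤ aw f)) ⟩
    nonneg N · ((1# - x v * x⁻ N) * c) ≈⟨ op-cong (nonneg N) (lem (x v) (x⁻ N) c) ⟩
    nonneg N · (c - x v * (x⁻ N * c)) ≈⟨ op-+ (nonneg N) c _ ⟩
    nonneg N · c + nonneg N · (- (x v * (x⁻ N * c)))
      ≈⟨ +-cong (nonneg-const N f) (≈-trans (op-neg (nonneg N) _) (-‿cong (≈-trans (diag-X-≢ N v _ (+ 1) v≢N _)
           (≈-trans (*-congˡ (nonneg-neg-const N N≤ f)) (zeroʳ (x v)))))) ⟩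
    c - 0# ≈⟨ ≈-trans (+-congˡ -0≈0) (+-identityʳ c) ⟩
    c ∎
    where open ≈-R
          c = const N · f
          lem = solve 3 (λ a b c → ((con (+ 1)) :- a :* b) :* c := c :- a :* (b :* c)) ≈-refl

  -- Negative powers of the largest variable are annihilated: `E` only lowers the exponent of x_N,
  -- `T vs` leaves it alone, and `J` sends x_N^a to h_a = 0 for a < 0.
  T-nonneg : (N : ℕ) (vs : List ℕ) → N ℕ.≤ n → Away N vs → ∀ f → T (N ∷ vs) · nonneg N · f ≈ T (N ∷ vs) · f
  T-nonneg N vs N≤ aw f = begin
    J N vs · T vs · (E N vs * nonneg N · f) ≈⟨ J-nonneg N vs _ ⟨
    J N vs · nonneg N · T vs · (E N vs * nonneg N · f) ≈⟨ op-cong (J N vs) (T-indicator vs N isNonneg aw _) ⟨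
    J N vs · T vs · nonneg N · (E N vs * nonneg N · f) ≈⟨ op-cong (J N vs ⊙ T vs) (negClosed-E N vs N≤ aw f) ⟩
    J N vs · T vs · nonneg N · (E N vs * f) ≈⟨ op-cong (J N vs) (T-indicator vs N isNonneg aw _) ⟩
    J N vs · nonneg N · T vs · (E N vs * f) ≈⟨ J-nonneg N vs _ ⟩
    J N vs · T vs · (E N vs * f) ∎
    where open ≈-R

  T-const : (N : ℕ) (vs : List ℕ) → N ℕ.≤ n → Away N vs → ∀ f → T (N ∷ vs) · const N · f ≈ T vs · const N · f
  T-const N vs N≤ aw f = begin
    J N vs · T vs · (E N vs * const N · f) ≈⟨ J-nonneg N vs _ ⟨
    J N vs · nonneg N · T vs · (E N vs * const N · f) ≈⟨ op-cong (J N vs) (T-indicator vs N isNonneg aw _) ⟨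
    J N vs · T vs · nonneg N · (E N vs * const N · f) ≈⟨ op-cong (J N vs ⊙ T vs) (nonneg-E-const N vs N≤ aw f) ⟩
    J N vs · T vs · const N · f ≈⟨ op-cong (J N vs) (T-indicator vs N isZero aw f) ⟩
    J N vs · const N · T vs · f ≈⟨ J-const N vs _ ⟩
    const N · T vs · f ≈⟨ T-indicator vs N isZero aw f ⟨
    T vs · const N · f ∎
    where open ≈-R

  const-normalised : (N : ℕ) → N ℕ.≤ n → ∀ d α →
    const N · (X N (ℤ.- coord α N) * mono d α) ≈ X N (ℤ.- coord α N) * mono d α
  const-normalised N N≤ d α = begin
    const N · g ≈⟨ op-cong (const N) (X-*-mono N _ d α) ⟩
    const N · mono d β ≈⟨ diag-mono N (indicator isZero) d β ⟩
    indicator isZero (coord β N) * mono d β ≈⟨ *-congʳ (≈-reflexive (cong (indicator isZero)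
        (trans (single-⊞ N (ℤ.- coord α N) α (ℕ.s≤s N≤)) (ℤₚ.+-inverseˡ (coord α N))))) ⟩
    1# * mono d β ≈⟨ *-identityˡ _ ⟩
    mono d β ≈⟨ X-*-mono N _ d α ⟨
    g ∎
    where open ≈-R
          g = X N (ℤ.- coord α N) * mono d α
          β = single N (ℤ.- coord α N) ⊞ α

  h-preserves : (N : ℕ) → N ℕ.≤ n → ∀ vs z → Preserves N (h z (vars vs))
  h-preserves N N≤ vs = h-closed (Preserves N) (preserves-0 N) (preserves-1 N) (preserves-+ N) (preserves-* N)
    (Allₚ.map⁺ (Allˡ.universal (λ v → preserves-x N v N≤) vs))

  J-mono : (N : ℕ) (vs : List ℕ) (d : ℤ) (α : Exp (suc n)) →
    J N vs · mono d α ≈ h (coord α N) (vars (N ∷ vs)) * (X N (ℤ.- coord α N) * mono d α)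
  J-mono N vs d α = ≈-trans (diag-mono N _ d α) (*-assoc _ _ _)

  -- In h_a(x_N, vs) = x_N h_{a-1}(x_N, vs) + h_a(vs) the second summand is free of x_N, so division
  -- by x_N makes its exponent negative and only h_{a-1}(x_N, vs) is kept.
  nonneg-x⁻-J : (N : ℕ) (vs : List ℕ) → N ℕ.≤ n → Away N vs → ∀ f → nonneg N · (x⁻ N * J N vs · f) ≈ J N vs · (x⁻ N * f)
  nonneg-x⁻-J N vs N≤ aw = op-ext (nonneg N ⊙ mulBy (x⁻ N) ⊙ J N vs) (J N vs ⊙ mulBy (x⁻ N)) λ d α →
    let a = coord α N
        z = ℤ.- + 1 ℤ.+ a
        g = X N (ℤ.- a) * mono d α
        L = vars (N ∷ vs)
        g-const = const-normalised N N≤ d α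
        g-nonneg : nonneg N · g ≈ g
        g-nonneg = ≈-trans (op-cong (nonneg N) (≈-sym g-const)) (≈-trans (nonneg-const N g) g-const)
        1+z : + 1 ℤ.+ z ≡ a
        1+z = lem₁ a
    in begin
      nonneg N · (x⁻ N * J N vs · mono d α) ≈⟨ op-cong (nonneg N) (*-congˡ (J-mono N vs d α)) ⟩
      nonneg N · (x⁻ N * (h a L * g))
        ≈⟨ op-cong (nonneg N)
        (*-congˡ (*-congʳ (≈-trans (≈-reflexive (cong (λ w → h w L) (sym 1+z))) (h-cons z (x N) (vars vs))))) ⟩
      nonneg N · (x⁻ N * ((x N * h z L + h (+ 1 ℤ.+ z) (vars vs)) * g))
        ≈⟨ op-cong (nonneg N) (lem₂ (x⁻ N) (x N) (h z L) (h (+ 1 ℤ.+ z) (vars vs)) g) ⟩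
      nonneg N · (x⁻ N * (x N * (h z L * g)) + h (+ 1 ℤ.+ z) (vars vs) * (x⁻ N * g)) ≈⟨ op-+ (nonneg N) _ _ ⟩
      nonneg N · (x⁻ N * (x N * (h z L * g))) + nonneg N · (h (+ 1 ℤ.+ z) (vars vs) * (x⁻ N * g))
        ≈⟨ +-cong (≈-trans (op-cong (nonneg N) (X-cancel N (+ 1) (h z L * g))) (h-preserves N N≤ (N ∷ vs) z g g-nonneg))
             (≈-trans (diag-h N vs _ aw (+ 1 ℤ.+ z) (x⁻ N * g))
               (≈-trans (*-congˡ (≈-trans (op-cong (nonneg N) (*-congˡ (≈-sym g-const)))
               (nonneg-neg-const N N≤ g))) (zeroʳ _))) ⟩
      h z L * g + 0# ≈⟨ +-identityʳ _ ⟩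
      h z L * g ≈⟨ *-congˡ (lem₃ a (mono d α)) ⟩
      h z L * (X N (ℤ.- z) * (x⁻ N * mono d α)) ≈⟨ lem₄ (h z L) (X N (ℤ.- z)) (x⁻ N) (mono d α) ⟩
      x⁻ N * (h z L * X N (ℤ.- z) * mono d α) ≈⟨ *-congˡ (diag-mono N _ d α) ⟨
      x⁻ N * diag N (λ a → h (ℤ.- + 1 ℤ.+ a) L * X N (ℤ.- (ℤ.- + 1 ℤ.+ a))) · mono d α
        ≈⟨ diag-X-≡ N _ (ℤ.- + 1) N≤ (mono d α) ⟨
      J N vs · (x⁻ N * mono d α) ∎
    where
    open ≈-R
    lem₁ : ∀ a → + 1 ℤ.+ (ℤ.- + 1 ℤ.+ a) ≡ a
    lem₁ = solve-∀
    lem₂ = solve 5 (λ i u a b g → i :* ((u :* a :+ b) :* g) := i :* (u :* (a :* g)) :+ b :* (i :* g)) ≈-refl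
    lem₃ : ∀ a f → X N (ℤ.- a) * f ≈ X N (ℤ.- (ℤ.- + 1 ℤ.+ a)) * (x⁻ N * f)
    lem₃ a f = ≈-trans (*-congʳ (≈-trans (mono-cong refl (cong (single N) (lem a))) (≈-sym (X-+ N _ _))))
      (*-assoc _ _ _)
      where lem : ∀ a → ℤ.- a ≡ ℤ.- (ℤ.- + 1 ℤ.+ a) ℤ.+ ℤ.- + 1
            lem = solve-∀
    lem₄ = solve 4 (λ a b c d → a :* (b :* (c :* d)) := c :* (a :* b :* d)) ≈-refl

  nonneg-x⁻-T : (N : ℕ) (vs : List ℕ) → N ℕ.≤ n → Away N vs → ∀ f →
    nonneg N · (x⁻ N * T (N ∷ vs) · f) ≈ T (N ∷ vs) · (x⁻ N * f)
  nonneg-x⁻-T N vs N≤ aw f = ≈-trans (nonneg-x⁻-J N vs N≤ aw (T vs · (E N vs * f)))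
    (op-cong (J N vs) (≈-trans (≈-sym (T-X vs N (ℤ.- + 1) aw (E N vs * f))) (op-cong (T vs) (swap* (x⁻ N) (E N vs) f))))

  nonneg-T : (N : ℕ) (vs : List ℕ) → N ℕ.≤ n → ∀ f → nonneg N · T (N ∷ vs) · f ≈ T (N ∷ vs) · f
  nonneg-T N vs N≤ f = op-ext (nonneg N ⊙ J N vs) (J N vs) (λ d α → begin
      nonneg N · J N vs · mono d α ≈⟨ op-cong (nonneg N) (J-mono N vs d α) ⟩
      nonneg N · (h (coord α N) (vars (N ∷ vs)) * (X N (ℤ.- coord α N) * mono d α))
        ≈⟨ h-preserves N N≤ (N ∷ vs) (coord α N) _ (≈-trans (op-cong (nonneg N) (≈-sym (const-normalised N N≤ d α)))
             (≈-trans (nonneg-const N _) (const-normalised N N≤ d α))) ⟩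
      h (coord α N) (vars (N ∷ vs)) * (X N (ℤ.- coord α N) * mono d α) ≈⟨ J-mono N vs d α ⟨
      J N vs · mono d α ∎) (T vs · (E N vs * f))
    where open ≈-R

  h-single : (N : ℕ) (z : ℤ) → h z (vars (N ∷ [])) * X N (ℤ.- z) ≈ indicator isNonneg z
  h-single N -[1+ m ] = zeroˡ _
  h-single N (+ m) = ≈-trans (*-congʳ (power m)) (≈-trans (X-+ N (+ m) (ℤ.- + m))
    (≈-trans (mono-cong refl (cong (single N) (ℤₚ.+-inverseʳ (+ m)))) (X-0 N)))
    where
    power : ∀ m → hℕ m (vars (N ∷ [])) ≈ X N (+ m)
    power zero = ≈-sym (X-0 N)
    power (suc m) = ≈-trans (+-identityʳ _) (≈-trans (*-congˡ (power m)) (X-+ N (+ 1) (+ m)))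

  T-single : (N : ℕ) (f : P) → T (N ∷ []) · f ≈ nonneg N · f
  T-single N f = ≈-trans (diag-cong N _ _ (h-single N) (1# * f)) (op-cong (nonneg N) (*-identityˡ f))

  E-snoc : (N : ℕ) (vs : List ℕ) (v : ℕ) → E N (vs ++ v ∷ []) ≈ (1# - x v * x⁻ N) * E N vs
  E-snoc N [] v = ≈-refl
  E-snoc N (u ∷ vs) v = ≈-trans (*-congˡ (E-snoc N vs v)) (swap* _ _ _)

  -- The identity h_a(L, x_v) - x_v h_{a-1}(L, x_v) = h_a(L): the factor 1 - x_v/x_N takes x_v out
  -- of the alphabet again.
  J-snoc : (N : ℕ) (vs : List ℕ) (v : ℕ) → N ℕ.≤ n → v ≢ N → ∀ f →
    J N (vs ++ v ∷ []) · ((1# - x v * x⁻ N) * f) ≈ J N vs · f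
  J-snoc N vs v N≤ v≢N = op-ext (J N vs⁺ ⊙ mulBy (1# - x v * x⁻ N)) (J N vs) λ d α →
    let a = coord α N
        z = ℤ.- + 1 ℤ.+ a
        g = X N (ℤ.- a) * mono d α
    in begin
      J N vs⁺ · ((1# - x v * x⁻ N) * mono d α) ≈⟨ op-cong (J N vs⁺) (lem₁ (x v) (x⁻ N) (mono d α)) ⟩
      J N vs⁺ · (mono d α + - (x v * (x⁻ N * mono d α)))
        ≈⟨ ≈-trans (op-+ (J N vs⁺) _ _) (+-congˡ (op-neg (J N vs⁺) _)) ⟩
      J N vs⁺ · mono d α - J N vs⁺ · (x v * (x⁻ N * mono d α))
        ≈⟨ +-cong (J-mono N vs⁺ d α)
          (-‿cong (≈-trans (diag-X-≢ N v _ (+ 1) v≢N _) (*-congˡ (≈-trans (diag-X-≡ N _ (ℤ.- + 1) N≤ (mono d α))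
             (*-congˡ (diag-mono N _ d α)))))) ⟩
      h a L⁺ * g - x v * (x⁻ N * (h z L⁺ * X N (ℤ.- z) * mono d α))
        ≈⟨ +-congˡ (-‿cong (≈-trans (lem₂ (x v) (x⁻ N) (h z L⁺) (X N (ℤ.- z)) (mono d α))
        (*-congˡ (*-congˡ (≈-trans (≈-sym (*-assoc _ _ _))
        (*-congʳ (≈-trans (X-+ N _ _) (mono-cong refl (cong (single N) (lem₃ a)))))))))) ⟩
      h a L⁺ * g - x v * (h z L⁺ * g) ≈⟨ +-congʳ (*-congʳ (h-expand a)) ⟩
      (x v * h z L⁺ + h a (vars (N ∷ vs))) * g - x v * (h z L⁺ * g) ≈⟨ lem₄ (x v) (h z L⁺) (h a (vars (N ∷ vs))) g ⟩
      h a (vars (N ∷ vs)) * g ≈⟨ J-mono N vs d α ⟨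
      J N vs · mono d α ∎
    where
    open ≈-R
    vs⁺ = vs ++ v ∷ []
    L⁺ = vars (N ∷ vs⁺)
    h-expand : ∀ a → h a L⁺ ≈ x v * h (ℤ.- + 1 ℤ.+ a) L⁺ + h a (vars (N ∷ vs))
    h-expand a = subst (λ b → h b L⁺ ≈ x v * h (ℤ.- + 1 ℤ.+ a) L⁺ + h b (vars (N ∷ vs))) (lem a)
      (subst (λ L → h (+ 1 ℤ.+ (ℤ.- + 1 ℤ.+ a)) L ≈
        x v * h (ℤ.- + 1 ℤ.+ a) L + h (+ 1 ℤ.+ (ℤ.- + 1 ℤ.+ a)) (vars (N ∷ vs)))
        (sym (cong (x N ∷_) (Listₚ.map-++ x vs (v ∷ [])))) (h-snoc (ℤ.- + 1 ℤ.+ a) (vars (N ∷ vs)) (x v)))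
      where lem : ∀ a → + 1 ℤ.+ (ℤ.- + 1 ℤ.+ a) ≡ a
            lem = solve-∀
    lem₁ = solve 3 (λ u i f → ((con (+ 1)) :- u :* i) :* f := f :+ :- (u :* (i :* f))) ≈-refl
    lem₂ = solve 5 (λ u i a b f → u :* (i :* (a :* b :* f)) := u :* (a :* (i :* (b :* f)))) ≈-refl
    lem₃ : ∀ a → ℤ.- + 1 ℤ.+ ℤ.- (ℤ.- + 1 ℤ.+ a) ≡ ℤ.- a
    lem₃ = solve-∀
    lem₄ = solve 4 (λ u a b g → (u :* a :+ b) :* g :- u :* (a :* g) := b :* g) ≈-refl

  preserves-E : (k N : ℕ) (vs : List ℕ) → k ℕ.≤ n → N ≢ k → Preserves k (E N vs)
  preserves-E k N [] k≤ N≢k = preserves-1 k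
  preserves-E k N (v ∷ vs) k≤ N≢k = preserves-* k (preserves-+ k (preserves-1 k)
    (preserves-neg k (preserves-* k (preserves-x k v k≤) (preserves-X-≢ k N (ℤ.- + 1) N≢k))))
      (preserves-E k N vs k≤ N≢k)

  -- The smallest variable stands at the end of the list. It occurs in the alphabet of each `J` and,
  -- through 1 - x_v/x_N, in each `E`; `J-snoc` cancels the two. What remains is the truncation in
  -- x_v alone, which fixes f.
  T-snoc : (vs : List ℕ) (v : ℕ) → v ℕ.≤ n → Allˡ (ℕ._≤ n) vs → Away v vs → Distinct vs →
    ∀ f → nonneg v · f ≈ f → T (vs ++ v ∷ []) · f ≈ T vs · f
  T-snoc [] v v≤ [] [] [] f e = ≈-trans (T-single v f) e
  T-snoc (N ∷ vs) v v≤ (N≤ ∷ vs≤) (N≢v ∷ aw) (N∉ ∷ dist) f e = begin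
    J N vs⁺ · T vs⁺ · (E N vs⁺ * f)
      ≈⟨ op-cong (J N vs⁺) (T-snoc vs v v≤ vs≤ aw dist (E N vs⁺ * f) (preserves-E v N vs⁺ v≤ N≢v f e)) ⟩
    J N vs⁺ · T vs · (E N vs⁺ * f) ≈⟨ op-cong (J N vs⁺ ⊙ T vs) (≈-trans (*-congʳ (E-snoc N vs v)) (*-assoc _ _ _)) ⟩
    J N vs⁺ · T vs · ((1# - x v * x⁻ N) * (E N vs * f)) ≈⟨ op-cong (J N vs⁺)
      (tw-+ tw-1 (tw-neg (tw-* (T-X vs v (+ 1) aw) (T-X vs N (ℤ.- + 1) N∉))) (E N vs * f)) ⟩
    J N vs⁺ · ((1# - x v * x⁻ N) * T vs · (E N vs * f)) ≈⟨ J-snoc N vs v N≤ (N≢v ∘ sym) _ ⟩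
    J N vs · T vs · (E N vs * f) ∎
    where open ≈-R
          open Intertwining (T vs)
          vs⁺ = vs ++ v ∷ []

-- Truncation commutes with the Demazure operators.

module _ {n : ℕ} where
  open LaurentRing (suc n)
  open Operators {suc n}
  open Variables {suc n}
  open PolySolver (suc n) using (solve; _:+_; _:*_; :-_; _:-_; con; _:=_)

  private
    P : Set
    P = Poly (suc n)

  module Symmetric (i : Fin n) where
    private
      k k′ : ℕ
      k = toℕ i
      k′ = suc (toℕ i)
      s : Op (suc n)
      s = π i
    open ≈-R

    sym-cong : {f g : P} → f ≈ g → Sym i f → Sym i g
    sym-cong e q = ≈-trans (op-cong s (≈-sym e)) (≈-trans q e)

    sym-0 : Sym i 0#
    sym-0 = op-0 s

    sym-1 : Sym i 1#
    sym-1 = π-1 i (+ 0)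

    sym-+ : {f g : P} → Sym i f → Sym i g → Sym i (f + g)
    sym-+ {f} {g} p q = ≈-trans (op-+ s f g) (+-cong p q)

    sym-neg : {f : P} → Sym i f → Sym i (- f)
    sym-neg {f} p = ≈-trans (op-neg s f) (-‿cong p)

    sym-* : {f g : P} → Sym i f → Sym i g → Sym i (f * g)
    sym-* {f} {g} p q = ≈-trans (π-sym i p g) (*-congˡ q)

    sym-X : (j : ℕ) (z : ℤ) → j ≢ k → j ≢ k′ → Sym i (X j z)
    sym-X j z p q = sym-cong (*-identityʳ (X j z)) (≈-trans (π-x₃ i j z p q 1#) (*-congˡ sym-1))

    π-x⁻₂ : (f : P) → s · (x⁻ k′ * f) ≈ x⁻ k * s · f + x⁻ k′ * f
    π-x⁻₂ f = begin
      s · (x⁻ k′ * f) ≈⟨ X-cancel k (+ 1) _ ⟨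
      x⁻ k * (x k * s · (x⁻ k′ * f)) ≈⟨ *-congˡ (π-x₂ i (x⁻ k′ * f)) ⟨
      x⁻ k * (s · (x k′ * (x⁻ k′ * f)) + x k * (x⁻ k′ * f)) ≈⟨ *-congˡ (+-congʳ (op-cong s (X-cancel k′ (ℤ.- + 1) f))) ⟩
      x⁻ k * (s · f + x k * (x⁻ k′ * f)) ≈⟨ distribˡ _ _ _ ⟩
      x⁻ k * s · f + x⁻ k * (x k * (x⁻ k′ * f)) ≈⟨ +-congˡ (X-cancel k (+ 1) (x⁻ k′ * f)) ⟩
      x⁻ k * s · f + x⁻ k′ * f ∎

    π-x : s · x k ≈ x k + x k′
    π-x = begin
      s · x k ≈⟨ op-cong s (*-identityʳ (x k)) ⟨
      s · (x k * 1#) ≈⟨ π-x₁ i 1# ⟩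
      x k * 1# + x k′ * s · 1# ≈⟨ +-cong (*-identityʳ _) (≈-trans (*-congˡ sym-1) (*-identityʳ _)) ⟩
      x k + x k′ ∎

    -- The sum is π_i x_i, and images of the idempotent π_i are fixed by it.
    sym-x+x : Sym i (x k + x k′)
    sym-x+x = sym-cong π-x (π-idem i (x k))

    sym-x⁻+x⁻ : Sym i (x⁻ k + x⁻ k′)
    sym-x⁻+x⁻ = sym-cong e (π-idem i (x⁻ k′ * 1#))
      where e : s · (x⁻ k′ * 1#) ≈ x⁻ k + x⁻ k′
            e = ≈-trans (π-x⁻₂ 1#) (+-cong (≈-trans (*-congˡ sym-1) (*-identityʳ _)) (*-identityʳ _))

    sym-XX : (z : ℤ) → Sym i (X k z * X k′ z)
    sym-XX z = sym-cong (≈-sym (mono-* (+ 0) (+ 0) (single k z) (single k′ z))) (π-balanced i (+ 0) β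
      (trans (trans (single-⊞ k z (single k′ z) k<)
        (trans (cong (λ w → z ℤ.+ w) (coord-single-≢ {suc n} k′ k z (ℕₚ.1+n≢n ∘ sym))) (ℤₚ.+-identityʳ z)))
        (sym (trans (single-⊞-≢ {suc n} k k′ z (single k′ z) ℕₚ.1+n≢n) (coord-single {suc n} k′ z (ℕ.s≤s (toℕ< i)))))))
      where
      β : Exp (suc n)
      β = single k z ⊞ single k′ z
      k< : k ℕ.< suc n
      k< = ℕₚ.m≤n⇒m≤1+n (toℕ< i)

    π-x₂-sym : (f : P) → Sym i f → s · (x k′ * f) ≈ 0#
    π-x₂-sym f q = ≈-trans (π-x₂′ i f) (≈-trans (+-congˡ (*-congˡ q)) (-‿inverseˡ (x k * f)))

    HSym : List P → Set
    HSym vs = ∀ z → Sym i (h z vs)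

    h-sym : {vs : List P} → Allˡ (Sym i) vs → HSym vs
    h-sym = h-closed (Sym i) sym-0 sym-1 sym-+ sym-*

    HSym-cons : {v : P} {vs : List P} → Sym i v → HSym vs → HSym (v ∷ vs)
    HSym-cons v-sym vs-sym -[1+ m ] = sym-0
    HSym-cons {v} {vs} v-sym vs-sym (+ m) = go m
      where go : ∀ m → Sym i (hℕ m (v ∷ vs))
            go zero = sym-1
            go (suc m) = sym-+ (sym-* v-sym (go m)) (vs-sym (+ suc m))

    -- The twisted rule for x_i turns the recursion over the alphabet x_i, vs into the one over
    -- x_{i+1}, x_i, vs. The right side is thereby an image of π_i, which yields its symmetry in
    -- `HSym-pair`.
    π-hℕ : {vs : List P} → HSym vs → ∀ m → s · hℕ m (x k ∷ vs) ≈ hℕ m (x k′ ∷ x k ∷ vs)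
    π-hℕ q zero = sym-1
    π-hℕ {vs} q (suc m) = begin
      s · (x k * hℕ m (x k ∷ vs) + hℕ (suc m) vs) ≈⟨ op-+ s _ _ ⟩
      s · (x k * hℕ m (x k ∷ vs)) + s · hℕ (suc m) vs
        ≈⟨ +-cong (≈-trans (π-x₁ i _) (+-congˡ (*-congˡ (π-hℕ q m)))) (q (+ suc m)) ⟩
      x k * hℕ m (x k ∷ vs) + x k′ * hℕ m (x k′ ∷ x k ∷ vs) + hℕ (suc m) vs ≈⟨ lem _ _ _ ⟩
      x k′ * hℕ m (x k′ ∷ x k ∷ vs) + (x k * hℕ m (x k ∷ vs) + hℕ (suc m) vs) ∎
      where lem = solve 3 (λ a b c → a :+ b :+ c := b :+ (a :+ c)) ≈-refl

    HSym-pair : {vs : List P} → HSym vs → HSym (x k′ ∷ x k ∷ vs)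
    HSym-pair q -[1+ m ] = sym-0
    HSym-pair q (+ m) = sym-cong (π-hℕ q m) (π-idem i _)

    Outside : List ℕ → Set
    Outside = Allˡ λ v → (v ≢ k) × (v ≢ k′)

    outside-sym : {vs : List ℕ} → Outside vs → HSym (vars vs)
    outside-sym out = h-sym (Allₚ.map⁺ (Allˡ.map (λ {v} (p , q) → sym-X v (+ 1) p q) out))

    sym-E : (N : ℕ) (vs : List ℕ) → N ≢ k → N ≢ k′ → Outside vs → Sym i (E N vs)
    sym-E N vs p q out = E-commutes′ vs out
      where
      E-commutes′ : ∀ vs → Outside vs → Sym i (E N vs)
      E-commutes′ [] [] = sym-1
      E-commutes′ (v ∷ vs) ((p′ , q′) ∷ out) =
        sym-* (sym-+ sym-1 (sym-neg (sym-* (sym-X v (+ 1) p′ q′) (sym-X N (ℤ.- + 1) p q)))) (E-commutes′ vs out)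

    sym-E-pair : (N : ℕ) (vs : List ℕ) → N ≢ k → N ≢ k′ → Sym i (E N vs) → Sym i (E N (k′ ∷ k ∷ vs))
    sym-E-pair N vs p q e = sym-cong (lem (x k) (x k′) (x⁻ N) (E N vs))
      (sym-* (sym-+ (sym-+ sym-1 (sym-neg (sym-* sym-x+x nN))) (sym-* (sym-XX (+ 1)) (sym-* nN nN))) e)
      where nN = sym-X N (ℤ.- + 1) p q
            lem = solve 4 (λ a b c e → ((con (+ 1)) :- (a :+ b) :* c :+ a :* b :* (c :* c)) :* e :=
              ((con (+ 1)) :- b :* c) :* (((con (+ 1)) :- a :* c) :* e)) ≈-refl

    sym-EE : (vs : List ℕ) → Outside vs → Sym i (E k vs * E k′ vs)
    sym-EE [] [] = sym-* sym-1 sym-1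
    sym-EE (v ∷ vs) ((p , q) ∷ out) = sym-cong (lem (x v) (x⁻ k) (x⁻ k′) (E k vs) (E k′ vs))
      (sym-* (sym-+ (sym-+ sym-1 (sym-neg (sym-* v-sym sym-x⁻+x⁻))) (sym-* (sym-* v-sym v-sym) (sym-XX (ℤ.- + 1))))
        (sym-EE vs out))
      where v-sym = sym-X v (+ 1) p q
            lem = solve 5 (λ v a b e f → ((con (+ 1)) :- v :* (a :+ b) :+ v :* v :* (a :* b)) :* (e :* f) :=
              ((con (+ 1)) :- v :* a) :* e :* (((con (+ 1)) :- v :* b) :* f)) ≈-refl

    -- T commutes with π_i

    -- The exponent of x_N is constant along the string of a monomial, so there `diag` is
    -- multiplication by a single symmetric polynomial, which π_i respects.
    π-diag : (N : ℕ) (φ : ℤ → P) → N ≢ k → N ≢ k′ → (∀ z → Sym i (φ z)) → ∀ f → diag N φ · s · f ≈ s · diag N φ · f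
    π-diag N φ p q φ-sym = op-ext (diag N φ ⊙ s) (s ⊙ diag N φ) λ d α → begin
      diag N φ · s · mono d α ≈⟨ mk≈ (λ F → trans (spec (diag N φ) F (s · mono d α))
          (trans (π-local i (dual (diag N φ) F) (dual (mulBy (φ (coord α N))) F) d d α (pointwise F d α))
            (sym (spec (mulBy (φ (coord α N))) F (s · mono d α))))) ⟩
      φ (coord α N) * s · mono d α ≈⟨ π-sym i (φ-sym (coord α N)) (mono d α) ⟨
      s · (φ (coord α N) * mono d α) ≈⟨ op-cong s (diag-mono N φ d α) ⟨
      s · diag N φ · mono d α ∎
      where
      pointwise : ∀ F d α u v → dual (diag N φ) F d (set2 i u v α) ≡ dual (mulBy (φ (coord α N))) F d (set2 i u v α)
      pointwise F d α u v = trans (dual-mono (diag N φ) F d (set2 i u v α))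
        (trans (at (diag-mono N φ d (set2 i u v α)) F)
        (trans (cong (λ z → ev F (φ z * mono d (set2 i u v α))) (coord-set2-≢ i u v α N p q))
          (sym (dual-mono (mulBy (φ (coord α N))) F d (set2 i u v α)))))

    CommutesT : List ℕ → Set
    CommutesT vs = ∀ f → T vs · s · f ≈ s · T vs · f

    commutesT-cons : (N : ℕ) (vs : List ℕ) → N ≢ k → N ≢ k′ → HSym (vars (N ∷ vs)) → Sym i (E N vs) → CommutesT vs →
      CommutesT (N ∷ vs)
    commutesT-cons N vs p q hs es c f = begin
      J N vs · T vs · (E N vs * s · f) ≈⟨ op-cong (J N vs ⊙ T vs) (π-sym i es f) ⟨
      J N vs · T vs · s · (E N vs * f) ≈⟨ op-cong (J N vs) (c (E N vs * f)) ⟩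
      J N vs · s · T vs · (E N vs * f) ≈⟨ π-diag N _ p q (λ z → sym-* (hs z) (sym-X N (ℤ.- z) p q)) _ ⟩
      s · J N vs · T vs · (E N vs * f) ∎

    commutesT-outside : (vs : List ℕ) → Outside vs → CommutesT vs
    commutesT-outside [] [] f = ≈-refl
    commutesT-outside (N ∷ vs) ((p , q) ∷ out) =
      commutesT-cons N vs p q (outside-sym ((p , q) ∷ out)) (sym-E N vs p q out) (commutesT-outside vs out)

    module Pair (vs : List ℕ) (out : Outside vs) where
      private
        x₁ x₂ x₁⁻ x₂⁻ : P
        x₁ = x k
        x₂ = x k′
        x₁⁻ = x⁻ k
        x₂⁻ = x⁻ k′
        L₁ L₂ : List P
        L₁ = vars (k ∷ vs)
        L₂ = vars (k′ ∷ k ∷ vs)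
        L₂-sym : HSym L₂
        L₂-sym = HSym-pair (outside-sym out)
        k≤ : k ℕ.≤ n
        k≤ = ℕₚ.<⇒≤ (toℕ< i)
        k′≤ : k′ ℕ.≤ n
        k′≤ = toℕ< i
        k≢k′ : k ≢ k′
        k≢k′ = ℕₚ.1+n≢n ∘ sym

        opaque
          -- A 2×2 Jacobi-Trudi determinant over the alphabet that contains both x_i and x_{i+1}. It
          -- is symmetric in these variables and antisymmetric in a and b; the offset -1 in `B`
          -- makes `A u v` the factor belonging to x_{i+1} times a monomial with exponents u, v.
          A : ℤ → ℤ → P
          A a b = h a L₂ * h (+ 1 ℤ.+ b) L₂ - h (+ 1 ℤ.+ a) L₂ * h b L₂

          A-def : ∀ a b → A a b ≈ h a L₂ * h (+ 1 ℤ.+ b) L₂ - h (+ 1 ℤ.+ a) L₂ * h b L₂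
          A-def a b = ≈-refl

        A-sym : ∀ a b → Sym i (A a b)
        A-sym a b = sym-cong (≈-sym (A-def a b))
          (sym-+ (sym-* (L₂-sym a) (L₂-sym (+ 1 ℤ.+ b))) (sym-neg (sym-* (L₂-sym (+ 1 ℤ.+ a)) (L₂-sym b))))

        A-antisym : ∀ a b g → A a b * g ≈ - (A b a * g)
        A-antisym a b g = ≈-trans (*-congʳ (A-def a b))
          (≈-trans (lem (h a L₂) (h b L₂) (h (+ 1 ℤ.+ a) L₂) (h (+ 1 ℤ.+ b) L₂) g)
          (-‿cong (*-congʳ (≈-sym (A-def b a)))))
          where lem = solve 5 (λ a b a′ b′ g → (a :* b′ :- a′ :* b) :* g := :- ((b :* a′ :- b′ :* a) :* g)) ≈-refl

        base : ℤ → Exp (suc n) → P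
        base d α = mono d (set2 i (+ 0) (+ 0) α)

        opaque
          B : Op (suc n)
          B = lin λ d α → A (coord α k) (ℤ.- + 1 ℤ.+ coord α k′) * base d α

          B-mono : ∀ d α → B · mono d α ≈ A (coord α k) (ℤ.- + 1 ℤ.+ coord α k′) * base d α
          B-mono = lin-mono λ d α → A (coord α k) (ℤ.- + 1 ℤ.+ coord α k′) * base d α

        -- The two outermost variables of T, after T has acted on the remaining ones.
        K : Op (suc n)
        K = J k′ (k ∷ vs) ⊙ J k vs ⊙ mulBy (1# - x₁ * x₂⁻)

        JJ-mono : ∀ d α → J k′ (k ∷ vs) · J k vs · mono d α ≈ h (coord α k) L₁ * (h (coord α k′) L₂ * base d α)
        JJ-mono d α = begin
          J k′ (k ∷ vs) · J k vs · mono d α ≈⟨ op-cong (J k′ (k ∷ vs)) (J-mono k vs d α) ⟩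
          J k′ (k ∷ vs) · (h a L₁ * (X k (ℤ.- a) * mono d α)) ≈⟨ diag-h k′ (k ∷ vs) _ (k≢k′ ∷ Allˡ.map proj₂ out) a _ ⟩
          h a L₁ * J k′ (k ∷ vs) · (X k (ℤ.- a) * mono d α) ≈⟨ *-congˡ (diag-X-≢ k′ k _ (ℤ.- a) k≢k′ _) ⟩
          h a L₁ * (X k (ℤ.- a) * J k′ (k ∷ vs) · mono d α) ≈⟨ *-congˡ (*-congˡ (J-mono k′ (k ∷ vs) d α)) ⟩
          h a L₁ * (X k (ℤ.- a) * (h b L₂ * (X k′ (ℤ.- b) * mono d α))) ≈⟨ *-congˡ (swap* _ _ _) ⟩
          h a L₁ * (h b L₂ * (X k (ℤ.- a) * (X k′ (ℤ.- b) * mono d α)))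
            ≈⟨ *-congˡ (*-congˡ (≈-trans (*-congˡ (X-*-mono k′ _ d α))
              (≈-trans (X-*-mono k _ d _) (mono-cong refl α₀≡)))) ⟩
          h a L₁ * (h b L₂ * base d α) ∎
          where
          a = coord α k
          b = coord α k′
          α₀≡ : single k (ℤ.- a) ⊞ (single k′ (ℤ.- b) ⊞ α) ≡ set2 i (+ 0) (+ 0) α
          α₀≡ = sym (set2-unique i (+ 0) (+ 0) α _
            (trans (single-⊞ k (ℤ.- a) _ (ℕ.s≤s k≤))
              (trans (cong (λ w → ℤ.- a ℤ.+ w) (single-⊞-≢ k′ k (ℤ.- b) α k≢k′)) (ℤₚ.+-inverseˡ a)))
            (trans (single-⊞-≢ k k′ (ℤ.- a) (single k′ (ℤ.- b) ⊞ α) (k≢k′ ∘ sym))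
              (trans (single-⊞ k′ (ℤ.- b) α (ℕ.s≤s k′≤)) (ℤₚ.+-inverseˡ b)))
            (λ j p q → trans (single-⊞-≢ k j (ℤ.- a) (single k′ (ℤ.- b) ⊞ α) p) (single-⊞-≢ k′ j (ℤ.- b) α q)))

        base-shift : ∀ d z w α → base d (single k z ⊞ (single k′ w ⊞ α)) ≈ base d α
        base-shift d z w α = mono-cong refl (set2-overwrite i (+ 0) (+ 0) _ α
          λ j p q → trans (single-⊞-≢ k j z (single k′ w ⊞ α) p) (single-⊞-≢ k′ j w α q))

        base-shift₁ : ∀ d z α → base d (single k z ⊞ α) ≈ base d α
        base-shift₁ d z α = mono-cong refl (set2-overwrite i (+ 0) (+ 0) _ α λ j p q → single-⊞-≢ k j z α p)

        base-shift₂ : ∀ d z α → base d (single k′ z ⊞ α) ≈ base d α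
        base-shift₂ d z α = mono-cong refl (set2-overwrite i (+ 0) (+ 0) _ α λ j p q → single-⊞-≢ k′ j z α q)

        h-cong : ∀ {a b} L → a ≡ b → h a L ≈ h b L
        h-cong L refl = ≈-refl

        h-L₁ : ∀ z → h (+ 1 ℤ.+ z) L₁ ≈ h (+ 1 ℤ.+ z) L₂ - x₂ * h z L₂
        h-L₁ z = ≈-trans (lem _ (x₂ * h z L₂)) (+-congʳ (≈-sym (h-cons z x₂ L₁)))
          where lem = solve 2 (λ a b → a := b :+ a :- b) ≈-refl

        -- `K` gives h_a(L₁) h_b(L₂) - h_{a+1}(L₁) h_{b-1}(L₂). Substituting h_z(L₁) = h_z(L₂) -
        -- x_{i+1} h_{z-1}(L₂) in both products leaves A(a, b-1) - x_{i+1} A(a-1, b-1).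
        K-B : ∀ f → K · f ≈ B · f - x₂ * B · (x₁⁻ * f)
        K-B f = ≈-trans (op-ext K (B ⊕ (mulBy (- x₂) ⊙ B ⊙ mulBy x₁⁻)) on-mono f) (+-congˡ (≈-sym (-‿distribˡ-* x₂ _)))
          where
          m₁ : ∀ a → + 1 ℤ.+ (ℤ.- + 1 ℤ.+ a) ≡ a
          m₁ = solve-∀
          on-mono : ∀ d α → K · mono d α ≈ B · mono d α + - x₂ * B · (x₁⁻ * mono d α)
          on-mono d α = begin
            JJ · ((1# - x₁ * x₂⁻) * mono d α) ≈⟨ op-cong JJ (lem₁ x₁ x₂⁻ (mono d α)) ⟩
            JJ · (mono d α + - (x₁ * (x₂⁻ * mono d α))) ≈⟨ ≈-trans (op-+ JJ _ _) (+-congˡ (op-neg JJ _)) ⟩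
            JJ · mono d α - JJ · (x₁ * (x₂⁻ * mono d α))
              ≈⟨ +-cong (JJ-mono d α)
                (-‿cong (≈-trans (op-cong JJ (≈-trans (*-congˡ (X-*-mono k′ _ d α)) (X-*-mono k _ d _)))
                (JJ-mono d α′))) ⟩
            h a L₁ * (h b L₂ * g) - h (coord α′ k) L₁ * (h (coord α′ k′) L₂ * base d α′)
              ≈⟨ +-cong (*-cong (≈-trans (h-cong L₁ (sym (m₁ a))) (h-L₁ a₋)) (*-congʳ (h-cong L₂ (sym (m₁ b)))))
                   (-‿cong (*-cong (≈-trans (h-cong L₁ a′)
                     (≈-trans (h-L₁ a) (+-congʳ (h-cong L₂ (cong (λ w → + 1 ℤ.+ w) (sym (m₁ a)))))))
                     (*-cong (h-cong L₂ b′) (base-shift d (+ 1) (ℤ.- + 1) α)))) ⟩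
            (h (+ 1 ℤ.+ a₋) L₂ - x₂ * h a₋ L₂) * (h (+ 1 ℤ.+ b₋) L₂ * g)
              - (h (+ 1 ℤ.+ (+ 1 ℤ.+ a₋)) L₂ - x₂ * h a L₂) * (h b₋ L₂ * g)
              ≈⟨ +-congˡ (-‿cong (*-congʳ (+-congˡ (-‿cong (*-congˡ (h-cong L₂ (sym (m₁ a)))))))) ⟩
            (h (+ 1 ℤ.+ a₋) L₂ - x₂ * h a₋ L₂) * (h (+ 1 ℤ.+ b₋) L₂ * g)
              - (h (+ 1 ℤ.+ (+ 1 ℤ.+ a₋)) L₂ - x₂ * h (+ 1 ℤ.+ a₋) L₂) * (h b₋ L₂ * g)
              ≈⟨ lem₂ (h (+ 1 ℤ.+ a₋) L₂) (h a₋ L₂) (h (+ 1 ℤ.+ b₋) L₂) (h (+ 1 ℤ.+ (+ 1 ℤ.+ a₋)) L₂) (h b₋ L₂) x₂ g ⟩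
            (h (+ 1 ℤ.+ a₋) L₂ * h (+ 1 ℤ.+ b₋) L₂ - h (+ 1 ℤ.+ (+ 1 ℤ.+ a₋)) L₂ * h b₋ L₂) * g
              + - x₂ * ((h a₋ L₂ * h (+ 1 ℤ.+ b₋) L₂ - h (+ 1 ℤ.+ a₋) L₂ * h b₋ L₂) * g)
              ≈⟨ +-cong (*-congʳ (A-def (+ 1 ℤ.+ a₋) b₋)) (*-congˡ (*-congʳ (A-def a₋ b₋))) ⟨
            A (+ 1 ℤ.+ a₋) b₋ * g + - x₂ * (A a₋ b₋ * g)
              ≈⟨ +-cong (*-congʳ (≈-reflexive (cong (λ w → A w b₋) (m₁ a))))
                (*-congˡ (*-cong (≈-reflexive (cong₂ A (sym a″) (cong (λ w → ℤ.- + 1 ℤ.+ w) (sym b″))))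
                (≈-sym (base-shift₁ d (ℤ.- + 1) α)))) ⟩
            A a b₋ * g + - x₂ * (A (coord α″ k) (ℤ.- + 1 ℤ.+ coord α″ k′) * base d α″)
              ≈⟨ +-cong (B-mono d α) (*-congˡ (≈-trans (op-cong B (X-*-mono k _ d α)) (B-mono d α″))) ⟨
            B · mono d α + - x₂ * B · (x₁⁻ * mono d α) ∎
            where
            JJ = J k′ (k ∷ vs) ⊙ J k vs
            a = coord α k
            b = coord α k′
            a₋ = ℤ.- + 1 ℤ.+ a
            b₋ = ℤ.- + 1 ℤ.+ b
            g = base d α
            α′ α″ : Exp (suc n)
            α′ = single k (+ 1) ⊞ (single k′ (ℤ.- + 1) ⊞ α)
            α″ = single k (ℤ.- + 1) ⊞ α
            a′ : coord α′ k ≡ + 1 ℤ.+ a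
            a′ = trans (single-⊞ k (+ 1) _ (ℕ.s≤s k≤)) (cong (λ w → + 1 ℤ.+ w) (single-⊞-≢ k′ k (ℤ.- + 1) α k≢k′))
            b′ : coord α′ k′ ≡ b₋
            b′ = trans (single-⊞-≢ k k′ (+ 1) (single k′ (ℤ.- + 1) ⊞ α) (k≢k′ ∘ sym))
              (single-⊞ k′ (ℤ.- + 1) α (ℕ.s≤s k′≤))
            a″ : coord α″ k ≡ a₋
            a″ = single-⊞ k (ℤ.- + 1) α (ℕ.s≤s k≤)
            b″ : coord α″ k′ ≡ b
            b″ = single-⊞-≢ k k′ (ℤ.- + 1) α (k≢k′ ∘ sym)
            lem₁ = solve 3 (λ u v f → ((con (+ 1)) :- u :* v) :* f := f :+ :- (u :* (v :* f))) ≈-refl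
            lem₂ = solve 7 (λ p q r t u y g → (p :- y :* q) :* (r :* g) :- (t :- y :* p) :* (u :* g) :=
              (p :* r :- t :* u) :* g :+ :- y :* ((q :* r :- p :* u) :* g)) ≈-refl

        -- A is antisymmetric, so B kills x_{i+1} times anything symmetric.
        B-antisym : ∀ f → B · (x₂ * s · f) ≈ 0#
        B-antisym = op-ext (B ⊙ mulBy x₂ ⊙ s) 0ₒ λ d α → mk≈ λ F →
          trans (spec (B ⊙ mulBy x₂) F (s · mono d α)) (π-antisym i (dual (B ⊙ mulBy x₂) F) d α (antisym F d α))
          where
          value : ∀ d α u v → B · (x₂ * mono d (set2 i u v α)) ≈ A u v * base d α
          value d α u v = begin
            B · (x₂ * mono d β) ≈⟨ op-cong B (X-*-mono k′ (+ 1) d β) ⟩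
            B · mono d β⁺ ≈⟨ B-mono d β⁺ ⟩
            A (coord β⁺ k) (ℤ.- + 1 ℤ.+ coord β⁺ k′) * base d β⁺
              ≈⟨ *-cong (≈-reflexive (cong₂ A (trans (single-⊞-≢ k′ k (+ 1) β k≢k′) (coord-set2₁ i u v α))
                   (trans (cong (λ w → ℤ.- + 1 ℤ.+ w)
                     (trans (single-⊞ k′ (+ 1) β (ℕ.s≤s k′≤)) (cong (λ w → + 1 ℤ.+ w) (coord-set2₂ i u v α)))) (m v))))
                 (≈-trans (base-shift₂ d (+ 1) β)
                   (mono-cong refl (set2-overwrite i (+ 0) (+ 0) β α λ j p q → coord-set2-≢ i u v α j p q))) ⟩
            A u v * base d α ∎
            where
            β = set2 i u v α
            β⁺ = single k′ (+ 1) ⊞ β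
            m : ∀ v → ℤ.- + 1 ℤ.+ (+ 1 ℤ.+ v) ≡ v
            m = solve-∀
          antisym : ∀ F d α u v → dual (B ⊙ mulBy x₂) F d (set2 i u v α) ≡ ℤ.- dual (B ⊙ mulBy x₂) F d (set2 i v u α)
          antisym F d α u v = trans (dual-mono C F d (set2 i u v α))
            (trans (at (≈-trans (value d α u v) (≈-trans (A-antisym u v (base d α))
                (-‿cong (≈-sym (value d α v u))))) F)
              (trans (ev-neg F (C · mono d (set2 i v u α))) (cong ℤ.-_ (sym (dual-mono C F d (set2 i v u α))))))
            where
            C = B ⊙ mulBy x₂

        B-sym : ∀ f → s · B · f ≈ B · f
        B-sym = op-ext (s ⊙ B) B λ d α → begin
          s · B · mono d α ≈⟨ op-cong s (B-mono d α) ⟩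
          s · (A (coord α k) (ℤ.- + 1 ℤ.+ coord α k′) * base d α)
            ≈⟨ sym-* (A-sym _ _) (π-balanced i d _
            (trans (coord-set2₁ i (+ 0) (+ 0) α) (sym (coord-set2₂ i (+ 0) (+ 0) α)))) ⟩
          A (coord α k) (ℤ.- + 1 ℤ.+ coord α k′) * base d α ≈⟨ B-mono d α ⟨
          B · mono d α ∎

        B-π : ∀ f → B · s · f ≈ B · f
        B-π f = begin
          B · s · f ≈⟨ op-cong B decompose ⟩
          B · (f + x₂ * s · ∂f) ≈⟨ op-+ B _ _ ⟩
          B · f + B · (x₂ * s · ∂f) ≈⟨ +-congˡ (B-antisym ∂f) ⟩
          B · f + 0# ≈⟨ +-identityʳ _ ⟩
          B · f ∎
          where
          -- The divided difference (f - s_i f)/(x_i - x_{i+1}), obtained from π_i f = f + x_{i+1}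
          -- ∂f; its symmetry puts the correction into the form that `B-antisym` kills.
          ∂f : P
          ∂f = x₂⁻ * (s · f - f)
          sym-∂ : s · ∂f ≈ ∂f
          sym-∂ = begin
            s · (x₂⁻ * (s · f - f)) ≈⟨ π-x⁻₂ _ ⟩
            x₁⁻ * s · (s · f - f) + ∂f ≈⟨ +-congʳ (*-congˡ (≈-trans (op-+ s _ _) (+-cong (π-idem i f) (op-neg s f)))) ⟩
            x₁⁻ * (s · f - s · f) + ∂f ≈⟨ +-congʳ (≈-trans (*-congˡ (-‿inverseʳ _)) (zeroʳ _)) ⟩
            0# + ∂f ≈⟨ +-identityˡ _ ⟩
            ∂f ∎
          decompose : s · f ≈ f + x₂ * s · ∂f
          decompose = begin
            s · f ≈⟨ lem f (s · f) ⟩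
            f + (s · f - f) ≈⟨ +-congˡ (X-cancel k′ (ℤ.- + 1) (s · f - f)) ⟨
            f + x₂ * ∂f ≈⟨ +-congˡ (*-congˡ sym-∂) ⟨
            f + x₂ * s · ∂f ∎
            where lem = solve 2 (λ a b → b := a :+ (b :- a)) ≈-refl

        -- Since 1/x_i is x_{i+1} times the symmetric 1/(x_i x_{i+1}), this is again x_{i+1} times
        -- something symmetric.
        B-x₁⁻π : ∀ f → B · (x₁⁻ * s · f) ≈ 0#
        B-x₁⁻π f = begin
          B · (x₁⁻ * s · f) ≈⟨ op-cong B (X-cancel k′ (ℤ.- + 1) _) ⟨
          B · (x₂ * (x₂⁻ * (x₁⁻ * s · f))) ≈⟨ op-cong B (*-congˡ (lem x₂⁻ x₁⁻ (s · f))) ⟩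
          B · (x₂ * (x₁⁻ * x₂⁻ * s · f)) ≈⟨ op-cong B (*-congˡ (π-sym i (sym-XX (ℤ.- + 1)) f)) ⟨
          B · (x₂ * s · (x₁⁻ * x₂⁻ * f)) ≈⟨ B-antisym _ ⟩
          0# ∎
          where lem = solve 3 (λ a b c → a :* (b :* c) := b :* a :* c) ≈-refl

        K-π : ∀ f → K · s · f ≈ s · K · f
        K-π f = begin
          K · s · f ≈⟨ K-B (s · f) ⟩
          B · s · f - x₂ * B · (x₁⁻ * s · f) ≈⟨ +-cong (B-π f) (-‿cong (*-congˡ (B-x₁⁻π f))) ⟩
          -- Both sides are equal to `B · f`: the second summand of `K` vanishes after `s` acts on
          -- the right, and also after `s` acts on the left, where π_i kills x_{i+1} times a
          -- symmetric polynomial.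
          B · f - x₂ * 0# ≈⟨ +-congˡ (-‿cong (≈-trans (zeroʳ x₂) (≈-sym (π-x₂-sym _ (B-sym (x₁⁻ * f)))))) ⟩
          B · f - s · (x₂ * B · (x₁⁻ * f)) ≈⟨ +-congʳ (B-sym f) ⟨
          s · B · f - s · (x₂ * B · (x₁⁻ * f)) ≈⟨ ≈-trans (op-+ s _ _) (+-congˡ (op-neg s _)) ⟨
          s · (B · f - x₂ * B · (x₁⁻ * f)) ≈⟨ op-cong s (K-B f) ⟨
          s · K · f ∎

        T-K : ∀ f → T (k′ ∷ k ∷ vs) · f ≈ K · T vs · (E k vs * E k′ vs * f)
        T-K f = begin
          J k′ (k ∷ vs) · J k vs · T vs · (E k vs * ((1# - x₁ * x₂⁻) * E k′ vs * f))
            ≈⟨ op-cong (JJ ⊙ T vs) (lem _ _ _ _) ⟩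
          J k′ (k ∷ vs) · J k vs · T vs · ((1# - x₁ * x₂⁻) * (E k vs * E k′ vs * f))
            ≈⟨ op-cong JJ (tw-+ tw-1
              (tw-neg (tw-* (T-X vs k (+ 1) (Allˡ.map proj₁ out)) (T-X vs k′ (ℤ.- + 1) (Allˡ.map proj₂ out)))) _) ⟩
          J k′ (k ∷ vs) · J k vs · ((1# - x₁ * x₂⁻) * T vs · (E k vs * E k′ vs * f)) ∎
          where
          JJ = J k′ (k ∷ vs) ⊙ J k vs
          open Intertwining (T vs)
          lem = solve 4 (λ a c b f → a :* (c :* b :* f) := c :* (a :* b :* f)) ≈-refl

      commutesT-pair : CommutesT (k′ ∷ k ∷ vs)
      commutesT-pair f = begin
        T (k′ ∷ k ∷ vs) · s · f ≈⟨ T-K (s · f) ⟩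
        K · T vs · (E k vs * E k′ vs * s · f) ≈⟨ op-cong (K ⊙ T vs) (π-sym i (sym-EE vs out) f) ⟨
        K · T vs · s · (E k vs * E k′ vs * f) ≈⟨ op-cong K (commutesT-outside vs out _) ⟩
        K · s · T vs · (E k vs * E k′ vs * f) ≈⟨ K-π _ ⟩
        s · K · T vs · (E k vs * E k′ vs * f) ≈⟨ op-cong s (T-K f) ⟨
        s · T (k′ ∷ k ∷ vs) · f ∎

    private
      below : (N : ℕ) → N ℕ.≤ k → Outside (downFrom N)
      below zero _ = []
      below (suc N) N<k = ((ℕₚ.<⇒≢ N<k) , (ℕₚ.<⇒≢ (ℕₚ.m≤n⇒m≤1+n N<k))) ∷ below N (ℕₚ.<⇒≤ N<k)

      record Good (vs : List ℕ) : Set where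
        field
          hsym : HSym (vars vs)
          esym : ∀ N → N ≢ k → N ≢ k′ → Sym i (E N vs)
          comm : CommutesT vs

      -- The base case has x_i and x_{i+1} as its two largest variables. Adding a larger one keeps
      -- alphabets and `E`-factors symmetric, so its `J` commutes with π_i by `π-diag`.
      good : (j : ℕ) → Good (downFrom (j ℕ.+ suc k′))
      good zero = record
        { hsym = HSym-pair (outside-sym out)
        ; esym = λ N p q → sym-E-pair N (downFrom k) p q (sym-E N (downFrom k) p q out)
        ; comm = Pair.commutesT-pair (downFrom k) out }
        where out = below k ℕₚ.≤-refl
      good (suc j) = record
        { hsym = hs
        ; esym = λ M p q → sym-* (sym-+ sym-1 (sym-neg (sym-* (sym-X N (+ 1) N≢k N≢k′) (sym-X M (ℤ.- + 1) p q))))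
            (Good.esym g M p q)
        ; comm = commutesT-cons N _ N≢k N≢k′ hs (Good.esym g N N≢k N≢k′) (Good.comm g) }
        where
        g = good j
        N = j ℕ.+ suc k′
        k′<N : k′ ℕ.< N
        k′<N = ℕₚ.m≤n+m (suc k′) j
        N≢k : N ≢ k
        N≢k = ℕₚ.>⇒≢ (ℕₚ.<-trans (ℕₚ.n<1+n k) k′<N)
        N≢k′ : N ≢ k′
        N≢k′ = ℕₚ.>⇒≢ k′<N
        hs = HSym-cons (sym-X N (+ 1) N≢k N≢k′) (Good.hsym g)

    commutesT-downFrom : (N : ℕ) → k′ ℕ.< N → CommutesT (downFrom N)
    commutesT-downFrom N k′<N = subst (λ N → CommutesT (downFrom N)) (ℕₚ.m∸n+n≡m k′<N) (Good.comm (good (N ℕ.∸ suc k′)))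

-- Ranges of variables, in descending order

range : ℕ → ℕ → List ℕ
range s zero = []
range s (suc N) = s ℕ.+ N ∷ range s N

range-snoc : (s N : ℕ) → range s (suc N) ≡ range (suc s) N ++ s ∷ []
range-snoc s zero = cong (_∷ []) (ℕₚ.+-identityʳ s)
range-snoc s (suc N) = cong₂ _∷_ (ℕₚ.+-suc s N) (range-snoc s N)

range-suc : (s N : ℕ) → map suc (range s N) ≡ range (suc s) N
range-suc s zero = refl
range-suc s (suc N) = cong (suc (s ℕ.+ N) ∷_) (range-suc s N)

range-downFrom : (N : ℕ) → range 0 N ≡ downFrom N
range-downFrom zero = refl
range-downFrom (suc N) = cong (N ∷_) (range-downFrom N)

range-All : (Q : ℕ → Set) (s N : ℕ) → (∀ j → s ℕ.≤ j → j ℕ.< s ℕ.+ N → Q j) → Allˡ Q (range s N)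
range-All Q s zero q = []
range-All Q s (suc N) q = q (s ℕ.+ N) (ℕₚ.m≤m+n s N) (ℕₚ.+-monoʳ-< s (ℕₚ.n<1+n N))
  ∷ range-All Q s N λ j s≤ j< → q j s≤ (ℕₚ.<-trans j< (ℕₚ.+-monoʳ-< s (ℕₚ.n<1+n N)))

range-distinct : (s N : ℕ) → Distinct (range s N)
range-distinct s zero = []
range-distinct s (suc N) = range-All _ s N (λ j _ j< e → ℕₚ.<-irrefl e j<) ∷ range-distinct s N

-- Rotation of the variables, coefficients in q and in the last variable.

last-coord : ∀ {m} (α : Exp (suc m)) → V.last α ≡ coord α m
last-coord (a ∷ []) = refl
last-coord (a ∷ b ∷ α) = last-coord (b ∷ α)

init-coord : ∀ {m} (α : Exp (suc m)) (k : ℕ) → k ℕ.< m → coord (V.init α) k ≡ coord α k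
init-coord {suc m} (a ∷ b ∷ α) zero _ = refl
init-coord {suc m} (a ∷ b ∷ α) (suc k) (ℕ.s≤s k<) = init-coord (b ∷ α) k k<

coord-past : ∀ {m} (α : Exp m) (k : ℕ) → m ℕ.≤ k → coord α k ≡ + 0
coord-past [] k _ = refl
coord-past (a ∷ α) (suc k) (ℕ.s≤s le) = coord-past α k le

-- A primitive of the function with value v at 0 and 0 elsewhere; it evaluates a string on which at
-- most one monomial contributes.
heaviside : ℤ → ℤ → ℤ
heaviside v (+ suc _) = v
heaviside v _ = + 0

heaviside-primitive : ∀ v w → heaviside v (+ 1 ℤ.+ w) ≡ heaviside v w ℤ.+ (if isZero w then v else + 0)
heaviside-primitive v (+ zero) = sym (ℤₚ.+-identityˡ v)
heaviside-primitive v (+ suc m) = sym (ℤₚ.+-identityʳ v)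
heaviside-primitive v -[1+ zero ] = refl
heaviside-primitive v -[1+ suc m ] = refl

module _ {n : ℕ} where
  open LaurentRing (suc n)
  open Operators {suc n}
  open Variables {suc n}
  open PolySolver (suc n) using (solve; _:+_; _:*_; :-_; _:-_; con; _:=_)

  private
    P : Set
    P = Poly (suc n)

  -- All exponents being nonnegative, `T-snoc` strips the variables one by one, from the smallest
  -- upwards, until `T` is the identity.
  T-fixed : (s N : ℕ) → s ℕ.+ N ℕ.≤ suc n → (f : P) → (∀ j → j ℕ.≤ n → nonneg j · f ≈ f) → T (range s N) · f ≈ f
  T-fixed s zero _ f pos = ≈-refl
  T-fixed s (suc N) le f pos = subst (λ vs → T vs · f ≈ f) (sym (range-snoc s N)) (≈-trans
    (T-snoc (range (suc s) N) s s≤n (range-All (ℕ._≤ n) (suc s) N λ j _ j< → ℕₚ.≤-pred (ℕₚ.≤-trans j< le′))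
      (range-All (_≢ s) (suc s) N λ j s<j _ e → ℕₚ.<-irrefl (sym e) s<j) (range-distinct (suc s) N) f (pos s s≤n))
    (T-fixed (suc s) N le′ f pos))
    where
    le′ : suc s ℕ.+ N ℕ.≤ suc n
    le′ = subst (ℕ._≤ suc n) (ℕₚ.+-suc s N) le
    s≤n : s ℕ.≤ n
    s≤n = ℕₚ.≤-pred (ℕₚ.≤-trans (ℕ.s≤s (ℕₚ.m≤m+n s N)) le′)

  -- The rotation Φ

  rot : Exp (suc n) → Exp (suc n)
  rot α = V.last α ∷ V.init α

  rot-unique : (α β : Exp (suc n)) → coord β 0 ≡ coord α n → (∀ k → k ℕ.< n → coord β (suc k) ≡ coord α k) → rot α ≡ β
  rot-unique α β h₀ h₁ = coord-ext _ _ λ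
    { zero → trans (last-coord α) (sym h₀)
    ; (suc k) → case k (k ℕ.<? n) }
    where
    case : ∀ k → Dec (k ℕ.< n) → coord (V.init α) k ≡ coord β (suc k)
    case k (yes k<) = trans (init-coord α k k<) (sym (h₁ k k<))
    case k (no k≮) = trans (coord-past (V.init α) k (ℕₚ.≮⇒≥ k≮)) (sym (coord-past β (suc k) (ℕ.s≤s (ℕₚ.≮⇒≥ k≮))))

  coord-rot : (α : Exp (suc n)) (k : ℕ) → k ℕ.< n → coord (rot α) (suc k) ≡ coord α k
  coord-rot α k k< = init-coord α k k<

  opaque
    rotate : Op (suc n)
    rotate = mkOp Φ (λ F d α → F (d ℤ.+ V.last α) (rot α)) λ F p →
      trans (ev-map _ F (λ d α → F (d ℤ.+ V.last α) (rot α)) (+ 1) (λ t → sym (ℤₚ.*-identityˡ _)) p) (ℤₚ.*-identityˡ _)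

    rotate-def : (f : P) → rotate · f ≡ Φ f
    rotate-def f = refl

    rotate-mono : (d : ℤ) (α : Exp (suc n)) → rotate · mono d α ≈ mono (d ℤ.+ coord α n) (rot α)
    rotate-mono d α = mono-cong (cong (λ z → d ℤ.+ z) (last-coord α)) refl

    dual-rotate : ∀ F d α → dual rotate F d α ≡ F (d ℤ.+ coord α n) (rot α)
    dual-rotate F d α = cong (λ z → F (d ℤ.+ z) (rot α)) (last-coord α)

  Lifts : P → P → Set
  Lifts = Intertwines rotate

  private module Rot = Intertwining rotate

  lifts-X : (k : ℕ) (z : ℤ) → k ℕ.< n → Lifts (X k z) (X (suc k) z)
  lifts-X k z k< = op-ext (rotate ⊙ mulBy (X k z)) (mulBy (X (suc k) z) ⊙ rotate) λ d α → begin
    rotate · (X k z * mono d α) ≈⟨ op-cong rotate (X-*-mono k z d α) ⟩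
    rotate · mono d (single k z ⊞ α) ≈⟨ rotate-mono d _ ⟩
    mono (d ℤ.+ coord (single k z ⊞ α) n) (rot (single k z ⊞ α))
      ≈⟨ mono-cong (cong (λ z → d ℤ.+ z) (single-⊞-≢ k n z α n≢k))
        (rot-unique (single k z ⊞ α) (single (suc k) z ⊞ rot α)
        (trans (single-⊞-≢ (suc k) 0 z (rot α) (λ ())) (trans (last-coord α) (sym (single-⊞-≢ k n z α n≢k))))
        (λ j j< → trans (coord-⊞ (single (suc k) z) (rot α) (suc j))
          (trans (cong₂ ℤ._+_ (coord-single-suc j j<) (coord-rot α j j<)) (sym (coord-⊞ (single k z) α j))))) ⟩
    mono (d ℤ.+ coord α n) (single (suc k) z ⊞ rot α) ≈⟨ X-*-mono (suc k) z _ (rot α) ⟨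
    X (suc k) z * mono (d ℤ.+ coord α n) (rot α) ≈⟨ *-congˡ (rotate-mono d α) ⟨
    X (suc k) z * rotate · mono d α ∎
    where
    open ≈-R
    n≢k : n ≢ k
    n≢k = ℕₚ.>⇒≢ k<
    coord-single-suc : ∀ j → j ℕ.< n → coord (single {suc n} (suc k) z) (suc j) ≡ coord (single {suc n} k z) j
    coord-single-suc j j< with j ℕ.≟ k
    ... | yes refl = trans (coord-single {suc n} (suc k) z (ℕ.s≤s k<))
      (sym (coord-single {suc n} k z (ℕₚ.m≤n⇒m≤1+n k<)))
    ... | no ne = trans (coord-single-≢ {suc n} (suc k) (suc j) z (ne ∘ ℕₚ.suc-injective))
      (sym (coord-single-≢ {suc n} k j z ne))

  lifts-h : (φ : ℕ → P) → (∀ k → k ℕ.< n → Lifts (φ k) (φ (suc k))) →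
    (vs : List ℕ) → Allˡ (ℕ._< n) vs → ∀ z → Lifts (h z (map φ vs)) (h z (map φ (map suc vs)))
  lifts-h φ l vs vs< -[1+ m ] = Rot.tw-0
  lifts-h φ l vs vs< (+ m) = go m vs vs<
    where
    go : ∀ m vs → Allˡ (ℕ._< n) vs → Lifts (hℕ m (map φ vs)) (hℕ m (map φ (map suc vs)))
    go zero vs _ = Rot.tw-1
    go (suc m) [] _ = Rot.tw-0
    go (suc m) (v ∷ vs) (v< ∷ vs<) = Rot.tw-+ (Rot.tw-* (l v v<) (go m (v ∷ vs) (v< ∷ vs<))) (go (suc m) vs vs<)

  lifts-E : (N : ℕ) (vs : List ℕ) → N ℕ.< n → Allˡ (ℕ._< n) vs → Lifts (E N vs) (E (suc N) (map suc vs))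
  lifts-E N [] N< [] = Rot.tw-1
  lifts-E N (v ∷ vs) N< (v< ∷ vs<) =
    Rot.tw-* (Rot.tw-+ Rot.tw-1 (Rot.tw-neg (Rot.tw-* (lifts-X v (+ 1) v<) (lifts-X N (ℤ.- + 1) N<))))
    (lifts-E N vs N< vs<)

  rotate-diag : (N : ℕ) (φ φ′ : ℤ → P) → N ℕ.< n → (∀ z → Lifts (φ z) (φ′ z)) → ∀ f →
    rotate · diag N φ · f ≈ diag (suc N) φ′ · rotate · f
  rotate-diag N φ φ′ N< l = op-ext (rotate ⊙ diag N φ) (diag (suc N) φ′ ⊙ rotate) λ d α → begin
    rotate · diag N φ · mono d α ≈⟨ op-cong rotate (diag-mono N φ d α) ⟩
    rotate · (φ (coord α N) * mono d α) ≈⟨ l (coord α N) (mono d α) ⟩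
    φ′ (coord α N) * rotate · mono d α ≈⟨ *-cong (≈-reflexive (cong φ′ (sym (coord-rot α N N<)))) (rotate-mono d α) ⟩
    φ′ (coord (rot α) (suc N)) * mono (d ℤ.+ coord α n) (rot α) ≈⟨ diag-mono (suc N) φ′ _ (rot α) ⟨
    diag (suc N) φ′ · mono (d ℤ.+ coord α n) (rot α) ≈⟨ op-cong (diag (suc N) φ′) (rotate-mono d α) ⟨
    diag (suc N) φ′ · rotate · mono d α ∎
    where open ≈-R

  rotate-T : (vs : List ℕ) → Allˡ (ℕ._< n) vs → ∀ f → rotate · T vs · f ≈ T (map suc vs) · rotate · f
  rotate-T [] [] f = ≈-refl
  rotate-T (N ∷ vs) (N< ∷ vs<) f = begin
    rotate · J N vs · T vs · (E N vs * f)
      ≈⟨ rotate-diag N _ _ N<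
      (λ z → Rot.tw-* (lifts-h x (λ k → lifts-X k (+ 1)) (N ∷ vs) (N< ∷ vs<) z) (lifts-X N (ℤ.- z) N<)) _ ⟩
    J (suc N) (map suc vs) · rotate · T vs · (E N vs * f) ≈⟨ op-cong (J (suc N) (map suc vs)) (rotate-T vs vs< _) ⟩
    J (suc N) (map suc vs) · T (map suc vs) · rotate · (E N vs * f)
      ≈⟨ op-cong (J (suc N) (map suc vs) ⊙ T (map suc vs)) (lifts-E N vs N< vs< f) ⟩
    J (suc N) (map suc vs) · T (map suc vs) · (E (suc N) (map suc vs) * rotate · f) ∎
    where open ≈-R

  lifts-indicator : (b : ℤ → Bool) (z : ℤ) → Lifts (indicator b z) (indicator b z)
  lifts-indicator b z with b z
  ... | true = Rot.tw-1
  ... | false = Rot.tw-0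

  rotate-const : (N : ℕ) → N ℕ.< n → ∀ f → rotate · const N · f ≈ const (suc N) · rotate · f
  rotate-const N N< = rotate-diag N _ _ N< (lifts-indicator isZero)

  rotate-const-last : ∀ f → rotate · const n · f ≈ const 0 · rotate · f
  rotate-const-last = op-ext (rotate ⊙ const n) (const 0 ⊙ rotate) λ d α → begin
    rotate · const n · mono d α ≈⟨ op-cong rotate (diag-mono n _ d α) ⟩
    rotate · (indicator isZero (coord α n) * mono d α) ≈⟨ lifts-indicator isZero (coord α n) (mono d α) ⟩
    indicator isZero (coord α n) * rotate · mono d α
      ≈⟨ *-cong (≈-reflexive (cong (indicator isZero) (sym (last-coord α)))) (rotate-mono d α) ⟩
    indicator isZero (coord (rot α) 0) * mono (d ℤ.+ coord α n) (rot α) ≈⟨ diag-mono 0 _ _ (rot α) ⟨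
    const 0 · mono (d ℤ.+ coord α n) (rot α) ≈⟨ op-cong (const 0) (rotate-mono d α) ⟨
    const 0 · rotate · mono d α ∎
    where open ≈-R

  rotate-π : (i j : Fin n) → toℕ j ≡ suc (toℕ i) → ∀ f → rotate · π i · f ≈ π j · rotate · f
  rotate-π i j adj = op-ext (rotate ⊙ π i) (π j ⊙ rotate) λ d α → mk≈ λ F → begin
    ev F (rotate · π i · mono d α) ≡⟨ spec rotate F (π i · mono d α) ⟩
    ev (dual rotate F) (π i · mono d α) ≡⟨ π-ev i (dual rotate F) d α (∫ (g F d α)) (∫-primitive (g F d α)) ⟩
    ∫ (g F d α) (+ 1 ℤ.+ coord α k) ℤ.- ∫ (g F d α) (coord α (suc k))
      ≡⟨ cong₂ (λ u v → ∫ (g F d α) (+ 1 ℤ.+ u) ℤ.- ∫ (g F d α) v) (c₁ α) (c₂ α) ⟨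
    ∫ (g F d α) (+ 1 ℤ.+ coord (rot α) (toℕ j)) ℤ.- ∫ (g F d α) (coord (rot α) (suc (toℕ j)))
      ≡⟨ π-ev j F (d ℤ.+ coord α n) (rot α) (∫ (g F d α))
        (λ u → trans (∫-primitive (g F d α) u) (cong (λ z → ∫ (g F d α) u ℤ.+ z) (g≡ F d α u))) ⟨
    ev F (π j · mono (d ℤ.+ coord α n) (rot α)) ≡⟨ at (op-cong (π j) (rotate-mono d α)) F ⟨
    ev F (π j · rotate · mono d α) ∎
    where
    open ≡-Reasoning
    k = toℕ i
    sk<n : suc k ℕ.< n
    sk<n = subst (ℕ._< n) adj (toℕ< j)
    k<n : k ℕ.< n
    k<n = toℕ< i
    g : Fun (suc n) → ℤ → Exp (suc n) → ℤ → ℤ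
    g F d α = along i (dual rotate F) d α
    c₁ : ∀ α → coord (rot α) (toℕ j) ≡ coord α k
    c₁ α = trans (cong (coord (rot α)) adj) (coord-rot α k k<n)
    c₂ : ∀ α → coord (rot α) (suc (toℕ j)) ≡ coord α (suc k)
    c₂ α = trans (cong (coord (rot α) ∘ suc) adj) (coord-rot α (suc k) sk<n)
    n≢k : n ≢ k
    n≢k = ℕₚ.>⇒≢ k<n
    n≢sk : n ≢ suc k
    n≢sk = ℕₚ.>⇒≢ sk<n
    rot-set2 : ∀ u v α → rot (set2 i u v α) ≡ set2 j u v (rot α)
    rot-set2 u v α = rot-unique (set2 i u v α) (set2 j u v (rot α))
      (trans (coord-set2-≢ j u v (rot α) 0 (λ e → ℕₚ.0≢1+n (trans e adj)) ℕₚ.0≢1+n)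
        (trans (last-coord α) (sym (coord-set2-≢ i u v α n n≢k n≢sk))))
      (λ m m< → cases m m< (m ℕ.≟ k) (m ℕ.≟ suc k))
      where
      cases : ∀ m → m ℕ.< n → Dec (m ≡ k) → Dec (m ≡ suc k) →
        coord (set2 j u v (rot α)) (suc m) ≡ coord (set2 i u v α) m
      cases m m< (yes refl) _ =
        trans (cong (coord (set2 j u v (rot α))) (sym adj))
        (trans (coord-set2₁ j u v (rot α)) (sym (coord-set2₁ i u v α)))
      cases m m< (no _) (yes refl) =
        trans (cong (coord (set2 j u v (rot α)) ∘ suc) (sym adj))
        (trans (coord-set2₂ j u v (rot α)) (sym (coord-set2₂ i u v α)))
      cases m m< (no p) (no q) = trans (coord-set2-≢ j u v (rot α) (suc m) (λ e → p (ℕₚ.suc-injective (trans e adj)))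
        (λ e → q (ℕₚ.suc-injective (trans e (cong suc adj)))))
          (trans (coord-rot α m m<) (sym (coord-set2-≢ i u v α m p q)))
    g≡ : ∀ F d α u → g F d α u ≡ along j F (d ℤ.+ coord α n) (rot α) u
    g≡ F d α u = trans (dual-rotate F d (set2 i u v α))
      (cong₂ F (cong (λ z → d ℤ.+ z) (coord-set2-≢ i u v α n n≢k n≢sk))
        (trans (rot-set2 u v α) (cong₂ (λ a b → set2 j u (a ℤ.+ b ℤ.- u) (rot α)) (sym (c₁ α)) (sym (c₂ α)))))
      where v = coord α k ℤ.+ coord α (suc k) ℤ.- u

  -- Coefficients in q

  opaque
    coefq : ℕ → Op (suc n)
    coefq m = lin λ d α → if does (d ℤ.≟ + m) then mono (+ 0) α else 0#

    coefq-mono : (m : ℕ) (d : ℤ) (α : Exp (suc n)) →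
      coefq m · mono d α ≈ (if does (d ℤ.≟ + m) then mono (+ 0) α else 0#)
    coefq-mono m = lin-mono λ d α → if does (d ℤ.≟ + m) then mono (+ 0) α else 0#

  coefq-≡ : (m : ℕ) (α : Exp (suc n)) → coefq m · mono (+ m) α ≈ mono (+ 0) α
  coefq-≡ m α = ≈-trans (coefq-mono m (+ m) α)
    (≈-reflexive (cong (if_then mono (+ 0) α else 0#) (dec-true (+ m ℤ.≟ + m) refl)))

  coefq-≢ : (m : ℕ) (d : ℤ) (α : Exp (suc n)) → d ≢ + m → coefq m · mono d α ≈ 0#
  coefq-≢ m d α ne = ≈-trans (coefq-mono m d α)
    (≈-reflexive (cong (if_then mono (+ 0) α else 0#) (dec-false (d ℤ.≟ + m) ne)))

  coefq-X : (m : ℕ) (k : ℕ) (z : ℤ) → Commutes (coefq m) (X k z)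
  coefq-X m k z = op-ext (coefq m ⊙ mulBy (X k z)) (mulBy (X k z) ⊙ coefq m) λ d α → begin
    coefq m · (X k z * mono d α) ≈⟨ op-cong (coefq m) (X-*-mono k z d α) ⟩
    coefq m · mono d (single k z ⊞ α) ≈⟨ coefq-mono m d (single k z ⊞ α) ⟩
    (if does (d ℤ.≟ + m) then mono (+ 0) (single k z ⊞ α) else 0#) ≈⟨ lem (does (d ℤ.≟ + m)) α ⟩
    X k z * (if does (d ℤ.≟ + m) then mono (+ 0) α else 0#) ≈⟨ *-congˡ (coefq-mono m d α) ⟨
    X k z * coefq m · mono d α ∎
    where
    open ≈-R
    lem : ∀ b α → (if b then mono (+ 0) (single k z ⊞ α) else 0#) ≈ X k z * (if b then mono (+ 0) α else 0#)
    lem true α = ≈-sym (X-*-mono k z (+ 0) α)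
    lem false α = ≈-sym (zeroʳ _)

  coefq-π : (m : ℕ) (i : Fin n) → ∀ f → coefq m · π i · f ≈ π i · coefq m · f
  coefq-π m i = op-ext (coefq m ⊙ π i) (π i ⊙ coefq m) λ d α → mk≈ λ F →
    trans (spec (coefq m) F (π i · mono d α)) (lem F d α (d ℤ.≟ + m))
    where
    lem : ∀ F d α → Dec (d ≡ + m) → ev (dual (coefq m) F) (π i · mono d α) ≡ ev F (π i · coefq m · mono d α)
    lem F d α (yes refl) = trans
      (π-local i (dual (coefq m) F) F (+ m) (+ 0) α
        (λ u v → trans (dual-mono (coefq m) F (+ m) _)
        (trans (at (coefq-≡ m (set2 i u v α)) F) (ev-mono F (+ 0) (set2 i u v α)))))
      (sym (at (op-cong (π i) (coefq-≡ m α)) F))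
    lem F d α (no ne) = trans
      (π-local i (dual (coefq m) F) (λ _ _ → + 0) d d α
        (λ u v → trans (dual-mono (coefq m) F d _) (at (coefq-≢ m d (set2 i u v α) ne) F)))
      (trans (ev-0 (π i · mono d α)) (sym (trans (at (op-cong (π i) (coefq-≢ m d α ne)) F) (at (op-0 (π i)) F))))

  -- The coefficient of the a-th power of the last variable
  extract : ℕ → Op (suc n)
  extract a = const n ⊙ mulBy (X n (ℤ.- + a))

  -- The Cauchy sum of `G a b` over a + b = m.
  conv : (ℕ → ℕ → P) → ℕ → P
  conv G zero = G 0 0
  conv G (suc m) = G 0 (suc m) + conv (λ a b → G (suc a) b) m

  conv-cong : {G G′ : ℕ → ℕ → P} → (∀ a b → G a b ≈ G′ a b) → ∀ m → conv G m ≈ conv G′ m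
  conv-cong e zero = e 0 0
  conv-cong e (suc m) = +-cong (e 0 (suc m)) (conv-cong (λ a b → e (suc a) b) m)

  op-conv : (A : Op (suc n)) (G : ℕ → ℕ → P) (m : ℕ) → A · conv G m ≈ conv (λ a b → A · G a b) m
  op-conv A G zero = ≈-refl
  op-conv A G (suc m) = ≈-trans (op-+ A _ _) (+-congˡ (op-conv A (λ a b → G (suc a) b) m))

  conv-0 : (G : ℕ → ℕ → P) (m : ℕ) → (∀ a b → a ℕ.+ b ≡ m → G a b ≈ 0#) → conv G m ≈ 0#
  conv-0 G zero z = z 0 0 refl
  conv-0 G (suc m) z = ≈-trans (+-cong (z 0 (suc m) refl) (conv-0 _ m (λ a b e → z (suc a) b (cong suc e))))
    (+-identityˡ 0#)

  conv-single : (G : ℕ → ℕ → P) (r : P) (a₀ b₀ : ℕ) → G a₀ b₀ ≈ r → (∀ a b → a ≢ a₀ → G a b ≈ 0#) →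
    conv G (a₀ ℕ.+ b₀) ≈ r
  conv-single G r zero zero e z = e
  conv-single G r zero (suc b₀) e z = ≈-trans (+-cong e (conv-0 _ b₀ λ a b _ → z (suc a) b λ ())) (+-identityʳ r)
  conv-single G r (suc a₀) b₀ e z =
    ≈-trans (+-cong (z 0 _ λ ()) (conv-single _ r a₀ b₀ e (λ a b ne → z (suc a) b (ne ∘ ℕₚ.suc-injective))))
    (+-identityˡ r)

  convₒ : (ℕ → ℕ → Op (suc n)) → ℕ → Op (suc n)
  convₒ G zero = G 0 0
  convₒ G (suc m) = G 0 (suc m) ⊕ convₒ (λ a b → G (suc a) b) m

  convₒ-· : (G : ℕ → ℕ → Op (suc n)) (m : ℕ) (f : P) → convₒ G m · f ≡ conv (λ a b → G a b · f) m
  convₒ-· G zero f = refl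
  convₒ-· G (suc m) f = cong (λ g → G 0 (suc m) · f + g) (convₒ-· (λ a b → G (suc a) b) m f)

  NonnegTerm : Term (suc n) → Set
  NonnegTerm t = (+ 0 ℤ.≤ Term.qdeg t) × (∀ k → + 0 ℤ.≤ coord (Term.exp t) k)

  -- Meant for `coefq-rotate`, whose sum has only a ≥ 0: a negative power of x_ℓ would turn into a
  -- negative power of q and be missed.
  op-ext-nonneg : (A B : Op (suc n)) → (∀ d α → NonnegTerm (term (+ 1) d α) → A · mono d α ≈ B · mono d α) →
    ∀ p → Allˡ NonnegTerm p → A · p ≈ B · p
  op-ext-nonneg A B e p ps = mk≈ λ F → trans (spec A F p) (trans (go F p ps) (sym (spec B F p)))
    where
    go : ∀ F p → Allˡ NonnegTerm p → ev (dual A F) p ≡ ev (dual B F) p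
    go F [] [] = refl
    go F (term c d α ∷ p) (q ∷ ps) = cong₂ ℤ._+_
      (cong (c ℤ.*_) (trans (dual-mono A F d α) (trans (at (e d α q) F) (sym (dual-mono B F d α))))) (go F p ps)

  -- Because Φ(x_ℓ^a) = q^a x_1^a, the power q^m arises from q^b present before the rotation and
  -- from the exponent a of x_ℓ, with a + b = m.
  coefq-rotate : (m : ℕ) (p : P) → Allˡ NonnegTerm p →
    coefq m · rotate · p ≈ conv (λ a b → X 0 (+ a) * rotate · extract a · coefq b · p) m
  coefq-rotate m p ps = ≈-trans
    (op-ext-nonneg (coefq m ⊙ rotate) (convₒ G m)
      (λ d α q → ≈-trans (on-mono d α q) (≈-reflexive (sym (convₒ-· G m (mono d α))))) p ps)
    (≈-reflexive (convₒ-· G m p))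
    where
    open ≈-R
    G : ℕ → ℕ → Op (suc n)
    G a b = mulBy (X 0 (+ a)) ⊙ rotate ⊙ extract a ⊙ coefq b
    G-0 : ∀ a b {f} → coefq b · f ≈ 0# → G a b · f ≈ 0#
    G-0 a b e = ≈-trans (op-cong (mulBy (X 0 (+ a)) ⊙ rotate ⊙ extract a) e)
      (op-0 (mulBy (X 0 (+ a)) ⊙ rotate ⊙ extract a))
    extract-mono : ∀ a α → extract a · mono (+ 0) α ≈
      indicator isZero (ℤ.- + a ℤ.+ coord α n) * mono (+ 0) (single n (ℤ.- + a) ⊞ α)
    extract-mono a α = ≈-trans (op-cong (const n) (X-*-mono n _ (+ 0) α))
      (≈-trans (diag-mono n _ (+ 0) (single n (ℤ.- + a) ⊞ α))
      (*-congʳ (≈-reflexive (cong (indicator isZero) (single-⊞ n (ℤ.- + a) α ℕₚ.≤-refl)))))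
    isZero-≢ : ∀ z → z ≢ + 0 → isZero z ≡ false
    isZero-≢ (+ zero) ne = ⊥-elim (ne refl)
    isZero-≢ (+ suc _) ne = refl
    isZero-≢ -[1+ _ ] ne = refl
    on-mono : ∀ d α → NonnegTerm (term (+ 1) d α) → coefq m · rotate · mono d α ≈ conv (λ a b → G a b · mono d α) m
    on-mono -[1+ _ ] α (() , _)
    on-mono (+ e) α (_ , pos) with coord α n in eq
    ... | -[1+ b ] with () ← subst (+ 0 ℤ.≤_) eq (pos n)
    ... | + b = ≈-trans (op-cong (coefq m) (≈-trans (rotate-mono (+ e) α) (mono-cong (cong (λ z → + e ℤ.+ z) eq) refl)))
      (case (b ℕ.+ e ℕ.≟ m))
      where
      G≡ : G b e · mono (+ e) α ≈ mono (+ 0) (rot α)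
      G≡ = begin
        X 0 (+ b) * rotate · extract b · coefq e · mono (+ e) α
          ≈⟨ op-cong (mulBy (X 0 (+ b)) ⊙ rotate) (≈-trans (op-cong (extract b) (coefq-≡ e α)) (extract-mono b α)) ⟩
        X 0 (+ b) * rotate · (indicator isZero (ℤ.- + b ℤ.+ coord α n) * mono (+ 0) β)
          ≈⟨ op-cong (mulBy (X 0 (+ b)) ⊙ rotate)
            (≈-trans (*-congʳ (≈-reflexive
            (cong (indicator isZero) (trans (cong (λ z → ℤ.- + b ℤ.+ z) eq) (ℤₚ.+-inverseˡ (+ b)))))) (*-identityˡ _)) ⟩
        X 0 (+ b) * rotate · mono (+ 0) β ≈⟨ *-congˡ (rotate-mono (+ 0) β) ⟩
        X 0 (+ b) * mono (+ 0 ℤ.+ coord β n) (rot β) ≈⟨ X-*-mono 0 (+ b) _ (rot β) ⟩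
        mono (+ 0 ℤ.+ coord β n) (single 0 (+ b) ⊞ rot β)
          ≈⟨ mono-cong (trans (ℤₚ.+-identityˡ _) βn) (sym (rot-unique α _
            (trans (single-⊞ 0 (+ b) (rot β) (ℕ.s≤s ℕ.z≤n))
              (trans (cong (λ z → + b ℤ.+ z) (trans (last-coord β) βn)) (trans (ℤₚ.+-identityʳ _) (sym eq))))
            (λ k k< → trans (single-⊞-≢ 0 (suc k) (+ b) (rot β) λ ())
              (trans (coord-rot β k k<) (single-⊞-≢ n k _ α λ e → ℕₚ.<-irrefl e k<))))) ⟩
        mono (+ 0) (rot α) ∎
        where
        β : Exp (suc n)
        β = single n (ℤ.- + b) ⊞ α
        βn : coord β n ≡ + 0
        βn = trans (single-⊞ n (ℤ.- + b) α ℕₚ.≤-refl) (trans (cong (λ z → ℤ.- + b ℤ.+ z) eq) (ℤₚ.+-inverseˡ (+ b)))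
      extract-≢ : ∀ a → a ≢ b → extract a · mono (+ 0) α ≈ 0#
      extract-≢ a ne = ≈-trans (extract-mono a α)
        (≈-trans (*-congʳ (≈-reflexive (cong (if_then 1# else 0#) (isZero-≢ _ λ z → ne (sym (ℤₚ.+-injective
        (trans (sym eq) (trans (trans (lem (+ a) (coord α n)) (cong (λ w → + a ℤ.+ w) z)) (ℤₚ.+-identityʳ (+ a))))))))))
          (zeroˡ _))
        where lem : ∀ a c → c ≡ a ℤ.+ (ℤ.- a ℤ.+ c)
              lem = solve-∀
      G-≢ : ∀ a c → a ≢ b → G a c · mono (+ e) α ≈ 0#
      G-≢ a c ne with c ℕ.≟ e
      ... | no c≢e = G-0 a c (coefq-≢ c (+ e) α (c≢e ∘ sym ∘ ℤₚ.+-injective))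
      ... | yes refl = ≈-trans
        (op-cong (mulBy (X 0 (+ a)) ⊙ rotate) (≈-trans (op-cong (extract a) (coefq-≡ c α)) (extract-≢ a ne)))
        (op-0 (mulBy (X 0 (+ a)) ⊙ rotate))
      case : Dec (b ℕ.+ e ≡ m) → coefq m · mono (+ e ℤ.+ + b) (rot α) ≈ conv (λ a b → G a b · mono (+ e) α) m
      case (yes refl) = ≈-trans
        (≈-trans (op-cong (coefq m) (mono-cong (cong +_ (ℕₚ.+-comm e b)) refl)) (coefq-≡ m (rot α)))
        (≈-sym (conv-single _ _ b e G≡ G-≢))
      case (no ne) = ≈-trans (coefq-≢ m _ (rot α) (λ q → ne (trans (ℕₚ.+-comm b e) (ℤₚ.+-injective q))))
        (≈-sym (conv-0 _ m vanish))
        where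
        vanish : ∀ a c → a ℕ.+ c ≡ m → G a c · mono (+ e) α ≈ 0#
        vanish a c s with a ℕ.≟ b
        ... | no a≢b = G-≢ a c a≢b
        ... | yes refl = G-0 a c (coefq-≢ c (+ e) α λ q → ne (trans (cong (a ℕ.+_) (ℤₚ.+-injective q)) s))

  -- For p ≥ 0 the operator π_{ℓ-1} sends x_{ℓ-1}^p to h_p(x_{ℓ-1}, x_ℓ), where x_ℓ^a has the
  -- coefficient x_{ℓ-1}^{p-a} if a ≤ p and none otherwise. For p < 0 every exponent of x_ℓ in the
  -- result is negative, and both sides vanish.
  extract-π : (i : Fin n) → suc (toℕ i) ≡ n → ∀ a f →
    extract a · π i · const n · f ≈ nonneg (toℕ i) · (X (toℕ i) (ℤ.- + a) * const n · f)
  extract-π i last a = op-ext (extract a ⊙ π i ⊙ const n)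
    (nonneg (toℕ i) ⊙ mulBy (X (toℕ i) (ℤ.- + a)) ⊙ const n) on-mono
    where
    k = toℕ i
    k< : k ℕ.< suc n
    k< = ℕₚ.m≤n⇒m≤1+n (toℕ< i)
    n≢k : n ≢ k
    n≢k = ℕₚ.>⇒≢ (toℕ< i)
    const-mono : ∀ d α → coord α n ≡ + 0 → const n · mono d α ≈ mono d α
    const-mono d α z = ≈-trans (diag-mono n _ d α)
      (≈-trans (*-congʳ (≈-reflexive (cong (indicator isZero) z))) (*-identityˡ _))
    const-0 : ∀ d α → indicator isZero (coord α n) ≡ 0# → const n · mono d α ≈ 0#
    const-0 d α z = ≈-trans (diag-mono n _ d α) (≈-trans (*-congʳ (≈-reflexive z)) (zeroˡ _))
    both-0 : ∀ {f} → f ≈ 0# → extract a · π i · f ≈ nonneg k · (X k (ℤ.- + a) * f)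
    both-0 e = ≈-trans (op-cong (extract a ⊙ π i) e) (≈-trans (op-0 (extract a ⊙ π i)) (≈-sym
      (≈-trans (op-cong (nonneg k ⊙ mulBy (X k (ℤ.- + a))) e) (op-0 (nonneg k ⊙ mulBy (X k (ℤ.- + a)))))))
    main : ∀ d α → coord α n ≡ + 0 → extract a · π i · mono d α ≈ nonneg k · (X k (ℤ.- + a) * mono d α)
    main d α z = mk≈ λ F →
      -- The string contains one point with exponent a at x_ℓ; `c` is the exponent of x_{ℓ-1} at
      -- that point.
      let c = coord α k ℤ.- + a
          val = F d (single k (ℤ.- + a) ⊞ α)
          F′ = dual (extract a) F
          g≡ : ∀ u → along i F′ d α u ≡ (if isZero (u ℤ.- c) then val else + 0)
          g≡ u = let v = coord α k ℤ.+ coord α (suc k) ℤ.- u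
                     β = set2 i u v α
                     e : ℤ.- + a ℤ.+ coord β n ≡ ℤ.- (u ℤ.- c)
                     e = trans (cong (λ w → ℤ.- + a ℤ.+ w)
                       (trans (cong (coord β) (sym last)) (trans (coord-set2₂ i u v α)
                          (cong (λ w → coord α k ℤ.+ w ℤ.- u) (trans (cong (coord α) last) z)))))
                            (lem₁ (+ a) (coord α k) u)
                 in begin
            F′ d β ≡⟨ dual-mono (extract a) F d β ⟩
            ev F (extract a · mono d β) ≡⟨ at (≈-trans (op-cong (const n) (X-*-mono n _ d β)) (diag-mono n _ d _)) F ⟩
            ev F (indicator isZero (coord (single n (ℤ.- + a) ⊞ β) n) * mono d (single n (ℤ.- + a) ⊞ β))
              ≡⟨ cong (λ w → ev F (indicator isZero w * mono d (single n (ℤ.- + a) ⊞ β)))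
                (trans (single-⊞ n (ℤ.- + a) β ℕₚ.≤-refl) e) ⟩
            ev F (indicator isZero (ℤ.- (u ℤ.- c)) * mono d (single n (ℤ.- + a) ⊞ β))
              ≡⟨ value F d α (u ℤ.- c) β
                (λ q → target α z u v (trans (lem₂ u c) (trans (cong (ℤ._+ c) q) (ℤₚ.+-identityˡ c))) refl) ⟩
            (if isZero (u ℤ.- c) then val else + 0) ∎
          H : ℤ → ℤ
          H u = heaviside val (u ℤ.- c)
      in begin
        ev F (extract a · π i · mono d α) ≡⟨ spec (extract a) F (π i · mono d α) ⟩
        ev F′ (π i · mono d α) ≡⟨ π-ev i F′ d α H
          (λ u → trans (cong (heaviside val) (ℤₚ.+-assoc (+ 1) u (ℤ.- c)))
          (trans (heaviside-primitive val (u ℤ.- c)) (cong (λ w → H u ℤ.+ w) (sym (g≡ u))))) ⟩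
        H (+ 1 ℤ.+ coord α k) ℤ.- H (coord α (suc k))
          ≡⟨ cong₂ (λ u v → heaviside val u ℤ.- heaviside val v) (lem₃ (coord α k) (+ a))
          (trans (cong (ℤ._- c) (trans (cong (coord α) last) z)) (ℤₚ.+-identityˡ _)) ⟩
        val ℤ.- heaviside val (ℤ.- c) ≡⟨ final val c ⟩
        (if isNonneg c then val else + 0)
          ≡⟨ cong (λ w → if isNonneg w then val else + 0)
          (trans (ℤₚ.+-comm (coord α k) (ℤ.- + a)) (sym (single-⊞ k (ℤ.- + a) α k<))) ⟩
        (if isNonneg (coord (single k (ℤ.- + a) ⊞ α) k) then val else + 0)
          ≡⟨ ev-indicator F isNonneg (coord (single k (ℤ.- + a) ⊞ α) k) d _ ⟨
        ev F (indicator isNonneg (coord (single k (ℤ.- + a) ⊞ α) k) * mono d (single k (ℤ.- + a) ⊞ α))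
          ≡⟨ at (≈-trans (op-cong (nonneg k) (X-*-mono k _ d α)) (diag-mono k _ d _)) F ⟨
        ev F (nonneg k · (X k (ℤ.- + a) * mono d α)) ∎
      where
      open ≡-Reasoning
      lem₁ : ∀ a p u → ℤ.- a ℤ.+ (p ℤ.+ + 0 ℤ.- u) ≡ ℤ.- (u ℤ.- (p ℤ.- a))
      lem₁ = solve-∀
      lem₂ : ∀ u c → u ≡ u ℤ.- c ℤ.+ c
      lem₂ = solve-∀
      lem₃ : ∀ p a → + 1 ℤ.+ p ℤ.- (p ℤ.- a) ≡ + 1 ℤ.+ a
      lem₃ = solve-∀
      lem₄ : ∀ p a → p ℤ.+ + 0 ℤ.- (p ℤ.- a) ≡ a
      lem₄ = solve-∀
      ev-indicator : ∀ F (b : ℤ → Bool) w d β → ev F (indicator b w * mono d β) ≡ (if b w then F d β else + 0)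
      ev-indicator F b w d β with b w
      ... | true = trans (at (*-identityˡ (mono d β)) F) (ev-mono F d β)
      ... | false = at (zeroˡ (mono d β)) F
      target : ∀ α → coord α n ≡ + 0 → ∀ u v → u ≡ coord α k ℤ.- + a → v ≡ coord α k ℤ.+ coord α (suc k) ℤ.- u →
        single n (ℤ.- + a) ⊞ set2 i u v α ≡ single k (ℤ.- + a) ⊞ α
      target α z u v refl refl = coord-ext _ _ λ j → cases j (j ℕ.≟ k) (j ℕ.≟ n)
        where
        β = set2 i u v α
        cases : ∀ j → Dec (j ≡ k) → Dec (j ≡ n) → coord (single n (ℤ.- + a) ⊞ β) j ≡ coord (single k (ℤ.- + a) ⊞ α) j
        cases j (yes refl) _ = trans (single-⊞-≢ n k _ β (n≢k ∘ sym))
          (trans (coord-set2₁ i u v α) (trans (ℤₚ.+-comm (coord α k) (ℤ.- + a)) (sym (single-⊞ k _ α k<))))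
        cases j (no _) (yes refl) =
          trans (single-⊞ n _ β ℕₚ.≤-refl)
          (trans (cong (λ w → ℤ.- + a ℤ.+ w) (trans (cong (coord β) (sym last)) (trans (coord-set2₂ i u v α)
          (trans (cong (λ w → coord α k ℤ.+ w ℤ.- u) (trans (cong (coord α) last) z)) (lem₄ (coord α k) (+ a))))))
          (trans (ℤₚ.+-inverseˡ (+ a)) (sym (trans (single-⊞-≢ k n _ α n≢k) z))))
        cases j (no p) (no q) =
          trans (single-⊞-≢ n j _ β q)
          (trans (coord-set2-≢ i u v α j p (λ e → q (trans e last))) (sym (single-⊞-≢ k j _ α p)))
      value : ∀ F d α w β → (w ≡ + 0 → single n (ℤ.- + a) ⊞ β ≡ single k (ℤ.- + a) ⊞ α) →
        ev F (indicator isZero (ℤ.- w) * mono d (single n (ℤ.- + a) ⊞ β)) ≡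
          (if isZero w then F d (single k (ℤ.- + a) ⊞ α) else + 0)
      value F d α (+ zero) β t = trans (ev-indicator F isZero (+ 0) d _) (cong (F d) (t refl))
      value F d α (+ suc m) β t = ev-indicator F isZero -[1+ m ] d _
      value F d α -[1+ m ] β t = ev-indicator F isZero (+ suc m) d _
      final : ∀ v c → v ℤ.- heaviside v (ℤ.- c) ≡ (if isNonneg c then v else + 0)
      final v (+ zero) = ℤₚ.+-identityʳ v
      final v (+ suc m) = ℤₚ.+-identityʳ v
      final v -[1+ m ] = ℤₚ.+-inverseʳ v
    on-mono : ∀ d α → extract a · π i · const n · mono d α ≈ nonneg k · (X k (ℤ.- + a) * const n · mono d α)
    on-mono d α with coord α n in eq
    ... | + zero = ≈-trans (op-cong (extract a ⊙ π i) (const-mono d α eq))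
      (≈-trans (main d α eq) (op-cong (nonneg k ⊙ mulBy (X k (ℤ.- + a))) (≈-sym (const-mono d α eq))))
    ... | + suc b = both-0 (const-0 d α (cong (indicator isZero) eq))
    ... | -[1+ b ] = both-0 (const-0 d α (cong (indicator isZero) eq))

-- Cycles and symmetrisers.

-- The numbers N-1, ..., δ. They are read both as 0-based letters of a cycle and as 0-based indices
-- of the inverse variables of a row.
gens : ℕ → ℕ → List ℕ
gens δ N = filter (δ ℕ.≤?_) (downFrom N)

gens-∷ : (δ N : ℕ) → δ ℕ.≤ N → gens δ (suc N) ≡ N ∷ gens δ N
gens-∷ δ N = Listₚ.filter-accept (δ ℕ.≤?_)

gens-[] : (δ N : ℕ) → N ℕ.≤ δ → gens δ N ≡ []
gens-[] δ zero _ = refl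
gens-[] δ (suc N) N<δ = trans (Listₚ.filter-reject (δ ℕ.≤?_) (ℕₚ.<⇒≱ N<δ)) (gens-[] δ N (ℕₚ.<⇒≤ N<δ))

downFrom-< : (N : ℕ) → Allˡ (ℕ._< N) (downFrom N)
downFrom-< zero = []
downFrom-< (suc N) = ℕₚ.≤-refl ∷ Allˡ.map ℕₚ.m≤n⇒m≤1+n (downFrom-< N)

gens-bounds : (δ N : ℕ) → Allˡ (λ j → (δ ℕ.≤ j) × (j ℕ.< N)) (gens δ N)
gens-bounds δ N = Allˡ.zip (Allₚ.all-filter (δ ℕ.≤?_) (downFrom N) , Allₚ.filter⁺ (δ ℕ.≤?_) (downFrom-< N))

gens-suc : (δ N : ℕ) → map suc (gens δ N) ≡ gens (suc δ) (suc N)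
gens-suc δ zero = refl
gens-suc δ (suc N) with δ ℕ.≤? N
... | yes δ≤N = trans (cong (map suc) (gens-∷ δ N δ≤N))
  (trans (cong (suc N ∷_) (gens-suc δ N)) (sym (gens-∷ (suc δ) (suc N) (ℕ.s≤s δ≤N))))
... | no δ≰N = trans (cong (map suc) (gens-[] δ (suc N) (ℕₚ.≰⇒> δ≰N)))
  (sym (gens-[] (suc δ) (suc (suc N)) (ℕ.s≤s (ℕₚ.≰⇒> δ≰N))))

module _ {n : ℕ} where
  open LaurentRing (suc n)
  open Operators {suc n}
  open Variables {suc n}
  open PolySolver (suc n) using (solve; _:+_; _:*_; :-_; _:-_; con; _:=_)

  private
    P : Set
    P = Poly (suc n)

  -- The identity for k ≥ n.
  πℕ : ℕ → Op (suc n)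
  πℕ k with k ℕ.<? n
  ... | yes k<n = π (fromℕ< k<n)
  ... | no _ = idₒ

  asFin : (k : ℕ) → k ℕ.< n → Σ[ i ∈ Fin n ] (toℕ i ≡ k) × (πℕ k ≡ π i)
  asFin k k<n with k ℕ.<? n
  ... | yes p = fromℕ< p , Finₚ.toℕ-fromℕ< p , refl
  ... | no np = ⊥-elim (np k<n)

  πℕ-toℕ : (i : Fin n) → πℕ (toℕ i) ≡ π i
  πℕ-toℕ i with asFin (toℕ i) (toℕ< i)
  ... | j , e , q = trans q (cong π (Finₚ.toℕ-injective e))

  πℕ-idem : (k : ℕ) → k ℕ.< n → ∀ f → πℕ k · πℕ k · f ≈ πℕ k · f
  πℕ-idem k k< f with asFin k k<
  ... | i , _ , q rewrite q = π-idem i f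

  πℕ-comm : (k l : ℕ) → suc k ℕ.< l → l ℕ.< n → ∀ f → πℕ k · πℕ l · f ≈ πℕ l · πℕ k · f
  πℕ-comm k l far l< f with asFin k (ℕₚ.<-trans (ℕₚ.<-trans (ℕₚ.n<1+n k) far) l<) | asFin l l<
  ... | i , refl , q | j , refl , q′ rewrite q | q′ = π-comm i j far f

  πℕ-braid : (k : ℕ) → suc k ℕ.< n → ∀ f → πℕ k · πℕ (suc k) · πℕ k · f ≈ πℕ (suc k) · πℕ k · πℕ (suc k) · f
  πℕ-braid k k< f with asFin k (ℕₚ.<-trans (ℕₚ.n<1+n k) k<) | asFin (suc k) k<
  ... | i , e , q | j , e′ , q′ rewrite q | q′ = π-braid i j (trans e′ (cong suc (sym e))) f

  πℕ-X : (k j : ℕ) (z : ℤ) → k ℕ.< n → j ≢ k → j ≢ suc k → Commutes (πℕ k) (X j z)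
  πℕ-X k j z k< p p′ f with asFin k k<
  ... | i , refl , q rewrite q = π-x₃ i j z p p′ f

  πℕ-x⁻₂ : (k : ℕ) → k ℕ.< n → ∀ f → πℕ k · (x⁻ (suc k) * f) ≈ x⁻ k * πℕ k · f + x⁻ (suc k) * f
  πℕ-x⁻₂ k k< f with asFin k k<
  ... | i , refl , q rewrite q = Symmetric.π-x⁻₂ i f

  πℕ-sym : (k : ℕ) → k ℕ.< n → ∀ {r} → πℕ k · r ≈ r → Commutes (πℕ k) r
  πℕ-sym k k< e f with asFin k k<
  ... | i , refl , q rewrite q = π-sym i e f

  πℕ-indicator : (k N : ℕ) (b : ℤ → Bool) → k ℕ.< n → N ≢ k → N ≢ suc k → ∀ f →
    diag N (indicator b) · πℕ k · f ≈ πℕ k · diag N (indicator b) · f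
  πℕ-indicator k N b k< p p′ f with asFin k k<
  ... | i , refl , q rewrite q = Symmetric.π-diag i N (indicator b) p p′ (λ z → sym-ind z) f
    where sym-ind : ∀ z → Sym i (indicator b z)
          sym-ind z with b z
          ... | true = Symmetric.sym-1 i
          ... | false = Symmetric.sym-0 i

  πℕ-T : (k N : ℕ) → suc k ℕ.< N → N ℕ.≤ suc n → ∀ f → T (range 0 N) · πℕ k · f ≈ πℕ k · T (range 0 N) · f
  πℕ-T k N k< N≤ f rewrite range-downFrom N with asFin k (ℕₚ.≤-pred (ℕₚ.≤-trans k< N≤))
  ... | i , refl , q rewrite q = Symmetric.commutesT-downFrom i N k< f

  πℕ-rotate : (k : ℕ) → suc k ℕ.< n → ∀ f → rotate · πℕ k · f ≈ πℕ (suc k) · rotate · f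
  πℕ-rotate k k< f with asFin k (ℕₚ.<-trans (ℕₚ.n<1+n k) k<) | asFin (suc k) k<
  ... | i , e , q | j , e′ , q′ rewrite q | q′ = rotate-π i j (trans e′ (cong suc (sym e))) f

  πs : List ℕ → Op (suc n)
  πs [] = idₒ
  πs (k ∷ ks) = πℕ k ⊙ πs ks

  πs-commute : (A : Op (suc n)) (ks : List ℕ) →
    Allˡ (λ k → ∀ f → A · πℕ k · f ≈ πℕ k · A · f) ks → ∀ f → A · πs ks · f ≈ πs ks · A · f
  πs-commute A [] [] f = ≈-refl
  πs-commute A (k ∷ ks) (c ∷ cs) f = ≈-trans (c (πs ks · f)) (op-cong (πℕ k) (πs-commute A ks cs f))

  πs-absorb : (A : Op (suc n)) (ks : List ℕ) → Allˡ (λ k → ∀ f → A · πℕ k · f ≈ A · f) ks → ∀ f → A · πs ks · f ≈ A · f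
  πs-absorb A [] [] f = ≈-refl
  πs-absorb A (k ∷ ks) (c ∷ cs) f = ≈-trans (c (πs ks · f)) (πs-absorb A ks cs f)

  πs-fix : (ks : List ℕ) {f : P} → Allˡ (λ k → πℕ k · f ≈ f) ks → πs ks · f ≈ f
  πs-fix [] [] = ≈-refl
  πs-fix (k ∷ ks) (c ∷ cs) = ≈-trans (op-cong (πℕ k) (πs-fix ks cs)) c

  cycle : ℕ → ℕ → Op (suc n)
  cycle δ N = πs (gens δ N)

  cycle-∷ : (δ N : ℕ) → δ ℕ.≤ N → ∀ f → cycle δ (suc N) · f ≡ πℕ N · cycle δ N · f
  cycle-∷ δ N δ≤N f = cong (λ ks → πs ks · f) (gens-∷ δ N δ≤N)

  cycle-[] : (δ N : ℕ) → N ℕ.≤ δ → ∀ f → cycle δ N · f ≡ f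
  cycle-[] δ N N≤δ f = cong (λ ks → πs ks · f) (gens-[] δ N N≤δ)

  private
    gens-All : (Q : ℕ → Set) (δ N : ℕ) → (∀ j → δ ℕ.≤ j → j ℕ.< N → Q j) → Allˡ Q (gens δ N)
    gens-All Q δ N q = Allˡ.map (λ {j} (l , u) → q j l u) (gens-bounds δ N)

  cycle-last : (δ N : ℕ) → δ ℕ.< N → N ℕ.≤ n → ∀ f → cycle δ N · πℕ δ · f ≈ cycle δ N · f
  cycle-last δ (suc M) δ<N N≤ f with δ ℕ.≟ M
  ... | yes refl = begin
    cycle δ (suc δ) · πℕ δ · f ≡⟨ cycle-∷ δ δ ℕₚ.≤-refl _ ⟩
    πℕ δ · cycle δ δ · πℕ δ · f ≡⟨ cong (πℕ δ ·_) (cycle-[] δ δ ℕₚ.≤-refl _) ⟩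
    πℕ δ · πℕ δ · f ≈⟨ πℕ-idem δ N≤ f ⟩
    πℕ δ · f ≡⟨ cong (πℕ δ ·_) (cycle-[] δ δ ℕₚ.≤-refl _) ⟨
    πℕ δ · cycle δ δ · f ≡⟨ cycle-∷ δ δ ℕₚ.≤-refl _ ⟨
    cycle δ (suc δ) · f ∎
    where open ≈-R
  ... | no δ≢M = begin
    cycle δ (suc M) · πℕ δ · f ≡⟨ cycle-∷ δ M (ℕₚ.≤-pred δ<N) _ ⟩
    πℕ M · cycle δ M · πℕ δ · f ≈⟨ op-cong (πℕ M) (cycle-last δ M (ℕₚ.≤∧≢⇒< (ℕₚ.≤-pred δ<N) δ≢M) (ℕₚ.<⇒≤ N≤) f) ⟩
    πℕ M · cycle δ M · f ≡⟨ cycle-∷ δ M (ℕₚ.≤-pred δ<N) _ ⟨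
    cycle δ (suc M) · f ∎
    where open ≈-R

  -- The letter i+1 commutes with the letters below i, a single braid move at i+1, i turns it into
  -- i, and that commutes with the letters above i+1.
  cycle-shift : (δ N i : ℕ) → δ ℕ.≤ i → suc i ℕ.< N → N ℕ.≤ n → ∀ f → cycle δ N · πℕ (suc i) · f ≈ πℕ i · cycle δ N · f
  cycle-shift δ (suc M) i δ≤i i<M N≤ f with suc i ℕ.≟ M
  ... | yes refl = begin
    cycle δ (suc (suc i)) · πℕ (suc i) · f ≡⟨ unfold _ ⟩
    πℕ (suc i) · πℕ i · cycle δ i · πℕ (suc i) · f
      ≈⟨ op-cong (πℕ (suc i) ⊙ πℕ i)
        (πs-commute (πℕ (suc i)) (gens δ i)
        (gens-All _ δ i λ j _ j<i g → ≈-sym (πℕ-comm j (suc i) (ℕ.s≤s j<i) N≤ g)) f) ⟨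
    πℕ (suc i) · πℕ i · πℕ (suc i) · cycle δ i · f ≈⟨ πℕ-braid i N≤ _ ⟨
    πℕ i · πℕ (suc i) · πℕ i · cycle δ i · f ≡⟨ cong (πℕ i ·_) (unfold _) ⟨
    πℕ i · cycle δ (suc (suc i)) · f ∎
    where open ≈-R
          unfold : ∀ g → cycle δ (suc (suc i)) · g ≡ πℕ (suc i) · πℕ i · cycle δ i · g
          unfold g = trans (cycle-∷ δ (suc i) (ℕₚ.m≤n⇒m≤1+n δ≤i) g) (cong (πℕ (suc i) ·_) (cycle-∷ δ i δ≤i g))
  ... | no ne = begin
    cycle δ (suc M) · πℕ (suc i) · f ≡⟨ cycle-∷ δ M δ≤M _ ⟩
    πℕ M · cycle δ M · πℕ (suc i) · f ≈⟨ op-cong (πℕ M) (cycle-shift δ M i δ≤i si<M (ℕₚ.<⇒≤ N≤) f) ⟩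
    πℕ M · πℕ i · cycle δ M · f ≈⟨ πℕ-comm i M si<M N≤ _ ⟨
    πℕ i · πℕ M · cycle δ M · f ≡⟨ cong (πℕ i ·_) (cycle-∷ δ M δ≤M _) ⟨
    πℕ i · cycle δ (suc M) · f ∎
    where open ≈-R
          si<M : suc i ℕ.< M
          si<M = ℕₚ.≤∧≢⇒< (ℕₚ.≤-pred i<M) ne
          δ≤M : δ ℕ.≤ M
          δ≤M = ℕₚ.≤-trans (ℕₚ.m≤n⇒m≤1+n δ≤i) (ℕₚ.<⇒≤ si<M)

  -- The Demazure operator of the longest element permuting the variables δ, …, N - 1
  symm : ℕ → ℕ → Op (suc n)
  symm δ zero = idₒ
  symm δ (suc N) = symm δ N ⊙ cycle δ N

  symm-id : (δ N : ℕ) → N ℕ.≤ suc δ → ∀ f → symm δ N · f ≡ f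
  symm-id δ zero _ f = refl
  symm-id δ (suc N) (ℕ.s≤s N≤δ) f = trans (cong (symm δ N ·_) (cycle-[] δ N N≤δ f)) (symm-id δ N (ℕₚ.m≤n⇒m≤1+n N≤δ) f)

  -- The letter δ is absorbed by the end of the last cycle. Any other letter passes through that
  -- cycle, drops by one, and meets the smaller symmetriser.
  symm-absorbʳ : (δ N i : ℕ) → δ ℕ.≤ i → suc i ℕ.< N → N ℕ.≤ suc n → ∀ f → symm δ N · πℕ i · f ≈ symm δ N · f
  symm-absorbʳ δ (suc M) i δ≤i (ℕ.s≤s i<M) (ℕ.s≤s M≤n) f with δ ℕ.≟ i
  ... | yes refl = op-cong (symm δ M) (cycle-last δ M i<M M≤n f)
  symm-absorbʳ δ (suc M) zero δ≤i (ℕ.s≤s i<M) (ℕ.s≤s M≤n) f | no ne = ⊥-elim (ne (ℕₚ.n≤0⇒n≡0 δ≤i))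
  symm-absorbʳ δ (suc M) (suc i) δ≤i (ℕ.s≤s i<M) (ℕ.s≤s M≤n) f | no ne =
    ≈-trans (op-cong (symm δ M) (cycle-shift δ M i δ≤i′ i<M M≤n f))
      (symm-absorbʳ δ M i δ≤i′ i<M (ℕₚ.m≤n⇒m≤1+n M≤n) (cycle δ M · f))
    where δ≤i′ : δ ℕ.≤ i
          δ≤i′ = ℕₚ.≤-pred (ℕₚ.≤∧≢⇒< δ≤i ne)

  symm-commute : (A : Op (suc n)) (δ N : ℕ) → (∀ j → δ ℕ.≤ j → suc j ℕ.< N → ∀ f → A · πℕ j · f ≈ πℕ j · A · f) →
    ∀ f → A · symm δ N · f ≈ symm δ N · A · f
  symm-commute A δ zero c f = ≈-refl
  symm-commute A δ (suc N) c f = ≈-trans (symm-commute A δ N (λ j δ≤j j< → c j δ≤j (ℕₚ.m≤n⇒m≤1+n j<)) (cycle δ N · f))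
    (op-cong (symm δ N) (πs-commute A (gens δ N) (gens-All _ δ N λ j δ≤j j<N → c j δ≤j (ℕ.s≤s j<N)) f))

  symm-absorbed : (A : Op (suc n)) (δ N : ℕ) → (∀ j → δ ℕ.≤ j → suc j ℕ.< N → ∀ f → A · πℕ j · f ≈ A · f) →
    ∀ f → A · symm δ N · f ≈ A · f
  symm-absorbed A δ zero c f = ≈-refl
  symm-absorbed A δ (suc N) c f = ≈-trans (symm-absorbed A δ N (λ j δ≤j j< → c j δ≤j (ℕₚ.m≤n⇒m≤1+n j<)) (cycle δ N · f))
    (πs-absorb A (gens δ N) (gens-All _ δ N λ j δ≤j j<N → c j δ≤j (ℕ.s≤s j<N)) f)

  symm-fix : (δ N : ℕ) {f : P} → (∀ j → δ ℕ.≤ j → suc j ℕ.< N → πℕ j · f ≈ f) → symm δ N · f ≈ f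
  symm-fix δ zero c = ≈-refl
  symm-fix δ (suc N) c = ≈-trans
    (op-cong (symm δ N) (πs-fix (gens δ N) (gens-All _ δ N λ j δ≤j j<N → c j δ≤j (ℕ.s≤s j<N))))
    (symm-fix δ N (λ j δ≤j j< → c j δ≤j (ℕₚ.m≤n⇒m≤1+n j<)))

  private
    -- Every letter of the second cycle except δ passes through the first one and drops by one; the
    -- final δ is absorbed.
    cycle-cycle : (δ i : ℕ) → δ ℕ.≤ i → suc i ℕ.≤ n → ∀ M → δ ℕ.≤ M → M ℕ.≤ i → ∀ f →
      cycle δ (suc i) · cycle δ (suc M) · f ≈ cycle δ M · cycle δ (suc i) · f
    cycle-cycle δ i δ≤i i<n M δ≤M M≤i f with δ ℕ.≟ M
    ... | yes refl = begin
      cycle δ (suc i) · cycle δ (suc δ) · f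
        ≡⟨ cong (cycle δ (suc i) ·_) (trans (cycle-∷ δ δ ℕₚ.≤-refl f) (cong (πℕ δ ·_) (cycle-[] δ δ ℕₚ.≤-refl f))) ⟩
      cycle δ (suc i) · πℕ δ · f ≈⟨ cycle-last δ (suc i) (ℕ.s≤s δ≤i) i<n f ⟩
      cycle δ (suc i) · f ≡⟨ cycle-[] δ δ ℕₚ.≤-refl _ ⟨
      cycle δ δ · cycle δ (suc i) · f ∎
      where open ≈-R
    cycle-cycle δ i δ≤i i<n zero δ≤M M≤i f | no ne = ⊥-elim (ne (ℕₚ.n≤0⇒n≡0 δ≤M))
    cycle-cycle δ i δ≤i i<n (suc M) δ≤M M≤i f | no ne = begin
      cycle δ (suc i) · cycle δ (suc (suc M)) · f ≡⟨ cong (cycle δ (suc i) ·_) (cycle-∷ δ (suc M) δ≤M f) ⟩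
      cycle δ (suc i) · πℕ (suc M) · cycle δ (suc M) · f ≈⟨ cycle-shift δ (suc i) M δ≤M′ (ℕ.s≤s M≤i) i<n _ ⟩
      πℕ M · cycle δ (suc i) · cycle δ (suc M) · f ≈⟨ op-cong (πℕ M) (cycle-cycle δ i δ≤i i<n M δ≤M′ (ℕₚ.<⇒≤ M≤i) f) ⟩
      πℕ M · cycle δ M · cycle δ (suc i) · f ≡⟨ cycle-∷ δ M δ≤M′ _ ⟨
      cycle δ (suc M) · cycle δ (suc i) · f ∎
      where open ≈-R
            δ≤M′ : δ ℕ.≤ M
            δ≤M′ = ℕₚ.≤-pred (ℕₚ.≤∧≢⇒< δ≤M ne)

  -- Smaller letters are left to the smaller symmetriser. The top letter commutes down to the two
  -- outermost cycles and lengthens the first of them; `cycle-cycle` makes the two equal cycles so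
  -- obtained collapse to the original pair.
  symm-absorbˡ : (δ N i : ℕ) → δ ℕ.≤ i → suc i ℕ.< N → N ℕ.≤ suc n → ∀ f → πℕ i · symm δ N · f ≈ symm δ N · f
  symm-absorbˡ δ (suc M) i δ≤i (ℕ.s≤s i<M) (ℕ.s≤s M≤n) f with suc i ℕ.≟ M
  ... | no ne = symm-absorbˡ δ M i δ≤i (ℕₚ.≤∧≢⇒< i<M ne) (ℕₚ.m≤n⇒m≤1+n M≤n) (cycle δ M · f)
  ... | yes refl = begin
    πℕ i · symm δ i · cycle δ i · cycle δ (suc i) · f
      ≈⟨ symm-commute (πℕ i) δ i (λ j _ j< g → ≈-sym (πℕ-comm j i j< M≤n g)) _ ⟩
    symm δ i · πℕ i · cycle δ i · cycle δ (suc i) · f ≡⟨ cong (symm δ i ·_) (cycle-∷ δ i δ≤i _) ⟨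
    symm δ i · cycle δ (suc i) · cycle δ (suc i) · f ≈⟨ op-cong (symm δ i) (cycle-cycle δ i δ≤i M≤n i δ≤i ℕₚ.≤-refl f) ⟩
    symm δ i · cycle δ i · cycle δ (suc i) · f ∎
    where open ≈-R

  invs : List ℕ → List P
  invs = map x⁻

  X⁻-suc : (k a : ℕ) (f : P) → X k (ℤ.- + suc a) * f ≈ x⁻ k * (X k (ℤ.- + a) * f)
  X⁻-suc k a f = ≈-trans (*-congʳ
    (≈-trans (mono-cong refl (cong (single k) (ℤₚ.neg-distrib-+ (+ 1) (+ a)))) (≈-sym (X-+ k (ℤ.- + 1) (ℤ.- + a)))))
    (*-assoc _ _ f)

  h-power : (k a : ℕ) → X k (ℤ.- + a) ≈ hℕ a (x⁻ k ∷ [])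
  h-power k zero = X-0 k
  h-power k (suc a) = ≈-trans (≈-sym (*-identityʳ _))
    (≈-trans (X⁻-suc k a 1#) (≈-trans (*-congˡ (≈-trans (*-identityʳ _) (h-power k a))) (≈-sym (+-identityʳ _))))

  private
    -- The rule π_k(g/x_{k+1}) = π_k(g)/x_k + g/x_{k+1} is, for powers of 1/x_{k+1} times a
    -- symmetric f, the recursion of h_a in two letters.
    πℕ-x⁻-power : (k : ℕ) → k ℕ.< n → ∀ {f} → πℕ k · f ≈ f → ∀ a →
      πℕ k · (X (suc k) (ℤ.- + a) * f) ≈ hℕ a (x⁻ k ∷ x⁻ (suc k) ∷ []) * f
    πℕ-x⁻-power k k< {f} e zero =
      ≈-trans (op-cong (πℕ k) (≈-trans (*-congʳ (X-0 (suc k))) (*-identityˡ f))) (≈-trans e (≈-sym (*-identityˡ f)))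
    πℕ-x⁻-power k k< {f} e (suc a) = begin
      πℕ k · (X (suc k) (ℤ.- + suc a) * f) ≈⟨ op-cong (πℕ k) (X⁻-suc (suc k) a f) ⟩
      πℕ k · (x⁻ (suc k) * (X (suc k) (ℤ.- + a) * f)) ≈⟨ πℕ-x⁻₂ k k< _ ⟩
      x⁻ k * πℕ k · (X (suc k) (ℤ.- + a) * f) + x⁻ (suc k) * (X (suc k) (ℤ.- + a) * f)
        ≈⟨ +-cong (≈-trans (*-congˡ (πℕ-x⁻-power k k< e a)) (≈-sym (*-assoc _ _ f)))
          (≈-trans (≈-sym (X⁻-suc (suc k) a f)) (*-congʳ (h-power (suc k) (suc a)))) ⟩
      x⁻ k * hℕ a (x⁻ k ∷ x⁻ (suc k) ∷ []) * f + hℕ (suc a) (x⁻ (suc k) ∷ []) * f ≈⟨ distribʳ f _ _ ⟨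
      hℕ (suc a) (x⁻ k ∷ x⁻ (suc k) ∷ []) * f ∎
      where open ≈-R

  -- Of the outermost cycle only its top letter acts, f being symmetric, and it produces h_a of the
  -- two largest inverse variables. Splitting off one factor of the largest, which the smaller
  -- symmetriser does not see, leaves a power of the next one: this is the recursion of h_a over the
  -- whole range.
  symm-power : (δ M : ℕ) → δ ℕ.≤ M → M ℕ.≤ n → ∀ {f} → (∀ i → δ ℕ.≤ i → i ℕ.< M → πℕ i · f ≈ f) →
    ∀ a → symm δ (suc M) · (X M (ℤ.- + a) * f) ≈ hℕ a (invs (gens δ (suc M))) * f
  symm-power δ M δ≤M M≤n {f} inv a with δ ℕ.≟ M
  ... | yes refl = begin
    symm δ (suc δ) · (X δ (ℤ.- + a) * f) ≡⟨ symm-id δ (suc δ) ℕₚ.≤-refl _ ⟩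
    X δ (ℤ.- + a) * f ≈⟨ *-congʳ (h-power δ a) ⟩
    hℕ a (x⁻ δ ∷ []) * f ≡⟨ cong (λ vs → hℕ a (invs vs) * f)
      (trans (gens-∷ δ δ ℕₚ.≤-refl) (cong (δ ∷_) (gens-[] δ δ ℕₚ.≤-refl))) ⟨
    hℕ a (invs (gens δ (suc δ))) * f ∎
    where open ≈-R
  symm-power δ zero δ≤M M≤n {f} inv a | no ne = ⊥-elim (ne (ℕₚ.n≤0⇒n≡0 δ≤M))
  symm-power δ (suc M) δ≤M M≤n {f} inv a | no ne = begin
    S · cycle δ (suc M) · (y^ a * f) ≡⟨ cong (S ·_) (cycle-∷ δ M δ≤M′ _) ⟩
    S · πℕ M · cycle δ M · (y^ a * f) ≈⟨ op-cong (S ⊙ πℕ M) (πs-commute (mulBy (y^ a)) (gens δ M)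
        (gens-All _ δ M λ j _ j<M g →
          ≈-sym (πℕ-X j (suc M) (ℤ.- + a) (ℕₚ.<-trans j<M M≤n) (ℕₚ.>⇒≢ (ℕₚ.m≤n⇒m≤1+n j<M))
          (λ e → ℕₚ.<-irrefl (sym (ℕₚ.suc-injective e)) j<M) g)) f) ⟨
    S · πℕ M · (y^ a * cycle δ M · f)
      ≈⟨ op-cong (S ⊙ πℕ M ⊙ mulBy (y^ a))
      (πs-fix (gens δ M) (gens-All _ δ M λ j δ≤j j<M → inv j δ≤j (ℕₚ.m≤n⇒m≤1+n j<M))) ⟩
    S · πℕ M · (y^ a * f) ≈⟨ main a ⟩
    hℕ a (x⁻ (suc M) ∷ invs (gens δ (suc M))) * f ≡⟨ cong (λ vs → hℕ a (invs vs) * f) (gens-∷ δ (suc M) δ≤M) ⟨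
    hℕ a (invs (gens δ (suc (suc M)))) * f ∎
    where
    open ≈-R
    S : Op (suc n)
    S = symm δ (suc M)
    y^ : ℕ → P
    y^ a = X (suc M) (ℤ.- + a)
    δ≤M′ : δ ℕ.≤ M
    δ≤M′ = ℕₚ.≤-pred (ℕₚ.≤∧≢⇒< δ≤M ne)
    f-sym : πℕ M · f ≈ f
    f-sym = inv M δ≤M′ ℕₚ.≤-refl
    S-y : Commutes S (x⁻ (suc M))
    S-y g = ≈-sym (symm-commute (mulBy (x⁻ (suc M))) δ (suc M)
      (λ j _ j< g → ≈-sym (πℕ-X j (suc M) (ℤ.- + 1) (ℕₚ.<-trans (ℕₚ.≤-pred j<) M≤n)
      (ℕₚ.>⇒≢ (ℕₚ.<-trans (ℕₚ.n<1+n j) j<)) (ℕₚ.>⇒≢ j<) g)) g)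
    main : ∀ a → S · πℕ M · (y^ a * f) ≈ hℕ a (x⁻ (suc M) ∷ invs (gens δ (suc M))) * f
    main zero = begin
      S · πℕ M · (y^ 0 * f) ≈⟨ op-cong (S ⊙ πℕ M) (≈-trans (*-congʳ (X-0 (suc M))) (*-identityˡ f)) ⟩
      S · πℕ M · f ≈⟨ op-cong S f-sym ⟩
      S · f ≈⟨ symm-fix δ (suc M) (λ j δ≤j j< → inv j δ≤j (ℕₚ.m≤n⇒m≤1+n (ℕₚ.≤-pred j<))) ⟩
      f ≈⟨ *-identityˡ f ⟨
      1# * f ∎
    main (suc a) = begin
      S · πℕ M · (y^ (suc a) * f)
        ≈⟨ op-cong S (≈-trans (πℕ-x⁻-power M M≤n f-sym (suc a)) (*-congʳ (hℕ-swap (suc a) (x⁻ M) (x⁻ (suc M)) []))) ⟩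
      S · ((x⁻ (suc M) * hℕ a (x⁻ (suc M) ∷ x⁻ M ∷ []) + hℕ (suc a) (x⁻ M ∷ [])) * f) ≈⟨ op-cong S (lem _ _ _ f) ⟩
      S · (x⁻ (suc M) * (hℕ a (x⁻ (suc M) ∷ x⁻ M ∷ []) * f) + hℕ (suc a) (x⁻ M ∷ []) * f) ≈⟨ op-+ S _ _ ⟩
      S · (x⁻ (suc M) * (hℕ a (x⁻ (suc M) ∷ x⁻ M ∷ []) * f)) + S · (hℕ (suc a) (x⁻ M ∷ []) * f)
        ≈⟨ +-cong (S-y _) (op-cong S (*-congʳ (≈-sym (h-power M (suc a))))) ⟩
      x⁻ (suc M) * S · (hℕ a (x⁻ (suc M) ∷ x⁻ M ∷ []) * f) + S · (X M (ℤ.- + suc a) * f)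
        ≈⟨ +-cong (*-congˡ (≈-trans
          (op-cong S (≈-trans (*-congʳ (hℕ-swap a (x⁻ (suc M)) (x⁻ M) [])) (≈-sym (πℕ-x⁻-power M M≤n f-sym a))))
          (main a)))
             (symm-power δ M δ≤M′ (ℕₚ.<⇒≤ M≤n) (λ i δ≤i i< → inv i δ≤i (ℕₚ.m≤n⇒m≤1+n i<)) (suc a)) ⟩
      x⁻ (suc M) * (hℕ a (x⁻ (suc M) ∷ invs (gens δ (suc M))) * f) + hℕ (suc a) (invs (gens δ (suc M))) * f
        ≈⟨ lem _ _ _ f ⟨
      (x⁻ (suc M) * hℕ a (x⁻ (suc M) ∷ invs (gens δ (suc M))) + hℕ (suc a) (invs (gens δ (suc M)))) * f ∎
      where lem = solve 4 (λ u a b f → (u :* a :+ b) :* f := u :* (a :* f) :+ b :* f) ≈-refl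

  -- Taking f = 1 in `symm-power` exhibits h_a as an image of the symmetriser, which absorbs π_i on
  -- the left.
  h-inv-sym : (δ M i : ℕ) → δ ℕ.≤ M → M ℕ.≤ n → δ ℕ.≤ i → i ℕ.< M → ∀ a →
    πℕ i · hℕ a (invs (gens δ (suc M))) ≈ hℕ a (invs (gens δ (suc M)))
  h-inv-sym δ M i δ≤M M≤n δ≤i i<M a = begin
    πℕ i · H ≈⟨ op-cong (πℕ i) e ⟨
    πℕ i · symm δ (suc M) · (X M (ℤ.- + a) * 1#) ≈⟨ symm-absorbˡ δ (suc M) i δ≤i (ℕ.s≤s i<M) (ℕ.s≤s M≤n) _ ⟩
    symm δ (suc M) · (X M (ℤ.- + a) * 1#) ≈⟨ e ⟩
    H ∎
    where
    open ≈-R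
    H = hℕ a (invs (gens δ (suc M)))
    one-sym : ∀ k → k ℕ.< M → πℕ k · 1# ≈ 1#
    one-sym k k<M with asFin k (ℕₚ.≤-trans k<M M≤n)
    ... | j , _ , q rewrite q = Symmetric.sym-1 j
    e : symm δ (suc M) · (X M (ℤ.- + a) * 1#) ≈ H
    e = ≈-trans (symm-power δ M δ≤M M≤n (λ k _ k<M → one-sym k k<M) a) (*-identityʳ H)

  symm-h : (δ M : ℕ) → δ ℕ.≤ M → M ℕ.≤ n → ∀ a → Commutes (symm δ (suc M)) (hℕ a (invs (gens δ (suc M))))
  symm-h δ M δ≤M M≤n a f = ≈-sym (symm-commute (mulBy (hℕ a (invs (gens δ (suc M))))) δ (suc M)
    (λ j δ≤j j< g → ≈-sym (πℕ-sym j (ℕₚ.≤-trans (ℕₚ.≤-pred j<) M≤n)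
      (h-inv-sym δ M j δ≤M M≤n δ≤j (ℕₚ.≤-pred j<) a) g)) f)

ascending-gens : (δ s : ℕ) {n m : ℕ} (f : Fin m → Fin n) → (∀ j → toℕ (f j) ≡ s ℕ.+ toℕ j) →
  map toℕ (reverse (filter (λ j → suc δ ℕ.≤? suc (toℕ j)) (tabulate f))) ≡ filter (δ ℕ.≤?_) (range s m)
ascending-gens δ s {m = zero} f e = refl
ascending-gens δ s {m = suc m} f e =
  trans (split (δ ℕ.≤? s))
  (sym (trans (cong (filter (δ ℕ.≤?_)) (range-snoc s m)) (Listₚ.filter-++ (δ ℕ.≤?_) (range (suc s) m) (s ∷ []))))
  where
  rest = filter (λ j → suc δ ℕ.≤? suc (toℕ j)) (tabulate (f ∘ suc))
  s≡ : toℕ (f zero) ≡ s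
  s≡ = trans (e zero) (ℕₚ.+-identityʳ s)
  ih : map toℕ (reverse rest) ≡ filter (δ ℕ.≤?_) (range (suc s) m)
  ih = ascending-gens δ (suc s) (f ∘ suc) (λ j → trans (e (suc j)) (ℕₚ.+-suc s (toℕ j)))
  split : Dec (δ ℕ.≤ s) → map toℕ (reverse (filter (λ j → suc δ ℕ.≤? suc (toℕ j)) (tabulate f)))
    ≡ filter (δ ℕ.≤?_) (range (suc s) m) ++ filter (δ ℕ.≤?_) (s ∷ [])
  split (yes δ≤s) = trans
    (cong (map toℕ ∘ reverse)
    (Listₚ.filter-accept (λ j → suc δ ℕ.≤? suc (toℕ j)) (ℕ.s≤s (subst (δ ℕ.≤_) (sym s≡) δ≤s))))
    (trans (cong (map toℕ) (Listₚ.unfold-reverse (f zero) rest)) (trans (Listₚ.map-++ toℕ (reverse rest) (f zero ∷ []))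
      (cong₂ _++_ ih (trans (cong (_∷ []) s≡) (sym (Listₚ.filter-accept (δ ℕ.≤?_) δ≤s))))))
  split (no δ≰s) = trans (cong (map toℕ ∘ reverse)
    (Listₚ.filter-reject (λ j → suc δ ℕ.≤? suc (toℕ j)) (λ { (ℕ.s≤s le) → δ≰s (subst (δ ℕ.≤_) s≡ le) })))
    (trans ih (sym (trans (cong (filter (δ ℕ.≤?_) (range (suc s) m) ++_) (Listₚ.filter-reject (δ ℕ.≤?_) δ≰s))
      (Listₚ.++-identityʳ _))))

-- Letter j stands for the generator with index j + 1, so 𝖼(δ + 1) has the 0-based letters from n -
-- 1 down to δ.
cWord-gens : (δ n : ℕ) → map toℕ (cWord {n} (suc δ)) ≡ gens δ n
cWord-gens δ n = trans (ascending-gens δ 0 id (λ _ → refl)) (cong (filter (δ ℕ.≤?_)) (range-downFrom n))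

gens-away : (δ N M : ℕ) → N ℕ.≤ M → Away M (gens δ N)
gens-away δ N M N≤M = Allˡ.map (λ { (_ , j<N) refl → ℕₚ.<-irrefl refl (ℕₚ.<-≤-trans j<N N≤M) }) (gens-bounds δ N)

range-away : (N : ℕ) → Away N (range 0 N)
range-away N = range-All _ 0 N λ j _ j<N e → ℕₚ.<-irrefl e j<N

-- Chains, row series and the change of the number of variables.

module _ {n : ℕ} where
  open LaurentRing (suc n)
  open Operators {suc n}
  open Variables {suc n}
  open PolySolver (suc n) using (solve; _:+_; _:*_; :-_; _:-_; con; _:=_)

  private
    P : Set
    P = Poly (suc n)

  demOp-πs : (w : Word n) (f : P) → demOp w · f ≡ πs (map toℕ w) · f
  demOp-πs [] f = refl
  demOp-πs (i ∷ w) f = trans (cong (_· (demOp w · f)) (sym (πℕ-toℕ i))) (cong (πℕ (toℕ i) ·_) (demOp-πs w f))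

  demWord-cWord : (δ : ℕ) (f : P) → demWord (cWord (suc δ)) f ≡ cycle δ n · f
  demWord-cWord δ f = trans (sym (demOp-demWord (cWord (suc δ)) f))
    (trans (demOp-πs (cWord (suc δ)) f) (cong (λ ks → πs ks · f) (cWord-gens δ n)))

  mulX1-X : (g : ℤ) (f : P) → mulX1 g f ≈ X 0 g * f
  mulX1-X g f = mk≈ λ F →
    trans (trans (ev-map _ F (λ d β → F d (β V.[ zero ]%= (λ z → g ℤ.+ z))) (+ 1) (λ t → sym (ℤₚ.*-identityˡ _)) f)
    (ℤₚ.*-identityˡ _))
    (trans (ev-cong (λ d β → cong (F d) (shift β)) f) (sym (ev-X F 0 g f)))
    where
    shift : (β : Exp (suc n)) → β V.[ zero ]%= (λ z → g ℤ.+ z) ≡ single 0 g ⊞ β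
    shift (b ∷ β) = cong (_ ∷_) (sym (⊞-identityˡ β))

  -- Nonnegativity of all exponents occurring in a chain

  demTerm-nonneg : (i : Fin n) (t : Term (suc n)) → NonnegTerm t → Allˡ NonnegTerm (demTerm i t)
  demTerm-nonneg i (term c d α) (q≥ , α≥) = main (r ℤ.<? p)
    where
    k = toℕ i
    β : Exp (suc n)
    β = α V.[ inject₁ i ]%= (λ z → z ℤ.+ + 1)
    p r : ℤ
    p = lookup β (inject₁ i)
    r = lookup β (suc i)
    p≥ : + 0 ℤ.≤ p
    p≥ = subst (+ 0 ℤ.≤_) (sym (trans (lookup-coord₁ i β) (coord-raised i α))) (ℤₚ.+-mono-≤ (α≥ k) (ℤ.+≤+ ℕ.z≤n))
    r≥ : + 0 ℤ.≤ r
    r≥ = subst (+ 0 ℤ.≤_) (sym (trans (lookup-coord₂ i β) (coord-raised-≢ i α (suc k) ℕₚ.1+n≢n))) (α≥ (suc k))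
    set2≥ : ∀ u v → + 0 ℤ.≤ u → + 0 ℤ.≤ v → ∀ j → + 0 ℤ.≤ coord (set2 i u v β) j
    set2≥ u v u≥ v≥ j with j ℕ.≟ k | j ℕ.≟ suc k
    ... | yes refl | _ = subst (+ 0 ℤ.≤_) (sym (coord-set2₁ i u v β)) u≥
    ... | no _ | yes refl = subst (+ 0 ℤ.≤_) (sym (coord-set2₂ i u v β)) v≥
    ... | no j≢k | no j≢sk =
      subst (+ 0 ℤ.≤_) (sym (trans (coord-set2-≢ i u v β j j≢k j≢sk) (coord-raised-≢ i α j j≢k))) (α≥ j)
    upper : ∀ a b t → + 0 ℤ.≤ a → a ℤ.≤ b → t ℕ.< ∣ b ℤ.- a ∣ → + 0 ℤ.≤ b ℤ.- + 1 ℤ.- + t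
    upper a b t a≥ a≤b t< = subst (+ 0 ℤ.≤_) (lem a b (+ t)) (ℤₚ.+-mono-≤ a≥ (ℤₚ.i≤j⇒0≤j-i
      (subst (+ suc t ℤ.≤_) (ℤₚ.0≤i⇒+∣i∣≡i (ℤₚ.i≤j⇒0≤j-i a≤b)) (ℤ.+≤+ t<))))
      where lem : ∀ a b t → a ℤ.+ (b ℤ.- a ℤ.- (+ 1 ℤ.+ t)) ≡ b ℤ.- + 1 ℤ.- t
            lem = solve-∀
    main : (dec : Dec (r ℤ.< p)) → Allˡ NonnegTerm (if does dec
       then map (λ t → term c d (set2 i (r ℤ.+ + t) ((p ℤ.- + 1) ℤ.- + t) β)) (upTo ∣ p ℤ.- r ∣)
       else map (λ t → term (ℤ.- c) d (set2 i (p ℤ.+ + t) ((r ℤ.- + 1) ℤ.- + t) β)) (upTo ∣ r ℤ.- p ∣))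
    main (yes r<p) = Allₚ.map⁺ (Allₚ.applyUpTo⁺₁ id ∣ p ℤ.- r ∣ λ {t} t< →
      q≥ , set2≥ _ _ (ℤₚ.+-mono-≤ r≥ (ℤ.+≤+ ℕ.z≤n)) (upper r p t r≥ (ℤₚ.<⇒≤ r<p) t<))
    main (no r≮p) = Allₚ.map⁺ (Allₚ.applyUpTo⁺₁ id ∣ r ℤ.- p ∣ λ {t} t< →
      q≥ , set2≥ _ _ (ℤₚ.+-mono-≤ p≥ (ℤ.+≤+ ℕ.z≤n)) (upper p r t p≥ (ℤₚ.≮⇒≥ r≮p) t<))

  demWord-nonneg : (w : Word n) {f : P} → Allˡ NonnegTerm f → Allˡ NonnegTerm (demWord w f)
  demWord-nonneg [] q = q
  demWord-nonneg (i ∷ w) q = Allₚ.concat⁺ (Allₚ.map⁺ (Allˡ.map (λ {t} → demTerm-nonneg i t) (demWord-nonneg w q)))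

  Φ-nonneg : {f : P} → Allˡ NonnegTerm f → Allˡ NonnegTerm (Φ f)
  Φ-nonneg q = Allₚ.map⁺ (Allˡ.map (λ {t} (d≥ , α≥) →
      let last≥ = subst (+ 0 ℤ.≤_) (sym (last-coord (Term.exp t))) (α≥ n)
      in ℤₚ.+-mono-≤ d≥ last≥ , λ { zero → last≥ ; (suc k) → init≥ (Term.exp t) α≥ k }) q)
    where
    init≥ : (α : Exp (suc n)) → (∀ k → + 0 ℤ.≤ coord α k) → ∀ k → + 0 ℤ.≤ coord (V.init α) k
    init≥ α α≥ k with k ℕ.<? n
    ... | yes k< = subst (+ 0 ℤ.≤_) (sym (init-coord α k k<)) (α≥ k)
    ... | no k≮ = subst (+ 0 ℤ.≤_) (sym (coord-past (V.init α) k (ℕₚ.≮⇒≥ k≮))) ℤₚ.≤-refl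

  mulX1-nonneg : (g : ℤ) {f : P} → + 0 ℤ.≤ g → Allˡ NonnegTerm f → Allˡ NonnegTerm (mulX1 g f)
  mulX1-nonneg g g≥ q = Allₚ.map⁺ (Allˡ.map (λ {t} (d≥ , α≥) → d≥ , raise (Term.exp t) α≥) q)
    where
    raise : (α : Exp (suc n)) → (∀ k → + 0 ℤ.≤ coord α k) → ∀ k → + 0 ℤ.≤ coord (α V.[ zero ]%= (λ z → g ℤ.+ z)) k
    raise (a ∷ α) α≥ zero = ℤₚ.+-mono-≤ g≥ (α≥ 0)
    raise (a ∷ α) α≥ (suc k) = α≥ (suc k)

  chain-nonneg : {k : ℕ} (γ : Vec ℤ (suc k)) (ms : Vec ℕ k) → All (+ 0 ℤ.≤_) γ → Allˡ NonnegTerm (chain {n} γ ms)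
  chain-nonneg (g ∷ []) [] (g≥ VAll.∷ _) =
    mulX1-nonneg g {f = one} g≥ ((ℤₚ.≤-refl , λ k → ℤₚ.≤-reflexive (sym (coord-𝟎 {suc n} k))) ∷ [])
  chain-nonneg (g ∷ g′ ∷ gs) (m ∷ ms) (g≥ VAll.∷ γ≥) =
    mulX1-nonneg g g≥ (Φ-nonneg (demWord-nonneg (cWord m) (chain-nonneg (g′ ∷ gs) ms γ≥)))

  -- Catalan series of the last k + 1 rows, with the variables shifted down so that these rows begin at x_1.

  rowSeries : {k : ℕ} → Vec ℤ (suc k) → Vec ℕ k → ℕ → P
  rowSeries (g ∷ []) [] zero = X 0 g
  rowSeries (g ∷ []) [] (suc m) = 0#
  rowSeries {suc k} (g ∷ g′ ∷ gs) (d ∷ ms) m =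
    X 0 g * conv (λ a b → X 0 (+ a) * (hℕ a (invs (gens d (suc (suc k)))) * rotate · rowSeries (g′ ∷ gs) ms b)) m

  hℕ-commutes : (A : Op (suc n)) {vs : List P} → Allˡ (Commutes A) vs → ∀ a → Commutes A (hℕ a vs)
  hℕ-commutes A cs a = h-closed (Commutes A) tw-0 tw-1 tw-+ tw-* cs (+ a)
    where open Intertwining A

  invs-commute : (N : ℕ) (φ : ℤ → P) (vs : List ℕ) → Away N vs → ∀ a → Commutes (diag N φ) (hℕ a (invs vs))
  invs-commute N φ vs aw = hℕ-commutes (diag N φ) (Allₚ.map⁺ (Allˡ.map (λ {v} p → diag-X-≢ N v φ (ℤ.- + 1) p) aw))

  lifts-invs : (δ N : ℕ) → N ℕ.≤ n → ∀ a → Lifts (hℕ a (invs (gens δ N))) (hℕ a (invs (gens (suc δ) (suc N))))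
  lifts-invs δ N N≤n a = subst (λ vs → Lifts (hℕ a (invs (gens δ N))) (hℕ a (invs vs))) (gens-suc δ N)
    (lifts-h x⁻ (λ k → lifts-X k (ℤ.- + 1)) (gens δ N) (Allˡ.map (λ (_ , j<N) → ℕₚ.<-≤-trans j<N N≤n) (gens-bounds δ N))
      (+ a))

  -- Each row uses one rotation, which raises indices by one, and inverse variables up to its own
  -- width. Thus k + 1 rows involve no variable with 0-based index above k.
  rowSeries-const : {k : ℕ} (γ : Vec ℤ (suc k)) (ms : Vec ℕ k) (m j : ℕ) → k ℕ.< j → j ℕ.≤ n →
    const j · rowSeries γ ms m ≈ rowSeries γ ms m
  rowSeries-const (g ∷ []) [] zero (suc j) _ j≤n = begin
    const (suc j) · X 0 g ≈⟨ op-cong (const (suc j)) (*-identityʳ (X 0 g)) ⟨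
    const (suc j) · (X 0 g * 1#) ≈⟨ diag-X-≢ (suc j) 0 _ g (λ ()) 1# ⟩
    X 0 g * const (suc j) · 1# ≈⟨ *-congˡ (≈-trans (diag-mono (suc j) _ (+ 0) 𝟎)
      (≈-trans (*-congʳ (≈-reflexive (cong (indicator isZero) (coord-𝟎 {suc n} (suc j))))) (*-identityˡ 1#))) ⟩
    X 0 g * 1# ≈⟨ *-identityʳ (X 0 g) ⟩
    X 0 g ∎
    where open ≈-R
  rowSeries-const (g ∷ []) [] (suc m) j _ _ = op-0 (const j)
  rowSeries-const {suc k} (g ∷ g′ ∷ gs) (d ∷ ms) m (suc j) (ℕ.s≤s k<j) j<n =
    ≈-trans (diag-X-≢ (suc j) 0 _ g (λ ()) _) (*-congˡ
    (≈-trans (op-conv (const (suc j)) _ m) (conv-cong (λ a b → begin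
      const (suc j) · (X 0 (+ a) * (H a * rotate · F b)) ≈⟨ diag-X-≢ (suc j) 0 _ (+ a) (λ ()) _ ⟩
      X 0 (+ a) * const (suc j) · (H a * rotate · F b)
        ≈⟨ *-congˡ (invs-commute (suc j) _ _ (gens-away d _ _ (ℕ.s≤s k<j)) a _) ⟩
      X 0 (+ a) * (H a * const (suc j) · rotate · F b) ≈⟨ *-congˡ (*-congˡ (rotate-const j j<n (F b))) ⟨
      X 0 (+ a) * (H a * rotate · const j · F b)
        ≈⟨ *-congˡ (*-congˡ (op-cong rotate (rowSeries-const (g′ ∷ gs) ms b j k<j (ℕₚ.<⇒≤ j<n)))) ⟩
      X 0 (+ a) * (H a * rotate · F b) ∎) m)))
    where
    open ≈-R
    H : ℕ → P
    H a = hℕ a (invs (gens d (suc (suc k))))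
    F : ℕ → P
    F = rowSeries (g′ ∷ gs) ms

  -- Under T, factors 1/x_N with x_N not occurring elsewhere disappear.

  negClosed-h : (N : ℕ) → N ℕ.≤ n → ∀ vs a → NegClosed N (hℕ a (invs vs))
  negClosed-h N N≤ vs a =
    h-closed (NegClosed N) (negClosed-commutes N tw-0) (negClosed-commutes N tw-1) plus (negClosed-* N)
    (Allₚ.map⁺ (Allˡ.universal single-neg vs)) (+ a)
    where
    open Intertwining (nonneg N)
    plus : ∀ {r s} → NegClosed N r → NegClosed N s → NegClosed N (r + s)
    plus {r} {s} p q f = ≈-trans (expand (nonneg N · f)) (≈-trans (+-cong (p f) (q f)) (≈-sym (expand f)))
      where expand : ∀ g → nonneg N · ((r + s) * g) ≈ nonneg N · (r * g) + nonneg N · (s * g)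
            expand g = ≈-trans (op-cong (nonneg N) (distribʳ g r s)) (op-+ (nonneg N) _ _)
    single-neg : ∀ v → NegClosed N (x⁻ v)
    single-neg v with v ℕ.≟ N
    ... | yes refl = negClosed-x⁻ N N≤
    ... | no v≢N = negClosed-commutes N (diag-X-≢ N v _ (ℤ.- + 1) v≢N)

  T-drop : (N : ℕ) → N ℕ.≤ n → ∀ vs a {F} → const N · F ≈ F → Away N vs →
    T (range 0 (suc N)) · (hℕ a (invs (N ∷ vs)) * F) ≈ T (range 0 N) · (hℕ a (invs vs) * F)
  T-drop N N≤ vs a {F} cF aw = ≈-trans (lower a) (begin
    T (range 0 (suc N)) · (hℕ a (invs vs) * F) ≈⟨ op-cong (T (range 0 (suc N))) fixed ⟨
    T (range 0 (suc N)) · const N · (hℕ a (invs vs) * F) ≈⟨ T-const N (range 0 N) N≤ (range-away N) _ ⟩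
    T (range 0 N) · const N · (hℕ a (invs vs) * F) ≈⟨ op-cong (T (range 0 N)) fixed ⟩
    T (range 0 N) · (hℕ a (invs vs) * F) ∎)
    where
    open ≈-R
    T₁ : Op (suc n)
    T₁ = T (range 0 (suc N))
    fixed : const N · (hℕ a (invs vs) * F) ≈ hℕ a (invs vs) * F
    fixed = ≈-trans (invs-commute N _ vs aw a F) (*-congˡ cF)
    lower : ∀ a → T₁ · (hℕ a (invs (N ∷ vs)) * F) ≈ T₁ · (hℕ a (invs vs) * F)
    lower zero = ≈-refl
    lower (suc a) = begin
      T₁ · ((x⁻ N * r + hℕ (suc a) (invs vs)) * F) ≈⟨ ≈-trans (op-cong T₁ (distribʳ F _ _)) (op-+ T₁ _ _) ⟩
      T₁ · (x⁻ N * r * F) + T₁ · (hℕ (suc a) (invs vs) * F)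
        ≈⟨ +-congʳ (≈-trans (≈-sym (T-nonneg N (range 0 N) N≤ (range-away N) _))
        (≈-trans (op-cong T₁ vanish) (op-0 T₁))) ⟩
      0# + T₁ · (hℕ (suc a) (invs vs) * F) ≈⟨ +-identityˡ _ ⟩
      T₁ · (hℕ (suc a) (invs vs) * F) ∎
      where
      r = hℕ a (invs (N ∷ vs))
      vanish : nonneg N · (x⁻ N * r * F) ≈ 0#
      vanish = begin
        nonneg N · (x⁻ N * r * F) ≈⟨ op-cong (nonneg N) (lem (x⁻ N) r F) ⟩
        nonneg N · (r * (x⁻ N * F)) ≈⟨ negClosed-h N N≤ (N ∷ vs) a (x⁻ N * F) ⟨
        nonneg N · (r * nonneg N · (x⁻ N * F))
          ≈⟨ op-cong (nonneg N)
          (*-congˡ (≈-trans (op-cong (nonneg N) (*-congˡ (≈-sym cF))) (nonneg-neg-const N N≤ F))) ⟩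
        nonneg N · (r * 0#) ≈⟨ ≈-trans (op-cong (nonneg N) (zeroʳ r)) (op-0 (nonneg N)) ⟩
        0# ∎
        where lem = solve 3 (λ a b c → a :* b :* c := b :* (a :* c)) ≈-refl

  -- Iterates `T-drop` from i + K variables down to K. Once δ exceeds the top index the alphabet is
  -- empty, and only `T` has a variable left to lose.
  T-restrict : (δ K : ℕ) (a : ℕ) {F : P} → (∀ j → K ℕ.≤ j → j ℕ.≤ n → const j · F ≈ F) →
    ∀ i → i ℕ.+ K ℕ.≤ suc n →
      T (range 0 (i ℕ.+ K)) · (hℕ a (invs (gens δ (i ℕ.+ K))) * F) ≈ T (range 0 K) · (hℕ a (invs (gens δ K)) * F)
  T-restrict δ K a c zero _ = ≈-refl
  T-restrict δ K a {F} c (suc i) (ℕ.s≤s N≤n) with δ ℕ.≤? i ℕ.+ K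
  ... | yes δ≤N = ≈-trans
    (≈-reflexive (cong (λ vs → T (range 0 (suc (i ℕ.+ K))) · (hℕ a (invs vs) * F)) (gens-∷ δ (i ℕ.+ K) δ≤N)))
    (≈-trans (T-drop (i ℕ.+ K) N≤n (gens δ (i ℕ.+ K)) a (c (i ℕ.+ K) (ℕₚ.m≤n+m K i) N≤n) (gens-away δ _ _ ℕₚ.≤-refl))
      (T-restrict δ K a c i (ℕₚ.m≤n⇒m≤1+n N≤n)))
  ... | no δ≰N = ≈-trans (≈-reflexive
    (cong (λ vs → T (range 0 (suc (i ℕ.+ K))) · (hℕ a (invs vs) * F)) (gens-[] δ _ (ℕₚ.≰⇒> δ≰N))))
    (≈-trans empty (≈-trans
      (≈-reflexive (cong (λ vs → T (range 0 (i ℕ.+ K)) · (hℕ a (invs vs) * F))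
      (sym (gens-[] δ _ (ℕₚ.<⇒≤ (ℕₚ.≰⇒> δ≰N))))))
      (T-restrict δ K a c i (ℕₚ.m≤n⇒m≤1+n N≤n))))
    where
    N = i ℕ.+ K
    cN = c N (ℕₚ.m≤n+m K i) N≤n
    fixed : const N · (hℕ a [] * F) ≈ hℕ a [] * F
    fixed = ≈-trans (invs-commute N _ [] [] a F) (*-congˡ cN)
    empty : T (range 0 (suc N)) · (hℕ a [] * F) ≈ T (range 0 N) · (hℕ a [] * F)
    empty = ≈-trans (op-cong (T (range 0 (suc N))) (≈-sym fixed))
      (≈-trans (T-const N (range 0 N) N≤n (range-away N) _) (op-cong (T (range 0 N)) fixed))

  -- The divisions are made one at a time. Truncating in between is harmless, since a negative
  -- exponent stays negative under division by x_N.
  nonneg-x⁻-power-T : (N : ℕ) → N ℕ.≤ n → ∀ a f →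
    nonneg N · (X N (ℤ.- + a) * T (range 0 (suc N)) · f) ≈ T (range 0 (suc N)) · (X N (ℤ.- + a) * f)
  nonneg-x⁻-power-T N N≤ zero f = begin
    nonneg N · (X N (+ 0) * T₁ · f) ≈⟨ op-cong (nonneg N) (one-* _) ⟩
    nonneg N · T₁ · f ≈⟨ nonneg-T N (range 0 N) N≤ f ⟩
    T₁ · f ≈⟨ op-cong T₁ (one-* f) ⟨
    T₁ · (X N (+ 0) * f) ∎
    where open ≈-R
          T₁ = T (range 0 (suc N))
          one-* : ∀ f → X N (+ 0) * f ≈ f
          one-* f = ≈-trans (*-congʳ (X-0 N)) (*-identityˡ f)
  nonneg-x⁻-power-T N N≤ (suc a) f = begin
    nonneg N · (X N (ℤ.- + suc a) * T₁ · f) ≈⟨ op-cong (nonneg N) (X⁻-suc N a _) ⟩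
    nonneg N · (x⁻ N * (X N (ℤ.- + a) * T₁ · f)) ≈⟨ negClosed-x⁻ N N≤ _ ⟨
    nonneg N · (x⁻ N * nonneg N · (X N (ℤ.- + a) * T₁ · f))
      ≈⟨ op-cong (nonneg N) (*-congˡ (nonneg-x⁻-power-T N N≤ a f)) ⟩
    nonneg N · (x⁻ N * T₁ · (X N (ℤ.- + a) * f)) ≈⟨ nonneg-x⁻-T N (range 0 N) N≤ (range-away N) _ ⟩
    T₁ · (x⁻ N * (X N (ℤ.- + a) * f)) ≈⟨ op-cong T₁ (X⁻-suc N a f) ⟨
    T₁ · (X N (ℤ.- + suc a) * f) ∎
    where open ≈-R
          T₁ = T (range 0 (suc N))

-- Extraction of the last variable from a symmetrised truncation.

module _ {n : ℕ} where
  open LaurentRing (suc n)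
  open Operators {suc n}
  open Variables {suc n}

  extract-πℕ : (a j : ℕ) → suc j ℕ.< n → ∀ f → extract a · πℕ j · f ≈ πℕ j · extract a · f
  extract-πℕ a j sj<n f =
    ≈-trans (op-cong (const n) (≈-sym (πℕ-X j n (ℤ.- + a) j<n n≢j n≢sj f))) (πℕ-indicator j n isZero j<n n≢j n≢sj _)
    where
    j<n : j ℕ.< n
    j<n = ℕₚ.<-trans (ℕₚ.n<1+n j) sj<n
    n≢j : n ≢ j
    n≢j = ℕₚ.>⇒≢ j<n
    n≢sj : n ≢ suc j
    n≢sj = ℕₚ.>⇒≢ sj<n

module LastVariable {p : ℕ} where
  private
    N : ℕ
    N = suc p
  open LaurentRing (suc N)
  open Operators {suc N}
  open Variables {suc N}

  extract-last : (a : ℕ) (u : Poly (suc N)) → const N · u ≈ u → extract a · πℕ p · u ≈ nonneg p · (X p (ℤ.- + a) * u)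
  extract-last a u cu with asFin {N} p ℕₚ.≤-refl
  ... | i , e , q rewrite q = begin
    extract a · π i · u ≈⟨ op-cong (extract a ⊙ π i) cu ⟨
    extract a · π i · const N · u ≈⟨ extract-π i (cong suc e) a u ⟩
    nonneg (toℕ i) · (X (toℕ i) (ℤ.- + a) * const N · u) ≡⟨ cong (λ k → nonneg k · (X k (ℤ.- + a) * const N · u)) e ⟩
    nonneg p · (X p (ℤ.- + a) * const N · u) ≈⟨ op-cong (nonneg p) (*-congˡ cu) ⟩
    nonneg p · (X p (ℤ.- + a) * u) ∎
    where open ≈-R

  extract-symm : (δ : ℕ) → δ ℕ.≤ p → ∀ a F → const N · F ≈ F →
    extract a · symm δ (suc N) · T (range 0 N) · F ≈ symm δ N · T (range 0 N) · (hℕ a (invs (gens δ N)) * F)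
  extract-symm δ δ≤p a F cF = begin
    extract a · symm δ (suc N) · T′ · F
      ≈⟨ op-cong (extract a) (symm-absorbed (symm δ (suc N)) δ N
        (λ j δ≤j sj<n → symm-absorbʳ δ (suc N) j δ≤j (ℕₚ.m≤n⇒m≤1+n sj<n) ℕₚ.≤-refl) _) ⟨
    extract a · S · cycle δ N · u ≡⟨ cong (λ v → extract a · S · v) (cycle-∷ δ p δ≤p u) ⟩
    extract a · S · πℕ p · cycle δ p · u
      ≈⟨ op-cong (extract a ⊙ S ⊙ πℕ p)
      (πs-fix (gens δ p) (Allˡ.map (λ (δ≤j , j<p) → u-sym δ≤j j<p) (gens-bounds δ p))) ⟩
    extract a · S · πℕ p · u ≈⟨ symm-commute (extract a) δ N (λ j _ sj<n → extract-πℕ a j sj<n) _ ⟩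
    S · extract a · πℕ p · u ≈⟨ op-cong S (extract-last a u cu) ⟩
    S · nonneg p · (X p (ℤ.- + a) * u) ≈⟨ op-cong (S ⊙ nonneg p ⊙ mulBy (X p (ℤ.- + a))) (ST F) ⟩
    S · nonneg p · (X p (ℤ.- + a) * T′ · S · F) ≈⟨ op-cong S (nonneg-x⁻-power-T p (ℕₚ.n≤1+n p) a (S · F)) ⟩
    S · T′ · (X p (ℤ.- + a) * S · F) ≈⟨ ST _ ⟩
    T′ · S · (X p (ℤ.- + a) * S · F) ≈⟨ op-cong T′ (symm-power δ p δ≤p (ℕₚ.n≤1+n p) (λ i δ≤i i<p → SF-sym δ≤i i<p) a) ⟩
    T′ · (hℕ a (invs (gens δ N)) * S · F) ≈⟨ op-cong T′ (symm-h δ p δ≤p (ℕₚ.n≤1+n p) a F) ⟨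
    T′ · S · (hℕ a (invs (gens δ N)) * F) ≈⟨ ST _ ⟨
    S · T′ · (hℕ a (invs (gens δ N)) * F) ∎
    where
    open ≈-R
    T′ S : Op (suc N)
    T′ = T (range 0 N)
    S = symm δ N
    u : Poly (suc N)
    u = S · T′ · F
    u-sym : ∀ {j} → δ ℕ.≤ j → j ℕ.< p → πℕ j · u ≈ u
    u-sym {j} δ≤j j<p = symm-absorbˡ δ N j δ≤j (ℕ.s≤s j<p) (ℕₚ.n≤1+n N) _
    SF-sym : ∀ {j} → δ ℕ.≤ j → j ℕ.< p → πℕ j · S · F ≈ S · F
    SF-sym {j} δ≤j j<p = symm-absorbˡ δ N j δ≤j (ℕ.s≤s j<p) (ℕₚ.n≤1+n N) _
    ST : ∀ f → S · T′ · f ≈ T′ · S · f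
    ST f = ≈-sym (symm-commute T′ δ N (λ j _ sj<n → πℕ-T j N sj<n (ℕₚ.n≤1+n N)) f)
    cu : const N · u ≈ u
    cu = ≈-trans (symm-commute (const N) δ N (λ j _ sj<n → πℕ-indicator j N isZero (ℕₚ.<-trans (ℕₚ.n<1+n j) sj<n)
        (ℕₚ.>⇒≢ (ℕₚ.<-trans (ℕₚ.n<1+n j) sj<n)) (ℕₚ.>⇒≢ sj<n)) _)
      (op-cong S (≈-trans (≈-sym (T-indicator (range 0 N) N isZero (range-away N) F)) (op-cong T′ cF)))

extract-symm : (n δ : ℕ) → δ ℕ.< n → ∀ a F → const n · F ≈ F →
  extract {n} a · symm δ (suc n) · T (range 0 n) · F ≈
    symm δ n · T (range 0 n) · (hℕ a (invs (gens δ n)) Evaluation.* F)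
extract-symm (suc p) δ δ<n = LastVariable.extract-symm δ (ℕₚ.≤-pred δ<n)

-- With δ = n_i - 1 this is n_{i+1} ≥ n_i - 1. It guarantees that the letters absorbed for one row
-- include those needed for the next.
HeadBound : {k : ℕ} → ℕ → Vec ℕ k → Set
HeadBound δ [] = ⊤
HeadBound δ (d ∷ _) = δ ℕ.≤ d

-- The conditions that nr imposes on the row lengths of a root ideal
data Admissible : {k : ℕ} → Vec ℕ k → Set where
  [] : Admissible []
  cons : {δ k : ℕ} {ms : Vec ℕ k} → HeadBound δ ms → Admissible ms → Admissible (suc δ ∷ ms)

-- Induction over the rows.

module _ {n : ℕ} where
  open LaurentRing (suc n)
  open Operators {suc n}
  open Variables {suc n}

  private
    P : Set
    P = Poly (suc n)

  truncation : Op (suc n)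
  truncation = T (range 0 (suc n))

  -- Tameness carried over from words to operators; with d = n_1 the 0-based j ≥ d are the
  -- generators with index n_1 + 1, ..., ℓ - 1.
  AbsorbsFrom : ℕ → Op (suc n) → Set
  AbsorbsFrom d W = ∀ j → d ℕ.≤ j → j ℕ.< n → ∀ f → W · πℕ j · f ≈ W · f

  Absorbs : {k : ℕ} → Op (suc n) → Vec ℕ k → Set
  Absorbs W [] = ⊤
  Absorbs W (d ∷ _) = AbsorbsFrom d W

  absorbs-head : (δ : ℕ) {k : ℕ} (ms : Vec ℕ k) (W : Op (suc n)) → HeadBound δ ms → AbsorbsFrom δ W → Absorbs W ms
  absorbs-head δ [] W _ _ = tt
  absorbs-head δ (d ∷ ms) W δ≤d ab j d≤j = ab j (ℕₚ.≤-trans δ≤d d≤j)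

  nonneg-mono : (j : ℕ) (d : ℤ) (α : Exp (suc n)) → + 0 ℤ.≤ coord α j → nonneg j · mono d α ≈ mono d α
  nonneg-mono j d α pos = ≈-trans (diag-mono j _ d α) (≈-trans (*-congʳ (true-ind (coord α j) pos)) (*-identityˡ _))
    where true-ind : ∀ z → + 0 ℤ.≤ z → indicator isNonneg z ≈ 1#
          true-ind (+ m) _ = ≈-refl

  truncation-mono : (d : ℤ) (α : Exp (suc n)) → (∀ j → + 0 ℤ.≤ coord α j) → truncation · mono d α ≈ mono d α
  truncation-mono d α pos = T-fixed 0 (suc n) ℕₚ.≤-refl (mono d α) (λ j _ → nonneg-mono j d α (pos j))

  preserves-X : (N : ℕ) → N ℕ.≤ n → ∀ z → + 0 ℤ.≤ z → Preserves N (X N z)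
  preserves-X N N≤ (+ zero) _ f e = ≈-trans (op-cong (nonneg N) one-*) (≈-trans e (≈-sym one-*))
    where one-* : X N (+ 0) * f ≈ f
          one-* = ≈-trans (*-congʳ (X-0 N)) (*-identityˡ f)
  preserves-X N N≤ (+ suc m) _ f e = ≈-trans (op-cong (nonneg N) (*-congʳ (≈-sym (X-+ N (+ 1) (+ m)))))
    (≈-trans (preserves-* N (preserves-x N N N≤) (preserves-X N N≤ (+ m) (ℤ.+≤+ ℕ.z≤n)) f e)
      (*-congʳ (X-+ N (+ 1) (+ m))))

  coefq-πs : (m : ℕ) (ks : List ℕ) → Allˡ (ℕ._< n) ks → ∀ f → coefq m · πs ks · f ≈ πs ks · coefq m · f
  coefq-πs m ks ks< = πs-commute (coefq m) ks (Allˡ.map (λ {k} k< → single-gen k k<) ks<)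
    where
    single-gen : ∀ k → k ℕ.< n → (f : P) → coefq m · πℕ k · f ≈ πℕ k · coefq m · f
    single-gen k k< f with asFin k k<
    ... | i , _ , q rewrite q = coefq-π m i f

  -- The summand of the first row with exponent `a`. `Q` stands for a q-coefficient of the chain of
  -- the remaining rows and `F` for the same coefficient of their series. The hypothesis `ih` ranges
  -- over operators because it is applied to V composed with extraction and a symmetriser.
  module Step {k : ℕ} (k<n : suc k ℕ.≤ n) (g : ℤ) (g≥0 : + 0 ℤ.≤ g) (δ : ℕ) (W : Op (suc n))
    (W-absorbs : AbsorbsFrom (suc δ) W)
    (a : ℕ) (Q F : P) (F-const : ∀ j → k ℕ.< j → j ℕ.≤ n → const j · F ≈ F)
    (ih : ∀ W → AbsorbsFrom δ W → W · Q ≈ W · truncation · F) where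

    open ≈-R

    private
      H : P
      H = hℕ a (invs (gens δ (suc k)))
      T′ : Op (suc n)
      T′ = T (range 0 n)
      cF : const n · F ≈ F
      cF = F-const n k<n ℕₚ.≤-refl

    V : Op (suc n)
    V = W ⊙ mulBy (X 0 g) ⊙ mulBy (X 0 (+ a)) ⊙ rotate

    -- Φ carries π_j to π_{j+1}, so absorption from δ + 1 on for W becomes absorption from δ on for
    -- V. The letter n - 1 is excluded, as Φ moves its second variable to the front; extraction
    -- takes care of it.
    V-absorbs : ∀ j → δ ℕ.≤ j → suc j ℕ.< n → ∀ f → V · πℕ j · f ≈ V · f
    V-absorbs j δ≤j sj<n f = begin
      W · (X 0 g * (X 0 (+ a) * rotate · πℕ j · f))
        ≈⟨ op-cong (W ⊙ mulBy (X 0 g) ⊙ mulBy (X 0 (+ a))) (πℕ-rotate j sj<n f) ⟩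
      W · (X 0 g * (X 0 (+ a) * πℕ (suc j) · rotate · f))
        ≈⟨ op-cong (W ⊙ mulBy (X 0 g)) (πℕ-X (suc j) 0 (+ a) sj<n (λ ()) (λ ()) _) ⟨
      W · (X 0 g * πℕ (suc j) · (X 0 (+ a) * rotate · f)) ≈⟨ op-cong W (πℕ-X (suc j) 0 g sj<n (λ ()) (λ ()) _) ⟨
      W · πℕ (suc j) · (X 0 g * (X 0 (+ a) * rotate · f)) ≈⟨ W-absorbs (suc j) (ℕ.s≤s δ≤j) sj<n _ ⟩
      W · (X 0 g * (X 0 (+ a) * rotate · f)) ∎

    truncation-F : truncation · F ≈ T′ · F
    truncation-F = ≈-trans (op-cong truncation (≈-sym cF))
      (≈-trans (T-const n (range 0 n) ℕₚ.≤-refl (range-away n) F) (op-cong T′ cF))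

    V-symm : ∀ f → V · symm δ n · f ≈ V · f
    V-symm = symm-absorbed V δ n V-absorbs

    -- V supplies the symmetriser on the smaller letters, which together with the cycle of the chain
    -- makes up the full symmetriser. That one absorbs every letter from δ on, as `ih` demands, and
    -- fits `extract-symm`.
    expand : V · extract a · cycle δ n · Q ≈ V · T′ · (hℕ a (invs (gens δ n)) * F)
    expand with δ ℕ.<? n
    ... | yes δ<n = begin
      V · extract a · cycle δ n · Q ≈⟨ V-symm _ ⟨
      V · symm δ n · extract a · cycle δ n · Q
        ≈⟨ op-cong V (symm-commute (extract a) δ n (λ j _ sj<n → extract-πℕ a j sj<n) _) ⟨
      V · extract a · symm δ (suc n) · Q
        ≈⟨ ih (V ⊙ extract a ⊙ symm δ (suc n))
        (λ j δ≤j j<n f → op-cong (V ⊙ extract a) (symm-absorbʳ δ (suc n) j δ≤j (ℕ.s≤s j<n) ℕₚ.≤-refl f)) ⟩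
      V · extract a · symm δ (suc n) · truncation · F ≈⟨ op-cong (V ⊙ extract a ⊙ symm δ (suc n)) truncation-F ⟩
      V · extract a · symm δ (suc n) · T′ · F ≈⟨ op-cong V (extract-symm n δ δ<n a F cF) ⟩
      V · symm δ n · T′ · (hℕ a (invs (gens δ n)) * F) ≈⟨ V-symm _ ⟩
      V · T′ · (hℕ a (invs (gens δ n)) * F) ∎
    -- Here the cycle is empty and so is the alphabet. Nothing contains x_ℓ, so both sides vanish
    -- unless a = 0.
    ... | no δ≮n = begin
      V · extract a · cycle δ n · Q ≡⟨ cong (λ v → V · extract a · v) (cycle-[] δ n (ℕₚ.≮⇒≥ δ≮n) Q) ⟩
      V · extract a · Q ≈⟨ ih (V ⊙ extract a) (λ j δ≤j j<n → ⊥-elim (δ≮n (ℕₚ.≤-<-trans δ≤j j<n))) ⟩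
      V · extract a · truncation · F ≈⟨ op-cong (V ⊙ extract a) truncation-F ⟩
      V · extract a · T′ · F ≈⟨ op-cong V
        (degenerate a (T′ · F) (≈-trans (≈-sym (T-indicator (range 0 n) n isZero (range-away n) F)) (op-cong T′ cF))) ⟩
      V · (hℕ a [] * T′ · F) ≈⟨ op-cong V (≈-sym (hℕ-commutes T′ [] a F)) ⟩
      V · T′ · (hℕ a [] * F) ≡⟨ cong (λ vs → V · T′ · (hℕ a (invs vs) * F)) (gens-[] δ n (ℕₚ.≮⇒≥ δ≮n)) ⟨
      V · T′ · (hℕ a (invs (gens δ n)) * F) ∎
      where
      degenerate : ∀ a f → const n · f ≈ f → extract a · f ≈ hℕ a [] * f
      degenerate zero f e = ≈-trans (op-cong (const n) (≈-trans (*-congʳ (X-0 n)) (*-identityˡ f)))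
        (≈-trans e (≈-sym (*-identityˡ f)))
      degenerate (suc a) f e = begin
        const n · (X n (ℤ.- + suc a) * f) ≈⟨ op-cong (const n) (*-congˡ e) ⟨
        const n · (X n (ℤ.- + suc a) * const n · f) ≈⟨ diag-X-≡ n _ (ℤ.- + suc a) ℕₚ.≤-refl _ ⟩
        X n (ℤ.- + suc a) * diag n (λ z → indicator isZero (ℤ.- + suc a ℤ.+ z)) · const n · f
          ≈⟨ *-congˡ (≈-trans (diag-indicator n _ isZero f) (diag-0 n _ vanish f)) ⟩
        X n (ℤ.- + suc a) * 0# ≈⟨ zeroʳ _ ⟩
        0# ≈⟨ zeroˡ f ⟨
        0# * f ∎
        where vanish : ∀ z → indicator isZero z * indicator isZero (ℤ.- + suc a ℤ.+ z) ≈ 0#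
              vanish (+ zero) = zeroʳ 1#
              vanish (+ suc m) = zeroˡ _
              vanish -[1+ m ] = zeroˡ _

    -- The cycle produced inverses of all variables up to x_{ℓ-1}, but the row ends at the 0-based
    -- index k. `T-restrict` removes the surplus on the way down to k + 1 variables; on the way back
    -- up it is used with degree 0, where h is 1.
    restrict : T′ · (hℕ a (invs (gens δ n)) * F) ≈ T′ · (H * F)
    restrict = begin
      T′ · (hℕ a (invs (gens δ n)) * F) ≈⟨ down δ a F F-const ⟩
      T (range 0 (suc k)) · (H * F) ≈⟨ op-cong (T (range 0 (suc k))) (*-identityˡ (H * F)) ⟨
      T (range 0 (suc k)) · (hℕ 0 (invs (gens δ (suc k))) * (H * F))
        ≈⟨ down δ 0 (H * F) (λ j k<j j≤n → ≈-trans (invs-commute j _ _ (gens-away δ _ _ k<j) a F)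
          (*-congˡ (F-const j k<j j≤n))) ⟨
      T′ · (hℕ 0 (invs (gens δ n)) * (H * F)) ≈⟨ op-cong T′ (*-identityˡ (H * F)) ⟩
      T′ · (H * F) ∎
      where
      down : ∀ δ a F → (∀ j → suc k ℕ.≤ j → j ℕ.≤ n → const j · F ≈ F) →
        T′ · (hℕ a (invs (gens δ n)) * F) ≈ T (range 0 (suc k)) · (hℕ a (invs (gens δ (suc k))) * F)
      down δ a F c = subst (λ N → T (range 0 N) · (hℕ a (invs (gens δ N)) * F) ≈
        T (range 0 (suc k)) · (hℕ a (invs (gens δ (suc k))) * F))
        (ℕₚ.m∸n+n≡m k<n) (T-restrict δ (suc k) a c (n ℕ.∸ suc k)
          (ℕₚ.≤-trans (ℕₚ.≤-reflexive (ℕₚ.m∸n+n≡m k<n)) (ℕₚ.n≤1+n n)))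

    private
      H⁺ Y : P
      H⁺ = hℕ a (invs (gens (suc δ) (suc (suc k))))
      Y = X 0 g * (X 0 (+ a) * (H⁺ * rotate · F))
      T⁺ : Op (suc n)
      T⁺ = T (range 1 n)

      away₀ : Away 0 (range 1 n)
      away₀ = range-All (_≢ 0) 1 n λ j 1≤j _ e → ℕₚ.<-irrefl (sym e) 1≤j

      H⁺-preserves : Preserves 0 H⁺
      H⁺-preserves = h-closed (Preserves 0) (preserves-0 0) (preserves-1 0) (preserves-+ 0) (preserves-* 0)
        (Allₚ.map⁺ (Allˡ.map (λ {v} (δ<v , _) → preserves-X-≢ 0 v (ℤ.- + 1) λ { refl → ℕₚ.n≮0 δ<v })
          (gens-bounds (suc δ) (suc (suc k))))) (+ a)

      rotate-F : nonneg 0 · rotate · F ≈ rotate · F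
      rotate-F = ≈-trans (op-cong (nonneg 0) (≈-sym e)) (≈-trans (nonneg-const 0 _) e)
        where e : const 0 · rotate · F ≈ rotate · F
              e = ≈-trans (≈-sym (rotate-const-last F)) (op-cong rotate cF)

      Y-nonneg : nonneg 0 · Y ≈ Y
      Y-nonneg = preserves-X 0 ℕ.z≤n g g≥0 _ (preserves-X 0 ℕ.z≤n (+ a) (ℤ.+≤+ ℕ.z≤n) _ (H⁺-preserves _ rotate-F))

      -- After the rotation the truncation acts on x_2, ..., x_ℓ. The missing x_1 may be added
      -- because Y has no negative power of it, and this is where g ≥ 0 enters the step.
      T⁺-Y : truncation · Y ≈ T⁺ · Y
      T⁺-Y = subst (λ vs → T vs · Y ≈ T⁺ · Y) (sym (range-snoc 0 n))
        (T-snoc (range 1 n) 0 ℕ.z≤n (range-All (ℕ._≤ n) 1 n λ j _ j< → ℕₚ.≤-pred j<) away₀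
          (range-distinct 1 n) Y Y-nonneg)

    row-step : V · extract a · cycle δ n · Q ≈ W · truncation · Y
    row-step = begin
      V · extract a · cycle δ n · Q ≈⟨ expand ⟩
      V · T′ · (hℕ a (invs (gens δ n)) * F) ≈⟨ op-cong V restrict ⟩
      W · (X 0 g * (X 0 (+ a) * rotate · T′ · (H * F)))
        ≈⟨ op-cong WXX (rotate-T (range 0 n) (range-All (ℕ._< n) 0 n λ _ _ j<n → j<n) (H * F)) ⟩
      W · (X 0 g * (X 0 (+ a) * T (map suc (range 0 n)) · rotate · (H * F)))
        ≡⟨ cong (λ vs → W · (X 0 g * (X 0 (+ a) * T vs · rotate · (H * F)))) (range-suc 0 n) ⟩
      W · (X 0 g * (X 0 (+ a) * T⁺ · rotate · (H * F))) ≈⟨ op-cong (WXX ⊙ T⁺) (lifts-invs δ (suc k) k<n a F) ⟩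
      W · (X 0 g * (X 0 (+ a) * T⁺ · (H⁺ * rotate · F)))
        ≈⟨ op-cong (W ⊙ mulBy (X 0 g)) (T-X (range 1 n) 0 (+ a) away₀ _) ⟨
      W · (X 0 g * T⁺ · (X 0 (+ a) * (H⁺ * rotate · F))) ≈⟨ op-cong W (T-X (range 1 n) 0 g away₀ _) ⟨
      W · T⁺ · Y ≈⟨ op-cong W T⁺-Y ⟨
      W · truncation · Y ∎
      where WXX = W ⊙ mulBy (X 0 g) ⊙ mulBy (X 0 (+ a))

  -- Stated for each q-coefficient and every absorbing W. The outermost row is split by
  -- `coefq-rotate` into summands a + b = m, and each is an instance of `row-step` with the
  -- hypothesis at b.
  chain-truncation : {k : ℕ} (γ : Vec ℤ (suc k)) (ms : Vec ℕ k) → k ℕ.≤ n → All (+ 0 ℤ.≤_) γ → Admissible ms →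
    (W : Op (suc n)) → Absorbs W ms → ∀ m → W · coefq m · chain γ ms ≈ W · truncation · rowSeries γ ms m
  chain-truncation (g ∷ []) [] k≤n (g≥0 VAll.∷ _) [] W ab m =
    op-cong W (≈-trans (op-cong (coefq m) (≈-trans (mulX1-X g one) (*-identityʳ _))) (base m))
    where
    pos : ∀ j → + 0 ℤ.≤ coord (single {suc n} 0 g) j
    pos zero = g≥0
    pos (suc j) = ℤₚ.≤-reflexive (sym (coord-𝟎 {n} j))
    base : ∀ m → coefq m · X 0 g ≈ truncation · rowSeries (g ∷ []) [] m
    base zero = ≈-trans (coefq-≡ 0 (single 0 g)) (≈-sym (truncation-mono (+ 0) (single 0 g) pos))
    base (suc m) = ≈-trans (coefq-≢ (suc m) (+ 0) (single 0 g) λ ()) (≈-sym (op-0 truncation))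
  chain-truncation {suc k} (g ∷ g′ ∷ gs) (.(suc δ) ∷ ms) k<n (g≥0 VAll.∷ γ≥0) (cons {δ} hb adm) W ab m = begin
    W · coefq m · mulX1 g (Φ D)
      ≈⟨ op-cong (W ⊙ coefq m) (≈-trans (mulX1-X g (Φ D)) (*-congˡ (≈-reflexive (sym (rotate-def D))))) ⟩
    W · coefq m · (X 0 g * rotate · D) ≈⟨ op-cong W (coefq-X m 0 g (rotate · D)) ⟩
    W · (X 0 g * coefq m · rotate · D)
      ≈⟨ op-cong (W ⊙ mulBy (X 0 g))
      (coefq-rotate m D (demWord-nonneg (cWord (suc δ)) (chain-nonneg (g′ ∷ gs) ms γ≥0))) ⟩
    W · (X 0 g * conv (λ a b → X 0 (+ a) * rotate · extract a · coefq b · D) m) ≈⟨ op-conv (W ⊙ mulBy (X 0 g)) _ m ⟩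
    conv (λ a b → W · (X 0 g * (X 0 (+ a) * rotate · extract a · coefq b · D))) m ≈⟨ conv-cong term≈ m ⟩
    conv (λ a b → W · truncation ·
      (X 0 g * (X 0 (+ a) * (hℕ a (invs (gens (suc δ) (suc (suc k)))) * rotate · rowSeries (g′ ∷ gs) ms b)))) m
      ≈⟨ op-conv (W ⊙ truncation ⊙ mulBy (X 0 g)) _ m ⟨
    W · truncation · rowSeries (g ∷ g′ ∷ gs) (suc δ ∷ ms) m ∎
    where
    open ≈-R
    C D : P
    C = chain (g′ ∷ gs) ms
    D = demWord (cWord (suc δ)) C
    term≈ : ∀ a b → W · (X 0 g * (X 0 (+ a) * rotate · extract a · coefq b · D))
      ≈ W · truncation · (X 0 g *
        (X 0 (+ a) * (hℕ a (invs (gens (suc δ) (suc (suc k)))) * rotate · rowSeries (g′ ∷ gs) ms b)))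
    term≈ a b = ≈-trans (op-cong (W ⊙ mulBy (X 0 g) ⊙ mulBy (X 0 (+ a)) ⊙ rotate ⊙ extract a)
        (≈-trans (≈-reflexive (cong (coefq b ·_) (demWord-cWord δ C)))
          (coefq-πs b (gens δ n) (Allˡ.map proj₂ (gens-bounds δ n)) C)))
      (Step.row-step k<n g g≥0 δ W ab a (coefq b · C) (rowSeries (g′ ∷ gs) ms b)
        (λ j → rowSeries-const (g′ ∷ gs) ms b j)
        (λ W′ ab′ → chain-truncation (g′ ∷ gs) ms (ℕₚ.<⇒≤ k<n) γ≥0 adm W′ (absorbs-head δ ms W′ hb ab′) b))

filter-∷ : {A : Set} {Q : A → Set} (Q? : Decidable Q) (a : A) (as : List A) →
  filter Q? (a ∷ as) ≡ (if does (Q? a) then a ∷ filter Q? as else filter Q? as)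
filter-∷ Q? a as with does (Q? a)
... | true = refl
... | false = refl

-- Key expansions

coord-nonneg : {ℓ : ℕ} {α : Exp ℓ} → All (+ 0 ℤ.≤_) α → ∀ k → + 0 ℤ.≤ coord α k
coord-nonneg VAll.[] k = ℤₚ.≤-refl
coord-nonneg (p VAll.∷ ps) zero = p
coord-nonneg (p VAll.∷ ps) (suc k) = coord-nonneg ps k

nonneg-coord : {ℓ : ℕ} (α : Exp ℓ) → (∀ k → + 0 ℤ.≤ coord α k) → All (+ 0 ℤ.≤_) α
nonneg-coord [] h = VAll.[]
nonneg-coord (a ∷ α) h = h 0 VAll.∷ nonneg-coord α (h ∘ suc)

decreasing-nonneg : {m : ℕ} (β : Exp (suc m)) → WeaklyDecreasing β → + 0 ℤ.≤ coord β m → ∀ k → + 0 ℤ.≤ coord β k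
decreasing-nonneg (b ∷ []) _ h zero = h
decreasing-nonneg (b ∷ []) _ h (suc k) = ℤₚ.≤-refl
decreasing-nonneg (b ∷ c ∷ β) (c≤b , dec) h zero = ℤₚ.≤-trans (decreasing-nonneg (c ∷ β) dec h 0) c≤b
decreasing-nonneg (b ∷ c ∷ β) (c≤b , dec) h (suc k) = decreasing-nonneg (c ∷ β) dec h k

module _ {n : ℕ} where
  hAct-nonneg : (i : Fin n) (α : Exp (suc n)) →
    ((∀ k → + 0 ℤ.≤ coord α k) → ∀ k → + 0 ℤ.≤ coord (hAct i α) k) ×
    ((∀ k → + 0 ℤ.≤ coord (hAct i α) k) → ∀ k → + 0 ℤ.≤ coord α k)
  hAct-nonneg i α with does (lookup α (suc i) ℤ.≤? lookup α (inject₁ i))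
  ... | false = id , id
  ... | true = fwd , bwd
    where
    a b : ℤ
    a = lookup α (inject₁ i)
    b = lookup α (suc i)
    fwd : (∀ k → + 0 ℤ.≤ coord α k) → ∀ k → + 0 ℤ.≤ coord (set2 i b a α) k
    fwd h k with position i k
    ... | left refl = subst (+ 0 ℤ.≤_) (sym (trans (coord-set2₁ i b a α) (lookup-coord₂ i α))) (h _)
    ... | right refl = subst (+ 0 ℤ.≤_) (sym (trans (coord-set2₂ i b a α) (lookup-coord₁ i α))) (h _)
    ... | away p q = subst (+ 0 ℤ.≤_) (sym (coord-set2-≢ i b a α k p q)) (h k)
    bwd : (∀ k → + 0 ℤ.≤ coord (set2 i b a α) k) → ∀ k → + 0 ℤ.≤ coord α k
    bwd h k with position i k
    ... | left refl = subst (+ 0 ℤ.≤_) (trans (coord-set2₂ i b a α) (lookup-coord₁ i α)) (h (suc (toℕ i)))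
    ... | right refl = subst (+ 0 ℤ.≤_) (trans (coord-set2₁ i b a α) (lookup-coord₂ i α)) (h (toℕ i))
    ... | away p q = subst (+ 0 ℤ.≤_) (coord-set2-≢ i b a α k p q) (h k)

  act-nonneg : (u : Word n) (α : Exp (suc n)) →
    ((∀ k → + 0 ℤ.≤ coord α k) → ∀ k → + 0 ℤ.≤ coord (act u α) k) ×
    ((∀ k → + 0 ℤ.≤ coord (act u α) k) → ∀ k → + 0 ℤ.≤ coord α k)
  act-nonneg [] α = id , id
  act-nonneg (i ∷ u) α = proj₁ (hAct-nonneg i (act u α)) ∘ proj₁ (act-nonneg u α) , proj₂ (act-nonneg u α) ∘ proj₂
    (hAct-nonneg i (act u α))

  open LaurentRing (suc n)
  open Operators {suc n}
  open Variables {suc n}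
  open PolySolver (suc n) using (solve; _:+_; _:*_; :-_; _:-_; con; _:=_)

  private
    P : Set
    P = Poly (suc n)

  truncation-π : (i : Fin n) (f : P) → truncation · π i · f ≈ π i · truncation · f
  truncation-π i f = subst (λ vs → T vs · π i · f ≈ π i · T vs · f) (sym (range-downFrom (suc n)))
    (Symmetric.commutesT-downFrom i (suc n) (ℕ.s≤s (toℕ< i)) f)

  truncation-demOp : (u : Word n) (f : P) → truncation · demOp u · f ≈ demOp u · truncation · f
  truncation-demOp [] f = ≈-refl
  truncation-demOp (i ∷ u) f = ≈-trans (truncation-π i (demOp u · f)) (op-cong (π i) (truncation-demOp u f))

  truncation-negative : (d : ℤ) (β : Exp (suc n)) → ¬ (+ 0 ℤ.≤ coord β n) → truncation · mono d β ≈ 0#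
  truncation-negative d β neg = ≈-trans (≈-sym (T-nonneg n (range 0 n) ℕₚ.≤-refl (range-away n) (mono d β)))
    (≈-trans (op-cong truncation
      (≈-trans (diag-mono n _ d β) (≈-trans (*-congʳ (false-ind (coord β n) neg)) (zeroˡ _)))) (op-0 truncation))
    where false-ind : ∀ z → ¬ (+ 0 ℤ.≤ z) → indicator isNonneg z ≈ 0#
          false-ind (+ m) h = ⊥-elim (h (ℤ.+≤+ ℕ.z≤n))
          false-ind -[1+ m ] h = ≈-refl

  -- Commutation with π_u leaves only x^β. The action of u permutes entries, so α is nonnegative
  -- exactly when β is; and since β decreases, a negative entry anywhere forces its last entry to be
  -- negative.
  truncation-key : (t : KeyTerm n) → let open KeyTerm t in
    truncation · demWord u (monomial β) ≈ (if nonneg? α then demWord u (monomial β) else 0#)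
  truncation-key t = ≈-trans
    (≈-trans (op-cong truncation (≈-reflexive (sym (demOp-demWord u (monomial β))))) (truncation-demOp u (monomial β)))
    (cases (VAll.all? (λ z → + 0 ℤ.≤? z) α))
    where
    open KeyTerm t
    cases : (dec : Dec (All (+ 0 ℤ.≤_) α)) →
      demOp u · truncation · monomial β ≈ (if does dec then demWord u (monomial β) else 0#)
    cases (yes α≥) = ≈-trans (op-cong (demOp u) (truncation-mono (+ 0) β
        (proj₂ (act-nonneg u β) (subst (λ α → ∀ k → + 0 ℤ.≤ coord α k) (sym u-act) (coord-nonneg α≥)))))
      (≈-reflexive (demOp-demWord u (monomial β)))
    cases (no α≱) = ≈-trans (op-cong (demOp u) (truncation-negative (+ 0) β λ βn≥ →
        α≱ (nonneg-coord α (subst (λ α → ∀ k → + 0 ℤ.≤ coord α k) u-act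
          (proj₁ (act-nonneg u β) (decreasing-nonneg β β-dec βn≥))))))
      (op-0 (demOp u))

  truncation-polyPart : (E : KeyExpansion n) → truncation · ⟦ E ⟧K ≈ polyPart E
  truncation-polyPart [] = op-0 truncation
  truncation-polyPart (t ∷ E) =
    ≈-trans (≈-trans (op-cong truncation (≈-reflexive (+-def _ ⟦ E ⟧K))) (≈-trans (op-+ truncation _ ⟦ E ⟧K)
      (+-cong (≈-trans (op-scale truncation kcoef κ) (scale-cong (truncation-key t))) (truncation-polyPart E))))
    (≈-trans (cases (nonneg? α))
      (≈-reflexive (cong ⟦_⟧K (sym (filter-∷ (λ t → nonneg? (KeyTerm.α t) Data.Bool.≟ true) t E)))))
    where
    open KeyTerm t
    κ : P
    κ = demWord u (monomial β)
    scale-cong : ∀ {f g} → f ≈ g → scale kcoef f ≈ scale kcoef g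
    scale-cong {f} {g} e = mk≈ λ F →
      trans (ev-scale F kcoef f) (trans (cong (kcoef ℤ.*_) (at e F)) (sym (ev-scale F kcoef g)))
    cases : ∀ b → scale kcoef (if b then κ else 0#) + polyPart E
      ≈ ⟦ (if does (b Data.Bool.≟ true) then t ∷ filter (λ t → nonneg? (KeyTerm.α t) Data.Bool.≟ true) E else filter
        (λ t → nonneg? (KeyTerm.α t) Data.Bool.≟ true) E) ⟧K
    cases true = ≈-reflexive (sym (+-def (scale kcoef κ) (polyPart E)))
    cases false = +-identityˡ (polyPart E)

-- Root ideals

-- In a row that is closed to the right and starts beyond the diagonal i, the nonroots from i on
-- form an initial segment, so their number locates the first root. The induction runs over the
-- columns s, ..., s + m - 1. The count starts from s once s has passed i and from i before that,
-- hence the two conclusions.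
count-threshold : {N : ℕ} (b : Fin N → Bool) (i : ℕ) → (∀ j → b j ≡ true → i ℕ.< toℕ j) →
  (∀ j j′ → toℕ j ℕ.≤ toℕ j′ → b j ≡ true → b j′ ≡ true) →
  {Q : Fin N → Set} (Q? : Decidable Q) → (∀ j → does (Q? j) ≡ does (i ℕ.≤? toℕ j) ∧ not (b j)) →
  (m s : ℕ) (f : Fin m → Fin N) → (∀ j → toℕ (f j) ≡ s ℕ.+ toℕ j) → i ℕ.≤ s ℕ.+ m →
  let c = length (filter Q? (tabulate f)) in
  (i ℕ.≤ s → s ℕ.+ c ℕ.≤ s ℕ.+ m × (∀ j → does (s ℕ.+ c ℕ.≤? toℕ (f j)) ≡ b (f j))) ×
  (s ℕ.≤ i → i ℕ.+ c ℕ.≤ s ℕ.+ m × (∀ j → does (i ℕ.+ c ℕ.≤? toℕ (f j)) ≡ b (f j)))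
count-threshold b i above upper Q? Q≡ zero s f f≡ i≤ =
  (λ i≤s → ℕₚ.≤-refl , λ ()) , (λ s≤i → ℕₚ.≤-trans (ℕₚ.≤-reflexive (ℕₚ.+-identityʳ i)) i≤ , λ ())
count-threshold {N} b i above upper Q? Q≡ (suc m) s f f≡ i≤ = part₁ , part₂
  where
  rest : List (Fin N)
  rest = filter Q? (tabulate (f ∘ suc))
  s≡ : toℕ (f zero) ≡ s
  s≡ = trans (f≡ zero) (ℕₚ.+-identityʳ s)
  ih = count-threshold b i above upper Q? Q≡ m (suc s) (f ∘ suc) (λ j → trans (f≡ (suc j)) (ℕₚ.+-suc s (toℕ j)))
    (subst (i ℕ.≤_) (ℕₚ.+-suc s m) i≤)
  head : does (Q? (f zero)) ≡ does (i ℕ.≤? s) ∧ not (b (f zero))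
  head = trans (Q≡ (f zero)) (cong (λ z → does (i ℕ.≤? z) ∧ not (b (f zero))) s≡)
  split : ∀ v → does (Q? (f zero)) ≡ v →
    length (filter Q? (tabulate f)) ≡ (if v then suc (length rest) else length rest)
  split v e = trans (cong length (filter-∷ Q? (f zero) (tabulate (f ∘ suc))))
    (trans (cong (λ v → length (if v then f zero ∷ rest else rest)) e) (length-if v))
    where length-if : ∀ v → length (if v then f zero ∷ rest else rest) ≡ (if v then suc (length rest) else length rest)
          length-if true = refl
          length-if false = refl
  none : ∀ {k} (g : Fin k → Fin N) → (∀ j → b (g j) ≡ true) → filter Q? (tabulate g) ≡ []
  none {zero} g all = refl
  none {suc k} g all with does (Q? (g zero)) | trans (Q≡ (g zero))
    (trans (cong (λ v → does (i ℕ.≤? toℕ (g zero)) ∧ not v) (all zero)) (and-false (does (i ℕ.≤? toℕ (g zero)))))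
    where and-false : ∀ v → v ∧ false ≡ false
          and-false true = refl
          and-false false = refl
  ... | false | _ = none (g ∘ suc) (all ∘ suc)
  part₁ : i ℕ.≤ s → let c = length (filter Q? (tabulate f)) in s ℕ.+ c ℕ.≤ s ℕ.+ suc m × (∀ j →
    does (s ℕ.+ c ℕ.≤? toℕ (f j)) ≡ b (f j))
  part₁ i≤s with b (f zero) in b₀
  ... | true = subst (λ c → s ℕ.+ c ℕ.≤ s ℕ.+ suc m × (∀ j → does (s ℕ.+ c ℕ.≤? toℕ (f j)) ≡ b (f j)))
    (sym (cong length (none f all)))
      (ℕₚ.+-monoʳ-≤ s ℕ.z≤n , λ j →
        trans (dec-true (s ℕ.+ 0 ℕ.≤? toℕ (f j)) (ℕₚ.≤-trans (ℕₚ.≤-reflexive (ℕₚ.+-identityʳ s)) (s≤ j))) (sym (all j)))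
    where
    s≤ : ∀ j → s ℕ.≤ toℕ (f j)
    s≤ j = subst (s ℕ.≤_) (sym (f≡ j)) (ℕₚ.m≤m+n s (toℕ j))
    all : ∀ j → b (f j) ≡ true
    all j = upper (f zero) (f j) (ℕₚ.≤-trans (ℕₚ.≤-reflexive s≡) (s≤ j)) b₀
  ... | false = subst (λ c → s ℕ.+ c ℕ.≤ s ℕ.+ suc m × (∀ j → does (s ℕ.+ c ℕ.≤? toℕ (f j)) ≡ b (f j)))
      (sym (split true (trans head (cong₂ (λ u v → u ∧ not v) (dec-true (i ℕ.≤? s) i≤s) b₀))))
      (subst₂′ (sym (ℕₚ.+-suc s (length rest))) (sym (ℕₚ.+-suc s m)) (proj₁ ih₁) , λ
        { zero → trans (dec-false (s ℕ.+ suc (length rest) ℕ.≤? toℕ (f zero))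
            (λ le → ℕₚ.m+1+n≰m s (subst (s ℕ.+ suc (length rest) ℕ.≤_) s≡ le))) (sym b₀)
        ; (suc j) → trans (cong (λ z → does (z ℕ.≤? toℕ (f (suc j)))) (ℕₚ.+-suc s (length rest))) (proj₂ ih₁ j) })
    where
    ih₁ = proj₁ ih (ℕₚ.m≤n⇒m≤1+n i≤s)
    subst₂′ : ∀ {a a′ c c′} → a ≡ a′ → c ≡ c′ → a ℕ.≤ c → a′ ℕ.≤ c′
    subst₂′ refl refl h = h
  part₂ : s ℕ.≤ i → let c = length (filter Q? (tabulate f)) in i ℕ.+ c ℕ.≤ s ℕ.+ suc m × (∀ j →
    does (i ℕ.+ c ℕ.≤? toℕ (f j)) ≡ b (f j))
  part₂ s≤i with s ℕ.≟ i
  ... | yes refl = part₁ ℕₚ.≤-refl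
  ... | no s≢i = subst (λ c → i ℕ.+ c ℕ.≤ s ℕ.+ suc m × (∀ j → does (i ℕ.+ c ℕ.≤? toℕ (f j)) ≡ b (f j)))
      (sym (split false (trans head (cong (_∧ not (b (f zero))) (dec-false (i ℕ.≤? s) (ℕₚ.<⇒≱ s<i))))))
      (subst (i ℕ.+ length rest ℕ.≤_) (sym (ℕₚ.+-suc s m)) (proj₁ ih₂) , λ
        { zero → trans (dec-false (i ℕ.+ length rest ℕ.≤? toℕ (f zero))
            (λ le → ℕₚ.<⇒≱ s<i (ℕₚ.≤-trans (ℕₚ.m≤m+n i (length rest)) (subst (i ℕ.+ length rest ℕ.≤_) s≡ le)))) (sym b₀)
        ; (suc j) → proj₂ ih₂ j })
    where
    s<i : s ℕ.< i
    s<i = ℕₚ.≤∧≢⇒< s≤i s≢i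
    ih₂ = proj₂ ih s<i
    b₀ : b (f zero) ≡ false
    b₀ with b (f zero) in e
    ... | false = refl
    ... | true = ⊥-elim (ℕₚ.<⇒≱ s<i (ℕₚ.<⇒≤ (subst (i ℕ.<_) s≡ (above (f zero) e))))

module RootIdeal {n : ℕ} (Ψ : Fin (suc n) → Fin (suc n) → Bool) (ideal : IsRootIdeal Ψ) where
  private
    threshold : (i : Fin n) → toℕ i ℕ.+ nr Ψ i ℕ.≤ suc n × (∀ j → does (toℕ i ℕ.+ nr Ψ i ℕ.≤? toℕ j) ≡ Ψ (inject₁ i) j)
    threshold i = proj₂ (count-threshold (Ψ (inject₁ i)) (toℕ i)
      (λ j e → subst (ℕ._< toℕ j) (Finₚ.toℕ-inject₁ i) (proj₁ ideal (inject₁ i) j e))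
      (λ j j′ le e → proj₂ ideal (inject₁ i) j (inject₁ i) j′ e ℕₚ.≤-refl le)
      (λ j → (does (toℕ i ℕ.≤? toℕ j) ∧ not (Ψ (inject₁ i) j)) Data.Bool.≟ true) (λ j → does-≟true _)
      (suc n) 0 id (λ _ → refl) (ℕₚ.<⇒≤ (ℕₚ.m≤n⇒m≤1+n (toℕ< i)))) ℕ.z≤n
      where does-≟true : ∀ b → does (b Data.Bool.≟ true) ≡ b
            does-≟true true = refl
            does-≟true false = refl

  nr-bound : (i : Fin n) → toℕ i ℕ.+ nr Ψ i ℕ.≤ suc n
  nr-bound i = proj₁ (threshold i)

  root-≥ : (i : Fin n) (j : Fin (suc n)) → does (toℕ i ℕ.+ nr Ψ i ℕ.≤? toℕ j) ≡ Ψ (inject₁ i) j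
  root-≥ i = proj₂ (threshold i)

  nr-positive : (i : Fin n) → nr Ψ i ≢ 0
  nr-positive i e = ℕₚ.<-irrefl refl (proj₁ ideal (inject₁ i) (inject₁ i)
    (trans (sym (root-≥ i (inject₁ i))) (dec-true (toℕ i ℕ.+ nr Ψ i ℕ.≤? toℕ (inject₁ i))
      (ℕₚ.≤-reflexive (trans (trans (cong (toℕ i ℕ.+_) e) (ℕₚ.+-identityʳ (toℕ i))) (sym (Finₚ.toℕ-inject₁ i)))))))

  -- If row i+1 has a root, its first column is also a root of row i by the ideal property. If it
  -- has none, the general bound on row i suffices.
  nr-next : (i j : Fin n) → toℕ j ≡ suc (toℕ i) → nr Ψ i ℕ.≤ suc (nr Ψ j)
  nr-next i j adj with suc (toℕ i) ℕ.+ nr Ψ j ℕ.<? suc n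
  ... | no end = ℕₚ.+-cancelˡ-≤ (toℕ i) _ _
    (ℕₚ.≤-trans (nr-bound i) (ℕₚ.≤-trans (ℕₚ.≮⇒≥ end) (ℕₚ.≤-reflexive (sym (ℕₚ.+-suc (toℕ i) (nr Ψ j))))))
  ... | yes lt = ℕₚ.+-cancelˡ-≤ (toℕ i) _ _
    (ℕₚ.≤-trans (does-true (toℕ i ℕ.+ nr Ψ i ℕ.≤? toℕ c) (trans (root-≥ i c) root-i))
      (ℕₚ.≤-reflexive (trans (Finₚ.toℕ-fromℕ< lt) (sym (ℕₚ.+-suc (toℕ i) (nr Ψ j))))))
    where
    c : Fin (suc n)
    c = F.fromℕ< lt
    root-j : Ψ (inject₁ j) c ≡ true
    root-j = trans (sym (root-≥ j c))
      (dec-true (toℕ j ℕ.+ nr Ψ j ℕ.≤? toℕ c)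
      (ℕₚ.≤-reflexive (trans (cong (ℕ._+ nr Ψ j) adj) (sym (Finₚ.toℕ-fromℕ< lt)))))
    root-i : Ψ (inject₁ i) c ≡ true
    root-i = proj₂ ideal (inject₁ j) c (inject₁ i) c root-j
      (ℕₚ.≤-trans (ℕₚ.≤-reflexive (Finₚ.toℕ-inject₁ i))
        (ℕₚ.≤-trans (ℕₚ.n≤1+n (toℕ i)) (ℕₚ.≤-reflexive (trans (sym adj) (sym (Finₚ.toℕ-inject₁ j)))))) ℕₚ.≤-refl
    does-true : ∀ {A : Set} (d : Dec A) → does d ≡ true → A
    does-true (yes a) _ = a

  admissible : {k : ℕ} (r : ℕ) (e : Fin k → Fin n) → (∀ j → toℕ (e j) ≡ r ℕ.+ toℕ j) →
    Admissible (V.tabulate (nr Ψ ∘ e))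
  admissible {zero} r e e≡ = []
  admissible {suc k} r e e≡ with nr Ψ (e zero) in eq
  ... | zero = ⊥-elim (nr-positive (e zero) eq)
  ... | suc δ = cons (bound e e≡ eq) (admissible (suc r) (e ∘ suc) (λ j → trans (e≡ (suc j)) (ℕₚ.+-suc r (toℕ j))))
    where
    bound : {k : ℕ} (e : Fin (suc k) → Fin n) → (∀ j → toℕ (e j) ≡ r ℕ.+ toℕ j) → nr Ψ (e zero) ≡ suc δ →
      HeadBound δ (V.tabulate (nr Ψ ∘ e ∘ suc))
    bound {zero} e e≡ eq = tt
    bound {suc k} e e≡ eq = ℕₚ.≤-pred (subst (ℕ._≤ suc (nr Ψ (e (suc zero)))) eq (nr-next (e zero) (e (suc zero))
      (trans (e≡ (suc zero)) (trans (ℕₚ.+-suc r 0) (cong suc (sym (e≡ zero)))))))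

-- The Catalan series as a product over rows.

filter-does : {A : Set} {Q Q′ : A → Set} (Q? : Decidable Q) (Q′? : Decidable Q′) → (∀ a → does (Q? a) ≡ does (Q′? a)) →
  ∀ as → filter Q? as ≡ filter Q′? as
filter-does Q? Q′? e [] = refl
filter-does Q? Q′? e (a ∷ as) = trans (filter-∷ Q? a as)
  (trans (cong₂ (λ v bs → if v then a ∷ bs else bs) (e a) (filter-does Q? Q′? e as)) (sym (filter-∷ Q′? a as)))

module _ {n : ℕ} where
  open LaurentRing (suc n)
  open Operators {suc n}
  open Variables {suc n}
  open PolySolver (suc n) using (solve; _:+_; _:*_; :-_; _:-_; con; _:=_)

  private
    P : Set
    P = Poly (suc n)

  conv-+ : (G G′ : ℕ → ℕ → P) (m : ℕ) → conv (λ a b → G a b + G′ a b) m ≈ conv G m + conv G′ m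
  conv-+ G G′ zero = ≈-refl
  conv-+ G G′ (suc m) = ≈-trans (+-congˡ (conv-+ (λ a b → G (suc a) b) (λ a b → G′ (suc a) b) m)) (lem _ _ _ _)
    where lem = solve 4 (λ a b c d → a :+ b :+ (c :+ d) := a :+ c :+ (b :+ d)) ≈-refl

  product-conv : (f g : Series (suc n)) (m : ℕ) → (f *S g) m ≈ conv (λ a b → f a * g b) m
  product-conv f g zero =
    ≈-trans (≈-reflexive (+-def (mulP (f 0) (g 0)) [])) (≈-trans (+-identityʳ _) (≈-reflexive (*-def (f 0) (g 0))))
  product-conv f g (suc m) = ≈-trans
    (≈-trans (≈-reflexive (+-def (mulP (f 0) (g (suc m))) _)) (+-cong (≈-reflexive (*-def (f 0) (g (suc m))))
      (≈-reflexive (trans (cong (concatMap G) (sym (Listₚ.map-upTo suc (suc m))))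
        (Listₚ.concatMap-map G suc (upTo (suc m)))))))
    (+-congˡ (product-conv (f ∘ suc) g m))
    where G : ℕ → P
          G a = mulP (f a) (g (suc m ℕ.∸ a))

  hℕ-cong-tail : {v : P} {vs ws : List P} → (∀ a → hℕ a vs ≈ hℕ a ws) → ∀ a → hℕ a (v ∷ vs) ≈ hℕ a (v ∷ ws)
  hℕ-cong-tail e zero = ≈-refl
  hℕ-cong-tail e (suc a) = +-cong (*-congˡ (hℕ-cong-tail e a)) (e (suc a))

  hℕ-∷ʳ : (vs : List P) (w : P) (a : ℕ) → hℕ a (vs ++ w ∷ []) ≈ hℕ a (w ∷ vs)
  hℕ-∷ʳ vs w zero = ≈-refl
  hℕ-∷ʳ vs w (suc a) = ≈-trans (hℕ-snoc a vs w) (+-congʳ (*-congˡ (hℕ-∷ʳ vs w a)))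

  -- The roots of a row are listed by increasing column, whereas `gens` decreases; h does not depend
  -- on the order.
  hℕ-reverse : {A : Set} (φ : A → P) (js : List A) (a : ℕ) → hℕ a (map φ (reverse js)) ≈ hℕ a (map φ js)
  hℕ-reverse φ [] a = ≈-refl
  hℕ-reverse φ (j ∷ js) a =
    ≈-trans (≈-reflexive (cong (hℕ a)
    (trans (cong (map φ) (Listₚ.unfold-reverse j js)) (Listₚ.map-++ φ (reverse js) (j ∷ [])))))
    (≈-trans (hℕ-∷ʳ (map φ (reverse js)) (φ j) a) (hℕ-cong-tail (hℕ-reverse φ js) a))

  hℕ-scale : (k : ℕ) (js : List ℕ) (a : ℕ) → hℕ a (map (λ j → x k * x⁻ j) js) ≈ X k (+ a) * hℕ a (invs js)
  hℕ-scale k js zero = ≈-sym (≈-trans (*-congʳ (X-0 k)) (*-identityˡ 1#))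
  hℕ-scale k [] (suc a) = ≈-sym (zeroʳ _)
  hℕ-scale k (j ∷ js) (suc a) = begin
    x k * x⁻ j * hℕ a (map (λ j → x k * x⁻ j) (j ∷ js)) + hℕ (suc a) (map (λ j → x k * x⁻ j) js)
      ≈⟨ +-cong (*-congˡ (hℕ-scale k (j ∷ js) a)) (hℕ-scale k js (suc a)) ⟩
    x k * x⁻ j * (X k (+ a) * hℕ a (invs (j ∷ js))) + X k (+ suc a) * hℕ (suc a) (invs js)
      ≈⟨ +-congˡ (*-congʳ (≈-sym (X-+ k (+ 1) (+ a)))) ⟩
    x k * x⁻ j * (X k (+ a) * hℕ a (invs (j ∷ js))) + x k * X k (+ a) * hℕ (suc a) (invs js)
      ≈⟨ lem (x k) (x⁻ j) (X k (+ a)) _ _ ⟩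
    x k * X k (+ a) * (x⁻ j * hℕ a (invs (j ∷ js)) + hℕ (suc a) (invs js)) ≈⟨ *-congʳ (X-+ k (+ 1) (+ a)) ⟩
    X k (+ suc a) * hℕ (suc a) (invs (j ∷ js)) ∎
    where open ≈-R
          lem = solve 5 (λ u v w c d → u :* v :* (w :* c) :+ u :* w :* d := u :* w :* (v :* c :+ d)) ≈-refl

  -- The series of one row

  geom-X : (i j : Fin (suc n)) → i ≢ j → ∀ m → geom i j m ≈ X (toℕ i) (+ m) * X (toℕ j) (ℤ.- + m)
  geom-X i j i≢j m = ≈-sym
    (≈-trans (mono-* (+ 0) (+ 0) (single (toℕ i) (+ m)) (single (toℕ j) (ℤ.- + m)))
    (mono-cong refl (coord-ext _ _ λ k → cases k (k ℕ.<? suc n))))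
    where
    entry : Fin (suc n) → ℤ
    entry k = if does (k F.≟ i) then + m else if does (k F.≟ j) then ℤ.- (+ m) else + 0
    coord-tabulate : ∀ {N} (g : Fin N → ℤ) (k : Fin N) → coord (V.tabulate g) (toℕ k) ≡ g k
    coord-tabulate g zero = refl
    coord-tabulate g (suc k) = coord-tabulate (g ∘ suc) k
    α : Exp (suc n)
    α = single (toℕ i) (+ m) ⊞ single (toℕ j) (ℤ.- + m)
    at-fin : ∀ k → coord α (toℕ k) ≡ entry k
    at-fin k with k F.≟ i | k F.≟ j
    ... | yes refl | yes refl = ⊥-elim (i≢j refl)
    ... | yes refl | no k≢j =
      trans (single-⊞ (toℕ k) (+ m) _ (Finₚ.toℕ<n k))
      (trans (cong (λ z → + m ℤ.+ z) (coord-single-≢ {suc n} (toℕ j) (toℕ k) _ (k≢j ∘ Finₚ.toℕ-injective)))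
      (ℤₚ.+-identityʳ (+ m)))
    ... | no k≢i | yes refl =
      trans (single-⊞-≢ {suc n} (toℕ i) (toℕ k) (+ m) (single (toℕ k) (ℤ.- + m)) (k≢i ∘ Finₚ.toℕ-injective))
      (coord-single {suc n} (toℕ k) (ℤ.- + m) (Finₚ.toℕ<n k))
    ... | no k≢i | no k≢j =
      trans (single-⊞-≢ {suc n} (toℕ i) (toℕ k) (+ m) (single (toℕ j) (ℤ.- + m)) (k≢i ∘ Finₚ.toℕ-injective))
      (coord-single-≢ {suc n} (toℕ j) (toℕ k) (ℤ.- + m) (k≢j ∘ Finₚ.toℕ-injective))
    cases : ∀ k → Dec (k ℕ.< suc n) → coord α k ≡ coord (V.tabulate entry) k
    cases k (yes k<) = subst (λ k → coord α k ≡ coord (V.tabulate entry) k) (Finₚ.toℕ-fromℕ< k<)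
      (trans (at-fin (F.fromℕ< k<)) (sym (coord-tabulate entry (F.fromℕ< k<))))
    cases k (no k≮) = trans (coord-past α k (ℕₚ.≮⇒≥ k≮)) (sym (coord-past (V.tabulate entry) k (ℕₚ.≮⇒≥ k≮)))

  private
    ratio : Fin (suc n) → Fin (suc n) → P
    ratio i j = x (toℕ i) * x⁻ (toℕ j)

  geom-suc : (i j : Fin (suc n)) → i ≢ j → ∀ m → geom i j (suc m) ≈ ratio i j * geom i j m
  geom-suc i j i≢j m = begin
    geom i j (suc m) ≈⟨ geom-X i j i≢j (suc m) ⟩
    X k (+ suc m) * X l (ℤ.- + suc m)
      ≈⟨ *-cong (X-+ k (+ 1) (+ m))
      (≈-trans (X-+ l (ℤ.- + 1) (ℤ.- + m)) (mono-cong refl (cong (single l) (sym (ℤₚ.neg-distrib-+ (+ 1) (+ m)))))) ⟨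
    x k * X k (+ m) * (x⁻ l * X l (ℤ.- + m)) ≈⟨ lem _ _ _ _ ⟩
    x k * x⁻ l * (X k (+ m) * X l (ℤ.- + m)) ≈⟨ *-congˡ (geom-X i j i≢j m) ⟨
    ratio i j * geom i j m ∎
    where
    open ≈-R
    k = toℕ i
    l = toℕ j
    lem = solve 4 (λ a b c d → a :* b :* (c :* d) := a :* c :* (b :* d)) ≈-refl

  geom-0 : (i j : Fin (suc n)) → i ≢ j → geom i j 0 ≈ 1#
  geom-0 i j i≢j = ≈-trans (geom-X i j i≢j 0) (≈-trans (*-cong (X-0 _) (X-0 _)) (*-identityˡ 1#))

  geom-*S-suc : (i j : Fin (suc n)) → i ≢ j →
    ∀ s m → (geom i j *S s) (suc m) ≈ s (suc m) + ratio i j * (geom i j *S s) m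
  geom-*S-suc i j i≢j s m = begin
    (geom i j *S s) (suc m) ≈⟨ product-conv (geom i j) s (suc m) ⟩
    geom i j 0 * s (suc m) + conv (λ a b → geom i j (suc a) * s b) m
      ≈⟨ +-cong (≈-trans (*-congʳ (geom-0 i j i≢j)) (*-identityˡ _))
        (conv-cong (λ a b → ≈-trans (*-congʳ (geom-suc i j i≢j a)) (*-assoc _ _ _)) m) ⟩
    s (suc m) + conv (λ a b → ratio i j * (geom i j a * s b)) m
      ≈⟨ +-congˡ (op-conv (mulBy (ratio i j)) (λ a b → geom i j a * s b) m) ⟨
    s (suc m) + ratio i j * conv (λ a b → geom i j a * s b) m ≈⟨ +-congˡ (*-congˡ (product-conv (geom i j) s m)) ⟨
    s (suc m) + ratio i j * (geom i j *S s) m ∎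
    where open ≈-R

  -- Multiplication by a geometric series obeys, coefficient by coefficient, the recursion of h in
  -- its first letter. The coefficient of q^a in the product over a row is therefore h_a of the
  -- ratios x_i/x_j.
  row-conv : (i : Fin (suc n)) (js : List (Fin (suc n))) →
    Allˡ (i ≢_) js → (s s′ : Series (suc n)) → (∀ m → s m ≈ s′ m) → ∀ m →
    foldr (λ j s → geom i j *S s) s js m ≈ conv (λ a b → hℕ a (map (ratio i) js) * s′ b) m
  row-conv i [] [] s s′ e zero = ≈-trans (e 0) (≈-sym (*-identityˡ _))
  row-conv i [] [] s s′ e (suc m) =
    ≈-trans (e (suc m)) (≈-sym (≈-trans (+-cong (*-identityˡ _) (conv-0 _ m λ a b _ → zeroˡ _)) (+-identityʳ _)))
  row-conv i (j ∷ js) (i≢j ∷ aw) s s′ e zero = begin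
    (geom i j *S t) 0 ≈⟨ product-conv (geom i j) t 0 ⟩
    geom i j 0 * t 0 ≈⟨ *-cong (geom-0 i j i≢j) (row-conv i js aw s s′ e 0) ⟩
    1# * (1# * s′ 0) ≈⟨ *-identityˡ _ ⟩
    1# * s′ 0 ∎
    where open ≈-R
          t = foldr (λ j s → geom i j *S s) s js
  row-conv i (j ∷ js) (i≢j ∷ aw) s s′ e (suc m) = begin
    (geom i j *S t) (suc m) ≈⟨ geom-*S-suc i j i≢j t m ⟩
    t (suc m) + v * (geom i j *S t) m
      ≈⟨ +-cong (row-conv i js aw s s′ e (suc m)) (*-congˡ (row-conv i (j ∷ js) (i≢j ∷ aw) s s′ e m)) ⟩
    1# * s′ (suc m) + conv (λ a b → hℕ (suc a) vs * s′ b) m + v * conv (λ a b → hℕ a (v ∷ vs) * s′ b) m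
      ≈⟨ +-congˡ (op-conv (mulBy v) (λ a b → hℕ a (v ∷ vs) * s′ b) m) ⟩
    1# * s′ (suc m) + conv (λ a b → hℕ (suc a) vs * s′ b) m + conv (λ a b → v * (hℕ a (v ∷ vs) * s′ b)) m
      ≈⟨ +-assoc _ _ _ ⟩
    1# * s′ (suc m) + (conv (λ a b → hℕ (suc a) vs * s′ b) m + conv (λ a b → v * (hℕ a (v ∷ vs) * s′ b)) m)
      ≈⟨ +-congˡ (≈-trans (≈-sym (conv-+ (λ a b → hℕ (suc a) vs * s′ b) (λ a b → v * (hℕ a (v ∷ vs) * s′ b)) m))
        (conv-cong (λ a b → lem v _ _ (s′ b)) m)) ⟩
    1# * s′ (suc m) + conv (λ a b → hℕ (suc a) (v ∷ vs) * s′ b) m ∎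
    where open ≈-R
          t = foldr (λ j s → geom i j *S s) s js
          v = ratio i j
          vs = map (ratio i) js
          lem = solve 4 (λ v a b s → b :* s :+ v :* (a :* s) := (v :* a :+ b) :* s) ≈-refl

  -- Iterated rotation

  rotate^ : ℕ → Op (suc n)
  rotate^ zero = idₒ
  rotate^ (suc r) = rotate^ r ⊙ rotate

  rotate^-X : (r k : ℕ) (z : ℤ) → k ℕ.+ r ℕ.≤ n → ∀ f → rotate^ r · (X k z * f) ≈ X (k ℕ.+ r) z * rotate^ r · f
  rotate^-X zero k z _ f = ≈-reflexive (cong (λ j → X j z * f) (sym (ℕₚ.+-identityʳ k)))
  rotate^-X (suc r) k z le f = begin
    rotate^ r · rotate · (X k z * f)
      ≈⟨ op-cong (rotate^ r) (lifts-X k z (ℕₚ.≤-trans (ℕ.s≤s (ℕₚ.m≤m+n k r)) (subst (ℕ._≤ n) (ℕₚ.+-suc k r) le)) f) ⟩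
    rotate^ r · (X (suc k) z * rotate · f) ≈⟨ rotate^-X r (suc k) z (subst (ℕ._≤ n) (ℕₚ.+-suc k r) le) (rotate · f) ⟩
    X (suc k ℕ.+ r) z * rotate^ r · rotate · f ≡⟨ cong (λ j → X j z * rotate^ r · rotate · f) (ℕₚ.+-suc k r) ⟨
    X (k ℕ.+ suc r) z * rotate^ r · rotate · f ∎
    where open ≈-R

  rotate^-invs : (r δ N : ℕ) → N ℕ.+ r ℕ.≤ suc n → ∀ a f →
    rotate^ r · (hℕ a (invs (gens δ N)) * f) ≈ hℕ a (invs (gens (δ ℕ.+ r) (N ℕ.+ r))) * rotate^ r · f
  rotate^-invs zero δ N _ a f =
    ≈-reflexive (cong₂ (λ d M → hℕ a (invs (gens d M)) * f) (sym (ℕₚ.+-identityʳ δ)) (sym (ℕₚ.+-identityʳ N)))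
  rotate^-invs (suc r) δ N le a f = begin
    rotate^ r · rotate · (hℕ a (invs (gens δ N)) * f)
      ≈⟨ op-cong (rotate^ r) (lifts-invs δ N (ℕₚ.≤-pred (ℕₚ.≤-trans (ℕ.s≤s (ℕₚ.m≤m+n N r)) le′)) a f) ⟩
    rotate^ r · (hℕ a (invs (gens (suc δ) (suc N))) * rotate · f) ≈⟨ rotate^-invs r (suc δ) (suc N) le′ a (rotate · f) ⟩
    hℕ a (invs (gens (suc δ ℕ.+ r) (suc N ℕ.+ r))) * rotate^ r · rotate · f
      ≡⟨ cong₂ (λ d M → hℕ a (invs (gens d M)) * rotate^ r · rotate · f) (ℕₚ.+-suc δ r) (ℕₚ.+-suc N r) ⟨
    hℕ a (invs (gens (δ ℕ.+ suc r) (N ℕ.+ suc r))) * rotate^ r · rotate · f ∎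
    where open ≈-R
          le′ : suc N ℕ.+ r ℕ.≤ suc n
          le′ = subst (ℕ._≤ suc n) (ℕₚ.+-suc N r) le

  -- The monomial x^γ, built by rotations in the same way as `rowSeries`, so that each row can carry
  -- its own power.
  weight : {k : ℕ} → Vec ℤ (suc k) → P
  weight (g ∷ []) = X 0 g
  weight (g ∷ g′ ∷ gs) = X 0 g * rotate · weight (g′ ∷ gs)

  module Rows (Ψ : Fin (suc n) → Fin (suc n) → Bool) (ideal : IsRootIdeal Ψ) where
    open RootIdeal Ψ ideal

    row : Fin (suc n) → List (Fin (suc n))
    row i = filter (λ j → Ψ i j Data.Bool.≟ true) (allFin (suc n))

    row-All : (i : Fin (suc n)) → Allˡ (i ≢_) (row i)
    row-All i = Allˡ.map (λ {j} e i≡j → ℕₚ.<-irrefl (cong toℕ i≡j) (proj₁ ideal i j e))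
      (Allₚ.all-filter (λ j → Ψ i j Data.Bool.≟ true) (allFin (suc n)))

    does-≟true : ∀ b → does (b Data.Bool.≟ true) ≡ b
    does-≟true true = refl
    does-≟true false = refl

    row-gens : (i : Fin n) → map toℕ (reverse (row (inject₁ i))) ≡ gens (toℕ i ℕ.+ nr Ψ i) (suc n)
    row-gens i = trans (cong (map toℕ ∘ reverse)
      (filter-does (λ j → Ψ (inject₁ i) j Data.Bool.≟ true) (λ j → suc D ℕ.≤? suc (toℕ j))
        (λ j → trans (does-≟true (Ψ (inject₁ i) j)) (trans (sym (root-≥ i j)) (suc-does D (toℕ j)))) (allFin (suc n))))
      (cWord-gens D (suc n))
      where
      D = toℕ i ℕ.+ nr Ψ i
      suc-does : ∀ a b → does (a ℕ.≤? b) ≡ does (suc a ℕ.≤? suc b)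
      suc-does zero b = refl
      suc-does (suc a) b = refl

    row-last : (i : Fin (suc n)) → toℕ i ≡ n → row i ≡ []
    row-last i i≡n = Listₚ.filter-none (λ j → Ψ i j Data.Bool.≟ true) (Allˡ.universal (λ j e →
      ℕₚ.<-irrefl refl (ℕₚ.<-≤-trans (subst (ℕ._< toℕ j) i≡n (proj₁ ideal i j e)) (ℕₚ.≤-pred (Finₚ.toℕ<n j))))
        (allFin (suc n)))

    rowsSeries : List (Fin (suc n)) → Series (suc n) → Series (suc n)
    rowsSeries [] s = s
    rowsSeries (i ∷ is) s = foldr (λ j s → geom i j *S s) (rowsSeries is s) (row i)

    -- In the Catalan series x^γ stands innermost, while in `rowSeries` every row has its own
    -- factor. `pre` collects the factors of the r rows already passed, and `rotate^ r` moves the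
    -- remaining rows from x_1 back to their true position.
    tail-series : {k : ℕ} (r : ℕ) → r ℕ.+ k ≡ n → (f : Fin (suc k) → Fin (suc n)) → (∀ j → toℕ (f j) ≡ r ℕ.+ toℕ j) →
      (e : Fin k → Fin n) → (∀ j → toℕ (e j) ≡ r ℕ.+ toℕ j) → (γ : Vec ℤ (suc k)) →
      (pre b : P) → b ≈ pre * rotate^ r · weight γ → ∀ m →
      rowsSeries (tabulate f) (constS b) m ≈ pre * rotate^ r · rowSeries γ (V.tabulate (nr Ψ ∘ e)) m
    tail-series {zero} r r+k f f≡ e e≡ (g ∷ []) pre b b≈ m = ≈-trans
      (≈-reflexive (cong (λ js → foldr (λ j s → geom (f zero) j *S s) (constS b) js m)
        (row-last (f zero) (trans (f≡ zero) r+k)))) (base m)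
      where
      base : ∀ m → constS b m ≈ pre * rotate^ r · rowSeries (g ∷ []) [] m
      base zero = b≈
      base (suc m) = ≈-sym (≈-trans (*-congˡ (op-0 (rotate^ r))) (zeroʳ pre))
    tail-series {suc k} r r+k f f≡ e e≡ (g ∷ g′ ∷ gs) pre b b≈ m = begin
      foldr (λ j s → geom (f zero) j *S s) (rowsSeries (tabulate (f ∘ suc)) (constS b)) (row (f zero)) m
        ≈⟨ row-conv (f zero) (row (f zero)) (row-All (f zero)) _ _ rest m ⟩
      conv (λ a c → hℕ a (map (ratio (f zero)) (row (f zero))) * (pre * X r g * rotate^ (suc r) · RS c)) m
        ≈⟨ conv-cong term≈ m ⟩
      conv (λ a c → pre * rotate^ r · (X 0 g * (X 0 (+ a) * (hℕ a (invs (gens d (suc (suc k)))) * rotate · RS c)))) m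
        ≈⟨ op-conv (mulBy pre ⊙ rotate^ r ⊙ mulBy (X 0 g)) _ m ⟨
      pre * rotate^ r · rowSeries (g ∷ g′ ∷ gs) (V.tabulate (nr Ψ ∘ e)) m ∎
      where
      open ≈-R
      d : ℕ
      d = nr Ψ (e zero)
      RS : ℕ → P
      RS = rowSeries (g′ ∷ gs) (V.tabulate (nr Ψ ∘ e ∘ suc))
      e₀ : toℕ (e zero) ≡ r
      e₀ = trans (e≡ zero) (ℕₚ.+-identityʳ r)
      f₀ : toℕ (f zero) ≡ r
      f₀ = trans (f≡ zero) (ℕₚ.+-identityʳ r)
      f₀≡ : f zero ≡ inject₁ (e zero)
      f₀≡ = Finₚ.toℕ-injective (trans f₀ (trans (sym e₀) (sym (Finₚ.toℕ-inject₁ (e zero)))))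
      r≤n : r ℕ.≤ n
      r≤n = ℕₚ.≤-trans (ℕₚ.m≤m+n r (suc k)) (ℕₚ.≤-reflexive r+k)
      size : suc (suc k) ℕ.+ r ≡ suc n
      size = cong suc (trans (ℕₚ.+-comm (suc k) r) r+k)
      b≈′ : b ≈ pre * X r g * rotate^ (suc r) · weight (g′ ∷ gs)
      b≈′ = ≈-trans b≈ (≈-trans (*-congˡ (rotate^-X r 0 g r≤n (rotate · weight (g′ ∷ gs)))) (≈-sym (*-assoc _ _ _)))
      rest : ∀ m → rowsSeries (tabulate (f ∘ suc)) (constS b) m ≈ pre * X r g * rotate^ (suc r) · RS m
      rest = tail-series (suc r) (trans (sym (ℕₚ.+-suc r k)) r+k) (f ∘ suc)
        (λ j → trans (f≡ (suc j)) (ℕₚ.+-suc r (toℕ j)))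
        (e ∘ suc) (λ j → trans (e≡ (suc j)) (ℕₚ.+-suc r (toℕ j))) (g′ ∷ gs) (pre * X r g) b b≈′
      row-h : ∀ a → hℕ a (map (ratio (f zero)) (row (f zero))) ≈
        X r (+ a) * hℕ a (invs (gens (d ℕ.+ r) (suc (suc k) ℕ.+ r)))
      row-h a = begin
        hℕ a (map (ratio (f zero)) (row (f zero))) ≈⟨ hℕ-reverse (ratio (f zero)) (row (f zero)) a ⟨
        hℕ a (map (ratio (f zero)) (reverse (row (f zero)))) ≡⟨ cong (hℕ a) (Listₚ.map-∘ (reverse (row (f zero)))) ⟩
        hℕ a (map (λ j → x (toℕ (f zero)) * x⁻ j) (map toℕ (reverse (row (f zero))))) ≈⟨ hℕ-scale (toℕ (f zero)) _ a ⟩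
        X (toℕ (f zero)) (+ a) * hℕ a (invs (map toℕ (reverse (row (f zero)))))
          ≡⟨ cong₂ (λ k vs → X k (+ a) * hℕ a (invs vs)) f₀
            (trans (cong (map toℕ ∘ reverse ∘ row) f₀≡) (trans (row-gens (e zero))
               (cong₂ gens (trans (cong (ℕ._+ d) e₀) (ℕₚ.+-comm r d)) (sym size)))) ⟩
        X r (+ a) * hℕ a (invs (gens (d ℕ.+ r) (suc (suc k) ℕ.+ r))) ∎
      term≈ : ∀ a c → hℕ a (map (ratio (f zero)) (row (f zero))) * (pre * X r g * rotate^ (suc r) · RS c)
        ≈ pre * rotate^ r · (X 0 g * (X 0 (+ a) * (hℕ a (invs (gens d (suc (suc k)))) * rotate · RS c)))
      term≈ a c = begin
        hℕ a (map (ratio (f zero)) (row (f zero))) * (pre * X r g * Y) ≈⟨ *-congʳ (row-h a) ⟩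
        X r (+ a) * H * (pre * X r g * Y) ≈⟨ lem (X r (+ a)) H pre (X r g) Y ⟩
        pre * (X r g * (X r (+ a) * (H * Y)))
          ≈⟨ *-congˡ (≈-trans (rotate^-X r 0 g r≤n _)
            (*-congˡ (≈-trans (rotate^-X r 0 (+ a) r≤n _)
            (*-congˡ (rotate^-invs r d (suc (suc k)) (ℕₚ.≤-reflexive size) a _))))) ⟨
        pre * rotate^ r · (X 0 g * (X 0 (+ a) * (hℕ a (invs (gens d (suc (suc k)))) * rotate · RS c))) ∎
        where
        H = hℕ a (invs (gens (d ℕ.+ r) (suc (suc k) ℕ.+ r)))
        Y = rotate^ r · rotate · RS c
        lem = solve 5 (λ u h p v y → u :* h :* (p :* v :* y) := p :* (v :* (u :* (h :* y)))) ≈-refl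

    private
      flatten : {S : Set} (f : Fin (suc n) × Fin (suc n) → S → S) (z : S) {Q : Fin (suc n) × Fin (suc n) →
        Set} (Q? : Decidable Q) →
        (∀ i j → does (Q? (i , j)) ≡ does (Ψ i j Data.Bool.≟ true)) → ∀ is →
        foldr f z (filter Q? (concatMap (λ i → map (i ,_) (allFin (suc n))) is)) ≡
          foldr (λ i s → foldr (λ j s → f (i , j) s) s (row i)) z is
      flatten f z Q? Q≡ [] = refl
      flatten {S} f z Q? Q≡ (i ∷ is) = trans (cong (foldr f z) (Listₚ.filter-++ Q? (map (i ,_) (allFin (suc n))) _))
        (trans (Listₚ.foldr-++ f z (filter Q? (map (i ,_) (allFin (suc n)))) _)
          (trans (go (allFin (suc n)) _) (cong (λ s → foldr (λ j s → f (i , j) s) s (row i)) (flatten f z Q? Q≡ is))))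
        where
        go : ∀ js (s : S) → foldr f s (filter Q? (map (i ,_) js)) ≡
          foldr (λ j s → f (i , j) s) s (filter (λ j → Ψ i j Data.Bool.≟ true) js)
        go [] s = refl
        go (j ∷ js) s = trans (cong (foldr f s) (filter-∷ Q? (i , j) (map (i ,_) js)))
          (trans (by (Ψ i j Data.Bool.≟ true) (Q≡ i j))
            (cong (foldr (λ j s → f (i , j) s) s) (sym (filter-∷ (λ j → Ψ i j Data.Bool.≟ true) j js))))
          where
          by : ∀ {v} (dec : Dec (Ψ i j ≡ true)) → v ≡ does dec →
            foldr f s (if v then (i , j) ∷ filter Q? (map (i ,_) js) else filter Q? (map (i ,_) js))
            ≡ foldr (λ j s → f (i , j) s) s
              (if does dec then j ∷ filter (λ j → Ψ i j Data.Bool.≟ true) js else filter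
              (λ j → Ψ i j Data.Bool.≟ true) js)
          by (yes _) refl = cong (f (i , j)) (go js s)
          by (no _) refl = go js s

      rowsSeries-foldr : ∀ is s → rowsSeries is s ≡ foldr (λ i s → foldr (λ j s → geom i j *S s) s (row i)) s is
      rowsSeries-foldr [] s = refl
      rowsSeries-foldr (i ∷ is) s = cong (λ s → foldr (λ j s → geom i j *S s) s (row i)) (rowsSeries-foldr is s)

    catalanSeries-rows : (γ : Exp (suc n)) → catalanSeries Ψ γ ≡ rowsSeries (allFin (suc n)) (constS (monomial γ))
    catalanSeries-rows γ = trans (flatten _ (constS (monomial γ)) _ (λ i j → refl) (allFin (suc n)))
      (sym (rowsSeries-foldr (allFin (suc n)) (constS (monomial γ))))

  -- With at most ℓ entries, x_ℓ does not yet occur when a rotation is applied, so no power of q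
  -- appears.
  weight-mono : {k : ℕ} → k ℕ.≤ n → (γ : Vec ℤ (suc k)) →
    Σ[ α ∈ Exp (suc n) ] (weight γ ≈ mono (+ 0) α) × (∀ j → coord α j ≡ coord γ j)
  weight-mono k≤n (g ∷ []) = single 0 g , ≈-refl , λ { zero → refl ; (suc j) → coord-𝟎 {n} j }
  weight-mono {suc k} k<n (g ∷ g′ ∷ gs) with weight-mono (ℕₚ.<⇒≤ k<n) (g′ ∷ gs)
  ... | α , e , c = single 0 g ⊞ rot α ,
      ≈-trans (*-congˡ (≈-trans (op-cong rotate e)
        (≈-trans (rotate-mono (+ 0) α) (mono-cong (trans (ℤₚ.+-identityˡ _) αn) refl)))) (X-*-mono 0 g (+ 0) (rot α)) ,
      λ { zero → trans (single-⊞ 0 g (rot α) (ℕ.s≤s ℕ.z≤n))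
        (trans (cong (λ z → g ℤ.+ z) (trans (last-coord α) αn)) (ℤₚ.+-identityʳ g))
        ; (suc j) → trans (single-⊞-≢ 0 (suc j) g (rot α) λ ()) (shift j (j ℕ.<? n)) }
    where
    αn : coord α n ≡ + 0
    αn = trans (c n) (coord-past (g′ ∷ gs) n k<n)
    shift : ∀ j → Dec (j ℕ.< n) → coord (rot α) (suc j) ≡ coord (g′ ∷ gs) j
    shift j (yes j<n) = trans (coord-rot α j j<n) (c j)
    shift j (no j≮n) = trans (coord-past (rot α) (suc j) (ℕ.s≤s (ℕₚ.≮⇒≥ j≮n)))
      (sym (coord-past (g′ ∷ gs) j (ℕₚ.≤-trans k<n (ℕₚ.≮⇒≥ j≮n))))

  catalanSeries-rowSeries : (Ψ : Fin (suc n) → Fin (suc n) → Bool) (ideal : IsRootIdeal Ψ) (γ : Exp (suc n)) (m : ℕ) →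
    catalanSeries Ψ γ m ≈ rowSeries γ (V.tabulate (nr Ψ)) m
  catalanSeries-rowSeries Ψ ideal γ m with weight-mono ℕₚ.≤-refl γ
  ... | α , e , c = ≈-trans (≈-reflexive (cong (λ s → s m) (catalanSeries-rows γ)))
    (≈-trans (tail-series 0 refl id (λ _ → refl) id (λ _ → refl) γ 1# (monomial γ)
      (≈-trans (mono-cong refl (sym (coord-ext α γ c))) (≈-trans (≈-sym e) (≈-sym (*-identityˡ _)))) m) (*-identityˡ _))
    where open Rows Ψ ideal

  -- Tameness, comparison of coefficients and conclusion.

  tame-absorbs : (Ψ : Fin (suc n) → Fin (suc n) → Bool) (w : Word n) → Tame Ψ w → (i : Fin n) →
    nr Ψ (firstFin i) ℕ.≤ toℕ i →
    ∀ f → demOp w · π i · f ≈ demOp w · f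
  tame-absorbs Ψ w tame i le f = ≈-trans (≈-reflexive (sym (demOp-++ w (i ∷ []) f))) (demOp-≈H (tame i le) f)

  coeffAt-coefq : (m : ℕ) (p : P) (α : Exp (suc n)) → coeffAt (coefq m · p) (+ 0) α ≡ coeffAt p (+ m) α
  coeffAt-coefq m p α = trans (coeffAt-ev (coefq m · p) (+ 0) α) (trans (spec (coefq m) (δ (+ 0) α) p)
    (trans (ev-cong (λ d β → trans (dual-mono (coefq m) (δ (+ 0) α) d β) (on-key d β (d ℤ.≟ + m))) p)
      (sym (coeffAt-ev p (+ m) α))))
    where
    on-key : ∀ d β → Dec (d ≡ + m) → ev (δ (+ 0) α) (coefq m · mono d β) ≡ δ (+ m) α d β
    on-key d β (yes refl) = trans (at (coefq-≡ m β) (δ (+ 0) α)) (trans (ev-mono (δ (+ 0) α) (+ 0) β)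
      (cong (λ v → if v ∧ does (≡-dec ℤ._≟_ β α) then + 1 else + 0) (sym (dec-refl ℤ._≟_ (+ m)))))
    on-key d β (no ne) = trans (at (coefq-≢ m d β ne) (δ (+ 0) α))
      (cong (λ v → if v ∧ does (≡-dec ℤ._≟_ β α) then + 1 else + 0) (sym (dec-false (d ℤ.≟ + m) ne)))

  coeffAt-negative : (p : P) → Allˡ NonnegTerm p → ∀ m α → coeffAt p -[1+ m ] α ≡ + 0
  coeffAt-negative [] [] m α = refl
  coeffAt-negative (term c (+ d) β ∷ p) (_ ∷ ps) m α = trans (ℤₚ.+-identityˡ _) (coeffAt-negative p ps m α)

tame-Absorbs : (n : ℕ) (Ψ : Fin (suc n) → Fin (suc n) → Bool) (w : Word n) → Tame Ψ w →
  Absorbs (demOp w) (V.tabulate (nr Ψ))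
tame-Absorbs zero Ψ w tame = tt
tame-Absorbs (suc n) Ψ w tame j d≤j j<n f with asFin j j<n
... | i , refl , q rewrite q = tame-absorbs Ψ w tame i (first i d≤j) f
  where
  first : ∀ i → nr Ψ zero ℕ.≤ toℕ i → nr Ψ (firstFin i) ℕ.≤ toℕ i
  first zero le = le
  first (suc i) le = le

theorem2p3 : (n : ℕ) (Ψ : Fin (suc n) → Fin (suc n) → Bool) (γ : Vec ℤ (suc n)) (w : Word n) →
    IsRootIdeal Ψ → Tame Ψ w → All (λ g → + 0 ≤ g) γ →
    HEquals Ψ γ w (rhs Ψ γ w)
theorem2p3 n Ψ γ w ideal tame γ≥0 E expansion =
  (λ m α → trans (≈⇒coeffAt (main m) (+ 0) α) (coeffAt-coefq m (rhs Ψ γ w) α)) ,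
  coeffAt-negative (rhs Ψ γ w) (demWord-nonneg w (chain-nonneg γ ms γ≥0))
  where
  open LaurentRing (suc n)
  open Operators {suc n}
  open ≈-R
  ms : Vec ℕ n
  ms = V.tabulate (nr Ψ)
  main : ∀ m → demWord w (polyPart (E m)) ≈ coefq m · rhs Ψ γ w
  main m = begin
    demWord w (polyPart (E m)) ≡⟨ demOp-demWord w (polyPart (E m)) ⟨
    demOp w · polyPart (E m) ≈⟨ op-cong (demOp w) (truncation-polyPart (E m)) ⟨
    demOp w · truncation · ⟦ E m ⟧K ≈⟨ op-cong (demOp w ⊙ truncation) (≈P⇒≈ (expansion m)) ⟩
    demOp w · truncation · catalanSeries Ψ γ m ≈⟨ op-cong (demOp w ⊙ truncation) (catalanSeries-rowSeries Ψ ideal γ m) ⟩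
    demOp w · truncation · rowSeries γ ms m
      ≈⟨ chain-truncation γ ms ℕₚ.≤-refl γ≥0 (RootIdeal.admissible Ψ ideal 0 id (λ _ → refl)) (demOp w)
      (tame-Absorbs n Ψ w tame) m ⟨
    -- Demazure operators do not involve q, so taking the coefficient of q^m may be moved in front
    -- of π_w.
    demOp w · coefq m · chain γ ms ≡⟨ demOp-πs w (coefq m · chain γ ms) ⟩
    πs (map toℕ w) · coefq m · chain γ ms ≈⟨ coefq-πs m (map toℕ w) (Allₚ.map⁺ (Allˡ.universal toℕ< w)) (chain γ ms) ⟨
    coefq m · πs (map toℕ w) · chain γ ms
      ≡⟨ cong (coefq m ·_) (trans (sym (demOp-πs w (chain γ ms))) (demOp-demWord w (chain γ ms))) ⟩
    coefq m · demWord w (chain γ ms) ∎
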